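{- Let $C=11\cdot 195^2$. Let $n\ge 2$ and let $\mathbf G=(G_1,G_2,G_3)$ be a graph triple of order $n$ with $\Delta(G_1),\Delta(G_2)\le n-2$ and $\Delta(G_3)\le n-1$. If $|E_1|+|E_2|+|E_3|+\max\{\Delta(G_1),\Delta(G_2)\}+\Delta(G_3)\le 3n-C$, then $\mathbf G$ packs.
   Context: A graph triple $\mathbf G=(G_1,G_2,G_3)$ of order $n$ consists of two disjoint $n$-vertex graphs $G_1=(V_1,E_1)$, $G_2=(V_2,E_2)$ and a bipartite graph $G_3=(V_1\cup V_2,E_3)$ with parts $V_1,V_2$. $\mathbf G$ packs if there is a bijection $f:V_1\to V_2$ such that $vf(v)\notin E_3$ for every $v\in V_1$, and $uv\in E_1$ implies $f(u)f(v)\notin E_2$. $\Delta(G)$ is the maximum degree of $G$. -}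

module Defs where

open import Data.Fin.Base using (Fin)
open import Data.Fin.Properties using (_<?_)
open import Data.List.Base using (List; length; filter; map; allFin; cartesianProduct; _++_)
open import Data.List.Extrema.Nat using (max)
open import Data.Nat.Base using (ℕ; _*_; _^_)
open import Data.Product.Base using (_×_; _,_; Σ-syntax)
open import Function.Bundles using (_⤖_; module Bijection)
open import Level using (0ℓ)
open import Relation.Binary.Core using (Rel; REL)
open import Relation.Binary.Definitions using (Decidable; Irreflexive; Symmetric)
open import Relation.Binary.PropositionalEquality.Core using (_≡_)
open import Relation.Nullary.Decidable.Core using (_×-dec_)
open import Relation.Nullary.Negation.Core using (¬_)

record Graph (n : ℕ) : Set₁ where
  field
    Adj    : Rel (Fin n) 0ℓ
    Adj?   : Decidable Adj
    sym    : Symmetric Adj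
    irrefl : Irreflexive _≡_ Adj

  degree : Fin n → ℕ
  degree v = length (filter (Adj? v) (allFin n))

  -- Each edge uv is listed once, as the pair with u < v.
  edges : List (Fin n × Fin n)
  edges = filter (λ (u , v) → (u <? v) ×-dec Adj? u v)
                 (cartesianProduct (allFin n) (allFin n))

  ∣E∣ : ℕ
  ∣E∣ = length edges

  Δ : ℕ
  Δ = max 0 (map degree (allFin n))

-- A bipartite graph whose parts are a copy of Fin m and a disjoint copy of
-- Fin n: Adj x y says that x in the first part is joined to y in the second.
record BipartiteGraph (m n : ℕ) : Set₁ where
  field
    Adj  : REL (Fin m) (Fin n) 0ℓ
    Adj? : Decidable Adj

  degreeˡ : Fin m → ℕ
  degreeˡ x = length (filter (Adj? x) (allFin n))

  degreeʳ : Fin n → ℕ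
  degreeʳ y = length (filter (λ x → Adj? x y) (allFin m))

  edges : List (Fin m × Fin n)
  edges = filter (λ (x , y) → Adj? x y) (cartesianProduct (allFin m) (allFin n))

  ∣E∣ : ℕ
  ∣E∣ = length edges

  -- The maximum is over the vertices of both parts.
  Δ : ℕ
  Δ = max 0 (map degreeˡ (allFin m) ++ map degreeʳ (allFin n))

-- V₁ and V₂ are two separate copies of Fin n, so they are disjoint by
-- construction; G₃ joins the copy carrying G₁ to the copy carrying G₂.
record GraphTriple (n : ℕ) : Set₁ where
  field
    G₁ : Graph n
    G₂ : Graph n
    G₃ : BipartiteGraph n n

  module G₁ = Graph G₁
  module G₂ = Graph G₂
  module G₃ = BipartiteGraph G₃

Packs : ∀ {n} → GraphTriple n → Set
Packs {n} 𝐆 =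
  Σ[ f ∈ Fin n ⤖ Fin n ]
    let open Bijection f using (to) in
      (∀ v → ¬ G₃.Adj v (to v))
    × (∀ u v → G₁.Adj u v → ¬ G₂.Adj (to u) (to v))
  where open GraphTriple 𝐆

C : ℕ
C = 11 * 195 ^ 2

{-# OPTIONS --safe #-}
-- Mapping v to w with vw ∉ E₃ and deleting both vertices reduces the triple to one of order n - 1 in
-- which N₁(v) × N₂(w) is added to E₃. This costs d₁(v) d₂(w) edges of G₃ and gains d₁(v) edges of G₁,
-- d₂(w) of G₂ and the edges of G₃ at v and w. So a vertex v of degree D = max(Δ(G₁), Δ(G₂)) should go
-- on an isolated vertex w, which is produced by first placing the neighbours of w; the induction on n
-- needs the weight |E₁| + |E₂| + |E₃| + D + Δ(G₃) to drop by 3 for each pair placed.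
--
-- If Δ(G₃) is nearly n, or if D ≤ n/700 and Δ(G₃) > n/4, one vertex carries almost all of G₃, and it is
-- removed or its degree lowered with the help of isolated vertices. If D ≤ n/700 and Δ(G₃) ≤ n/4, vertices
-- of high degree are placed greedily until transpositions repair a packing of the bounded-degree rest.
-- If n - D is bounded, G₁ is almost a star. Otherwise all but a bounded number of "hard" vertices y have
-- many cheap partners b (with d₁(b) d₂(y) ≤ D/20), so v can go on w unless w, of degree at most 3, has a
-- hard neighbour x. Then x in turn goes under some a of small degree, the hard neighbour v′ of a under
-- some w′, and counting degrees plus hard neighbours shows that suitable a and w′ exist.
module Submission where

open import Defs
open import Data.Bool.Base using (Bool; true; false; _∧_; _∨_; not; if_then_else_) renaming (T to True)
import Data.Bool.Properties as Bool
open import Data.Empty using (⊥; ⊥-elim)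
open import Data.Fin.Base using (Fin; zero; suc)
open import Data.Fin.Properties using () renaming (<-cmp to <-cmpᶠ; _≟_ to _≟ᶠ_; _<?_ to _<?ᶠ_)
open import Data.List.Base using (List; []; _∷_; length; filter; map; allFin; _++_; cartesianProduct; tabulate)
open import Data.List.Extrema.Nat using (max; xs≤max)
open import Data.List.Membership.Propositional using (_∈_)
open import Data.List.Membership.Propositional.Properties using (∈-filter⁺; ∈-filter⁻; ∈-allFin; ∈-map⁺; ∈-++⁺ˡ; ∈-++⁺ʳ)
open import Data.List.Properties using (length-++; length-map; filter-++; map-tabulate)
open import Data.List.Relation.Unary.All as All using (All; []; _∷_)
import Data.List.Relation.Unary.All.Properties as AllP
open import Data.List.Relation.Unary.AllPairs as AllPairs using (AllPairs; []; _∷_)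
import Data.List.Relation.Unary.AllPairs.Properties as AllPairsP
open import Data.List.Relation.Unary.Any using (here; there)
open import Data.List.Relation.Unary.Unique.Propositional using (Unique)
import Data.List.Relation.Unary.Unique.Propositional.Properties as Unique
open import Data.Nat.Base using (ℕ; zero; suc; _+_; _*_; _∸_; _⊔_; _⊓_; _≤_; _<_; z≤n; s≤s; _≤ᵇ_)
open import Data.Nat.DivMod using (_/_; m/n*n≤m; m*n/n≡m; /-monoˡ-≤)
open import Data.Nat.Induction using (<-wellFounded)
open import Data.Nat.Properties
open import Data.Product.Base using (_×_; _,_; proj₁; proj₂; ∃)
open import Data.Sum.Base using (_⊎_; inj₁; inj₂; [_,_]′) renaming (swap to ⊎-swap)
open import Data.Unit.Base using (tt)
open import Data.Vec.Base using (Vec; []; _∷_)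
open import Function.Base using (_∘_; id; case_of_)
open import Function.Bundles using (mk⤖)
open import Induction.WellFounded using (Acc; acc)
open import Relation.Binary.Definitions using (tri<; tri≈; tri>)
open import Relation.Binary.PropositionalEquality using (_≡_; _≢_; refl; sym; trans; cong; cong₂; subst; subst₂; module ≡-Reasoning)
open import Relation.Nullary using (¬_; yes; no; Dec; does)
open import Relation.Unary using (Decidable)

-- Linear arithmetic over ℕ by Farkas certificates: c refutes the negated
-- conclusion, the list cs weights the hypotheses.

-- The budget is kept doubled, so a placed pair must pay 6, and `836550 = 2 * C` forces
-- `139425 ≤ n`. In the induction `D` and `T` are mere upper bounds on the degrees, because a
-- placement may raise degrees in G₃; `tighten` turns them back into maxima at the start of each
-- step. The constants hang together at `D` near `n / 700`. The cost of a pair is capped at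
-- `D / 20`, and `m₁ * m₂` is at most `9 n²`, so at most about `20 * 9 n² / D`, that is `126000 n`,
-- pairs of vertices are too costly. A hard vertex takes part in nearly `n` pairs that fail, so at
-- most 132000 vertices are hard. Counting the vertices available for a chain loses this number
-- three times, and `418274 - 3 * 132000 = 22274` is what remains of `C`. Below `n / 700` the high
-- degrees are small enough against `n` for the greedy placement, which tolerates up to 185
-- overloaded vertices with `D` neighbours each.

infixl 6 _⊕_
infixr 7 _⊗_
infix  4 _⊴_

data Expr (k : ℕ) : Set where
  var : Fin k → Expr k
  #_  : ℕ → Expr k
  _⊕_ : Expr k → Expr k → Expr k
  _⊗_ : ℕ → Expr k → Expr k

record Ineq (k : ℕ) : Set where
  constructor _⊴_
  field lhs rhs : Expr k
open Ineq public

at : ∀ {k} → Vec ℕ k → Fin k → ℕ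
at (x ∷ ρ) zero    = x
at (x ∷ ρ) (suc i) = at ρ i

eval : ∀ {k} → Expr k → Vec ℕ k → ℕ
eval (var i) ρ = at ρ i
eval (# c)   ρ = c
eval (e ⊕ f) ρ = eval e ρ + eval f ρ
eval (c ⊗ e) ρ = c * eval e ρ

-- Coefficient vectors; the head is the constant term.
zeros : ∀ k → Vec ℕ k
zeros zero    = []
zeros (suc k) = 0 ∷ zeros k

unit : ∀ {k} → Fin k → Vec ℕ k
unit zero    = 1 ∷ zeros _
unit (suc i) = 0 ∷ unit i

add : ∀ {k} → Vec ℕ k → Vec ℕ k → Vec ℕ k
add []       []       = []
add (x ∷ xs) (y ∷ ys) = x + y ∷ add xs ys

scale : ∀ {k} → ℕ → Vec ℕ k → Vec ℕ k
scale c []       = []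
scale c (x ∷ xs) = c * x ∷ scale c xs

nf : ∀ {k} → Expr k → Vec ℕ (suc k)
nf (var i) = 0 ∷ unit i
nf (# c)   = c ∷ zeros _
nf (e ⊕ f) = add (nf e) (nf f)
nf (c ⊗ e) = scale c (nf e)

dot : ∀ {k} → Vec ℕ k → Vec ℕ k → ℕ
dot []       []       = 0
dot (x ∷ xs) (y ∷ ys) = x * y + dot xs ys

dot-zeros : ∀ {k} (ρ : Vec ℕ k) → dot (zeros k) ρ ≡ 0
dot-zeros []      = refl
dot-zeros (x ∷ ρ) = dot-zeros ρ

dot-unit : ∀ {k} (i : Fin k) ρ → dot (unit i) ρ ≡ at ρ i
dot-unit zero    (x ∷ ρ) rewrite dot-zeros ρ | +-identityʳ x = +-identityʳ x
dot-unit (suc i) (x ∷ ρ) = dot-unit i ρ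

+-interchange : ∀ a b c d → (a + b) + (c + d) ≡ (a + c) + (b + d)
+-interchange a b c d rewrite +-assoc a b (c + d) | sym (+-assoc b c d) | +-comm b c | +-assoc c b d = sym (+-assoc a c (b + d))

dot-add : ∀ {k} (xs ys ρ : Vec ℕ k) → dot (add xs ys) ρ ≡ dot xs ρ + dot ys ρ
dot-add []       []       []      = refl
dot-add (x ∷ xs) (y ∷ ys) (z ∷ ρ) rewrite dot-add xs ys ρ | *-distribʳ-+ z x y = +-interchange (x * z) (y * z) _ _

dot-scale : ∀ {k} c (xs ρ : Vec ℕ k) → dot (scale c xs) ρ ≡ c * dot xs ρ
dot-scale c []       []      = sym (*-zeroʳ c)
dot-scale c (x ∷ xs) (z ∷ ρ) rewrite dot-scale c xs ρ | *-distribˡ-+ c (x * z) (dot xs ρ) | *-assoc c x z = refl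

nf-sound : ∀ {k} (e : Expr k) ρ → dot (nf e) (1 ∷ ρ) ≡ eval e ρ
nf-sound (var i) ρ = dot-unit i ρ
nf-sound (# c)   ρ rewrite *-identityʳ c | dot-zeros ρ = +-identityʳ c
nf-sound (e ⊕ f) ρ rewrite dot-add (nf e) (nf f) (1 ∷ ρ) | nf-sound e ρ | nf-sound f ρ = refl
nf-sound (c ⊗ e) ρ rewrite dot-scale c (nf e) (1 ∷ ρ) | nf-sound e ρ = refl

_≼ᵇ_ : ∀ {k} → Vec ℕ k → Vec ℕ k → Bool
[]       ≼ᵇ []       = true
(x ∷ xs) ≼ᵇ (y ∷ ys) = if x ≤ᵇ y then xs ≼ᵇ ys else false

≼ᵇ-sound : ∀ {k} (xs ys ρ : Vec ℕ k) → True (xs ≼ᵇ ys) → dot xs ρ ≤ dot ys ρ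
≼ᵇ-sound []       []       []      _ = z≤n
≼ᵇ-sound (x ∷ xs) (y ∷ ys) (z ∷ ρ) t with x ≤ᵇ y in eq
... | true = +-mono-≤ (*-monoˡ-≤ z (≤ᵇ⇒≤ x y (subst True (sym eq) tt))) (≼ᵇ-sound xs ys ρ t)

combine : ∀ {k} → (Ineq k → Expr k) → List ℕ → List (Ineq k) → Expr k
combine side (c ∷ cs) (h ∷ hs) = c ⊗ side h ⊕ combine side cs hs
combine side _        _        = # 0

Holds : ∀ {k} → Ineq k → Vec ℕ k → Set
Holds (l ⊴ r) ρ = eval l ρ ≤ eval r ρ

_⇛_ : ∀ {k} → List (Ineq k) → Ineq k → Vec ℕ k → Set
([]       ⇛ g) ρ = Holds g ρ
((h ∷ hs) ⇛ g) ρ = Holds h ρ → (hs ⇛ g) ρ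

curryHyps : ∀ {k} (hs : List (Ineq k)) g ρ → (All (λ h → Holds h ρ) hs → Holds g ρ) → (hs ⇛ g) ρ
curryHyps []       g ρ f = f []
curryHyps (h ∷ hs) g ρ f = λ p → curryHyps hs g ρ (λ ps → f (p ∷ ps))

combine-mono : ∀ {k} cs (hs : List (Ineq k)) ρ → All (λ h → Holds h ρ) hs →
               eval (combine lhs cs hs) ρ ≤ eval (combine rhs cs hs) ρ
combine-mono []       hs       ρ ps       = z≤n
combine-mono (c ∷ cs) []       ρ ps       = z≤n
combine-mono (c ∷ cs) (h ∷ hs) ρ (p ∷ ps) = +-mono-≤ (*-monoʳ-≤ c p) (combine-mono cs hs ρ ps)

-- Adding `c` times the negated conclusion `1 + r ≤ l` to the weighted hypotheses bounds the right
-- argument of `≼ᵇ` by the left one without its leading 1. The coefficientwise comparison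
-- contradicts that. Both sides are sums, so no subtraction occurs.
Certificate : ∀ {k} → List (Ineq k) → Ineq k → ℕ → List ℕ → Set
Certificate hs (l ⊴ r) c cs =
  True (nf (# 1 ⊕ (c ⊗ l ⊕ combine rhs cs hs)) ≼ᵇ nf (c ⊗ (# 1 ⊕ r) ⊕ combine lhs cs hs))

certificate-sound : ∀ {k} (hs : List (Ineq k)) g c cs → Certificate hs g c cs →
                    ∀ ρ → All (λ h → Holds h ρ) hs → Holds g ρ
certificate-sound hs (l ⊴ r) c cs t ρ ps with eval l ρ ≤? eval r ρ
... | yes l≤r = l≤r
... | no  l≰r = ⊥-elim (<⇒≱ strict (+-mono-≤ (*-monoʳ-≤ c (≰⇒> l≰r)) (combine-mono cs hs ρ ps)))
  where
  strict : eval (c ⊗ l ⊕ combine rhs cs hs) ρ < eval (c ⊗ (# 1 ⊕ r) ⊕ combine lhs cs hs) ρ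
  strict = subst₂ _≤_ (nf-sound (# 1 ⊕ (c ⊗ l ⊕ combine rhs cs hs)) ρ) (nf-sound (c ⊗ (# 1 ⊕ r) ⊕ combine lhs cs hs) ρ)
                  (≼ᵇ-sound (nf (# 1 ⊕ (c ⊗ l ⊕ combine rhs cs hs))) (nf (c ⊗ (# 1 ⊕ r) ⊕ combine lhs cs hs)) (1 ∷ ρ) t)

Exprs : ℕ → Set → ℕ → Set
Exprs zero    A k = A
Exprs (suc m) A k = Expr k → Exprs m A k

applyVars : ∀ {A k} m → (Fin m → Fin k) → Exprs m A k → A
applyVars zero    ι f = f
applyVars (suc m) ι f = applyVars m (ι ∘ suc) (f (var (ι zero)))

∀ᵥ : ∀ k → (Vec ℕ k → Set) → Set
∀ᵥ zero    P = P []
∀ᵥ (suc k) P = ∀ x → ∀ᵥ k (λ ρ → P (x ∷ ρ))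

abstractᵥ : ∀ k {P : Vec ℕ k → Set} → (∀ ρ → P ρ) → ∀ᵥ k P
abstractᵥ zero    f = f []
abstractᵥ (suc k) f = λ x → abstractᵥ k (λ ρ → f (x ∷ ρ))

-- The interface used throughout. An equation enters as two opposite inequalities, a product of
-- unknowns as a variable of its own, and a contradiction is derived as `1 ≤ 0` with `c = 0`.
linear : ∀ k (problem : Exprs k (List (Ineq k) × Ineq k) k) (c : ℕ) (cs : List ℕ) →
         let hs , g = applyVars k id problem in
         {Certificate hs g c cs} → ∀ᵥ k (hs ⇛ g)
linear k problem c cs {t} = let hs , g = applyVars k id problem in
  abstractᵥ k (λ ρ → curryHyps hs g ρ (certificate-sound hs g c cs t ρ))

impossible : ∀ {a} {A : Set a} → 1 ≤ 0 → A
impossible ()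

-- Sums and counts over Fin N

opaque
  -- Opaque, so that sums, and with them degrees and sizes, stay symbolic during conversion;
  -- `∑-zero` and `∑-suc` state the recursion for use elsewhere.
  ∑ : ∀ {N} → (Fin N → ℕ) → ℕ
  ∑ {zero}  f = 0
  ∑ {suc N} f = f zero + ∑ (f ∘ suc)

  ∑-zero : (f : Fin 0 → ℕ) → ∑ f ≡ 0
  ∑-zero f = refl

  ∑-suc : ∀ {N} (f : Fin (suc N) → ℕ) → ∑ f ≡ f zero + ∑ (f ∘ suc)
  ∑-suc f = refl

𝟙 : Bool → ℕ
𝟙 true  = suc zero
𝟙 false = zero

count : ∀ {N} → (Fin N → Bool) → ℕ
count p = ∑ (λ x → 𝟙 (p x))

infix 5 _==_
_==_ : ∀ {N} → Fin N → Fin N → Bool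
x == y = does (x ≟ᶠ y)

==-refl : ∀ {N} (x : Fin N) → (x == x) ≡ true
==-refl x with x ≟ᶠ x
... | yes _ = refl
... | no ¬p = ⊥-elim (¬p refl)

==⇒≡ : ∀ {N} {x y : Fin N} → (x == y) ≡ true → x ≡ y
==⇒≡ {x = x} {y} eq with x ≟ᶠ y
... | yes p = p

≢⇒==-false : ∀ {N} {x y : Fin N} → x ≢ y → (x == y) ≡ false
≢⇒==-false {x = x} {y} ne with x ≟ᶠ y
... | yes p = ⊥-elim (ne p)
... | no _  = refl

==-false⇒≢ : ∀ {N} {x y : Fin N} → (x == y) ≡ false → x ≢ y
==-false⇒≢ {x = x} eq refl with x ≟ᶠ x
... | no ¬p = ¬p refl

true≢false : ∀ {b} → b ≡ true → b ≡ false → ⊥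
true≢false refl ()

decide : ∀ b → b ≡ true ⊎ b ≡ false
decide true  = inj₁ refl
decide false = inj₂ refl

¬true⇒false : ∀ {b} → ¬ (b ≡ true) → b ≡ false
¬true⇒false {true}  h = ⊥-elim (h refl)
¬true⇒false {false} h = refl

∧-intro : ∀ {a b} → a ≡ true → b ≡ true → a ∧ b ≡ true
∧-intro refl refl = refl

∧-elimˡ : ∀ {a b} → a ∧ b ≡ true → a ≡ true
∧-elimˡ {true} _ = refl

∧-elimʳ : ∀ {a b} → a ∧ b ≡ true → b ≡ true
∧-elimʳ {true} h = h

∨-elim : ∀ {a b} → a ∨ b ≡ true → a ≡ true ⊎ b ≡ true
∨-elim {true}  _ = inj₁ refl
∨-elim {false} h = inj₂ h

not-intro : ∀ {a} → a ≡ false → not a ≡ true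
not-intro refl = refl

not-elim : ∀ {a} → not a ≡ true → a ≡ false
not-elim {false} _ = refl

≤ᵇ-true : ∀ {m n} → m ≤ n → (m ≤ᵇ n) ≡ true
≤ᵇ-true {m} {n} le with m ≤ᵇ n | ≤⇒≤ᵇ le
... | true | _ = refl

≤ᵇ-true⁻ : ∀ {m n} → (m ≤ᵇ n) ≡ true → m ≤ n
≤ᵇ-true⁻ {m} {n} eq = ≤ᵇ⇒≤ m n (subst True (sym eq) tt)

≤ᵇ-false⁻ : ∀ {m n} → (m ≤ᵇ n) ≡ false → n < m
≤ᵇ-false⁻ {m} {n} eq with m ≤? n
... | yes le = ⊥-elim (true≢false (≤ᵇ-true le) eq)
... | no nle = ≰⇒> nle

𝟙-true : ∀ {b} → b ≡ true → 𝟙 b ≡ 1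
𝟙-true refl = refl

𝟙-false : ∀ {b} → b ≡ false → 𝟙 b ≡ 0
𝟙-false refl = refl

𝟙≡0 : ∀ {b} → 𝟙 b ≡ 0 → b ≡ false
𝟙≡0 {false} _ = refl

𝟙≤1 : ∀ b → 𝟙 b ≤ 1
𝟙≤1 true  = ≤-refl
𝟙≤1 false = z≤n

𝟙-mono : ∀ {a b} → (a ≡ true → b ≡ true) → 𝟙 a ≤ 𝟙 b
𝟙-mono {true}  {b} h rewrite h refl = ≤-refl
𝟙-mono {false} {b} h = z≤n

𝟙*-bound : ∀ b {x y} → (b ≡ true → x ≤ y) → 𝟙 b * x ≤ y
𝟙*-bound true  {x} h rewrite +-identityʳ x = h refl
𝟙*-bound false h = z≤n

opaque
  unfolding ∑

  ∑-cong : ∀ {N} {f g : Fin N → ℕ} → (∀ x → f x ≡ g x) → ∑ f ≡ ∑ g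
  ∑-cong {zero}  h = refl
  ∑-cong {suc N} h = cong₂ _+_ (h zero) (∑-cong (h ∘ suc))

opaque
  unfolding ∑

  ∑-mono : ∀ {N} {f g : Fin N → ℕ} → (∀ x → f x ≤ g x) → ∑ f ≤ ∑ g
  ∑-mono {zero}  h = z≤n
  ∑-mono {suc N} h = +-mono-≤ (h zero) (∑-mono (h ∘ suc))

opaque
  unfolding ∑

  ∑-+ : ∀ {N} (f g : Fin N → ℕ) → ∑ (λ x → f x + g x) ≡ ∑ f + ∑ g
  ∑-+ {zero}  f g = refl
  ∑-+ {suc N} f g rewrite ∑-+ (f ∘ suc) (g ∘ suc) = +-interchange (f zero) (g zero) _ _

∑-+≤ : ∀ {N} {f g : Fin N → ℕ} {a b} → ∑ f ≤ a → ∑ g ≤ b → ∑ (λ x → f x + g x) ≤ a + b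
∑-+≤ {f = f} {g} p q rewrite ∑-+ f g = +-mono-≤ p q

opaque
  unfolding ∑

  ∑-* : ∀ {N} c (f : Fin N → ℕ) → ∑ (λ x → c * f x) ≡ c * ∑ f
  ∑-* {zero}  c f = sym (*-zeroʳ c)
  ∑-* {suc N} c f rewrite ∑-* c (f ∘ suc) = sym (*-distribˡ-+ c (f zero) _)

opaque
  unfolding ∑

  ∑-0 : ∀ {N} {f : Fin N → ℕ} → (∀ x → f x ≡ 0) → ∑ f ≡ 0
  ∑-0 {zero}  h = refl
  ∑-0 {suc N} h rewrite h zero = ∑-0 (h ∘ suc)

opaque
  unfolding ∑

  ∑-swap : ∀ {M N} (f : Fin M → Fin N → ℕ) → ∑ (λ x → ∑ (f x)) ≡ ∑ (λ y → ∑ (λ x → f x y))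
  ∑-swap {zero} {N} f = sym (∑-0 {N} (λ _ → refl))
  ∑-swap {suc M} f rewrite ∑-swap (f ∘ suc) = sym (∑-+ (f zero) (λ y → ∑ (λ x → f (suc x) y)))

opaque
  unfolding ∑

  ≤∑ : ∀ {N} (f : Fin N → ℕ) x → f x ≤ ∑ f
  ≤∑ f zero    = m≤m+n _ _
  ≤∑ f (suc x) = ≤-trans (≤∑ (f ∘ suc) x) (m≤n+m _ _)

∑≡0 : ∀ {N} {f : Fin N → ℕ} → ∑ f ≡ 0 → ∀ x → f x ≡ 0
∑≡0 {f = f} h x = n≤0⇒n≡0 (subst (f x ≤_) h (≤∑ f x))

==-suc : ∀ {N} (x y : Fin N) → (suc x == suc y) ≡ (x == y)
==-suc x y with x ≟ᶠ y
... | yes _ = refl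
... | no  _ = refl

opaque
  unfolding ∑

  ∑-point : ∀ {N} (y : Fin N) (f : Fin N → ℕ) → ∑ (λ x → 𝟙 (x == y) * f x) ≡ f y
  ∑-point zero    f rewrite ∑-0 {f = λ x → 𝟙 (suc x == zero) * f (suc x)} (λ _ → refl) = trans (+-identityʳ _) (+-identityʳ _)
  ∑-point (suc y) f = trans (∑-cong (λ x → cong (λ b → 𝟙 b * f (suc x)) (==-suc x y))) (∑-point y (f ∘ suc))

count-point : ∀ {N} (y : Fin N) → count (_== y) ≡ 1
count-point y = trans (∑-cong (λ x → sym (*-identityʳ (𝟙 (x == y))))) (∑-point y (λ _ → 1))

-- A reindexing by f, injective on A because g inverts it there.
∑-reindex : ∀ {M N} (A : Fin M → Bool) (f : Fin M → Fin N) (g : Fin N → Fin M) (h : Fin N → ℕ) →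
            (∀ x → A x ≡ true → g (f x) ≡ x) → ∑ (λ x → 𝟙 (A x) * h (f x)) ≤ ∑ h
∑-reindex A f g h gf = begin
  ∑ (λ x → 𝟙 (A x) * h (f x))                ≤⟨ ∑-mono step ⟩
  ∑ (λ x → ∑ (λ y → 𝟙 (x == g y) * h y))     ≡⟨ ∑-swap (λ x y → 𝟙 (x == g y) * h y) ⟩
  ∑ (λ y → ∑ (λ x → 𝟙 (x == g y) * h y))     ≡⟨ ∑-cong (λ y → ∑-point (g y) (λ _ → h y)) ⟩
  ∑ h                                        ∎
  where
  open ≤-Reasoning
  -- For `x` in `A` the left side is the summand `y = f x` on the right, as `g (f x)` is `x`.
  step : ∀ x → 𝟙 (A x) * h (f x) ≤ ∑ (λ y → 𝟙 (x == g y) * h y)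
  step x = 𝟙*-bound (A x) λ ax → ≤-trans
    (≤-reflexive (sym (trans (cong (λ b → 𝟙 b * h (f x)) (trans (cong (x ==_) (gf x ax)) (==-refl x))) (+-identityʳ _))))
    (≤∑ (λ y → 𝟙 (x == g y) * h y) (f x))

opaque
  unfolding ∑

  -- Pigeonhole: an element of `A` with nonzero badness uses up at least one unit of `∑ bad`. The
  -- greedy choices below list their obstructions as summands of `bad` and read off the absence of
  -- each from the zero.
  pick : ∀ {N} (A : Fin N → Bool) (bad : Fin N → ℕ) → ∑ bad < count A → ∃ λ x → A x ≡ true × bad x ≡ 0
  pick {suc N} A bad lt with A zero in eq | bad zero in eq′
  ... | true  | zero  = zero , eq , eq′
  ... | false | _     = let x , ax , bx = pick (A ∘ suc) (bad ∘ suc) (≤-<-trans (m≤n+m _ _) lt) in suc x , ax , bx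
  ... | true  | suc b = let x , ax , bx = pick (A ∘ suc) (bad ∘ suc) (≤-<-trans (m≤n+m _ b) (≤-pred lt)) in suc x , ax , bx

nonempty : ∀ {N} (A : Fin N → Bool) → 0 < count A → ∃ λ x → A x ≡ true
nonempty {N} A lt = let x , ax , _ = pick A (λ _ → 0) (subst (_< count A) (sym (∑-0 {N} (λ _ → refl))) lt) in x , ax

search : ∀ {N} (p : Fin N → Bool) → (∃ λ x → p x ≡ true) ⊎ (∀ x → p x ≡ false)
search {zero}  p = inj₂ λ ()
search {suc N} p with decide (p zero) | search (p ∘ suc)
... | inj₁ t | _            = inj₁ (zero , t)
... | inj₂ _ | inj₁ (x , t) = inj₁ (suc x , t)
... | inj₂ f | inj₂ g       = inj₂ λ { zero → f ; (suc x) → g x }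

argmax : ∀ {N} (A : Fin N → Bool) (f : Fin N → ℕ) → ∃ (λ x → A x ≡ true) →
         ∃ λ x → A x ≡ true × (∀ y → A y ≡ true → f y ≤ f x)
argmax {suc N} A f ne with decide (A zero) | search (A ∘ suc)
argmax A f ne | inj₁ a | inj₂ none = zero , a , λ { zero _ → ≤-refl ; (suc y) ay → ⊥-elim (true≢false ay (none y)) }
argmax A f (zero , a)  | inj₂ a′ | inj₂ none = ⊥-elim (true≢false a a′)
argmax A f (suc x , a) | inj₂ a′ | inj₂ none = ⊥-elim (true≢false a (none x))
argmax A f ne | z | inj₁ ne′ with argmax (A ∘ suc) (f ∘ suc) ne′
argmax A f ne | inj₂ a′ | inj₁ _ | x , ax , max = suc x , ax , λ { zero a → ⊥-elim (true≢false a a′) ; (suc y) ay → max y ay }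
argmax A f ne | inj₁ a  | inj₁ _ | x , ax , max with ≤-total (f zero) (f (suc x))
... | inj₁ le = suc x , ax , λ { zero _ → le ; (suc y) ay → max y ay }
... | inj₂ ge = zero , a , λ { zero _ → ≤-refl ; (suc y) ay → ≤-trans (max y ay) ge }

below-average : ∀ {N} (A : Fin N → Bool) (f : Fin N → ℕ) → ∃ (λ x → A x ≡ true) →
                ∃ λ x → A x ≡ true × f x * count A ≤ ∑ f
below-average A f ne = x , ax , (begin
    f x * count A              ≡⟨ sym (∑-* (f x) (λ y → 𝟙 (A y))) ⟩
    ∑ (λ y → f x * 𝟙 (A y))    ≤⟨ ∑-mono least ⟩
    ∑ f                        ∎)
  where
  open ≤-Reasoning
  top = ∑ f
  -- A minimum of `f` is a maximum of `top ∸ f`; nothing is truncated, since `top` bounds every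
  -- value of `f`.
  best = argmax A (λ y → top ∸ f y) ne
  x = proj₁ best
  ax = proj₁ (proj₂ best)
  least : ∀ y → f x * 𝟙 (A y) ≤ f y
  least y with A y in eq
  ... | false rewrite *-zeroʳ (f x) = z≤n
  ... | true  rewrite *-identityʳ (f x) = ∸-cancelʳ-≤ {f x} {f y} {top} (≤∑ f x) (proj₂ (proj₂ best) y eq)

-- Graph triples on vertex sets A and B, and the removal of a matched pair

-- A and B are subsets of two separate copies of Fin N, so E₃ relates the first copy to the second.
record State (N : ℕ) : Set where
  field
    A B      : Fin N → Bool
    E₁ E₂ E₃ : Fin N → Fin N → Bool
    sym₁     : ∀ u u′ → E₁ u u′ ≡ E₁ u′ u
    sym₂     : ∀ y y′ → E₂ y y′ ≡ E₂ y′ y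
    irr₁     : ∀ u → E₁ u u ≡ false
    irr₂     : ∀ y → E₂ y y ≡ false
    on₁      : ∀ u u′ → E₁ u u′ ≡ true → A u ≡ true
    on₂      : ∀ y y′ → E₂ y y′ ≡ true → B y ≡ true
    on₃ˡ     : ∀ u y → E₃ u y ≡ true → A u ≡ true
    on₃ʳ     : ∀ u y → E₃ u y ≡ true → B y ≡ true

  d₁ d₂ d₃ˡ d₃ʳ : Fin N → ℕ
  d₁  u = count (E₁ u)
  d₂  y = count (E₂ y)
  d₃ˡ u = count (E₃ u)
  d₃ʳ y = count (λ u → E₃ u y)

  m₁ m₂ m₃ : ℕ
  m₁ = ∑ d₁
  m₂ = ∑ d₂
  m₃ = ∑ d₃ˡ

open State public

swap : ∀ {N} → State N → State N
swap σ = record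
  { A = B σ ; B = A σ ; E₁ = E₂ σ ; E₂ = E₁ σ ; E₃ = λ y u → E₃ σ u y
  ; sym₁ = sym₂ σ ; sym₂ = sym₁ σ ; irr₁ = irr₂ σ ; irr₂ = irr₁ σ
  ; on₁ = on₂ σ ; on₂ = on₁ σ ; on₃ˡ = λ y u → on₃ʳ σ u y ; on₃ʳ = λ y u → on₃ˡ σ u y }

m₃-swap : ∀ {N} (σ : State N) → m₃ (swap σ) ≡ m₃ σ
m₃-swap σ = ∑-swap (λ y u → 𝟙 (E₃ σ u y))

_∖_ : ∀ {N} → (Fin N → Bool) → Fin N → Fin N → Bool
(p ∖ v) x = p x ∧ not (x == v)

isolate : ∀ {N} → (Fin N → Fin N → Bool) → Fin N → Fin N → Fin N → Bool
isolate E v u u′ = E u u′ ∧ (not (u == v) ∧ not (u′ == v))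

place : ∀ {N} → Fin N → Fin N → State N → State N
place v w σ = record
  { A = A σ ∖ v ; B = B σ ∖ w
  ; E₁ = isolate (E₁ σ) v ; E₂ = isolate (E₂ σ) w
  ; E₃ = λ u y → (E₃ σ u y ∨ (E₁ σ u v ∧ E₂ σ y w)) ∧ (not (u == v) ∧ not (y == w))
  ; sym₁ = isolate-sym (sym₁ σ) v ; sym₂ = isolate-sym (sym₂ σ) w
  ; irr₁ = λ u → cong (_∧ _) (irr₁ σ u) ; irr₂ = λ u → cong (_∧ _) (irr₂ σ u)
  ; on₁ = λ u u′ h → ∧-intro (on₁ σ u u′ (∧-elimˡ h)) (∧-elimˡ (∧-elimʳ {E₁ σ u u′} h))
  ; on₂ = λ u u′ h → ∧-intro (on₂ σ u u′ (∧-elimˡ h)) (∧-elimˡ (∧-elimʳ {E₂ σ u u′} h))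
  ; on₃ˡ = λ u y h → ∧-intro (onˡ u y (∨-elim (∧-elimˡ h))) (∧-elimˡ (∧-elimʳ {E₃ σ u y ∨ (E₁ σ u v ∧ E₂ σ y w)} h))
  ; on₃ʳ = λ u y h → ∧-intro (onʳ u y (∨-elim (∧-elimˡ h)))
                       (∧-elimʳ {not (u == v)} (∧-elimʳ {E₃ σ u y ∨ (E₁ σ u v ∧ E₂ σ y w)} h))
  }
  where
  isolate-sym : ∀ {N} {E : Fin N → Fin N → Bool} → (∀ u u′ → E u u′ ≡ E u′ u) → ∀ v u u′ → isolate E v u u′ ≡ isolate E v u′ u
  isolate-sym s v u u′ rewrite s u u′ with u == v | u′ == v
  ... | true  | true  = refl
  ... | true  | false = refl
  ... | false | true  = refl
  ... | false | false = refl
  onˡ : ∀ u y → E₃ σ u y ≡ true ⊎ E₁ σ u v ∧ E₂ σ y w ≡ true → A σ u ≡ true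
  onˡ u y (inj₁ h) = on₃ˡ σ u y h
  onˡ u y (inj₂ h) = on₁ σ u v (∧-elimˡ h)
  onʳ : ∀ u y → E₃ σ u y ≡ true ⊎ E₁ σ u v ∧ E₂ σ y w ≡ true → B σ y ≡ true
  onʳ u y (inj₁ h) = on₃ʳ σ u y h
  onʳ u y (inj₂ h) = on₂ σ y w (∧-elimʳ {E₁ σ u v} h)

-- The maps are total on `Fin N` and inverse to each other only between `A` and `B`. Removing a pair
-- therefore changes no types, and putting it back is an update at one point.
record Packing {N} (σ : State N) : Set where
  field
    f g : Fin N → Fin N
    f∈  : ∀ u → A σ u ≡ true → B σ (f u) ≡ true
    g∈  : ∀ y → B σ y ≡ true → A σ (g y) ≡ true
    gf  : ∀ u → A σ u ≡ true → g (f u) ≡ u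
    fg  : ∀ y → B σ y ≡ true → f (g y) ≡ y
    ok₃ : ∀ u → A σ u ≡ true → E₃ σ u (f u) ≡ false
    ok  : ∀ u u′ → E₁ σ u u′ ≡ true → E₂ σ (f u) (f u′) ≡ false

on₁ʳ : ∀ {N} (σ : State N) u u′ → E₁ σ u u′ ≡ true → A σ u′ ≡ true
on₁ʳ σ u u′ h = on₁ σ u′ u (trans (sym₁ σ u′ u) h)

swap-packing : ∀ {N} (σ : State N) → Packing (swap σ) → Packing σ
swap-packing σ P = record
  { f = P.g ; g = P.f ; f∈ = P.g∈ ; g∈ = P.f∈ ; gf = P.fg ; fg = P.gf
  ; ok₃ = λ u au → subst (λ z → E₃ σ z (P.g u) ≡ false) (P.fg u au) (P.ok₃ (P.g u) (P.g∈ u au))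
  ; ok = λ u u′ h → ¬true⇒false λ h′ →
      true≢false h (subst₂ (λ a b → E₁ σ a b ≡ false) (P.fg u (on₁ σ u u′ h)) (P.fg u′ (on₁ʳ σ u u′ h)) (P.ok (P.g u) (P.g u′) h′)) }
  where module P = Packing P

_[_↦_] : ∀ {N} → (Fin N → Fin N) → Fin N → Fin N → Fin N → Fin N
(f [ v ↦ w ]) u = if u == v then w else f u

↦-same : ∀ {N} (f : Fin N → Fin N) v w → (f [ v ↦ w ]) v ≡ w
↦-same f v w rewrite ==-refl v = refl

↦-other : ∀ {N} (f : Fin N → Fin N) v w {u} → u ≢ v → (f [ v ↦ w ]) u ≡ f u
↦-other f v w ne rewrite ≢⇒==-false ne = refl

∖-intro : ∀ {N} {p : Fin N → Bool} {v u} → p u ≡ true → u ≢ v → (p ∖ v) u ≡ true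
∖-intro pu ne = ∧-intro pu (not-intro (≢⇒==-false ne))

∖-elimˡ : ∀ {N} {p : Fin N → Bool} {v u} → (p ∖ v) u ≡ true → p u ≡ true
∖-elimˡ h = ∧-elimˡ h

∖-elimʳ : ∀ {N} {p : Fin N → Bool} {v u} → (p ∖ v) u ≡ true → u ≢ v
∖-elimʳ {p = p} {u = u} h = ==-false⇒≢ (not-elim (∧-elimʳ {p u} h))

isolate-other : ∀ {N} (E : Fin N → Fin N → Bool) {v u u′} → u ≢ v → u′ ≢ v → isolate E v u u′ ≡ E u u′
isolate-other E {v} {u} {u′} ne ne′ rewrite ≢⇒==-false ne | ≢⇒==-false ne′ with E u u′
... | true  = refl
... | false = refl

E₃-place-elim : ∀ {N} (σ : State N) v w {u y} → u ≢ v → y ≢ w → E₃ (place v w σ) u y ≡ false →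
                E₃ σ u y ≡ false × E₁ σ u v ∧ E₂ σ y w ≡ false
E₃-place-elim σ v w {u} {y} ne ne′ h rewrite ≢⇒==-false ne | ≢⇒==-false ne′ with E₃ σ u y | E₁ σ u v ∧ E₂ σ y w
... | false | false = refl , refl

E₃-place-false : ∀ {N} (σ : State N) v w {u y} → E₃ σ u y ≡ false → (E₁ σ u v ≡ true → E₂ σ y w ≡ true → ⊥) →
                 E₃ (place v w σ) u y ≡ false
E₃-place-false σ v w {u} {y} h k with E₁ σ u v | E₂ σ y w
... | true  | true  = ⊥-elim (k refl refl)
... | true  | false rewrite h = refl
... | false | _     rewrite h = refl

-- A packing of the smaller triple avoids the pairs that `place` adds to `E₃`, so no neighbour of
-- `v` lands on a neighbour of `w`; this settles the edges at `v`.
place-packing : ∀ {N} (σ : State N) v w → A σ v ≡ true → B σ w ≡ true → E₃ σ v w ≡ false → Packing (place v w σ) → Packing σ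
place-packing {N} σ v w av bw nvw P = record
  { f = f′ ; g = g′ ; f∈ = f∈′ ; g∈ = g∈′ ; gf = gf′ ; fg = fg′ ; ok₃ = ok₃′ ; ok = ok′ }
  where
  module P = Packing P
  f′ = P.f [ v ↦ w ]
  g′ = P.g [ w ↦ v ]
  A∖ : ∀ {u} → A σ u ≡ true → u ≢ v → (A σ ∖ v) u ≡ true
  A∖ = ∖-intro {p = A σ}
  B∖ : ∀ {y} → B σ y ≡ true → y ≢ w → (B σ ∖ w) y ≡ true
  B∖ = ∖-intro {p = B σ}
  f≢w : ∀ {u} → A σ u ≡ true → u ≢ v → P.f u ≢ w
  f≢w au ne = ∖-elimʳ {p = B σ} (P.f∈ _ (A∖ au ne))
  g≢v : ∀ {y} → B σ y ≡ true → y ≢ w → P.g y ≢ v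
  g≢v by ne = ∖-elimʳ {p = A σ} (P.g∈ _ (B∖ by ne))
  f∈′ : ∀ u → A σ u ≡ true → B σ (f′ u) ≡ true
  f∈′ u au with u ≟ᶠ v
  ... | yes refl = bw
  ... | no ne    = ∖-elimˡ {p = B σ} (P.f∈ u (A∖ au ne))
  g∈′ : ∀ y → B σ y ≡ true → A σ (g′ y) ≡ true
  g∈′ y by with y ≟ᶠ w
  ... | yes refl = av
  ... | no ne    = ∖-elimˡ {p = A σ} (P.g∈ y (B∖ by ne))
  gf′ : ∀ u → A σ u ≡ true → g′ (f′ u) ≡ u
  gf′ u au with u ≟ᶠ v
  ... | yes refl = ↦-same P.g w v
  ... | no ne    = trans (↦-other P.g w v (f≢w au ne)) (P.gf u (A∖ au ne))
  fg′ : ∀ y → B σ y ≡ true → f′ (g′ y) ≡ y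
  fg′ y by with y ≟ᶠ w
  ... | yes refl = ↦-same P.f v w
  ... | no ne    = trans (↦-other P.f v w (g≢v by ne)) (P.fg y (B∖ by ne))
  clear : ∀ {u} → A σ u ≡ true → u ≢ v → E₃ σ u (P.f u) ≡ false × E₁ σ u v ∧ E₂ σ (P.f u) w ≡ false
  clear au ne = E₃-place-elim σ v w ne (f≢w au ne) (P.ok₃ _ (A∖ au ne))
  ok₃′ : ∀ u → A σ u ≡ true → E₃ σ u (f′ u) ≡ false
  ok₃′ u au with u ≟ᶠ v
  ... | yes refl = nvw
  ... | no ne    = proj₁ (clear au ne)
  star : ∀ u → u ≢ v → E₁ σ u v ≡ true → E₂ σ (P.f u) w ≡ false
  star u ne h = subst (λ b → b ∧ E₂ σ (P.f u) w ≡ false) h (proj₂ (clear (on₁ σ u v h) ne))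
  ok′ : ∀ u u′ → E₁ σ u u′ ≡ true → E₂ σ (f′ u) (f′ u′) ≡ false
  ok′ u u′ h with u ≟ᶠ v | u′ ≟ᶠ v
  ... | yes refl | yes refl = irr₂ σ w
  ... | yes refl | no ne    = trans (sym₂ σ w (P.f u′)) (star u′ ne (trans (sym₁ σ u′ u) h))
  ... | no ne    | yes refl = star u ne h
  ... | no ne    | no ne′   = trans
    (sym (isolate-other (E₂ σ) (f≢w (on₁ σ u u′ h) ne) (f≢w (on₁ʳ σ u u′ h) ne′)))
    (P.ok u u′ (trans (isolate-other (E₁ σ) ne ne′) h))

-- Effect of a placement on degrees and sizes

count-∖ : ∀ {N} (p : Fin N → Bool) v → count (p ∖ v) + 𝟙 (p v) ≡ count p
count-∖ p v = begin
  count (p ∖ v) + 𝟙 (p v)                               ≡⟨ cong (count (p ∖ v) +_) (sym (∑-point v (λ x → 𝟙 (p x)))) ⟩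
  count (p ∖ v) + ∑ (λ x → 𝟙 (x == v) * 𝟙 (p x))        ≡⟨ sym (∑-+ (λ x → 𝟙 ((p ∖ v) x)) _) ⟩
  ∑ (λ x → 𝟙 ((p ∖ v) x) + 𝟙 (x == v) * 𝟙 (p x))        ≡⟨ ∑-cong (λ x → pt (p x) (x == v)) ⟩
  count p                                               ∎
  where
  open ≡-Reasoning
  pt : ∀ a b → 𝟙 (a ∧ not b) + 𝟙 b * 𝟙 a ≡ 𝟙 a
  pt true  true  = refl
  pt true  false = refl
  pt false true  = refl
  pt false false = refl

count-∖-mem : ∀ {N} (p : Fin N → Bool) v → p v ≡ true → count (p ∖ v) + 1 ≡ count p
count-∖-mem p v h = trans (cong (λ b → count (p ∖ v) + 𝟙 b) (sym h)) (count-∖ p v)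

count-mono : ∀ {N} {p q : Fin N → Bool} → (∀ x → p x ≡ true → q x ≡ true) → count p ≤ count q
count-mono h = ∑-mono (λ x → 𝟙-mono (h x))

module _ {N} (E : Fin N → Fin N → Bool) (v : Fin N) where

  degree-isolate≤ : ∀ u → count (isolate E v u) ≤ count (E u)
  degree-isolate≤ u = count-mono λ x h → ∧-elimˡ h

  degree-isolate : ∀ u → u ≢ v → count (isolate E v u) + 𝟙 (E u v) ≡ count (E u)
  degree-isolate u ne = trans (cong (_+ 𝟙 (E u v)) (∑-cong λ x → cong (λ b → 𝟙 (E u x ∧ (not b ∧ not (x == v)))) (≢⇒==-false ne)))
                              (count-∖ (E u) v)

  degree-isolate-self : count (isolate E v v) ≡ 0
  degree-isolate-self = ∑-0 λ x → cong 𝟙 (f (E v x) (not (x == v)))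
    where
    f : ∀ a b → a ∧ (not (v == v) ∧ b) ≡ false
    f a b rewrite ==-refl v with a
    ... | true  = refl
    ... | false = refl

  size-isolate : (∀ u u′ → E u u′ ≡ E u′ u) → (∀ u → E u u ≡ false) →
                 ∑ (λ u → count (isolate E v u)) + 2 * count (E v) ≡ ∑ (λ u → count (E u))
  size-isolate s irr = begin
    S + 2 * count (E v)                                        ≡⟨ cong (S +_) (cong (count (E v) +_) (+-identityʳ _)) ⟩
    S + (count (E v) + count (E v))                            ≡⟨ cong (S +_) (cong₂ _+_ (∑-cong λ u → cong 𝟙 (s v u)) (sym (∑-point v (λ u → count (E u))))) ⟩
    S + (∑ (λ u → 𝟙 (E u v)) + ∑ (λ u → 𝟙 (u == v) * count (E u)))
      ≡⟨ sym (trans (∑-+ _ _) (cong (S +_) (∑-+ _ _))) ⟩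
    ∑ (λ u → count (isolate E v u) + (𝟙 (E u v) + 𝟙 (u == v) * count (E u)))  ≡⟨ ∑-cong pt ⟩
    ∑ (λ u → count (E u))                                      ∎
    where
    open ≡-Reasoning
    S = ∑ (λ u → count (isolate E v u))
    pt : ∀ u → count (isolate E v u) + (𝟙 (E u v) + 𝟙 (u == v) * count (E u)) ≡ count (E u)
    pt u = help (u ≟ᶠ v)
      where
      help : Dec (u ≡ v) → count (isolate E v u) + (𝟙 (E u v) + 𝟙 (u == v) * count (E u)) ≡ count (E u)
      help (yes refl) rewrite degree-isolate-self | irr u | ==-refl u = +-identityʳ _
      help (no ne) = trans (cong (λ z → count (isolate E v u) + (𝟙 (E u v) + 𝟙 z * count (E u))) (≢⇒==-false ne))
                           (trans (cong (count (isolate E v u) +_) (+-identityʳ _)) (degree-isolate u ne))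

-- One entry of the new `E₃`: `e` is the old edge, `a` and `b` say that the entry lies in the added
-- product, `p` and `q` mark the deleted row and column. An old edge in the deleted column is
-- credited on the left.
𝟙-∨-bound : ∀ e a b p q → 𝟙 ((e ∨ (a ∧ b)) ∧ (not p ∧ not q)) + 𝟙 q * 𝟙 e ≤ 𝟙 e + 𝟙 a * 𝟙 b
𝟙-∨-bound false false b     p q rewrite *-zeroʳ (𝟙 q) = z≤n
𝟙-∨-bound false true  false p q rewrite *-zeroʳ (𝟙 q) = z≤n
𝟙-∨-bound false true  true  p q rewrite *-zeroʳ (𝟙 q) | +-identityʳ (𝟙 (not p ∧ not q)) = 𝟙≤1 (not p ∧ not q)
𝟙-∨-bound true  a b true  true  = m≤m+n 1 _
𝟙-∨-bound true  a b true  false = z≤n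
𝟙-∨-bound true  a b false true  = m≤m+n 1 _
𝟙-∨-bound true  a b false false = m≤m+n 1 _

∧-swap-not : ∀ c p q → c ∧ (not p ∧ not q) ≡ c ∧ (not q ∧ not p)
∧-swap-not c true  true  = refl
∧-swap-not c true  false = refl
∧-swap-not c false true  = refl
∧-swap-not c false false = refl

module _ {N} (σ : State N) (v w : Fin N) where

  private τ = place v w σ

  d₁-place≤ : ∀ u → d₁ τ u ≤ d₁ σ u
  d₁-place≤ = degree-isolate≤ (E₁ σ) v
  d₂-place≤ : ∀ y → d₂ τ y ≤ d₂ σ y
  d₂-place≤ = degree-isolate≤ (E₂ σ) w

  d₁-place : ∀ u → u ≢ v → d₁ τ u + 𝟙 (E₁ σ u v) ≡ d₁ σ u
  d₁-place = degree-isolate (E₁ σ) v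
  d₂-place : ∀ y → y ≢ w → d₂ τ y + 𝟙 (E₂ σ y w) ≡ d₂ σ y
  d₂-place = degree-isolate (E₂ σ) w

  m₁-place : m₁ τ + 2 * d₁ σ v ≡ m₁ σ
  m₁-place = size-isolate (E₁ σ) v (sym₁ σ) (irr₁ σ)
  m₂-place : m₂ τ + 2 * d₂ σ w ≡ m₂ σ
  m₂-place = size-isolate (E₂ σ) w (sym₂ σ) (irr₂ σ)

  d₃ˡ-place : ∀ u → d₃ˡ τ u + 𝟙 (E₃ σ u w) ≤ d₃ˡ σ u + 𝟙 (E₁ σ u v) * d₂ σ w
  d₃ˡ-place u = begin
    d₃ˡ τ u + 𝟙 (E₃ σ u w)                                     ≡⟨ cong (d₃ˡ τ u +_) (sym (∑-point w (λ y → 𝟙 (E₃ σ u y)))) ⟩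
    d₃ˡ τ u + ∑ (λ y → 𝟙 (y == w) * 𝟙 (E₃ σ u y))              ≡⟨ sym (∑-+ (λ y → 𝟙 (E₃ τ u y)) _) ⟩
    ∑ (λ y → 𝟙 (E₃ τ u y) + 𝟙 (y == w) * 𝟙 (E₃ σ u y))         ≤⟨ ∑-mono (λ y → 𝟙-∨-bound (E₃ σ u y) (E₁ σ u v) (E₂ σ y w) (u == v) (y == w)) ⟩
    ∑ (λ y → 𝟙 (E₃ σ u y) + 𝟙 (E₁ σ u v) * 𝟙 (E₂ σ y w))       ≡⟨ ∑-+ _ _ ⟩
    d₃ˡ σ u + ∑ (λ y → 𝟙 (E₁ σ u v) * 𝟙 (E₂ σ y w))            ≡⟨ cong (d₃ˡ σ u +_) (∑-* (𝟙 (E₁ σ u v)) _) ⟩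
    d₃ˡ σ u + 𝟙 (E₁ σ u v) * ∑ (λ y → 𝟙 (E₂ σ y w))            ≡⟨ cong (λ s → d₃ˡ σ u + 𝟙 (E₁ σ u v) * s) (∑-cong λ y → cong 𝟙 (sym₂ σ y w)) ⟩
    d₃ˡ σ u + 𝟙 (E₁ σ u v) * d₂ σ w                            ∎
    where open ≤-Reasoning

  d₃ʳ-place : ∀ y → d₃ʳ τ y + 𝟙 (E₃ σ v y) ≤ d₃ʳ σ y + 𝟙 (E₂ σ y w) * d₁ σ v
  d₃ʳ-place y = begin
    d₃ʳ τ y + 𝟙 (E₃ σ v y)                                     ≡⟨ cong (d₃ʳ τ y +_) (sym (∑-point v (λ u → 𝟙 (E₃ σ u y)))) ⟩
    d₃ʳ τ y + ∑ (λ u → 𝟙 (u == v) * 𝟙 (E₃ σ u y))              ≡⟨ sym (∑-+ (λ u → 𝟙 (E₃ τ u y)) _) ⟩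
    ∑ (λ u → 𝟙 (E₃ τ u y) + 𝟙 (u == v) * 𝟙 (E₃ σ u y))         ≤⟨ ∑-mono pt ⟩
    ∑ (λ u → 𝟙 (E₃ σ u y) + 𝟙 (E₂ σ y w) * 𝟙 (E₁ σ u v))       ≡⟨ ∑-+ _ _ ⟩
    d₃ʳ σ y + ∑ (λ u → 𝟙 (E₂ σ y w) * 𝟙 (E₁ σ u v))            ≡⟨ cong (d₃ʳ σ y +_) (∑-* (𝟙 (E₂ σ y w)) _) ⟩
    d₃ʳ σ y + 𝟙 (E₂ σ y w) * ∑ (λ u → 𝟙 (E₁ σ u v))            ≡⟨ cong (λ s → d₃ʳ σ y + 𝟙 (E₂ σ y w) * s) (∑-cong λ u → cong 𝟙 (sym₁ σ u v)) ⟩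
    d₃ʳ σ y + 𝟙 (E₂ σ y w) * d₁ σ v                            ∎
    where
    open ≤-Reasoning
    pt : ∀ u → 𝟙 (E₃ τ u y) + 𝟙 (u == v) * 𝟙 (E₃ σ u y) ≤ 𝟙 (E₃ σ u y) + 𝟙 (E₂ σ y w) * 𝟙 (E₁ σ u v)
    pt u rewrite ∧-swap-not (E₃ σ u y ∨ (E₁ σ u v ∧ E₂ σ y w)) (u == v) (y == w) | *-comm (𝟙 (E₂ σ y w)) (𝟙 (E₁ σ u v)) =
      𝟙-∨-bound (E₃ σ u y) (E₁ σ u v) (E₂ σ y w) (y == w) (u == v)

  -- Since `vw` is no edge of G₃, the edges at `v` and those at `w` are disjoint sets, and both
  -- disappear.
  m₃-place : E₃ σ v w ≡ false → m₃ τ + (d₃ˡ σ v + d₃ʳ σ w) ≤ m₃ σ + d₁ σ v * d₂ σ w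
  m₃-place nvw = begin
    m₃ τ + (d₃ˡ σ v + d₃ʳ σ w)
      ≡⟨ cong (m₃ τ +_) (+-comm (d₃ˡ σ v) (d₃ʳ σ w)) ⟩
    m₃ τ + (d₃ʳ σ w + d₃ˡ σ v)
      ≡⟨ cong (λ z → m₃ τ + (d₃ʳ σ w + z)) (sym (∑-point v (d₃ˡ σ))) ⟩
    m₃ τ + (d₃ʳ σ w + ∑ (λ u → 𝟙 (u == v) * d₃ˡ σ u))
      ≡⟨ sym (trans (∑-+ _ _) (cong (m₃ τ +_) (∑-+ _ _))) ⟩
    ∑ (λ u → d₃ˡ τ u + (𝟙 (E₃ σ u w) + 𝟙 (u == v) * d₃ˡ σ u))
      ≤⟨ ∑-mono pt ⟩
    ∑ (λ u → d₃ˡ σ u + d₂ σ w * 𝟙 (E₁ σ u v))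
      ≡⟨ ∑-+ _ _ ⟩
    m₃ σ + ∑ (λ u → d₂ σ w * 𝟙 (E₁ σ u v))
      ≡⟨ cong (m₃ σ +_) (trans (∑-* (d₂ σ w) _) (*-comm (d₂ σ w) _)) ⟩
    m₃ σ + ∑ (λ u → 𝟙 (E₁ σ u v)) * d₂ σ w
      ≡⟨ cong (λ z → m₃ σ + z * d₂ σ w) (∑-cong λ u → cong 𝟙 (sym₁ σ u v)) ⟩
    m₃ σ + d₁ σ v * d₂ σ w ∎
    where
    open ≤-Reasoning
    gone : d₃ˡ τ v ≡ 0
    gone = ∑-0 λ y → cong 𝟙 (f (E₃ σ v y ∨ (E₁ σ v v ∧ E₂ σ y w)) (not (y == w)))
      where
      f : ∀ a b → a ∧ (not (v == v) ∧ b) ≡ false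
      f a b rewrite ==-refl v with a
      ... | true  = refl
      ... | false = refl
    pt : ∀ u → d₃ˡ τ u + (𝟙 (E₃ σ u w) + 𝟙 (u == v) * d₃ˡ σ u) ≤ d₃ˡ σ u + d₂ σ w * 𝟙 (E₁ σ u v)
    pt u = help (u ≟ᶠ v)
      where
      help : Dec (u ≡ v) → d₃ˡ τ u + (𝟙 (E₃ σ u w) + 𝟙 (u == v) * d₃ˡ σ u) ≤ d₃ˡ σ u + d₂ σ w * 𝟙 (E₁ σ u v)
      help (yes refl) rewrite gone | nvw | ==-refl u | +-identityʳ (d₃ˡ σ u) = m≤m+n _ _
      help (no ne) = subst (λ z → d₃ˡ τ u + (𝟙 (E₃ σ u w) + 𝟙 z * d₃ˡ σ u) ≤ d₃ˡ σ u + d₂ σ w * 𝟙 (E₁ σ u v)) (sym (≢⇒==-false ne))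
        (subst₂ _≤_ (cong (d₃ˡ τ u +_) (sym (+-identityʳ _))) (cong (d₃ˡ σ u +_) (*-comm (𝟙 (E₁ σ u v)) _)) (d₃ˡ-place u))

-- Bounded degrees: a conflict at one vertex is repaired by a transposition

-- Any pair may be placed, and as G₁ has no edges the placement adds nothing to G₃, so the
-- assumptions persist.
edgeless-packing : ∀ {N} n (σ : State N) → count (A σ) ≡ n → count (B σ) ≡ n →
                   (∀ u u′ → E₁ σ u u′ ≡ false) → (∀ u y → E₃ σ u y ≡ false) → Packing σ
edgeless-packing zero σ #A #B e₁ e₃ = record
  { f = id ; g = id
  ; f∈ = λ u au → ⊥-elim (true≢false au (none u)) ; g∈ = λ y by → ⊥-elim (true≢false by (𝟙≡0 (∑≡0 #B y)))
  ; gf = λ _ _ → refl ; fg = λ _ _ → refl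
  ; ok₃ = λ u _ → e₃ u u ; ok = λ u u′ h → ⊥-elim (true≢false h (e₁ u u′)) }
  where
  none : ∀ u → A σ u ≡ false
  none u = 𝟙≡0 (∑≡0 #A u)
edgeless-packing (suc n) σ #A #B e₁ e₃ =
  place-packing σ v w av bw (e₃ v w) (edgeless-packing n (place v w σ) (less (count-∖-mem (A σ) v av) #A) (less (count-∖-mem (B σ) w bw) #B)
    (λ u u′ → cong (_∧ (not (u == v) ∧ not (u′ == v))) (e₁ u u′)) (λ u y → E₃-place-false σ v w (e₃ u y) (λ h _ → true≢false h (e₁ u v))))
  where
  less : ∀ {a b} → a + 1 ≡ b → b ≡ suc n → a ≡ n
  less {a} p q = suc-injective (trans (trans (+-comm 1 a) p) q)
  inA = nonempty (A σ) (subst (0 <_) (sym #A) (s≤s z≤n))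
  inB = nonempty (B σ) (subst (0 <_) (sym #B) (s≤s z≤n))
  v = proj₁ inA
  av = proj₂ inA
  w = proj₁ inB
  bw = proj₂ inB

-- In contrast to `place`, the vertex stays in `A`; a packing of the muted state can violate the
-- original constraints only at `u`.
mute : ∀ {N} → Fin N → State N → State N
mute u σ = record
  { A = A σ ; B = B σ ; E₁ = isolate (E₁ σ) u ; E₂ = E₂ σ ; E₃ = λ x y → E₃ σ x y ∧ not (x == u)
  ; sym₁ = λ x x′ → trans (cong (_∧ (not (x == u) ∧ not (x′ == u))) (sym₁ σ x x′)) (∧-swap-not (E₁ σ x′ x) (x == u) (x′ == u))
  ; sym₂ = sym₂ σ ; irr₁ = λ x → cong (_∧ (not (x == u) ∧ not (x == u))) (irr₁ σ x) ; irr₂ = irr₂ σ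
  ; on₁ = λ x x′ h → on₁ σ x x′ (∧-elimˡ h) ; on₂ = on₂ σ
  ; on₃ˡ = λ x y h → on₃ˡ σ x y (∧-elimˡ h) ; on₃ʳ = λ x y h → on₃ʳ σ x y (∧-elimˡ h) }

transpose : ∀ {N} → Fin N → Fin N → Fin N → Fin N
transpose u u′ x = if x == u then u′ else (if x == u′ then u else x)

module _ {N} (u u′ : Fin N) where

  transpose-eqˡ : ∀ x → x ≡ u → transpose u u′ x ≡ u′
  transpose-eqˡ x refl rewrite ==-refl x = refl

  transpose-eqʳ : ∀ x → x ≡ u′ → transpose u u′ x ≡ u
  transpose-eqʳ x refl with x ≟ᶠ u
  ... | yes x≡u = x≡u
  ... | no _ rewrite ==-refl x = refl

  transpose-other : ∀ x → x ≢ u → x ≢ u′ → transpose u u′ x ≡ x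
  transpose-other x ne ne′ rewrite ≢⇒==-false ne | ≢⇒==-false ne′ = refl

  transpose-involutive : ∀ x → transpose u u′ (transpose u u′ x) ≡ x
  transpose-involutive x = help (x ≟ᶠ u) (x ≟ᶠ u′)
    where
    help : Dec (x ≡ u) → Dec (x ≡ u′) → transpose u u′ (transpose u u′ x) ≡ x
    help (yes e) _       = trans (cong (transpose u u′) (transpose-eqˡ x e)) (trans (transpose-eqʳ u′ refl) (sym e))
    help (no _)  (yes e) = trans (cong (transpose u u′) (transpose-eqʳ x e)) (trans (transpose-eqˡ u refl) (sym e))
    help (no ne) (no ne′) = trans (cong (transpose u u′) (transpose-other x ne ne′)) (transpose-other x ne ne′)

  transpose-closed : (A : Fin N → Bool) → A u ≡ true → A u′ ≡ true → ∀ x → A x ≡ true → A (transpose u u′ x) ≡ true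
  transpose-closed A au au′ x ax with x == u | x == u′
  ... | true  | _     = au′
  ... | false | true  = au
  ... | false | false = ax

∑∑-bound : ∀ {M N} (f : Fin M → Fin N → ℕ) {b} → ∑ (λ z → ∑ (λ x → f x z)) ≤ b → ∑ (λ x → ∑ (λ z → f x z)) ≤ b
∑∑-bound f h = ≤-trans (≤-reflexive (∑-swap f)) h

∑-weighted : ∀ {N} (p : Fin N → Bool) (f : Fin N → ℕ) {b} → (∀ x → f x ≤ b) → ∑ (λ x → 𝟙 (p x) * f x) ≤ count p * b
∑-weighted p f {b} h = begin
  ∑ (λ x → 𝟙 (p x) * f x)  ≤⟨ ∑-mono (λ x → *-monoʳ-≤ (𝟙 (p x)) (h x)) ⟩
  ∑ (λ x → 𝟙 (p x) * b)    ≡⟨ ∑-cong (λ x → *-comm (𝟙 (p x)) b) ⟩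
  ∑ (λ x → b * 𝟙 (p x))    ≡⟨ ∑-* b _ ⟩
  b * count p              ≡⟨ *-comm b _ ⟩
  count p * b              ∎
  where open ≤-Reasoning

zero₂ : ∀ a b → a + b ≡ 0 → a ≡ 0 × b ≡ 0
zero₂ zero b h = refl , h

𝟙*𝟙≡0 : ∀ {a b} → a ≡ true → 𝟙 a * 𝟙 b ≡ 0 → b ≡ false
𝟙*𝟙≡0 {b = b} refl h = 𝟙≡0 (trans (sym (+-identityʳ (𝟙 b))) h)

record Bounded {N} (σ : State N) (K T : ℕ) : Set where
  field
    Δ₁  : ∀ u → d₁ σ u ≤ K
    Δ₂  : ∀ y → d₂ σ y ≤ K
    Δ₃ˡ : ∀ u → d₃ˡ σ u ≤ T
    Δ₃ʳ : ∀ y → d₃ʳ σ y ≤ T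

module Repair {N} (σ : State N) {K T : ℕ} (bd : Bounded σ K T) {n : ℕ} (#A : count (A σ) ≡ n)
              (room : T + T + K * K + K * K + K < n) (u : Fin N) (au : A σ u ≡ true) (P : Packing (mute u σ)) where

  open Bounded bd
  private module P = Packing P
  f = P.f

  -- Obstructions to exchanging the images of `u` and `x`: G₃ forbids `u` on `f x`; it forbids `x`
  -- on `f u`; a neighbour of `u` sits next to `f x`; a neighbour of `x` sits next to `f u`; `x` is
  -- adjacent to `u`. Their totals are at most `T`, `T`, `K * K`, `K * K` and `K`. The choice
  -- `x = u` is allowed and means that `u` causes no conflict where it is.
  bad₁ bad₂ bad₃ bad₄ bad₅ bad : Fin N → ℕ
  bad₁ x = 𝟙 (A σ x) * 𝟙 (E₃ σ u (f x))
  bad₂ x = 𝟙 (E₃ σ x (f u))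
  bad₃ x = ∑ (λ z → 𝟙 (E₁ σ u z) * (𝟙 (A σ x) * 𝟙 (E₂ σ (f z) (f x))))
  bad₄ x = ∑ (λ z → 𝟙 (A σ z) * 𝟙 (E₂ σ (f u) (f z)) * 𝟙 (E₁ σ z x))
  bad₅ x = 𝟙 (E₁ σ u x)
  bad x = bad₁ x + bad₂ x + bad₃ x + bad₄ x + bad₅ x

  ∑bad : ∑ bad ≤ T + T + K * K + K * K + K
  ∑bad = ∑-+≤ (∑-+≤ (∑-+≤ (∑-+≤
    (≤-trans (∑-reindex (A σ) f P.g (λ y → 𝟙 (E₃ σ u y)) P.gf) (Δ₃ˡ u)) (Δ₃ʳ (f u)))
    (∑∑-bound _ (≤-trans (∑-mono third) (≤-trans (∑-weighted (E₁ σ u) (λ z → d₂ σ (f z)) (λ z → Δ₂ (f z))) (*-monoˡ-≤ K (Δ₁ u))))))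
    (∑∑-bound _ (≤-trans (∑-mono fourth) (≤-trans (∑-reindex (A σ) f P.g (λ y → 𝟙 (E₂ σ (f u) y) * K) P.gf)
      (≤-trans (∑-weighted (E₂ σ (f u)) (λ _ → K) (λ _ → ≤-refl)) (*-monoˡ-≤ K (Δ₂ (f u))))))))
    (Δ₁ u)
    where
    third : ∀ z → ∑ (λ x → 𝟙 (E₁ σ u z) * (𝟙 (A σ x) * 𝟙 (E₂ σ (f z) (f x)))) ≤ 𝟙 (E₁ σ u z) * d₂ σ (f z)
    third z = ≤-trans (≤-reflexive (∑-* (𝟙 (E₁ σ u z)) _)) (*-monoʳ-≤ (𝟙 (E₁ σ u z)) (∑-reindex (A σ) f P.g (λ y → 𝟙 (E₂ σ (f z) y)) P.gf))
    fourth : ∀ z → ∑ (λ x → 𝟙 (A σ z) * 𝟙 (E₂ σ (f u) (f z)) * 𝟙 (E₁ σ z x)) ≤ 𝟙 (A σ z) * (𝟙 (E₂ σ (f u) (f z)) * K)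
    fourth z = ≤-trans (≤-reflexive (∑-* (𝟙 (A σ z) * 𝟙 (E₂ σ (f u) (f z))) _))
      (≤-trans (*-monoʳ-≤ (𝟙 (A σ z) * 𝟙 (E₂ σ (f u) (f z))) (Δ₁ z)) (≤-reflexive (*-assoc (𝟙 (A σ z)) _ K)))

  choice = pick (A σ) bad (subst (∑ bad <_) (sym #A) (≤-<-trans ∑bad room))
  u′ = proj₁ choice
  au′ = proj₁ (proj₂ choice)

  good : bad₁ u′ ≡ 0 × bad₂ u′ ≡ 0 × bad₃ u′ ≡ 0 × bad₄ u′ ≡ 0 × bad₅ u′ ≡ 0
  good =
    let p , b₅ = zero₂ (bad₁ u′ + bad₂ u′ + bad₃ u′ + bad₄ u′) _ (proj₂ (proj₂ choice))
        q , b₄ = zero₂ (bad₁ u′ + bad₂ u′ + bad₃ u′) _ p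
        r , b₃ = zero₂ (bad₁ u′ + bad₂ u′) _ q
        b₁ , b₂ = zero₂ (bad₁ u′) _ r
    in b₁ , b₂ , b₃ , b₄ , b₅

  clear₁ : E₃ σ u (f u′) ≡ false
  clear₁ = 𝟙*𝟙≡0 au′ (proj₁ good)
  clear₂ : E₃ σ u′ (f u) ≡ false
  clear₂ = 𝟙≡0 (proj₁ (proj₂ good))
  clear₃ : ∀ z → E₁ σ u z ≡ true → E₂ σ (f z) (f u′) ≡ false
  clear₃ z h = 𝟙*𝟙≡0 au′ (trans (sym (+-identityʳ _)) (subst (λ b → 𝟙 b * (𝟙 (A σ u′) * 𝟙 (E₂ σ (f z) (f u′))) ≡ 0) h
    (∑≡0 {f = λ z → 𝟙 (E₁ σ u z) * (𝟙 (A σ u′) * 𝟙 (E₂ σ (f z) (f u′)))} (proj₁ (proj₂ (proj₂ good))) z)))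
  clear₄ : ∀ z → E₁ σ z u′ ≡ true → E₂ σ (f u) (f z) ≡ false
  clear₄ z h = 𝟙*𝟙≡0 (on₁ σ z u′ h) (trans (sym (*-identityʳ _)) (subst (λ b → 𝟙 (A σ z) * 𝟙 (E₂ σ (f u) (f z)) * 𝟙 b ≡ 0) h
    (∑≡0 {f = λ z → 𝟙 (A σ z) * 𝟙 (E₂ σ (f u) (f z)) * 𝟙 (E₁ σ z u′)} (proj₁ (proj₂ (proj₂ (proj₂ good)))) z)))
  clear₅ : E₁ σ u u′ ≡ false
  clear₅ = 𝟙≡0 (proj₂ (proj₂ (proj₂ (proj₂ good))))

  τ : Fin N → Fin N
  τ = transpose u u′
  τ∈ = transpose-closed u u′ (A σ) au au′

  ok₃′ : ∀ x → A σ x ≡ true → E₃ σ x (f (τ x)) ≡ false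
  ok₃′ x ax = help (x ≟ᶠ u) (x ≟ᶠ u′)
    where
    help : Dec (x ≡ u) → Dec (x ≡ u′) → E₃ σ x (f (τ x)) ≡ false
    help (yes refl) _       = trans (cong (E₃ σ x ∘ f) (transpose-eqˡ x u′ x refl)) clear₁
    help (no _) (yes refl)  = trans (cong (E₃ σ x ∘ f) (transpose-eqʳ u x x refl)) clear₂
    help (no ne) (no ne′)   = trans (cong (E₃ σ x ∘ f) (transpose-other u u′ x ne ne′))
      (¬true⇒false λ h → true≢false (∧-intro h (not-intro (≢⇒==-false ne))) (P.ok₃ x ax))

  Safe : Fin N → Fin N → Set
  Safe x x′ = E₁ σ x x′ ≡ true → E₂ σ (f (τ x)) (f (τ x′)) ≡ false

  flip-safe : ∀ {x x′} → Safe x′ x → Safe x x′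
  flip-safe {x} {x′} s h = trans (sym₂ σ (f (τ x)) (f (τ x′))) (s (trans (sym₁ σ x′ x) h))

  at-u : ∀ x → Safe u x
  at-u x h = help (x ≟ᶠ u) (x ≟ᶠ u′)
    where
    help : Dec (x ≡ u) → Dec (x ≡ u′) → E₂ σ (f (τ u)) (f (τ x)) ≡ false
    help (yes refl) _      = ⊥-elim (true≢false h (irr₁ σ x))
    help (no _) (yes refl) = ⊥-elim (true≢false h clear₅)
    help (no ne) (no ne′)  = trans (cong₂ (λ a b → E₂ σ (f a) (f b)) (transpose-eqˡ u u′ u refl) (transpose-other u u′ x ne ne′))
                                   (trans (sym₂ σ (f u′) (f x)) (clear₃ x h))

  at-u′ : ∀ x → x ≢ u → Safe u′ x
  at-u′ x ne h = help (x ≟ᶠ u′)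
    where
    help : Dec (x ≡ u′) → E₂ σ (f (τ u′)) (f (τ x)) ≡ false
    help (yes refl) = ⊥-elim (true≢false h (irr₁ σ x))
    help (no ne′)   = trans (cong₂ (λ a b → E₂ σ (f a) (f b)) (transpose-eqʳ u u′ u′ refl) (transpose-other u u′ x ne ne′))
                            (clear₄ x (trans (sym₁ σ x u′) h))

  safe : ∀ x x′ → Safe x x′
  safe x x′ = help (x ≟ᶠ u) (x′ ≟ᶠ u) (x ≟ᶠ u′) (x′ ≟ᶠ u′)
    where
    help : Dec (x ≡ u) → Dec (x′ ≡ u) → Dec (x ≡ u′) → Dec (x′ ≡ u′) → Safe x x′
    help (yes refl) _ _ _             = at-u x′
    help (no _) (yes refl) _ _        = flip-safe (at-u x)
    help (no _) (no ne) (yes refl) _  = at-u′ x′ ne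
    help (no ne) (no _) (no _) (yes refl) = flip-safe (at-u′ x ne)
    help (no a) (no b) (no c) (no d) h = trans (cong₂ (λ a b → E₂ σ (f a) (f b)) (transpose-other u u′ x a c) (transpose-other u u′ x′ b d))
                                               (P.ok x x′ (trans (isolate-other (E₁ σ) a b) h))

  repaired : Packing σ
  repaired = record
    { f = f ∘ τ ; g = τ ∘ P.g
    ; f∈ = λ x ax → P.f∈ (τ x) (τ∈ x ax) ; g∈ = λ y by → τ∈ (P.g y) (P.g∈ y by)
    ; gf = λ x ax → trans (cong τ (P.gf (τ x) (τ∈ x ax))) (transpose-involutive u u′ x)
    ; fg = λ y by → trans (cong f (transpose-involutive u u′ (P.g y))) (P.fg y by)
    ; ok₃ = ok₃′ ; ok = safe }

mute-bounded : ∀ {N} {σ : State N} {K T} u → Bounded σ K T → Bounded (mute u σ) K T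
mute-bounded {σ = σ} u bd = record
  { Δ₁ = λ x → ≤-trans (degree-isolate≤ (E₁ σ) u x) (Δ₁ x) ; Δ₂ = Δ₂
  ; Δ₃ˡ = λ x → ≤-trans (count-mono (λ y h → ∧-elimˡ h)) (Δ₃ˡ x)
  ; Δ₃ʳ = λ y → ≤-trans (count-mono (λ x h → ∧-elimˡ h)) (Δ₃ʳ y) }
  where open Bounded bd

-- Muting the vertices one after the other ends in an edgeless problem, and every muting is undone
-- by one repair. The degree bounds survive muting, so the same `room` serves each time. `S` holds
-- the vertices not yet muted.
bounded-packing : ∀ {N} (σ : State N) {K T n} → Bounded σ K T → count (A σ) ≡ n → count (B σ) ≡ n →
                  T + T + K * K + K * K + K < n → Packing σ
bounded-packing {N} σ₀ {K} {T} {n} bd₀ #A₀ #B₀ room =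
  go (count (A σ₀)) σ₀ bd₀ #A₀ #B₀ (A σ₀) refl (λ u h → h)
     (λ u u′ h → ¬true⇒false λ h′ → true≢false (on₁ σ₀ u u′ h′) h)
     (λ u y h → ¬true⇒false λ h′ → true≢false (on₃ˡ σ₀ u y h′) h)
  where
  go : ∀ k (σ : State N) → Bounded σ K T → count (A σ) ≡ n → count (B σ) ≡ n →
       (S : Fin N → Bool) → count S ≡ k → (∀ u → S u ≡ true → A σ u ≡ true) →
       (∀ u u′ → S u ≡ false → E₁ σ u u′ ≡ false) → (∀ u y → S u ≡ false → E₃ σ u y ≡ false) → Packing σ
  go zero σ bd #A #B S #S S⊆A e₁ e₃ =
    edgeless-packing n σ #A #B (λ u u′ → e₁ u u′ (𝟙≡0 (∑≡0 #S u))) (λ u y → e₃ u y (𝟙≡0 (∑≡0 #S u)))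
  go (suc k) σ bd #A #B S #S S⊆A e₁ e₃ =
    Repair.repaired σ bd #A room u (S⊆A u su)
      (go k (mute u σ) (mute-bounded u bd) #A #B (S ∖ u)
        (suc-injective (trans (trans (+-comm 1 _) (count-∖-mem S u su)) #S))
        (λ x h → S⊆A x (∖-elimˡ {p = S} h))
        (λ x x′ h → off (E₁ σ x x′) (not (x′ == u)) x h (e₁ x x′))
        (λ x y h → trans (cong (E₃ σ x y ∧_) (sym (∧-true-r (not (x == u))))) (off (E₃ σ x y) true x h (e₃ x y))))
    where
    inS = nonempty S (subst (0 <_) (sym #S) (s≤s z≤n))
    u = proj₁ inS
    su = proj₂ inS
    ∧-true-r : ∀ b → b ∧ true ≡ b
    ∧-true-r true  = refl
    ∧-true-r false = refl
    off : ∀ e b x → (S ∖ u) x ≡ false → (S x ≡ false → e ≡ false) → e ∧ (not (x == u) ∧ b) ≡ false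
    off false b x h k = refl
    off true  b x h k with S x | x == u
    ... | true  | true  = refl
    ... | false | _     with () ← k refl

-- Triples whose degrees are small against n

markov : ∀ {N} (p : Fin N → Bool) (f : Fin N → ℕ) c → (∀ x → p x ≡ true → c ≤ f x) → c * count p ≤ ∑ f
markov p f c h = ≤-trans (≤-reflexive (sym (∑-* c (λ x → 𝟙 (p x))))) (∑-mono λ x → ≤-trans (≤-reflexive (*-comm c _)) (𝟙*-bound (p x) (h x)))

d₁-place+ : ∀ {N} (σ : State N) v w u → d₁ (place v w σ) u + 𝟙 (E₁ σ u v) ≤ d₁ σ u
d₁-place+ σ v w u = help (u ≟ᶠ v)
  where
  help : Dec (u ≡ v) → d₁ (place v w σ) u + 𝟙 (E₁ σ u v) ≤ d₁ σ u
  help (yes refl) = ≤-trans (≤-reflexive (trans (cong (λ b → d₁ (place v w σ) u + 𝟙 b) (irr₁ σ u)) (+-identityʳ _))) (d₁-place≤ σ v w u)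
  help (no ne)    = ≤-reflexive (d₁-place σ v w u ne)

m₁-place≤ : ∀ {N} (σ : State N) v w → m₁ (place v w σ) ≤ m₁ σ
m₁-place≤ σ v w = ∑-mono (d₁-place≤ σ v w)

m₂-place≤ : ∀ {N} (σ : State N) v w → m₂ (place v w σ) ≤ m₂ σ
m₂-place≤ σ v w = ∑-mono (d₂-place≤ σ v w)

count-place : ∀ {N} (p : Fin N → Bool) v {n} → p v ≡ true → count p ≡ suc n → count (p ∖ v) ≡ n
count-place p v pv h = suc-injective (trans (trans (+-comm 1 _) (count-∖-mem p v pv)) h)

-- `120 = 6 * 20`: the degrees in G₁ and G₂ sum to at most `6 n`, so at most `n / 20` vertices are
-- high, and `19 n / 20` pairs are left when all of them have been placed.
high : ∀ {N} → (Fin N → ℕ) → Fin N → Bool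
high d u = 120 ≤ᵇ d u

module Sparse (n D : ℕ) (n-large : 139425 ≤ n) (D-small : 700 * D ≤ n) where

  -- Besides the degree bounds, the weights d₃ + 17 d and m₃ + 17 (m₁ + m₂)/2
  -- do not grow when a high vertex is placed on a vertex of degree at most 17
  -- none of whose neighbours is warm.
  record Inv {N} (σ : State N) (k h : ℕ) : Set where
    field
      #A     : count (A σ) ≡ k
      #B     : count (B σ) ≡ k
      Δ₁     : ∀ u → d₁ σ u ≤ D
      Δ₂     : ∀ y → d₂ σ y ≤ D
      loadˡ  : ∀ u → 10 * (d₃ˡ σ u + 17 * d₁ σ u) ≤ 3 * n
      loadʳ  : ∀ y → 10 * (d₃ʳ σ y + 17 * d₂ σ y) ≤ 3 * n
      weight : 2 * m₃ σ + 17 * (m₁ σ + m₂ σ) ≤ 102 * n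
      highs  : count (high (d₁ σ)) + count (high (d₂ σ)) ≤ h
      size   : 19 * n + 20 * h ≤ 20 * k

  swap-inv : ∀ {N} {σ : State N} {k h} → Inv σ k h → Inv (swap σ) k h
  swap-inv {σ = σ} I = record
    { #A = #B ; #B = #A ; Δ₁ = Δ₂ ; Δ₂ = Δ₁ ; loadˡ = loadʳ ; loadʳ = loadˡ
    ; weight = ≤-trans (≤-reflexive (cong₂ (λ a b → 2 * a + 17 * b) (m₃-swap σ) (+-comm (m₂ σ) (m₁ σ)))) weight
    ; highs = ≤-trans (≤-reflexive (+-comm (count (high (d₂ σ))) _)) highs ; size = size }
    where open Inv I

  warm-lin : ∀ x y d D n → 3 * n < 10 * (x + 17 * y + D) → y ≤ D → 700 * D ≤ n → 192 * n ≤ 700 * x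
  warm-lin = linear 5 (λ x y d D n → (# 1 ⊕ 3 ⊗ n ⊴ 10 ⊗ (x ⊕ 17 ⊗ y ⊕ D)) ∷ (y ⊴ D) ∷ (700 ⊗ D ⊴ n) ∷ [] , (192 ⊗ n ⊴ 700 ⊗ x)) 1 (70 ∷ 11900 ∷ 18 ∷ [])
  warm-count : ∀ a s n m t → a ≤ 700 * s → 2 * s + 17 * t ≤ 102 * n → 35712 * n ≤ a → 139425 ≤ n → 1 ≤ 0
  warm-count = linear 5 (λ a s n m t → (a ⊴ 700 ⊗ s) ∷ (2 ⊗ s ⊕ 17 ⊗ t ⊴ 102 ⊗ n) ∷ (35712 ⊗ n ⊴ a) ∷ (# 139425 ⊴ n) ∷ [] , (# 1 ⊴ # 0)) 0 (1 ∷ 350 ∷ 1 ∷ 12 ∷ [])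
  room-lin : ∀ x c y D n k m₁ m₂ m₃ h → 10 * (x + 17 * m₁) ≤ 3 * n → 18 * c ≤ m₂ → 2 * m₃ + 17 * (h + m₂) ≤ 102 * n → y ≤ 185 * D → 700 * D ≤ n → 19 * n + 20 ≤ 20 * k → x + c + y < k
  room-lin = linear 10 (λ x c y D n k m₁ m₂ m₃ h → (10 ⊗ (x ⊕ 17 ⊗ m₁) ⊴ 3 ⊗ n) ∷ (18 ⊗ c ⊴ m₂) ∷ (2 ⊗ m₃ ⊕ 17 ⊗ (h ⊕ m₂) ⊴ 102 ⊗ n) ∷ (y ⊴ 185 ⊗ D) ∷ (700 ⊗ D ⊴ n) ∷ (19 ⊗ n ⊕ # 20 ⊴ 20 ⊗ k) ∷ [] , (# 1 ⊕ (x ⊕ c ⊕ y) ⊴ k)) 21420 (2142 ∷ 1190 ∷ 70 ∷ 21420 ∷ 5661 ∷ 1071 ∷ [])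

  module Step {N} {σ : State N} {k h} (I : Inv σ (suc k) (suc h)) (v : Fin N) (v-high : 120 ≤ d₁ σ v) where
    open Inv I

    av : A σ v ≡ true
    av = let x , e , _ = pick (E₁ σ v) (λ _ → 0) (subst (_< d₁ σ v) (sym (∑-0 {N} (λ _ → refl))) (≤-trans (s≤s z≤n) v-high)) in on₁ σ v x e

    -- A neighbour of `w` may gain `d₁ σ v ≤ D` edges of G₃, so it needs that much room below the
    -- load bound `3 n / 10`.
    warm : Fin N → Bool
    warm y = suc (3 * n) ≤ᵇ 10 * (d₃ʳ σ y + 17 * d₂ σ y + D)

    -- As `18 * D ≤ 18 n / 700`, a warm vertex has `192 n ≤ 700 * d₃ʳ`. With `m₃ ≤ 51 n`, a number
    -- of 186 such vertices is too many: `192 * 186 = 35712` exceeds `700 * 51 = 35700`.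
    #warm : count warm ≤ 185
    #warm = ≮⇒≥ λ lt → impossible (warm-count (192 * n * count warm) (m₃ σ) n 0 (m₁ σ + m₂ σ)
      (≤-trans (markov warm (λ y → 700 * d₃ʳ σ y) (192 * n) (λ y wy → warm-lin (d₃ʳ σ y) (d₂ σ y) 0 D n (≤ᵇ-true⁻ wy) (Δ₂ y) D-small))
               (≤-reflexive (trans (∑-* 700 (d₃ʳ σ)) (cong (700 *_) (m₃-swap σ)))))
      weight (≤-trans (≤-reflexive (trans (*-assoc 192 186 n) (trans (cong (192 *_) (*-comm 186 n)) (sym (*-assoc 192 n 186))))) (*-monoʳ-≤ (192 * n) lt)) n-large)

    bad₁ bad₂ bad₃ : Fin N → ℕ
    bad₁ w = 𝟙 (E₃ σ v w)
    bad₂ w = 𝟙 (18 ≤ᵇ d₂ σ w)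
    bad₃ w = ∑ (λ y → 𝟙 (warm y) * 𝟙 (E₂ σ y w))

    ∑bad₃ : ∑ bad₃ ≤ 185 * D
    ∑bad₃ = ∑∑-bound _ (≤-trans (∑-mono (λ y → ≤-reflexive (∑-* (𝟙 (warm y)) _)))
      (≤-trans (∑-weighted warm (d₂ σ) Δ₂) (*-monoˡ-≤ D #warm)))

    -- The vertices joined to `v`, those of degree at least 18 and the neighbours of warm ones
    -- number at most `3 n / 10`, `n / 3` and `185 n / 700`, together less than `19 n / 20`.
    choice : ∃ λ w → B σ w ≡ true × bad₁ w + bad₂ w + bad₃ w ≡ 0
    choice = pick (B σ) (λ w → bad₁ w + bad₂ w + bad₃ w) (subst (∑ (λ w → bad₁ w + bad₂ w + bad₃ w) <_) (sym #B) (≤-<-trans (∑-+≤ (∑-+≤ ≤-refl ≤-refl) ≤-refl)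
      (room-lin (d₃ˡ σ v) (∑ bad₂) (∑ bad₃) D n (suc k) (d₁ σ v) (m₂ σ) (m₃ σ) (m₁ σ) (loadˡ v)
        (markov (λ w → 18 ≤ᵇ d₂ σ w) (d₂ σ) 18 (λ _ → ≤ᵇ-true⁻)) weight ∑bad₃ D-small
        (≤-trans (+-monoʳ-≤ (19 * n) (*-monoʳ-≤ 20 (s≤s z≤n))) size))))

    w = proj₁ choice
    bw = proj₁ (proj₂ choice)
    split = zero₂ (bad₁ w + bad₂ w) (bad₃ w) (proj₂ (proj₂ choice))
    split′ = zero₂ (bad₁ w) (bad₂ w) (proj₁ split)

    nvw : E₃ σ v w ≡ false
    nvw = 𝟙≡0 (proj₁ split′)

    d₂w : d₂ σ w ≤ 17
    d₂w = ≤-pred (≤ᵇ-false⁻ {18} (𝟙≡0 (proj₂ split′)))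

    cool : ∀ y → E₂ σ y w ≡ true → 10 * (d₃ʳ σ y + 17 * d₂ σ y + D) ≤ 3 * n
    cool y h = ≤-pred (≤ᵇ-false⁻ {suc (3 * n)} (𝟙≡0 (trans (sym (*-identityʳ _)) (subst (λ b → 𝟙 (warm y) * 𝟙 b ≡ 0) h
      (∑≡0 {f = λ y → 𝟙 (warm y) * 𝟙 (E₂ σ y w)} (proj₂ split) y)))))

    τ = place v w σ

    next : Inv τ k h
    next = record
      { #A = count-place (A σ) v av #A ; #B = count-place (B σ) w bw #B
      ; Δ₁ = λ u → ≤-trans (d₁-place≤ σ v w u) (Δ₁ u) ; Δ₂ = λ y → ≤-trans (d₂-place≤ σ v w y) (Δ₂ y)
      -- A neighbour of `v` loses one edge of G₁, which has weight 17, and gains at most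
      -- `d₂ σ w ≤ 17` edges of G₃. The same trade, summed over these neighbours, preserves
      -- `weight`.
      ; loadˡ = λ u → loadˡ′ (d₃ˡ σ u) (d₃ˡ τ u) (𝟙 (E₃ σ u w)) (d₁ τ u) (𝟙 (E₁ σ u v)) (𝟙 (E₁ σ u v) * d₂ σ w) (d₁ σ u) n
                  (d₃ˡ-place σ v w u) (≤-trans (*-monoʳ-≤ (𝟙 (E₁ σ u v)) d₂w) (≤-reflexive (*-comm (𝟙 (E₁ σ u v)) 17))) (d₁-place+ σ v w u) (loadˡ u)
      ; loadʳ = λ y → load (decide (E₂ σ y w))
      ; weight = weight′ (m₁ τ) (m₂ τ) (m₃ τ) (m₁ σ) (m₂ σ) (m₃ σ) (d₁ σ v) (d₁ σ v * d₂ σ w) (d₃ˡ σ v + d₃ʳ σ w) n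
                   (m₁-place σ v w) (m₂-place≤ σ v w) (m₃-place σ v w nvw) (≤-trans (*-monoʳ-≤ (d₁ σ v) d₂w) (≤-reflexive (*-comm (d₁ σ v) 17))) weight
      ; highs = highs′ (count (high (d₁ τ))) (count (high (d₂ τ))) (count (high (d₁ σ))) (count (high (d₂ σ))) h fewer
                  (count-mono λ y hy → ≤ᵇ-true (≤-trans (≤ᵇ-true⁻ hy) (d₂-place≤ σ v w y))) highs
      ; size = size′ n h k size }
      where
      loadˡ′ : ∀ x x′ q d′ e p d n → x′ + q ≤ x + p → p ≤ 17 * e → d′ + e ≤ d → 10 * (x + 17 * d) ≤ 3 * n → 10 * (x′ + 17 * d′) ≤ 3 * n
      loadˡ′ = linear 8 (λ x x′ q d′ e p d n → (x′ ⊕ q ⊴ x ⊕ p) ∷ (p ⊴ 17 ⊗ e) ∷ (d′ ⊕ e ⊴ d) ∷ (10 ⊗ (x ⊕ 17 ⊗ d) ⊴ 3 ⊗ n) ∷ [] , (10 ⊗ (x′ ⊕ 17 ⊗ d′) ⊴ 3 ⊗ n)) 1 (10 ∷ 10 ∷ 170 ∷ 1 ∷ [])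
      weight′ : ∀ a b c a₀ b₀ c₀ x p q n → a + 2 * x ≡ a₀ → b ≤ b₀ → c + q ≤ c₀ + p → p ≤ 17 * x → 2 * c₀ + 17 * (a₀ + b₀) ≤ 102 * n → 2 * c + 17 * (a + b) ≤ 102 * n
      weight′ a b c a₀ b₀ c₀ x p q n h0 h1 h2 h3 h4 =
        linear 10 (λ a b c a₀ b₀ c₀ x p q n → (a ⊕ 2 ⊗ x ⊴ a₀) ∷ (a₀ ⊴ a ⊕ 2 ⊗ x) ∷ (b ⊴ b₀) ∷ (c ⊕ q ⊴ c₀ ⊕ p) ∷ (p ⊴ 17 ⊗ x) ∷ (2 ⊗ c₀ ⊕ 17 ⊗ (a₀ ⊕ b₀) ⊴ 102 ⊗ n) ∷ [] , (2 ⊗ c ⊕ 17 ⊗ (a ⊕ b) ⊴ 102 ⊗ n)) 1 (17 ∷ 0 ∷ 17 ∷ 2 ∷ 2 ∷ 1 ∷ []) a b c a₀ b₀ c₀ x p q n (≤-reflexive h0) (≤-reflexive (sym h0)) h1 h2 h3 h4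
      highs′ : ∀ a b a₀ b₀ h → a + 1 ≤ a₀ → b ≤ b₀ → a₀ + b₀ ≤ 1 + h → a + b ≤ h
      highs′ = linear 5 (λ a b a₀ b₀ h → (a ⊕ # 1 ⊴ a₀) ∷ (b ⊴ b₀) ∷ (a₀ ⊕ b₀ ⊴ # 1 ⊕ h) ∷ [] , (a ⊕ b ⊴ h)) 1 (1 ∷ 1 ∷ 1 ∷ [])
      size′ : ∀ n h k → 19 * n + 20 * (1 + h) ≤ 20 * (1 + k) → 19 * n + 20 * h ≤ 20 * k
      size′ = linear 3 (λ n h k → (19 ⊗ n ⊕ 20 ⊗ (# 1 ⊕ h) ⊴ 20 ⊗ (# 1 ⊕ k)) ∷ [] , (19 ⊗ n ⊕ 20 ⊗ h ⊴ 20 ⊗ k)) 1 (1 ∷ [])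
      loadʳ′ : ∀ x x′ q d′ e D d n → x′ + q ≤ x + e → e ≤ D → d′ ≤ d → 10 * (x + 17 * d + D) ≤ 3 * n → 10 * (x′ + 17 * d′) ≤ 3 * n
      loadʳ′ = linear 8 (λ x x′ q d′ e D d n → (x′ ⊕ q ⊴ x ⊕ e) ∷ (e ⊴ D) ∷ (d′ ⊴ d) ∷ (10 ⊗ (x ⊕ 17 ⊗ d ⊕ D) ⊴ 3 ⊗ n) ∷ [] , (10 ⊗ (x′ ⊕ 17 ⊗ d′) ⊴ 3 ⊗ n)) 1 (10 ∷ 10 ∷ 170 ∷ 1 ∷ [])
      loadʳ″ : ∀ x x′ q d′ d n → x′ + q ≤ x + 0 → d′ ≤ d → 10 * (x + 17 * d) ≤ 3 * n → 10 * (x′ + 17 * d′) ≤ 3 * n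
      loadʳ″ = linear 6 (λ x x′ q d′ d n → (x′ ⊕ q ⊴ x ⊕ # 0) ∷ (d′ ⊴ d) ∷ (10 ⊗ (x ⊕ 17 ⊗ d) ⊴ 3 ⊗ n) ∷ [] , (10 ⊗ (x′ ⊕ 17 ⊗ d′) ⊴ 3 ⊗ n)) 1 (10 ∷ 170 ∷ 1 ∷ [])
      load : ∀ {y} → E₂ σ y w ≡ true ⊎ E₂ σ y w ≡ false → 10 * (d₃ʳ τ y + 17 * d₂ τ y) ≤ 3 * n
      load {y} (inj₁ t) = loadʳ′ (d₃ʳ σ y) (d₃ʳ τ y) (𝟙 (E₃ σ v y)) (d₂ τ y) (1 * d₁ σ v) D (d₂ σ y) n
        (subst (λ b → d₃ʳ τ y + 𝟙 (E₃ σ v y) ≤ d₃ʳ σ y + 𝟙 b * d₁ σ v) t (d₃ʳ-place σ v w y)) (≤-trans (≤-reflexive (*-identityˡ _)) (Δ₁ v)) (d₂-place≤ σ v w y) (cool y t)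
      load {y} (inj₂ f) = loadʳ″ (d₃ʳ σ y) (d₃ʳ τ y) (𝟙 (E₃ σ v y)) (d₂ τ y) (d₂ σ y) n
        (subst (λ b → d₃ʳ τ y + 𝟙 (E₃ σ v y) ≤ d₃ʳ σ y + 𝟙 b * d₁ σ v) f (d₃ʳ-place σ v w y)) (d₂-place≤ σ v w y) (loadʳ y)
      fewer : count (high (d₁ τ)) + 1 ≤ count (high (d₁ σ))
      fewer = ≤-trans (+-monoˡ-≤ 1 (count-mono λ u hu → ∖-intro {p = high (d₁ σ)} (≤ᵇ-true (≤-trans (≤ᵇ-true⁻ hu) (d₁-place≤ σ v w u)))
                  (λ { refl → case subst (120 ≤_) (degree-isolate-self (E₁ σ) v) (≤ᵇ-true⁻ {120} hu) of λ () })))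
                (≤-reflexive (count-∖-mem (high (d₁ σ)) v (≤ᵇ-true v-high)))

  k-pos : ∀ n h → 19 * n + 20 * h ≤ 20 * 0 → 139425 ≤ n → 1 ≤ 0
  k-pos = linear 2 (λ n h → (19 ⊗ n ⊕ 20 ⊗ h ⊴ 20 ⊗ # 0) ∷ (# 139425 ⊴ n) ∷ [] , (# 1 ⊴ # 0)) 0 (1 ∷ 19 ∷ [])
  -- With all degrees below 120 and `T = 3 n / 10` the transpositions need more than
  -- `3 n / 5 + 28441` vertices; for `n ≥ 139425` this leaves a margin under `19 n / 20`.
  final-room : ∀ n T k h → 10 * T ≤ 3 * n → 19 * n + 20 * h ≤ 20 * k → 139425 ≤ n → T + T + 119 * 119 + 119 * 119 + 119 < k
  final-room = linear 4 (λ n T k h → (10 ⊗ T ⊴ 3 ⊗ n) ∷ (19 ⊗ n ⊕ 20 ⊗ h ⊴ 20 ⊗ k) ∷ (# 139425 ⊴ n) ∷ [] , (# 1 ⊕ (T ⊕ T ⊕ 119 ⊗ # 119 ⊕ 119 ⊗ # 119 ⊕ # 119) ⊴ k)) 20 (4 ∷ 1 ∷ 7 ∷ [])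

  loop : ∀ {N} h {k} (σ : State N) → Inv σ k h → Packing σ
  loop h σ I with search (high (d₁ σ)) | search (high (d₂ σ))
  loop (suc h) {zero}  σ I | inj₁ _ | _ = impossible (k-pos n (suc h) (Inv.size I) n-large)
  loop (suc h) {zero}  σ I | inj₂ _ | inj₁ _ = impossible (k-pos n (suc h) (Inv.size I) n-large)
  loop (suc h) {suc k} σ I | inj₁ (v , hv) | _ =
    let module S = Step I v (≤ᵇ-true⁻ hv) in place-packing σ v S.w S.av S.bw S.nvw (loop h S.τ S.next)
  loop (suc h) {suc k} σ I | inj₂ _ | inj₁ (v , hv) =
    let module S = Step (swap-inv I) v (≤ᵇ-true⁻ hv) in swap-packing σ (place-packing (swap σ) v S.w S.av S.bw S.nvw (loop h S.τ S.next))
  loop zero σ I | inj₁ (v , hv) | _ = ⊥-elim (true≢false hv (𝟙≡0 (∑≡0 (proj₁ (zero₂ _ _ (n≤0⇒n≡0 (Inv.highs I)))) v)))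
  loop zero σ I | inj₂ _ | inj₁ (v , hv) = ⊥-elim (true≢false hv (𝟙≡0 (∑≡0 (proj₂ (zero₂ (count (high (d₁ σ))) _ (n≤0⇒n≡0 (Inv.highs I)))) v)))
  loop h {k} σ I | inj₂ low₁ | inj₂ low₂ = bounded-packing σ {119} {3 * n / 10} (record
      { Δ₁ = λ u → ≤-pred (≤ᵇ-false⁻ {120} (low₁ u)) ; Δ₂ = λ y → ≤-pred (≤ᵇ-false⁻ {120} (low₂ y))
      ; Δ₃ˡ = λ u → tenth (d₃ˡ σ u) (≤-trans (*-monoʳ-≤ 10 (m≤m+n (d₃ˡ σ u) _)) (loadˡ u))
      ; Δ₃ʳ = λ y → tenth (d₃ʳ σ y) (≤-trans (*-monoʳ-≤ 10 (m≤m+n (d₃ʳ σ y) _)) (loadʳ y)) })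
      #A #B (final-room n (3 * n / 10) k h (≤-trans (≤-reflexive (*-comm 10 (3 * n / 10))) (m/n*n≤m (3 * n) 10)) size n-large)
    where
    open Inv I
    tenth : ∀ x → 10 * x ≤ 3 * n → x ≤ 3 * n / 10
    tenth x le = ≤-trans (≤-reflexive (trans (sym (m*n/n≡m x 10)) (cong (_/ 10) (*-comm x 10)))) (/-monoˡ-≤ 10 le)

  start-lin : ∀ T x d → 4 * T ≤ n → x ≤ T → d ≤ D → 10 * (x + 17 * d) ≤ 3 * n
  start-lin T x d h₀ h₁ h₂ = go T x d n D h₀ h₁ h₂ D-small
    where
    go : ∀ T x d n D → 4 * T ≤ n → x ≤ T → d ≤ D → 700 * D ≤ n → 10 * (x + 17 * d) ≤ 3 * n
    go = linear 5 (λ T x d n D → (4 ⊗ T ⊴ n) ∷ (x ⊴ T) ∷ (d ⊴ D) ∷ (700 ⊗ D ⊴ n) ∷ [] , (10 ⊗ (x ⊕ 17 ⊗ d) ⊴ 3 ⊗ n)) 70 (175 ∷ 700 ∷ 11900 ∷ 17 ∷ [])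

  start-weight : ∀ a b c n → a + b + 2 * c ≤ 6 * n → 2 * c + 17 * (a + b) ≤ 102 * n
  start-weight = linear 4 (λ a b c n → (a ⊕ b ⊕ 2 ⊗ c ⊴ 6 ⊗ n) ∷ [] , (2 ⊗ c ⊕ 17 ⊗ (a ⊕ b) ⊴ 102 ⊗ n)) 1 (17 ∷ [])
  start-size : ∀ a b c x y n → a + b + 2 * c ≤ 6 * n → 120 * x ≤ a → 120 * y ≤ b → 19 * n + 20 * (x + y) ≤ 20 * n
  start-size = linear 6 (λ a b c x y n → (a ⊕ b ⊕ 2 ⊗ c ⊴ 6 ⊗ n) ∷ (120 ⊗ x ⊴ a) ∷ (120 ⊗ y ⊴ b) ∷ [] , (19 ⊗ n ⊕ 20 ⊗ (x ⊕ y) ⊴ 20 ⊗ n)) 6 (1 ∷ 1 ∷ 1 ∷ [])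

  sparse-packing : ∀ {N} (σ : State N) T → count (A σ) ≡ n → count (B σ) ≡ n → Bounded σ D T →
                   4 * T ≤ n → m₁ σ + m₂ σ + 2 * m₃ σ ≤ 6 * n → Packing σ
  sparse-packing σ T #A #B bd T-small edges = loop (count (high (d₁ σ)) + count (high (d₂ σ))) σ (record
    { #A = #A ; #B = #B ; Δ₁ = Δ₁ ; Δ₂ = Δ₂
    ; loadˡ = λ u → start-lin T _ _ T-small (Δ₃ˡ u) (Δ₁ u) ; loadʳ = λ y → start-lin T _ _ T-small (Δ₃ʳ y) (Δ₂ y)
    ; weight = start-weight (m₁ σ) (m₂ σ) (m₃ σ) n edges ; highs = ≤-refl
    ; size = start-size (m₁ σ) (m₂ σ) (m₃ σ) (count (high (d₁ σ))) (count (high (d₂ σ))) n edges (markov (high (d₁ σ)) (d₁ σ) 120 (λ _ → ≤ᵇ-true⁻)) (markov (high (d₂ σ)) (d₂ σ) 120 (λ _ → ≤ᵇ-true⁻)) })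
    where open Bounded bd

-- The inductive set-up, and triples dominated by a vertex of G₃

-- `D` and `T` need not be attained: after a placement it suffices to exhibit some bounds that
-- satisfy the budget.
record Good {N} (σ : State N) (n D T : ℕ) : Set where
  field
    #A      : count (A σ) ≡ n
    #B      : count (B σ) ≡ n
    bounded : Bounded σ D T
    D+2≤n   : D + 2 ≤ n
    T+1≤n   : T + 1 ≤ n
    -- Twice the hypothesis of the theorem: m₁ and m₂ count each edge twice.
    budget  : m₁ σ + m₂ σ + 2 * m₃ σ + 2 * D + 2 * T + 836550 ≤ 6 * n
  open Bounded bounded public

swap-good : ∀ {N} {σ : State N} {n D T} → Good σ n D T → Good (swap σ) n D T
swap-good {σ = σ} {n} {D} {T} G = record
  { #A = #B ; #B = #A ; bounded = record { Δ₁ = Δ₂ ; Δ₂ = Δ₁ ; Δ₃ˡ = Δ₃ʳ ; Δ₃ʳ = Δ₃ˡ } ; D+2≤n = D+2≤n ; T+1≤n = T+1≤n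
  ; budget = ≤-trans (≤-reflexive (cong₂ (λ a b → a + 2 * b + 2 * D + 2 * T + 836550) (+-comm (m₂ σ) (m₁ σ)) (m₃-swap σ))) budget }
  where open Good G

Hyp : ℕ → ℕ → Set
Hyp N n = ∀ (τ : State N) k D T → k < n → Good τ k D T → Packing τ

two-point : ∀ {N} (f : Fin N → ℕ) {x y} → x ≢ y → f x + f y ≤ ∑ f
two-point f {x} {y} ne = begin
  f x + f y                                              ≡⟨ cong₂ _+_ (sym (∑-point x f)) (sym (∑-point y f)) ⟩
  ∑ (λ z → 𝟙 (z == x) * f z) + ∑ (λ z → 𝟙 (z == y) * f z)  ≡⟨ sym (∑-+ _ (λ z → 𝟙 (z == y) * f z)) ⟩
  ∑ (λ z → 𝟙 (z == x) * f z + 𝟙 (z == y) * f z)          ≤⟨ ∑-mono pt ⟩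
  ∑ f                                                    ∎
  where
  open ≤-Reasoning
  pt : ∀ z → 𝟙 (z == x) * f z + 𝟙 (z == y) * f z ≤ f z
  pt z with z ≟ᶠ x | z ≟ᶠ y
  ... | yes refl | yes refl = ⊥-elim (ne refl)
  ... | yes refl | no _     = ≤-reflexive (trans (+-identityʳ _) (+-identityʳ _))
  ... | no _     | yes _    = ≤-reflexive (+-identityʳ _)
  ... | no _     | no _     = z≤n

-- At `p` the exchanged terms agree, elsewhere `g ≤ f`. Applied to the rows of G₃ this adds the
-- edges at a left vertex to those at a right vertex with at most the common edge counted twice.
∑-excess : ∀ {N} (f g : Fin N → ℕ) p → (∀ u → g u ≤ f u) → ∑ g + f p ≤ ∑ f + g p
∑-excess f g p le = begin
  ∑ g + f p                                        ≡⟨ cong (∑ g +_) (sym (∑-point p f)) ⟩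
  ∑ g + ∑ (λ u → 𝟙 (u == p) * f u)                 ≡⟨ sym (∑-+ g _) ⟩
  ∑ (λ u → g u + 𝟙 (u == p) * f u)                 ≤⟨ ∑-mono pt ⟩
  ∑ (λ u → f u + 𝟙 (u == p) * g u)                 ≡⟨ ∑-+ f _ ⟩
  ∑ f + ∑ (λ u → 𝟙 (u == p) * g u)                 ≡⟨ cong (∑ f +_) (∑-point p g) ⟩
  ∑ f + g p                                        ∎
  where
  open ≤-Reasoning
  pt : ∀ u → g u + 𝟙 (u == p) * f u ≤ f u + 𝟙 (u == p) * g u
  pt u with u ≟ᶠ p
  ... | yes _ = ≤-reflexive (trans (+-comm (g u) _) (cong₂ _+_ (+-identityʳ (f u)) (sym (+-identityʳ (g u)))))
  ... | no _  = ≤-trans (≤-reflexive (+-identityʳ _)) (≤-trans (le u) (m≤m+n _ _))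

𝟙≤count : ∀ {N} (p : Fin N → Bool) x → 𝟙 (p x) ≤ count p
𝟙≤count p x = ≤∑ (λ z → 𝟙 (p z)) x

1≤count : ∀ {N} (p : Fin N → Bool) {x} → p x ≡ true → 1 ≤ count p
1≤count p {x} h = subst (λ b → 𝟙 b ≤ count p) h (𝟙≤count p x)

d₃-crossing : ∀ {N} (σ : State N) p y → d₃ʳ σ y + d₃ˡ σ p ≤ m₃ σ + 𝟙 (E₃ σ p y)
d₃-crossing σ p y = ∑-excess (d₃ˡ σ) (λ u → 𝟙 (E₃ σ u y)) p (λ u → 𝟙≤count (E₃ σ u) y)

-- Isolating `v` removes `2 * d₁ σ v` from `m₁`, and what is left is nonnegative. The second vertex
-- given to `place` does not affect `E₁`.
degree≤half : ∀ {N} (σ : State N) v → 2 * d₁ σ v ≤ m₁ σ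
degree≤half σ v = ≤-trans (m≤n+m _ (m₁ (place v v σ))) (≤-reflexive (m₁-place σ v v))

count-zero : ∀ {N} {p : Fin N → Bool} → count p ≡ 0 → ∀ x → p x ≡ false
count-zero h x = 𝟙≡0 (∑≡0 h x)

module _ {N} (σ : State N) (v w : Fin N) where

  private τ = place v w σ

  d₃ˡ-place-self : d₃ˡ τ v ≡ 0
  d₃ˡ-place-self = ∑-0 λ y → cong 𝟙 (¬true⇒false λ h → ∖-elimʳ {p = A σ} (on₃ˡ τ v y h) refl)

  d₃ʳ-place-self : d₃ʳ τ w ≡ 0
  d₃ʳ-place-self = ∑-0 λ u → cong 𝟙 (¬true⇒false λ h → ∖-elimʳ {p = B σ} (on₃ʳ τ u w h) refl)

  d₁-place-self : d₁ τ v ≡ 0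
  d₁-place-self = degree-isolate-self (E₁ σ) v

  -- If one vertex of the pair is isolated, the product of the neighbourhoods is empty, so G₃ only
  -- loses edges.
  module Free (free : d₁ σ v ≡ 0 ⊎ d₂ σ w ≡ 0) where

    d₃ˡ-free : ∀ u → d₃ˡ τ u + 𝟙 (E₃ σ u w) ≤ d₃ˡ σ u
    d₃ˡ-free u = ≤-trans (d₃ˡ-place σ v w u) (≤-reflexive (trans (cong (d₃ˡ σ u +_) (vanish free)) (+-identityʳ _)))
      where
      vanish : d₁ σ v ≡ 0 ⊎ d₂ σ w ≡ 0 → 𝟙 (E₁ σ u v) * d₂ σ w ≡ 0
      vanish (inj₁ h) = cong (λ b → 𝟙 b * d₂ σ w) (trans (sym₁ σ u v) (count-zero h u))
      vanish (inj₂ h) = trans (cong (𝟙 (E₁ σ u v) *_) h) (*-zeroʳ (𝟙 (E₁ σ u v)))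

    d₃ʳ-free : ∀ y → d₃ʳ τ y + 𝟙 (E₃ σ v y) ≤ d₃ʳ σ y
    d₃ʳ-free y = ≤-trans (d₃ʳ-place σ v w y) (≤-reflexive (trans (cong (d₃ʳ σ y +_) (vanish free)) (+-identityʳ _)))
      where
      vanish : d₁ σ v ≡ 0 ⊎ d₂ σ w ≡ 0 → 𝟙 (E₂ σ y w) * d₁ σ v ≡ 0
      vanish (inj₁ h) = trans (cong (𝟙 (E₂ σ y w) *_) h) (*-zeroʳ (𝟙 (E₂ σ y w)))
      vanish (inj₂ h) = cong (λ b → 𝟙 b * d₁ σ v) (trans (sym₂ σ y w) (count-zero h y))

    m₃-free : E₃ σ v w ≡ false → m₃ τ + (d₃ˡ σ v + d₃ʳ σ w) ≤ m₃ σ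
    m₃-free nvw = ≤-trans (m₃-place σ v w nvw) (≤-reflexive (trans (cong (m₃ σ +_) (vanish free)) (+-identityʳ _)))
      where
      vanish : d₁ σ v ≡ 0 ⊎ d₂ σ w ≡ 0 → d₁ σ v * d₂ σ w ≡ 0
      vanish (inj₁ h) = cong (_* d₂ σ w) h
      vanish (inj₂ h) = trans (cong (d₁ σ v *_) h) (*-zeroʳ (d₁ σ v))

reduce : ∀ {N} {σ : State N} {k D T} → Hyp N (suc k) → Good σ (suc k) D T → ∀ v w → A σ v ≡ true → B σ w ≡ true → E₃ σ v w ≡ false →
         ∀ D′ T′ → (∀ u → d₁ (place v w σ) u ≤ D′) → (∀ y → d₂ (place v w σ) y ≤ D′) →
         (∀ u → u ≢ v → d₃ˡ (place v w σ) u ≤ T′) → (∀ y → y ≢ w → d₃ʳ (place v w σ) y ≤ T′) → D′ + 2 ≤ k → T′ + 1 ≤ k →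
         m₁ (place v w σ) + m₂ (place v w σ) + 2 * m₃ (place v w σ) + 2 * D′ + 2 * T′ + 836550 ≤ 6 * k → Packing σ
reduce {σ = σ} {k} hyp G v w av bw nvw D′ T′ δ₁ δ₂ δ₃ˡ δ₃ʳ safe₁ safe₃ bud = place-packing σ v w av bw nvw
  (hyp (place v w σ) k D′ T′ ≤-refl (record
    { #A = count-place (A σ) v av (Good.#A G) ; #B = count-place (B σ) w bw (Good.#B G)
    ; bounded = record { Δ₁ = δ₁ ; Δ₂ = δ₂ ; Δ₃ˡ = left ; Δ₃ʳ = right }
    ; D+2≤n = safe₁ ; T+1≤n = safe₃ ; budget = bud }))
  where
  left : ∀ u → d₃ˡ (place v w σ) u ≤ T′
  left u = help (u ≟ᶠ v)
    where
    help : Dec (u ≡ v) → d₃ˡ (place v w σ) u ≤ T′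
    help (yes refl) = ≤-trans (≤-reflexive (d₃ˡ-place-self σ v w)) z≤n
    help (no ne)    = δ₃ˡ u ne
  right : ∀ y → d₃ʳ (place v w σ) y ≤ T′
  right y = help (y ≟ᶠ w)
    where
    help : Dec (y ≡ w) → d₃ʳ (place v w σ) y ≤ T′
    help (yes refl) = ≤-trans (≤-reflexive (d₃ʳ-place-self σ v w)) z≤n
    help (no ne)    = δ₃ʳ y ne

isolated : ∀ {N} → (Fin N → Bool) → (Fin N → ℕ) → Fin N → Bool
isolated A d x = A x ∧ (d x ≤ᵇ 0)

isolated-intro : ∀ {N} {A : Fin N → Bool} {d x} → A x ≡ true → d x ≡ 0 → isolated A d x ≡ true
isolated-intro a z = ∧-intro a (≤ᵇ-true (≤-reflexive z))

isolated-∈ : ∀ {N} {A : Fin N → Bool} {d x} → isolated A d x ≡ true → A x ≡ true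
isolated-∈ h = ∧-elimˡ h

isolated-0 : ∀ {N} {A : Fin N → Bool} {d x} → isolated A d x ≡ true → d x ≡ 0
isolated-0 {A = A} {x = x} h = n≤0⇒n≡0 (≤ᵇ-true⁻ (∧-elimʳ {A x} h))

count-isolated : ∀ {N} (A : Fin N → Bool) d → count A ≤ count (isolated A d) + ∑ d
count-isolated A d = ≤-trans (∑-mono pt) (≤-reflexive (∑-+ _ d))
  where
  pt : ∀ x → 𝟙 (A x) ≤ 𝟙 (isolated A d x) + d x
  pt x with A x | d x
  ... | false | _     = z≤n
  ... | true  | zero  = ≤-refl
  ... | true  | suc _ = s≤s z≤n

count-off : ∀ {N} (B E : Fin N → Bool) → (∀ x → E x ≡ true → B x ≡ true) → count (λ x → B x ∧ not (E x)) + count E ≡ count B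
count-off B E sub = trans (sym (∑-+ _ _)) (∑-cong pt)
  where
  pt : ∀ x → 𝟙 (B x ∧ not (E x)) + 𝟙 (E x) ≡ 𝟙 (B x)
  pt x with B x in eq | E x in eq′
  ... | true  | true  = refl
  ... | true  | false = refl
  ... | false | false = refl
  ... | false | true  = ⊥-elim (true≢false (sub x eq′) eq)

zero-or-positive : ∀ n → n ≡ 0 ⊎ 1 ≤ n
zero-or-positive zero    = inj₁ refl
zero-or-positive (suc n) = inj₂ (s≤s z≤n)

neighbour : ∀ {N} {p : Fin N → Bool} → 1 ≤ count p → ∃ λ x → p x ≡ true
neighbour {p = p} h = nonempty p h

adjacent₁ : ∀ {N} (σ : State N) {u u′} → E₁ σ u u′ ≡ true → u ≢ u′
adjacent₁ σ h refl = true≢false h (irr₁ σ _)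

adjacent₂ : ∀ {N} (σ : State N) {y y′} → E₂ σ y y′ ≡ true → y ≢ y′
adjacent₂ σ h refl = true≢false h (irr₂ σ _)

-- `R` counts the edges of G₃ that miss `p`. By `R + 2 ≤ T` every other vertex has at most
-- `R + 1 < T` edges of G₃, so the maximum falls as soon as `p` is removed or loses an edge.
module Dominated {N} (σ : State N) {k D T R : ℕ} (hyp : Hyp N (suc k)) (G : Good σ (suc k) D T)
                 (p : Fin N) (ap : A σ p ≡ true) (d₃p : d₃ˡ σ p ≡ T) (R-def : T + R ≡ m₃ σ)
                 (unique : R + 2 ≤ T) (D-safe : D + 3 ≤ suc k) where

  open Good G

  others-lin : ∀ x → x + T ≤ m₃ σ → x ≤ R
  others-lin x h = +-cancelˡ-≤ T x R (≤-trans (≤-reflexive (+-comm T x)) (≤-trans h (≤-reflexive (sym R-def))))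

  d₃ˡ-other : ∀ u → u ≢ p → d₃ˡ σ u ≤ R
  d₃ˡ-other u ne = others-lin _ (subst (λ t → d₃ˡ σ u + t ≤ m₃ σ) d₃p (two-point (d₃ˡ σ) ne))

  d₃ʳ-other : ∀ y → d₃ʳ σ y ≤ R + 𝟙 (E₃ σ p y)
  d₃ʳ-other y = +-cancelˡ-≤ T _ _ (≤-trans (≤-reflexive (trans (+-comm T _) (cong (d₃ʳ σ y +_) (sym d₃p))))
    (≤-trans (d₃-crossing σ p y) (≤-reflexive (trans (cong (_+ _) (sym R-def)) (+-assoc T R _)))))

  d₃ʳ-other′ : ∀ y → d₃ʳ σ y ≤ R + 1
  d₃ʳ-other′ y = ≤-trans (d₃ʳ-other y) (+-monoʳ-≤ R (𝟙≤1 (E₃ σ p y)))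

  c1-budget : ∀ a b c D T R a₀ b₀ c₀ x k → a ≤ a₀ → b ≤ b₀ → c + (T + x) ≤ c₀ → R + 2 ≤ T → a₀ + b₀ + 2 * c₀ + 2 * D + 2 * T + 836550 ≤ 6 * (1 + k) → a + b + 2 * c + 2 * D + 2 * (R + 1) + 836550 ≤ 6 * k
  c1-budget = linear 11 (λ a b c D T R a₀ b₀ c₀ x k → (a ⊴ a₀) ∷ (b ⊴ b₀) ∷ (c ⊕ (T ⊕ x) ⊴ c₀) ∷ (R ⊕ # 2 ⊴ T) ∷ (a₀ ⊕ b₀ ⊕ 2 ⊗ c₀ ⊕ 2 ⊗ D ⊕ 2 ⊗ T ⊕ # 836550 ⊴ 6 ⊗ (# 1 ⊕ k)) ∷ [] , (a ⊕ b ⊕ 2 ⊗ c ⊕ 2 ⊗ D ⊕ 2 ⊗ (R ⊕ # 1) ⊕ # 836550 ⊴ 6 ⊗ k)) 1 (1 ∷ 1 ∷ 2 ∷ 4 ∷ 1 ∷ [])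
  c1-safe : ∀ D k → D + 3 ≤ 1 + k → D + 2 ≤ k
  c1-safe = linear 2 (λ D k → (D ⊕ # 3 ⊴ # 1 ⊕ k) ∷ [] , (D ⊕ # 2 ⊴ k)) 1 (1 ∷ [])
  c1-safe′ : ∀ T R k → R + 2 ≤ T → T + 1 ≤ 1 + k → R + 1 + 1 ≤ k
  c1-safe′ = linear 3 (λ T R k → (R ⊕ # 2 ⊴ T) ∷ (T ⊕ # 1 ⊴ # 1 ⊕ k) ∷ [] , (R ⊕ # 1 ⊕ # 1 ⊴ k)) 1 (1 ∷ 1 ∷ [])

  -- The `T` edges at `p` pay `2 T ≥ 4`, and lowering the bound from `T` to `R + 1` pays at least 2
  -- more.
  drop-p : ∀ w → B σ w ≡ true → E₃ σ p w ≡ false → d₁ σ p ≡ 0 ⊎ d₂ σ w ≡ 0 → Packing σ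
  drop-p w bw npw free = reduce hyp G p w ap bw npw D (R + 1)
    (λ u → ≤-trans (d₁-place≤ σ p w u) (Δ₁ u)) (λ y → ≤-trans (d₂-place≤ σ p w y) (Δ₂ y))
    (λ u ne → ≤-trans (m+n≤o⇒m≤o _ (d₃ˡ-free u)) (≤-trans (d₃ˡ-other u ne) (m≤m+n R 1)))
    (λ y _ → ≤-trans (m+n≤o⇒m≤o _ (d₃ʳ-free y)) (d₃ʳ-other′ y))
    (c1-safe D k D-safe) (c1-safe′ T R k unique T+1≤n)
    (c1-budget (m₁ τ) (m₂ τ) (m₃ τ) D T R (m₁ σ) (m₂ σ) (m₃ σ) (d₃ʳ σ w) k (m₁-place≤ σ p w) (m₂-place≤ σ p w)
      (subst (λ t → m₃ τ + (t + d₃ʳ σ w) ≤ m₃ σ) d₃p (m₃-free npw)) unique budget)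
    where
    τ = place p w σ
    open Free σ p w free

  T-pred : ∀ R T x → R + 2 ≤ T → x ≤ R → x + 1 ≤ T
  T-pred = linear 3 (λ R T x → (R ⊕ # 2 ⊴ T) ∷ (x ⊴ R) ∷ [] , (x ⊕ # 1 ⊴ T)) 1 (1 ∷ 1 ∷ [])
  T-pred′ : ∀ R T x → R + 2 ≤ T → x ≤ R + 1 → x + 1 ≤ T
  T-pred′ = linear 3 (λ R T x → (R ⊕ # 2 ⊴ T) ∷ (x ⊴ R ⊕ # 1) ∷ [] , (x ⊕ # 1 ⊴ T)) 1 (1 ∷ 1 ∷ [])
  tiny-safe : ∀ T k T′ → T + 1 ≤ 1 + k → T′ + 1 ≤ T → T′ + 1 ≤ k
  tiny-safe = linear 3 (λ T k T′ → (T ⊕ # 1 ⊴ # 1 ⊕ k) ∷ (T′ ⊕ # 1 ⊴ T) ∷ [] , (T′ ⊕ # 1 ⊴ k)) 1 (1 ∷ 1 ∷ [])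
  tiny-budget′ : ∀ a b c D T T′ a₀ b₀ c₀ k → a + b + 2 * c + 4 ≤ a₀ + b₀ + 2 * c₀ → T′ + 1 ≡ T → a₀ + b₀ + 2 * c₀ + 2 * D + 2 * T + 836550 ≤ 6 * (1 + k) → a + b + 2 * c + 2 * D + 2 * T′ + 836550 ≤ 6 * k
  tiny-budget′ a b c D T T′ a₀ b₀ c₀ k h0 h1 h2 =
    linear 10 (λ a b c D T T′ a₀ b₀ c₀ k → (a ⊕ b ⊕ 2 ⊗ c ⊕ # 4 ⊴ a₀ ⊕ b₀ ⊕ 2 ⊗ c₀) ∷ (T′ ⊕ # 1 ⊴ T) ∷ (T ⊴ T′ ⊕ # 1) ∷ (a₀ ⊕ b₀ ⊕ 2 ⊗ c₀ ⊕ 2 ⊗ D ⊕ 2 ⊗ T ⊕ # 836550 ⊴ 6 ⊗ (# 1 ⊕ k)) ∷ [] , (a ⊕ b ⊕ 2 ⊗ c ⊕ 2 ⊗ D ⊕ 2 ⊗ T′ ⊕ # 836550 ⊴ 6 ⊗ k)) 1 (1 ∷ 2 ∷ 0 ∷ 1 ∷ []) a b c D T T′ a₀ b₀ c₀ k h0 (≤-reflexive h1) (≤-reflexive (sym h1)) h2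

  T-suc : ∃ λ T′ → T′ + 1 ≡ T
  T-suc = let e = m≤n⇒∃[o]m+o≡n unique in (R + 1 + proj₁ e) , trans (trans (+-assoc (R + 1) _ 1) (trans (cong (R + 1 +_) (+-comm _ 1)) (sym (+-assoc (R + 1) 1 _)))) (trans (cong (_+ proj₁ e) (+-assoc R 1 1)) (proj₂ e))

  -- Such a pair uses up an edge of G₃ at p, so that T drops by one.
  tiny : ∀ u y → A σ u ≡ true → B σ y ≡ true → E₃ σ u y ≡ false → E₃ σ p y ≡ true →
         d₁ σ u ≡ 0 ⊎ d₂ σ y ≡ 0 → 1 ≤ d₁ σ u + d₂ σ y → Packing σ
  tiny u y au by nuy py free edge = reduce hyp G u y au by nuy D T′
    (λ x → ≤-trans (d₁-place≤ σ u y x) (Δ₁ x)) (λ x → ≤-trans (d₂-place≤ σ u y x) (Δ₂ x))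
    (λ x _ → left x) (λ x _ → pred _ (T-pred′ R T _ unique (≤-trans (m+n≤o⇒m≤o _ (d₃ʳ-free x)) (d₃ʳ-other′ x))))
    (c1-safe D k D-safe) (tiny-safe T k T′ T+1≤n (≤-reflexive T′-def))
    (tiny-budget′ (m₁ τ) (m₂ τ) (m₃ τ) D T T′ (m₁ σ) (m₂ σ) (m₃ σ) k
      (sum (m₁ τ) (m₂ τ) (m₃ τ) (m₁ σ) (m₂ σ) (m₃ σ) (d₁ σ u) (d₂ σ y) (d₃ˡ σ u) (d₃ʳ σ y)
        (m₁-place σ u y) (m₂-place σ u y) (m₃-free nuy) edge (1≤count (λ x → E₃ σ x y) py)) T′-def budget)
    where
    τ = place u y σ
    open Free σ u y free
    T′ = proj₁ T-suc
    T′-def = proj₂ T-suc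
    sum : ∀ a b c a₀ b₀ c₀ x z p q → a + 2 * x ≡ a₀ → b + 2 * z ≡ b₀ → c + (p + q) ≤ c₀ → 1 ≤ x + z → 1 ≤ q → a + b + 2 * c + 4 ≤ a₀ + b₀ + 2 * c₀
    sum a b c a₀ b₀ c₀ x z p q h0 h1 h2 h3 h4 =
      linear 10 (λ a b c a₀ b₀ c₀ x z p q → (a ⊕ 2 ⊗ x ⊴ a₀) ∷ (a₀ ⊴ a ⊕ 2 ⊗ x) ∷ (b ⊕ 2 ⊗ z ⊴ b₀) ∷ (b₀ ⊴ b ⊕ 2 ⊗ z) ∷ (c ⊕ (p ⊕ q) ⊴ c₀) ∷ (# 1 ⊴ x ⊕ z) ∷ (# 1 ⊴ q) ∷ [] , (a ⊕ b ⊕ 2 ⊗ c ⊕ # 4 ⊴ a₀ ⊕ b₀ ⊕ 2 ⊗ c₀)) 1 (1 ∷ 0 ∷ 1 ∷ 0 ∷ 2 ∷ 2 ∷ 2 ∷ []) a b c a₀ b₀ c₀ x z p q (≤-reflexive h0) (≤-reflexive (sym h0)) (≤-reflexive h1) (≤-reflexive (sym h1)) h2 h3 h4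
    pred : ∀ x → x + 1 ≤ T → x ≤ T′
    pred x h = +-cancelʳ-≤ 1 x T′ (≤-trans h (≤-reflexive (sym T′-def)))
    left : ∀ x → d₃ˡ τ x ≤ T′
    left x = help (x ≟ᶠ p)
      where
      help : Dec (x ≡ p) → d₃ˡ τ x ≤ T′
      help (yes refl) = pred _ (≤-trans (≤-reflexive (cong (λ b → d₃ˡ τ p + 𝟙 b) (sym py))) (≤-trans (d₃ˡ-free p) (Δ₃ˡ p)))
      help (no ne)    = pred _ (T-pred R T _ unique (≤-trans (m+n≤o⇒m≤o _ (d₃ˡ-free x)) (d₃ˡ-other x ne)))

  big-budget : ∀ a b c D T a₀ b₀ c₀ x q k → a ≤ a₀ → b + 2 * x ≡ b₀ → c + q ≤ c₀ → 3 ≤ x → a₀ + b₀ + 2 * c₀ + 2 * D + 2 * T + 836550 ≤ 6 * (1 + k) → a + b + 2 * c + 2 * D + 2 * T + 836550 ≤ 6 * k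
  big-budget a b c D T a₀ b₀ c₀ x q k h0 h1 h2 h3 h4 =
    linear 11 (λ a b c D T a₀ b₀ c₀ x q k → (a ⊴ a₀) ∷ (b ⊕ 2 ⊗ x ⊴ b₀) ∷ (b₀ ⊴ b ⊕ 2 ⊗ x) ∷ (c ⊕ q ⊴ c₀) ∷ (# 3 ⊴ x) ∷ (a₀ ⊕ b₀ ⊕ 2 ⊗ c₀ ⊕ 2 ⊗ D ⊕ 2 ⊗ T ⊕ # 836550 ⊴ 6 ⊗ (# 1 ⊕ k)) ∷ [] , (a ⊕ b ⊕ 2 ⊗ c ⊕ 2 ⊗ D ⊕ 2 ⊗ T ⊕ # 836550 ⊴ 6 ⊗ k)) 1 (1 ∷ 1 ∷ 0 ∷ 2 ∷ 2 ∷ 1 ∷ []) a b c D T a₀ b₀ c₀ x q k h0 (≤-reflexive h1) (≤-reflexive (sym h1)) h2 h3 h4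

  -- The three edges of G₂ at `z` pay the whole 6. As `T` is not lowered, it must be at least 2
  -- below the old order.
  big : ∀ a z → A σ a ≡ true → B σ z ≡ true → E₃ σ a z ≡ false → d₁ σ a ≡ 0 → 3 ≤ d₂ σ z → T + 2 ≤ suc k → Packing σ
  big a z aa bz naz d₁a d₂z T-safe = reduce hyp G a z aa bz naz D T
    (λ x → ≤-trans (d₁-place≤ σ a z x) (Δ₁ x)) (λ x → ≤-trans (d₂-place≤ σ a z x) (Δ₂ x))
    (λ x _ → ≤-trans (m+n≤o⇒m≤o _ (d₃ˡ-free x)) (Δ₃ˡ x)) (λ x _ → ≤-trans (m+n≤o⇒m≤o _ (d₃ʳ-free x)) (Δ₃ʳ x))
    (c1-safe D k D-safe) (T-safe′ T k T-safe)
    (big-budget (m₁ τ) (m₂ τ) (m₃ τ) D T (m₁ σ) (m₂ σ) (m₃ σ) (d₂ σ z) (d₃ˡ σ a + d₃ʳ σ z) k (m₁-place≤ σ a z) (m₂-place σ a z) (m₃-free naz) d₂z budget)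
    where
    τ = place a z σ
    open Free σ a z (inj₁ d₁a)
    T-safe′ : ∀ T k → T + 2 ≤ 1 + k → T + 1 ≤ k
    T-safe′ = linear 2 (λ T k → (T ⊕ # 2 ⊴ # 1 ⊕ k) ∷ [] , (T ⊕ # 1 ⊴ k)) 1 (1 ∷ [])

  off-p : Fin N → Bool
  off-p y = B σ y ∧ not (E₃ σ p y)

  count-off-p : count off-p + T ≡ suc k
  count-off-p = trans (cong (count off-p +_) (sym d₃p)) (trans (count-off (B σ) (E₃ σ p) (on₃ʳ σ p)) #B)

  i₁ = isolated (A σ) (d₁ σ)
  i₂ = isolated (B σ) (d₂ σ)

  i₁-∈ : ∀ {x} → i₁ x ≡ true → A σ x ≡ true
  i₁-∈ = isolated-∈ {A = A σ} {d₁ σ}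
  i₁-0 : ∀ {x} → i₁ x ≡ true → d₁ σ x ≡ 0
  i₁-0 = isolated-0 {A = A σ} {d₁ σ}
  i₂-∈ : ∀ {x} → i₂ x ≡ true → B σ x ≡ true
  i₂-∈ = isolated-∈ {A = B σ} {d₂ σ}
  i₂-0 : ∀ {x} → i₂ x ≡ true → d₂ σ x ≡ 0
  i₂-0 = isolated-0 {A = B σ} {d₂ σ}

  -- What remains when the free pairs give no packing: the edges of G₂ form paths and cycles that
  -- avoid the G₃-neighbours of `p`. In `nearly-full` the vertex `p` is then put on such a path or
  -- cycle; elsewhere this outcome is refuted.
  Leftover : Set
  Leftover = ∀ y → 1 ≤ d₂ σ y → E₃ σ p y ≡ false × d₂ σ y ≤ 2

  some-off-p : ∃ λ w → off-p w ≡ true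
  some-off-p = nonempty off-p (≮⇒≥ λ lt → impossible (contra (count off-p) T k count-off-p T+1≤n lt))
    where
    contra : ∀ q T k → q + T ≡ 1 + k → T + 1 ≤ 1 + k → q < 1 → 1 ≤ 0
    contra q T k h0 h1 h2 =
      linear 3 (λ q T k → (q ⊕ T ⊴ # 1 ⊕ k) ∷ (# 1 ⊕ k ⊴ q ⊕ T) ∷ (T ⊕ # 1 ⊴ # 1 ⊕ k) ∷ (# 1 ⊕ q ⊴ # 1) ∷ [] , (# 1 ⊴ # 0)) 0 (0 ∷ 1 ∷ 1 ∷ 1 ∷ []) q T k (≤-reflexive h0) (≤-reflexive (sym h0)) h1 h2

  -- An isolated vertex that misses `p` takes `p`. If there is none and `p` is not isolated, a
  -- G₁-neighbour `u` of `p` has at most `R` edges in G₃, so it misses one of the isolated vertices,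
  -- and this vertex is joined to `p` as `tiny` requires.
  by-isolated₂ : R + 2 ≤ count i₂ → Packing σ
  by-isolated₂ many with search (λ y → i₂ y ∧ not (E₃ σ p y)) | zero-or-positive (d₁ σ p)
  ... | inj₁ (y , h) | _ = drop-p y (i₂-∈ (∧-elimˡ h)) (not-elim (∧-elimʳ {i₂ y} h)) (inj₂ (i₂-0 (∧-elimˡ h)))
  ... | inj₂ _ | inj₁ d₁p = let w , h = some-off-p in drop-p w (∧-elimˡ h) (not-elim (∧-elimʳ {B σ w} h)) (inj₁ d₁p)
  ... | inj₂ none | inj₂ pos =
    let u , pu = neighbour {p = E₁ σ p} pos
        u≢p = λ e → adjacent₁ σ pu (sym e)
        y , iy , nuy = pick i₂ (λ y → 𝟙 (E₃ σ u y)) (≤-<-trans (d₃ˡ-other u u≢p) (≤-trans (≤-reflexive (+-comm 1 R)) (≤-trans (+-monoʳ-≤ R (s≤s z≤n)) many)))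
    in tiny u y (on₁ʳ σ p u pu) (i₂-∈ iy) (𝟙≡0 nuy)
         (¬true⇒false′ (λ f → true≢false (∧-intro iy (not-intro f)) (none y))) (inj₂ (i₂-0 iy))
         (≤-trans (1≤count (E₁ σ u) {p} (trans (sym₁ σ u p) pu)) (m≤m+n _ _))
    where
    ¬true⇒false′ : ∀ {b} → (b ≡ false → ⊥) → b ≡ true
    ¬true⇒false′ {true}  h = refl
    ¬true⇒false′ {false} h = ⊥-elim (h refl)

  isolated-avoiding : R + 3 ≤ count i₁ → ∀ z → ∃ λ a → A σ a ≡ true × d₁ σ a ≡ 0 × E₃ σ a z ≡ false
  isolated-avoiding many z =
    let a , ia , naz = pick i₁ (λ a → 𝟙 (E₃ σ a z)) (≤-<-trans (d₃ʳ-other′ z) (≤-trans (≤-reflexive (+-comm 1 (R + 1))) (≤-trans (≤-reflexive (+-assoc R 1 1)) (≤-trans (+-monoʳ-≤ R (s≤s (s≤s z≤n))) many))))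
    in a , i₁-∈ ia , i₁-0 ia , 𝟙≡0 naz

  by-isolated₁ : R + 3 ≤ count i₁ → Packing σ ⊎ Leftover
  by-isolated₁ many with search (λ z → E₃ σ p z ∧ (1 ≤ᵇ d₂ σ z))
  ... | inj₁ (z , h) =
    let a , aa , d₁a , naz = isolated-avoiding many z
    in inj₁ (tiny a z aa (on₃ʳ σ p z (∧-elimˡ h)) naz (∧-elimˡ h) (inj₁ d₁a) (≤-trans (≤ᵇ-true⁻ {1} {d₂ σ z} (∧-elimʳ {E₃ σ p z} h)) (m≤n+m (d₂ σ z) (d₁ σ a))))
  ... | inj₂ none with search (λ z → 3 ≤ᵇ d₂ σ z)
  ...   | inj₂ low = inj₂ λ y pos → off y pos , ≤-pred (≤ᵇ-false⁻ {3} (low y))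
    where
    off : ∀ y → 1 ≤ d₂ σ y → E₃ σ p y ≡ false
    off y pos = ¬true⇒false λ h → true≢false (∧-intro h (≤ᵇ-true pos)) (none y)
  ...   | inj₁ (z , h) =
    let a , aa , d₁a , naz = isolated-avoiding many z
        z′ , zz′ = neighbour {p = E₂ σ z} (≤-trans (s≤s z≤n) (≤ᵇ-true⁻ {3} h))
        ne : z ≢ z′
        ne = adjacent₂ σ zz′
        pos′ : 1 ≤ d₂ σ z′
        pos′ = 1≤count (E₂ σ z′) {z} (trans (sym₂ σ z′ z) zz′)
        -- Both `z` and its neighbour `z′` miss `p`, which yields the slack `T + 2` under the order
        -- that `big` asks for.
        two : 2 ≤ count off-p
        two = ≤-trans (≤-reflexive (cong₂ (λ a b → 𝟙 a + 𝟙 b)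
                (sym (∧-intro (on₂ σ z z′ zz′) (not-intro (off z (≤-trans (s≤s z≤n) (≤ᵇ-true⁻ {3} h))))))
                (sym (∧-intro (on₂ σ z′ z (trans (sym₂ σ z′ z) zz′)) (not-intro (off z′ pos′))))))
              (two-point (λ y → 𝟙 (off-p y)) ne)
    in inj₁ (big a z aa (on₂ σ z z′ zz′) naz d₁a (≤ᵇ-true⁻ h) (T-safe (count off-p) T k two count-off-p))
    where
    T-safe : ∀ q T k → 2 ≤ q → q + T ≡ 1 + k → T + 2 ≤ 1 + k
    T-safe q T k h0 h1 =
      linear 3 (λ q T k → (# 2 ⊴ q) ∷ (q ⊕ T ⊴ # 1 ⊕ k) ∷ (# 1 ⊕ k ⊴ q ⊕ T) ∷ [] , (T ⊕ # 2 ⊴ # 1 ⊕ k)) 1 (1 ∷ 1 ∷ 0 ∷ []) q T k h0 (≤-reflexive h1) (≤-reflexive (sym h1))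
    off : ∀ y → 1 ≤ d₂ σ y → E₃ σ p y ≡ false
    off y pos = ¬true⇒false λ h → true≢false (∧-intro h (≤ᵇ-true pos)) (none y)

  by-isolated : 2 * R + 4 ≤ count i₁ + count i₂ → Packing σ ⊎ Leftover
  by-isolated many with R + 2 ≤? count i₂
  ... | yes h = inj₁ (by-isolated₂ h)
  ... | no h  = by-isolated₁ (split R (count i₁) (count i₂) many (≰⇒> h))
    where
    split : ∀ R x y → 2 * R + 4 ≤ x + y → y < R + 2 → R + 3 ≤ x
    split = linear 3 (λ R x y → (2 ⊗ R ⊕ # 4 ⊴ x ⊕ y) ∷ (# 1 ⊕ y ⊴ R ⊕ # 2) ∷ [] , (R ⊕ # 3 ⊴ x)) 1 (1 ∷ 1 ∷ [])

module _ {N} (σ : State N) {k D T : ℕ} (hyp : Hyp N (suc k)) (G : Good σ (suc k) D T)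
         (p : Fin N) (ap : A σ p ≡ true) where

  open Good G

  remainder : ∀ {x} → d₃ˡ σ p ≡ x → ∃ λ R → x + R ≡ m₃ σ
  remainder refl = m≤n⇒∃[o]m+o≡n (≤∑ (d₃ˡ σ) p)

  -- At least `2 n - m₁ - m₂` vertices are isolated. With `T` this close to `n` the budget pushes
  -- `m₁ + m₂ + 2 R` below `2 n`, which leaves more than `2 R` isolated vertices.
  nearly-full : d₃ˡ σ p ≡ T → 2 * D ≤ m₁ σ + m₂ σ → 3 * suc k ≤ 3 * T + D + 400 → Packing σ
  nearly-full d₃p dense near with remainder d₃p
  ... | R , R-def = conclude (by-isolated (iso-lin R D T (suc k) (m₁ σ) (m₂ σ) (m₃ σ) (count i₁) (count i₂) R-def dense near budget
                                   (subst (_≤ count i₁ + m₁ σ) #A (count-isolated (A σ) (d₁ σ))) (subst (_≤ count i₂ + m₂ σ) #B (count-isolated (B σ) (d₂ σ)))))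
    where
    unique-lin : ∀ R D T n a b c → T + R ≡ c → 2 * D ≤ a + b → 3 * n ≤ 3 * T + D + 400 → a + b + 2 * c + 2 * D + 2 * T + 836550 ≤ 6 * n → R + 2 ≤ T
    unique-lin R D T n a b c h0 h1 h2 h3 =
      linear 7 (λ R D T n a b c → (T ⊕ R ⊴ c) ∷ (c ⊴ T ⊕ R) ∷ (2 ⊗ D ⊴ a ⊕ b) ∷ (3 ⊗ n ⊴ 3 ⊗ T ⊕ D ⊕ # 400) ∷ (a ⊕ b ⊕ 2 ⊗ c ⊕ 2 ⊗ D ⊕ 2 ⊗ T ⊕ # 836550 ⊴ 6 ⊗ n) ∷ [] , (R ⊕ # 2 ⊴ T)) 2 (2 ∷ 0 ∷ 0 ∷ 2 ∷ 1 ∷ []) R D T n a b c (≤-reflexive h0) (≤-reflexive (sym h0)) h1 h2 h3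
    safe-lin : ∀ R D T n a b c → T + R ≡ c → 2 * D ≤ a + b → 3 * n ≤ 3 * T + D + 400 → a + b + 2 * c + 2 * D + 2 * T + 836550 ≤ 6 * n → D + 3 ≤ n
    safe-lin R D T n a b c h0 h1 h2 h3 =
      linear 7 (λ R D T n a b c → (T ⊕ R ⊴ c) ∷ (c ⊴ T ⊕ R) ∷ (2 ⊗ D ⊴ a ⊕ b) ∷ (3 ⊗ n ⊴ 3 ⊗ T ⊕ D ⊕ # 400) ∷ (a ⊕ b ⊕ 2 ⊗ c ⊕ 2 ⊗ D ⊕ 2 ⊗ T ⊕ # 836550 ⊴ 6 ⊗ n) ∷ [] , (D ⊕ # 3 ⊴ n)) 3 (1 ∷ 0 ∷ 1 ∷ 1 ∷ 1 ∷ []) R D T n a b c (≤-reflexive h0) (≤-reflexive (sym h0)) h1 h2 h3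
    iso-lin : ∀ R D T n a b c i j → T + R ≡ c → 2 * D ≤ a + b → 3 * n ≤ 3 * T + D + 400 → a + b + 2 * c + 2 * D + 2 * T + 836550 ≤ 6 * n → n ≤ i + a → n ≤ j + b → 2 * R + 4 ≤ i + j
    iso-lin R D T n a b c i j h0 h1 h2 h3 h4 h5 =
      linear 9 (λ R D T n a b c i j → (T ⊕ R ⊴ c) ∷ (c ⊴ T ⊕ R) ∷ (2 ⊗ D ⊴ a ⊕ b) ∷ (3 ⊗ n ⊴ 3 ⊗ T ⊕ D ⊕ # 400) ∷ (a ⊕ b ⊕ 2 ⊗ c ⊕ 2 ⊗ D ⊕ 2 ⊗ T ⊕ # 836550 ⊴ 6 ⊗ n) ∷ (n ⊴ i ⊕ a) ∷ (n ⊴ j ⊕ b) ∷ [] , (2 ⊗ R ⊕ # 4 ⊴ i ⊕ j)) 3 (6 ∷ 0 ∷ 0 ∷ 4 ∷ 3 ∷ 3 ∷ 3 ∷ []) R D T n a b c i j (≤-reflexive h0) (≤-reflexive (sym h0)) h1 h2 h3 h4 h5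
    open Dominated σ hyp G p ap d₃p R-def (unique-lin R D T (suc k) (m₁ σ) (m₂ σ) (m₃ σ) R-def dense near budget)
                                          (safe-lin R D T (suc k) (m₁ σ) (m₂ σ) (m₃ σ) R-def dense near budget)
    conclude : Packing σ ⊎ Leftover → Packing σ
    conclude (inj₁ P) = P
    conclude (inj₂ left) with some-off-p
    ... | w , h with zero-or-positive (d₂ σ w)
    ...   | inj₁ d₂w = drop-p w (∧-elimˡ h) (not-elim (∧-elimʳ {B σ w} h)) (inj₂ d₂w)
    -- Now `d₂ σ w ≤ 2`, so left vertices gain at most 2. The neighbours of `w` are not isolated,
    -- hence miss `p`: they have at most `R` edges of G₃ before they gain `d₁ σ p`. The new bound
    -- covers both.
    ...   | inj₂ pos = reduce hyp G p w ap (∧-elimˡ h) npw D (R + 2 + d₁ σ p)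
          (λ u → ≤-trans (d₁-place≤ σ p w u) (Δ₁ u)) (λ y → ≤-trans (d₂-place≤ σ p w y) (Δ₂ y))
          (λ u ne → ≤-trans (m+n≤o⇒m≤o _ (d₃ˡ-place σ p w u)) (≤-trans (+-mono-≤ (d₃ˡ-other u ne) (𝟙*-bound (E₁ σ u p) (λ _ → d₂w))) (m≤m+n _ _)))
          (λ y _ → right y (decide (E₂ σ y w)))
          (c1-safe D k D-safe)
          (T-lin R D T (suc k) (m₁ σ) (m₂ σ) (m₃ σ) (d₁ σ p) k R-def dense near budget (degree≤half σ p) refl)
          (budget-lin R D T k (m₁ σ) (m₂ σ) (m₃ σ) (d₁ σ p) (m₁ τ) (m₂ τ) (m₃ τ) (d₁ σ p * d₂ σ w) (d₃ʳ σ w) R-def dense near budget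
             (Δ₁ p) (m₁-place σ p w) (m₂-place≤ σ p w)
             (subst (λ t → m₃ τ + (t + d₃ʳ σ w) ≤ m₃ σ + d₁ σ p * d₂ σ w) d₃p (m₃-place σ p w npw))
             (≤-trans (*-monoʳ-≤ (d₁ σ p) d₂w) (≤-reflexive (*-comm (d₁ σ p) 2))))
      where
      D-safe = safe-lin R D T (suc k) (m₁ σ) (m₂ σ) (m₃ σ) R-def dense near budget
      τ = place p w σ
      npw = not-elim (∧-elimʳ {B σ w} h)
      d₂w = proj₂ (left w pos)
      T-lin : ∀ R D T n a b c x k → T + R ≡ c → 2 * D ≤ a + b → 3 * n ≤ 3 * T + D + 400 → a + b + 2 * c + 2 * D + 2 * T + 836550 ≤ 6 * n → 2 * x ≤ a → n ≡ 1 + k → R + 2 + x + 1 ≤ k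
      T-lin R D T n a b c x k h0 h1 h2 h3 h4 h5 =
        linear 9 (λ R D T n a b c x k → (T ⊕ R ⊴ c) ∷ (c ⊴ T ⊕ R) ∷ (2 ⊗ D ⊴ a ⊕ b) ∷ (3 ⊗ n ⊴ 3 ⊗ T ⊕ D ⊕ # 400) ∷ (a ⊕ b ⊕ 2 ⊗ c ⊕ 2 ⊗ D ⊕ 2 ⊗ T ⊕ # 836550 ⊴ 6 ⊗ n) ∷ (2 ⊗ x ⊴ a) ∷ (n ⊴ # 1 ⊕ k) ∷ (# 1 ⊕ k ⊴ n) ∷ [] , (R ⊕ # 2 ⊕ x ⊕ # 1 ⊴ k)) 6 (6 ∷ 0 ∷ 0 ∷ 4 ∷ 3 ∷ 3 ∷ 6 ∷ 0 ∷ []) R D T n a b c x k (≤-reflexive h0) (≤-reflexive (sym h0)) h1 h2 h3 h4 (≤-reflexive h5) (≤-reflexive (sym h5))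
      budget-lin : ∀ R D T k a b c x a′ b′ c′ z s → T + R ≡ c → 2 * D ≤ a + b → 3 * (1 + k) ≤ 3 * T + D + 400 → a + b + 2 * c + 2 * D + 2 * T + 836550 ≤ 6 * (1 + k) → x ≤ D → a′ + 2 * x ≡ a → b′ ≤ b → c′ + (T + s) ≤ c + z → z ≤ 2 * x → a′ + b′ + 2 * c′ + 2 * D + 2 * (R + 2 + x) + 836550 ≤ 6 * k
      budget-lin R D T k a b c x a′ b′ c′ z s h0 h1 h2 h3 h4 h5 h6 h7 h8 =
        linear 13 (λ R D T k a b c x a′ b′ c′ z s → (T ⊕ R ⊴ c) ∷ (c ⊴ T ⊕ R) ∷ (2 ⊗ D ⊴ a ⊕ b) ∷ (3 ⊗ (# 1 ⊕ k) ⊴ 3 ⊗ T ⊕ D ⊕ # 400) ∷ (a ⊕ b ⊕ 2 ⊗ c ⊕ 2 ⊗ D ⊕ 2 ⊗ T ⊕ # 836550 ⊴ 6 ⊗ (# 1 ⊕ k)) ∷ (x ⊴ D) ∷ (a′ ⊕ 2 ⊗ x ⊴ a) ∷ (a ⊴ a′ ⊕ 2 ⊗ x) ∷ (b′ ⊴ b) ∷ (c′ ⊕ (T ⊕ s) ⊴ c ⊕ z) ∷ (z ⊴ 2 ⊗ x) ∷ [] , (a′ ⊕ b′ ⊕ 2 ⊗ c′ ⊕ 2 ⊗ D ⊕ 2 ⊗ (R ⊕ # 2 ⊕ x) ⊕ # 836550 ⊴ 6 ⊗ k)) 1 (4 ∷ 0 ∷ 0 ∷ 4 ∷ 3 ∷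 0 ∷ 3 ∷ 0 ∷ 1 ∷ 2 ∷ 2 ∷ []) R D T k a b c x a′ b′ c′ z s (≤-reflexive h0) (≤-reflexive (sym h0)) h1 h2 h3 h4 (≤-reflexive h5) (≤-reflexive (sym h5)) h6 h7 h8
      right : ∀ y → E₂ σ y w ≡ true ⊎ E₂ σ y w ≡ false → d₃ʳ τ y ≤ R + 2 + d₁ σ p
      right y (inj₁ t) = ≤-trans (m+n≤o⇒m≤o _ (subst (λ b → d₃ʳ τ y + 𝟙 (E₃ σ p y) ≤ d₃ʳ σ y + 𝟙 b * d₁ σ p) t (d₃ʳ-place σ p w y)))
        (+-mono-≤ (≤-trans (subst (λ b → d₃ʳ σ y ≤ R + 𝟙 b) (proj₁ (left y (1≤count (E₂ σ y) t))) (d₃ʳ-other y)) (+-monoʳ-≤ R z≤n)) (≤-reflexive (+-identityʳ _)))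
      right y (inj₂ f) = ≤-trans (m+n≤o⇒m≤o _ (subst (λ b → d₃ʳ τ y + 𝟙 (E₃ σ p y) ≤ d₃ʳ σ y + 𝟙 b * d₁ σ p) f (d₃ʳ-place σ p w y)))
        (≤-trans (≤-reflexive (+-identityʳ _)) (≤-trans (d₃ʳ-other′ y) (≤-trans (+-monoʳ-≤ R (s≤s z≤n)) (m≤m+n _ _))))

  -- The edges of G₃ at `p` pay at least `n / 2`, hence `350 D`. Up to `100 D` new edges and a
  -- maximum raised by `D + 100` cost about `202 D`. `cool` keeps the neighbours of `w` below the
  -- new order.
  match-low : ∀ w → B σ w ≡ true → E₃ σ p w ≡ false → d₂ σ w ≤ 100 → 700 * D ≤ suc k → suc k ≤ 4 * d₃ˡ σ p → T + 103 ≤ suc k →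
              (∀ y → E₂ σ y w ≡ true → d₃ʳ σ y + D + 3 ≤ suc k) → Packing σ
  match-low w bw npw d₂w D-small large T-safe cool = reduce hyp G p w ap bw npw D T′
      (λ u → ≤-trans (d₁-place≤ σ p w u) (Δ₁ u)) (λ y → ≤-trans (d₂-place≤ σ p w y) (Δ₂ y))
      (λ u _ → ⊓-glb (left₁ u) (left₂ u)) (λ y _ → right y (decide (E₂ σ y w)))
      (D-lin D k (m₁ σ + m₂ σ + 2 * m₃ σ + 2 * D + 2 * T) D-small budget)
      (≤-trans (≤-reflexive (+-comm T′ 1)) (≤-trans (s≤s (m⊓n≤n (T + D + 100) (proj₁ k-pred))) (≤-reflexive (proj₂ k-pred))))
      (budget-lin D T k (m₁ σ) (m₂ σ) (m₃ σ) (d₁ σ p) (m₁ τ) (m₂ τ) (m₃ τ) (d₁ σ p * d₂ σ w) (d₃ˡ σ p) (d₃ʳ σ w) T′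
         budget (Δ₁ p) (m₁-place≤ σ p w) (m₂-place≤ σ p w) (m₃-place σ p w npw)
         (≤-trans (*-monoʳ-≤ (d₁ σ p) d₂w) (≤-reflexive (*-comm (d₁ σ p) 100))) D-small large (m⊓n≤m (T + D + 100) (proj₁ k-pred)))
    where
    τ = place p w σ
    k-pred : ∃ λ k′ → suc k′ ≡ k
    k-pred = let o , e = m≤n⇒∃[o]m+o≡n (pos T k T-safe) in o , e
      where
      pos : ∀ T k → T + 103 ≤ 1 + k → 1 ≤ k
      pos = linear 2 (λ T k → (T ⊕ # 103 ⊴ # 1 ⊕ k) ∷ [] , (# 1 ⊴ k)) 1 (1 ∷ [])
    -- The first bound serves the budget, the second the requirement `T′ + 1 ≤ k`.
    T′ = (T + D + 100) ⊓ proj₁ k-pred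
    D-lin : ∀ D k s → 700 * D ≤ 1 + k → s + 836550 ≤ 6 * (1 + k) → D + 2 ≤ k
    D-lin = linear 3 (λ D k s → (700 ⊗ D ⊴ # 1 ⊕ k) ∷ (s ⊕ # 836550 ⊴ 6 ⊗ (# 1 ⊕ k)) ∷ [] , (D ⊕ # 2 ⊴ k)) 1400 (2 ∷ 233 ∷ [])
    budget-lin : ∀ D T k a b c x a′ b′ c′ z t s T′ → a + b + 2 * c + 2 * D + 2 * T + 836550 ≤ 6 * (1 + k) → x ≤ D → a′ ≤ a → b′ ≤ b → c′ + (t + s) ≤ c + z → z ≤ 100 * x → 700 * D ≤ 1 + k → 1 + k ≤ 4 * t → T′ ≤ T + D + 100 → a′ + b′ + 2 * c′ + 2 * D + 2 * T′ + 836550 ≤ 6 * k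
    budget-lin = linear 14 (λ D T k a b c x a′ b′ c′ z t s T′ → (a ⊕ b ⊕ 2 ⊗ c ⊕ 2 ⊗ D ⊕ 2 ⊗ T ⊕ # 836550 ⊴ 6 ⊗ (# 1 ⊕ k)) ∷ (x ⊴ D) ∷ (a′ ⊴ a) ∷ (b′ ⊴ b) ∷ (c′ ⊕ (t ⊕ s) ⊴ c ⊕ z) ∷ (z ⊴ 100 ⊗ x) ∷ (700 ⊗ D ⊴ # 1 ⊕ k) ∷ (# 1 ⊕ k ⊴ 4 ⊗ t) ∷ (T′ ⊴ T ⊕ D ⊕ # 100) ∷ [] , (a′ ⊕ b′ ⊕ 2 ⊗ c′ ⊕ 2 ⊗ D ⊕ 2 ⊗ T′ ⊕ # 836550 ⊴ 6 ⊗ k)) 2024 (2098 ∷ 419600 ∷ 2024 ∷ 2024 ∷ 4196 ∷ 4196 ∷ 605 ∷ 1049 ∷ 4048 ∷ [])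
    low-lin : ∀ T x k k′ → x ≤ T + 100 → T + 103 ≤ 1 + k → k′ + 1 ≡ k → x ≤ k′
    low-lin T x k k′ h0 h1 h2 =
      linear 4 (λ T x k k′ → (x ⊴ T ⊕ # 100) ∷ (T ⊕ # 103 ⊴ # 1 ⊕ k) ∷ (k′ ⊕ # 1 ⊴ k) ∷ (k ⊴ k′ ⊕ # 1) ∷ [] , (x ⊴ k′)) 1 (1 ∷ 1 ∷ 0 ∷ 1 ∷ []) T x k k′ h0 h1 (≤-reflexive h2) (≤-reflexive (sym h2))
    high-lin : ∀ D x k k′ → x + D + 3 ≤ 1 + k → k′ + 1 ≡ k → x + D ≤ k′
    high-lin D x k k′ h0 h1 =
      linear 4 (λ D x k k′ → (x ⊕ D ⊕ # 3 ⊴ # 1 ⊕ k) ∷ (k′ ⊕ # 1 ⊴ k) ∷ (k ⊴ k′ ⊕ # 1) ∷ [] , (x ⊕ D ⊴ k′)) 1 (1 ∷ 0 ∷ 1 ∷ []) D x k k′ h0 (≤-reflexive h1) (≤-reflexive (sym h1))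
    k-def : proj₁ k-pred + 1 ≡ k
    k-def = trans (+-comm _ 1) (proj₂ k-pred)
    left₀ : ∀ u → d₃ˡ τ u ≤ T + 100
    left₀ u = ≤-trans (m+n≤o⇒m≤o _ (d₃ˡ-place σ p w u)) (+-mono-≤ (Δ₃ˡ u) (𝟙*-bound (E₁ σ u p) (λ _ → d₂w)))
    left₁ : ∀ u → d₃ˡ τ u ≤ T + D + 100
    left₁ u = ≤-trans (left₀ u) (+-monoˡ-≤ 100 (m≤m+n T D))
    left₂ : ∀ u → d₃ˡ τ u ≤ proj₁ k-pred
    left₂ u = low-lin T _ k _ (left₀ u) T-safe k-def
    right : ∀ y → E₂ σ y w ≡ true ⊎ E₂ σ y w ≡ false → d₃ʳ τ y ≤ T′
    right y (inj₁ t) = ⊓-glb (≤-trans heat (≤-trans (+-monoˡ-≤ D (Δ₃ʳ y)) (m≤m+n _ 100))) (≤-trans heat (high-lin D _ k _ (cool y t) k-def))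
      where
      heat : d₃ʳ τ y ≤ d₃ʳ σ y + D
      heat = ≤-trans (m+n≤o⇒m≤o _ (d₃ʳ-place σ p w y)) (+-monoʳ-≤ (d₃ʳ σ y) (𝟙*-bound (E₂ σ y w) (λ _ → Δ₁ p)))
    right y (inj₂ f) = ⊓-glb (≤-trans heat (≤-trans (m≤m+n T D) (m≤m+n _ 100))) (low-lin T _ k _ (≤-trans heat (m≤m+n T 100)) T-safe k-def)
      where
      heat : d₃ʳ τ y ≤ T
      heat = ≤-trans (m+n≤o⇒m≤o _ (subst (λ b → d₃ʳ τ y + 𝟙 (E₃ σ p y) ≤ d₃ʳ σ y + 𝟙 b * d₁ σ p) f (d₃ʳ-place σ p w y)))
                     (≤-trans (≤-reflexive (+-identityʳ _)) (Δ₃ʳ y))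

d₃-crossing₂ : ∀ {N} (σ : State N) p {y y′} → y ≢ y′ → d₃ʳ σ y + d₃ʳ σ y′ + d₃ˡ σ p ≤ m₃ σ + 2
d₃-crossing₂ σ p {y} {y′} ne = ≤-trans (≤-reflexive (cong (_+ d₃ˡ σ p) (sym (∑-+ _ _))))
  (≤-trans (∑-excess (d₃ˡ σ) (λ u → 𝟙 (E₃ σ u y) + 𝟙 (E₃ σ u y′)) p (λ u → two-point (λ z → 𝟙 (E₃ σ u z)) ne))
           (+-monoʳ-≤ (m₃ σ) (+-mono-≤ (𝟙≤1 (E₃ σ p y)) (𝟙≤1 (E₃ σ p y′)))))

-- For `w ≠ x` in `Q` the degree of `w` plus the indicator of `wx` is at least 2. The indicators sum
-- to the degree of `x`, which takes the place of the omitted term at `x`; the final 2 covers `x` as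
-- a member of `Q`.
degree-sum≥ : ∀ {N} (E : Fin N → Fin N → Bool) (Q : Fin N → Bool) x →
              (∀ w → Q w ≡ true → w ≢ x → E w x ≡ true ⊎ 2 ≤ count (E w)) → (∀ u u′ → E u u′ ≡ E u′ u) →
              2 * count Q ≤ ∑ (λ w → count (E w)) + 2
degree-sum≥ E Q x h s = +-cancelʳ-≤ (d x) _ _ (begin
  2 * count Q + d x                                                     ≡⟨ cong₂ _+_ (sym (∑-* 2 _)) (sym (∑-point x d)) ⟩
  ∑ (λ w → 2 * 𝟙 (Q w)) + ∑ (λ w → 𝟙 (w == x) * d w)                    ≡⟨ sym (∑-+ _ (λ w → 𝟙 (w == x) * d w)) ⟩
  ∑ (λ w → 2 * 𝟙 (Q w) + 𝟙 (w == x) * d w)                              ≤⟨ ∑-mono (λ w → pt w (w ≟ᶠ x)) ⟩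
  ∑ (λ w → d w + 𝟙 (E w x) + 𝟙 (w == x) * 2)                            ≡⟨ trans (∑-+ _ (λ w → 𝟙 (w == x) * 2)) (cong₂ _+_ (∑-+ d _) (∑-point x (λ _ → 2))) ⟩
  ∑ d + count (λ w → E w x) + 2                                         ≡⟨ cong (λ z → ∑ d + z + 2) (∑-cong (λ w → cong 𝟙 (s w x))) ⟩
  ∑ d + d x + 2                                                         ≡⟨ trans (+-assoc (∑ d) (d x) 2) (trans (cong (∑ d +_) (+-comm (d x) 2)) (sym (+-assoc (∑ d) 2 (d x)))) ⟩
  ∑ d + 2 + d x                                                         ∎)
  where
  open ≤-Reasoning
  d = λ w → count (E w)
  pt : ∀ w → Dec (w ≡ x) → 2 * 𝟙 (Q w) + 𝟙 (w == x) * d w ≤ d w + 𝟙 (E w x) + 𝟙 (w == x) * 2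
  pt w (yes refl) = subst (λ b → 2 * 𝟙 (Q w) + 𝟙 b * d w ≤ d w + 𝟙 (E w w) + 𝟙 b * 2) (sym (==-refl w))
    (self (𝟙 (Q w)) (d w) (𝟙 (E w w)) (𝟙≤1 (Q w)))
    where
    self : ∀ q d e → q ≤ 1 → 2 * q + 1 * d ≤ d + e + 1 * 2
    self = linear 3 (λ q d e → (q ⊴ # 1) ∷ [] , (2 ⊗ q ⊕ 1 ⊗ d ⊴ d ⊕ e ⊕ 1 ⊗ # 2)) 1 (2 ∷ [])
  pt w (no ne) = subst (λ b → 2 * 𝟙 (Q w) + 𝟙 b * d w ≤ d w + 𝟙 (E w x) + 𝟙 b * 2) (sym (≢⇒==-false ne)) (other (Q w) refl)
    where
    other : ∀ b → Q w ≡ b → 2 * 𝟙 b + 0 ≤ d w + 𝟙 (E w x) + 0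
    other false _ = z≤n
    other true q with h w q ne
    ... | inj₁ e = ≤-trans (+-mono-≤ (1≤count (E w) e) (≤-reflexive (sym (𝟙-true e)))) (≤-reflexive (sym (+-identityʳ _)))
    ... | inj₂ two = ≤-trans two (≤-trans (m≤m+n _ _) (m≤m+n _ 0))

-- A dominating vertex of G₃ when `D` is at most `n / 700`

module _ {N} (σ : State N) {k D T : ℕ} (hyp : Hyp N (suc k)) (G : Good σ (suc k) D T)
         (p : Fin N) (ap : A σ p ≡ true) (d₃p : d₃ˡ σ p ≡ T)
         (D-small : 700 * D ≤ suc k) (T-large : suc k ≤ 4 * T) (far : 3 * T + D + 400 < 3 * suc k) where

  open Good G

  private
    -- The gain of `D` edges that `match-low` allows for could bring such a vertex up to the full
    -- order.
    dangerous : Fin N → Bool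
    dangerous y = suc k ≤ᵇ d₃ʳ σ y + D + 2

    low-off : Fin N → Bool
    low-off w = B σ w ∧ not (E₃ σ p w) ∧ (d₂ σ w ≤ᵇ 100)

    low-off-elim : ∀ {w} → low-off w ≡ true → B σ w ≡ true × E₃ σ p w ≡ false × d₂ σ w ≤ 100
    low-off-elim {w} h = ∧-elimˡ h , not-elim (∧-elimˡ (∧-elimʳ {B σ w} h)) , ≤ᵇ-true⁻ (∧-elimʳ {not (E₃ σ p w)} (∧-elimʳ {B σ w} h))

    hot : Fin N → Fin N → Bool
    hot w y = E₂ σ w y ∧ dangerous y

    calm : ∀ x D k → x + D + 2 < 1 + k → x + D + 3 ≤ 1 + k
    calm = linear 3 (λ x D k → (# 1 ⊕ (x ⊕ D ⊕ # 2) ⊴ # 1 ⊕ k) ∷ [] , (x ⊕ D ⊕ # 3 ⊴ # 1 ⊕ k)) 1 (1 ∷ [])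
    T-safe : ∀ T D k → 3 * T + D + 400 < 3 * (1 + k) → T + 103 ≤ 1 + k
    T-safe = linear 3 (λ T D k → (# 1 ⊕ (3 ⊗ T ⊕ D ⊕ # 400) ⊴ 3 ⊗ (# 1 ⊕ k)) ∷ [] , (T ⊕ # 103 ⊴ # 1 ⊕ k)) 3 (1 ∷ [])

    cool : ∀ w → (count (hot w) ≤ᵇ 0) ≡ true → ∀ y → E₂ σ y w ≡ true → d₃ʳ σ y + D + 3 ≤ suc k
    cool w h y e = calm (d₃ʳ σ y) D k (≤ᵇ-false⁻ {suc k} (¬true⇒false λ t →
      true≢false (∧-intro (trans (sym₂ σ w y) e) t) (count-zero (n≤0⇒n≡0 (≤ᵇ-true⁻ h)) y)))

  dominated : Packing σ
  dominated with search (λ w → low-off w ∧ (count (hot w) ≤ᵇ 0))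
  ... | inj₁ (w , h) = let bw , npw , d₂w = low-off-elim (∧-elimˡ h) in
        match-low σ hyp G p ap w bw npw d₂w D-small (subst (λ t → suc k ≤ 4 * t) (sym d₃p) T-large) (T-safe T D k far) (cool w (∧-elimʳ {low-off w} h))
  ... | inj₂ none with search low-off
  -- Every vertex of G₂ that misses `p` has degree at least 101. Such degrees use up so much of the
  -- budget that the other vertices include many isolated ones; the degree bound 2 in `Leftover` is
  -- then absurd.
  ...   | inj₂ no-low = conclude (by-isolated (iso-lin R D T (suc k) (m₁ σ) (m₂ σ) (m₃ σ) (count i₁) (count i₂) (count off-p) R-def budget
                                   (subst (_≤ count i₁ + m₁ σ) #A (count-isolated (A σ) (d₁ σ))) heavy count-off-p))
    where
    iso-lin : ∀ R D T n a b c i j q → T + R ≡ c → a + b + 2 * c + 2 * D + 2 * T + 836550 ≤ 6 * n → n ≤ i + a → n + 100 * q ≤ j + b → q + T ≡ n → 2 * R + 4 ≤ i + j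
    iso-lin R D T n a b c i j q h0 h1 h2 h3 h4 =
      linear 10 (λ R D T n a b c i j q → (T ⊕ R ⊴ c) ∷ (c ⊴ T ⊕ R) ∷ (a ⊕ b ⊕ 2 ⊗ c ⊕ 2 ⊗ D ⊕ 2 ⊗ T ⊕ # 836550 ⊴ 6 ⊗ n) ∷ (n ⊴ i ⊕ a) ∷ (n ⊕ 100 ⊗ q ⊴ j ⊕ b) ∷ (q ⊕ T ⊴ n) ∷ (n ⊴ q ⊕ T) ∷ [] , (2 ⊗ R ⊕ # 4 ⊴ i ⊕ j)) 1 (2 ∷ 0 ∷ 1 ∷ 1 ∷ 1 ∷ 0 ∷ 4 ∷ []) R D T n a b c i j q (≤-reflexive h0) (≤-reflexive (sym h0)) h1 h2 h3 (≤-reflexive h4) (≤-reflexive (sym h4))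
    unique-lin : ∀ R D T n a b c q → T + R ≡ c → a + b + 2 * c + 2 * D + 2 * T + 836550 ≤ 6 * n → 101 * q ≤ b → q + T ≡ n → R + 2 ≤ T
    unique-lin R D T n a b c q h0 h1 h2 h3 =
      linear 8 (λ R D T n a b c q → (T ⊕ R ⊴ c) ∷ (c ⊴ T ⊕ R) ∷ (a ⊕ b ⊕ 2 ⊗ c ⊕ 2 ⊗ D ⊕ 2 ⊗ T ⊕ # 836550 ⊴ 6 ⊗ n) ∷ (101 ⊗ q ⊴ b) ∷ (q ⊕ T ⊴ n) ∷ (n ⊴ q ⊕ T) ∷ [] , (R ⊕ # 2 ⊴ T)) 202 (202 ∷ 0 ∷ 101 ∷ 6 ∷ 0 ∷ 606 ∷ []) R D T n a b c q (≤-reflexive h0) (≤-reflexive (sym h0)) h1 h2 (≤-reflexive h3) (≤-reflexive (sym h3))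
    D-lin : ∀ D k s → 700 * D ≤ 1 + k → s + 836550 ≤ 6 * (1 + k) → D + 3 ≤ 1 + k
    D-lin = linear 3 (λ D k s → (700 ⊗ D ⊴ # 1 ⊕ k) ∷ (s ⊕ # 836550 ⊴ 6 ⊗ (# 1 ⊕ k)) ∷ [] , (D ⊕ # 3 ⊴ # 1 ⊕ k)) 1400 (2 ∷ 233 ∷ [])
    rem = remainder σ hyp G p ap d₃p
    R = proj₁ rem
    R-def = proj₂ rem
    off : Fin N → Bool
    off y = B σ y ∧ not (E₃ σ p y)
    off-high : ∀ y → off y ≡ true → 101 ≤ d₂ σ y
    off-high y h = ≤ᵇ-false⁻ {d₂ σ y} {100} (¬true⇒false λ t →
      true≢false (∧-intro (∧-elimˡ {B σ y} h) (∧-intro (∧-elimʳ {B σ y} h) t)) (no-low y))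
    count-off′ : count off + T ≡ suc k
    count-off′ = trans (cong (count off +_) (sym d₃p)) (trans (count-off (B σ) (E₃ σ p) (on₃ʳ σ p)) #B)
    open Dominated σ hyp G p ap d₃p R-def
      (unique-lin R D T (suc k) (m₁ σ) (m₂ σ) (m₃ σ) (count off) R-def budget (markov off (d₂ σ) 101 off-high) count-off′)
      (D-lin D k _ D-small budget)
    heavy : suc k + 100 * count off-p ≤ count i₂ + m₂ σ
    heavy = ≤-trans (≤-reflexive (cong₂ _+_ (sym #B) (sym (∑-* 100 (λ y → 𝟙 (off-p y))))))
      (≤-trans (≤-reflexive (sym (∑-+ _ (λ y → 100 * 𝟙 (off-p y))))) (≤-trans (∑-mono pt) (≤-reflexive (∑-+ _ (d₂ σ)))))
      where
      pt : ∀ y → 𝟙 (B σ y) + 100 * 𝟙 (off-p y) ≤ 𝟙 (i₂ y) + d₂ σ y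
      pt y with decide (off-p y)
      ... | inj₁ t = ≤-trans (+-mono-≤ (𝟙≤1 (B σ y)) (*-monoʳ-≤ 100 (𝟙≤1 (off-p y)))) (≤-trans (off-high y t) (m≤n+m _ _))
      ... | inj₂ f = ≤-trans (≤-reflexive (trans (cong (λ b → 𝟙 (B σ y) + 100 * 𝟙 b) f) (+-identityʳ _))) (base (B σ y) (d₂ σ y))
        where
        base : ∀ b d → 𝟙 b ≤ 𝟙 (b ∧ (d ≤ᵇ 0)) + d
        base false d       = z≤n
        base true  zero    = ≤-refl
        base true  (suc d) = s≤s z≤n
    conclude : Packing σ ⊎ Leftover → Packing σ
    conclude (inj₁ P) = P
    conclude (inj₂ left) = let w , h = some-off-p in
      case ≤-trans (off-high w h) (proj₂ (left w (≤-trans (s≤s z≤n) (off-high w h)))) of λ { (s≤s (s≤s ())) }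
  ...   | inj₁ (w₀ , h₀) = finish (search avoid)
    where
    hot-neighbour : ∀ w → low-off w ≡ true → ∃ λ y → hot w y ≡ true
    hot-neighbour w h with count (hot w) ≤ᵇ 0 in eq
    ... | true  = ⊥-elim (true≢false (∧-intro h eq) (none w))
    ... | false = nonempty (hot w) (≤ᵇ-false⁻ {count (hot w)} eq)
    p₂ = proj₁ (hot-neighbour w₀ h₀)
    hot₀ = proj₂ (hot-neighbour w₀ h₀)
    full : suc k ≤ d₃ʳ σ p₂ + D + 2
    full = ≤ᵇ-true⁻ (∧-elimʳ {E₂ σ w₀ p₂} hot₀)
    three : ∀ x y T D n c s → n ≤ x + D + 2 → n ≤ y + D + 2 → x ≤ T → x + y + T ≤ c + 2 → s + 2 * c + 2 * D + 2 * T + 836550 ≤ 6 * n → 700 * D ≤ n → 1 ≤ 0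
    three = linear 7 (λ x y T D n c s → (n ⊴ x ⊕ D ⊕ # 2) ∷ (n ⊴ y ⊕ D ⊕ # 2) ∷ (x ⊴ T) ∷ (x ⊕ y ⊕ T ⊴ c ⊕ # 2) ∷ (s ⊕ 2 ⊗ c ⊕ 2 ⊗ D ⊕ 2 ⊗ T ⊕ # 836550 ⊴ 6 ⊗ n) ∷ (700 ⊗ D ⊴ n) ∷ [] , (# 1 ⊴ # 0)) 0 (2800 ∷ 1398 ∷ 1402 ∷ 1398 ∷ 699 ∷ 4 ∷ [])
    -- Two dangerous vertices together with `p` would account for almost `3 n` edges of G₃, and `T`
    -- for almost another `n`.
    only : ∀ y → dangerous y ≡ true → y ≡ p₂
    only y t with y ≟ᶠ p₂
    ... | yes e = e
    ... | no ne = impossible (three (d₃ʳ σ y) (d₃ʳ σ p₂) T D (suc k) (m₃ σ) (m₁ σ + m₂ σ) (≤ᵇ-true⁻ t) full (Δ₃ʳ y)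
                    (subst (λ z → d₃ʳ σ y + d₃ʳ σ p₂ + z ≤ m₃ σ + 2) d₃p (d₃-crossing₂ σ p ne)) budget D-small)
    off₂ avoid : Fin N → Bool
    off₂ a = A σ a ∧ not (E₃ σ a p₂)
    avoid a = off₂ a ∧ (d₁ σ a ≤ᵇ 100) ∧ not (E₁ σ a p)
    large : ∀ x D n → n ≤ x + D + 2 → 700 * D ≤ n → 10 ≤ n → n ≤ 4 * x
    large = linear 3 (λ x D n → (n ⊴ x ⊕ D ⊕ # 2) ∷ (700 ⊗ D ⊴ n) ∷ (# 10 ⊴ n) ∷ [] , (n ⊴ 4 ⊗ x)) 175 (700 ∷ 1 ∷ 524 ∷ [])
    n-large : ∀ n s → s + 836550 ≤ 6 * n → 10 ≤ n
    n-large = linear 2 (λ n s → (s ⊕ # 836550 ⊴ 6 ⊗ n) ∷ [] , (# 10 ⊴ n)) 6 (1 ∷ [])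
    off : Fin N → Bool
    off y = B σ y ∧ not (E₃ σ p y)
    clash : ∀ q q₂ T t D n a b c → q + T ≡ n → q₂ + t ≡ n → t ≤ T → n ≤ t + D + 2 → 2 * q ≤ b + 2 → 2 * q₂ ≤ a + 2 → t + T ≤ c + 1 → a + b + 2 * c + 2 * D + 2 * T + 836550 ≤ 6 * n → 1 ≤ 0
    clash q q₂ T t D n a b c h0 h1 h2 h3 h4 h5 h6 h7 =
      linear 9 (λ q q₂ T t D n a b c → (q ⊕ T ⊴ n) ∷ (n ⊴ q ⊕ T) ∷ (q₂ ⊕ t ⊴ n) ∷ (n ⊴ q₂ ⊕ t) ∷ (t ⊴ T) ∷ (n ⊴ t ⊕ D ⊕ # 2) ∷ (2 ⊗ q ⊴ b ⊕ # 2) ∷ (2 ⊗ q₂ ⊴ a ⊕ # 2) ∷ (t ⊕ T ⊴ c ⊕ # 1) ∷ (a ⊕ b ⊕ 2 ⊗ c ⊕ 2 ⊗ D ⊕ 2 ⊗ T ⊕ # 836550 ⊴ 6 ⊗ n) ∷ [] , (# 1 ⊴ # 0)) 0 (0 ∷ 2 ∷ 0 ∷ 2 ∷ 2 ∷ 2 ∷ 1 ∷ 1 ∷ 2 ∷ 1 ∷ []) q q₂ T t D n a b c (≤-reflexive h0) (≤-reflexive (sym h0)) (≤-reflexive h1) (≤-reflexive (sym h1)) h2 h3 h4 h5 h6 h7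
    finish : (∃ λ a → avoid a ≡ true) ⊎ (∀ a → avoid a ≡ false) → Packing σ
    -- The sides are exchanged: `p₂` is the dominating vertex and goes on `a`. A neighbour of `a`
    -- differs from `p`, so it cannot carry nearly `n` edges of G₃ beside `p` and `p₂`.
    finish (inj₁ (a , h)) = swap-packing σ (match-low (swap σ) hyp (swap-good G) p₂ (on₂ σ p₂ w₀ (trans (sym₂ σ p₂ w₀) (∧-elimˡ hot₀)))
        a (∧-elimˡ (∧-elimˡ h)) (not-elim (∧-elimʳ {A σ a} (∧-elimˡ h))) (≤ᵇ-true⁻ (∧-elimˡ (∧-elimʳ {off₂ a} h))) D-small
        (large (d₃ʳ σ p₂) D (suc k) full D-small (n-large (suc k) _ budget)) (T-safe T D k far) calm-u)
      where
      calm-u : ∀ u → E₁ σ u a ≡ true → d₃ˡ σ u + D + 3 ≤ suc k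
      calm-u u e = calm (d₃ˡ σ u) D k (≰⇒> λ le → impossible (three′ (d₃ˡ σ u) (d₃ʳ σ p₂) T D (suc k) (m₃ (swap σ)) (m₁ σ + m₂ σ) le full (Δ₃ʳ p₂)
          (subst (λ t → d₃ˡ σ u + t + d₃ʳ σ p₂ ≤ m₃ (swap σ) + 2) d₃p (d₃-crossing₂ (swap σ) p₂ u≢p)) (subst (λ t → m₁ σ + m₂ σ + 2 * t + 2 * D + 2 * T + 836550 ≤ 6 * suc k) (sym (m₃-swap σ)) budget) D-small))
        where
        three′ : ∀ x y T D n c s → n ≤ x + D + 2 → n ≤ y + D + 2 → y ≤ T → x + T + y ≤ c + 2 → s + 2 * c + 2 * D + 2 * T + 836550 ≤ 6 * n → 700 * D ≤ n → 1 ≤ 0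
        three′ = linear 7 (λ x y T D n c s → (n ⊴ x ⊕ D ⊕ # 2) ∷ (n ⊴ y ⊕ D ⊕ # 2) ∷ (y ⊴ T) ∷ (x ⊕ T ⊕ y ⊴ c ⊕ # 2) ∷ (s ⊕ 2 ⊗ c ⊕ 2 ⊗ D ⊕ 2 ⊗ T ⊕ # 836550 ⊴ 6 ⊗ n) ∷ (700 ⊗ D ⊴ n) ∷ [] , (# 1 ⊴ # 0)) 0 (1398 ∷ 2800 ∷ 1402 ∷ 1398 ∷ 699 ∷ 4 ∷ [])
        u≢p : u ≢ p
        u≢p refl = true≢false (trans (sym₁ σ a u) e) (not-elim (∧-elimʳ {d₁ σ a ≤ᵇ 100} (∧-elimʳ {off₂ a} h)))
    -- On both sides the missing vertices now have degree sum about 2 each. With the edges of G₃ at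
    -- `p` and `p₂` this makes `m₁ + m₂ + 2 * m₃` about `4 n`, and `2 D + 2 T` is at least about
    -- `2 n`: the whole `6 n` would be used up.
    finish (inj₂ stuck) = impossible (clash (count off) (count off₂) T (d₃ʳ σ p₂) D (suc k) (m₁ σ) (m₂ σ) (m₃ σ)
        (trans (cong (count off +_) (sym d₃p)) (trans (count-off (B σ) (E₃ σ p) (on₃ʳ σ p)) #B))
        (trans (count-off (A σ) (λ a → E₃ σ a p₂) (λ a → on₃ˡ σ a p₂)) #A) (Δ₃ʳ p₂) full
        (degree-sum≥ (E₂ σ) off p₂ at-p₂ (sym₂ σ)) (degree-sum≥ (E₁ σ) off₂ p at-p (sym₁ σ))
        (≤-trans (subst (λ t → d₃ʳ σ p₂ + t ≤ m₃ σ + 𝟙 (E₃ σ p p₂)) d₃p (d₃-crossing σ p p₂)) (+-monoʳ-≤ (m₃ σ) (𝟙≤1 (E₃ σ p p₂)))) budget)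
      where
      at-p₂ : ∀ w → off w ≡ true → w ≢ p₂ → E₂ σ w p₂ ≡ true ⊎ 2 ≤ d₂ σ w
      at-p₂ w h _ with decide (d₂ σ w ≤ᵇ 100)
      ... | inj₂ f = inj₂ (≤-trans (s≤s (s≤s z≤n)) (≤ᵇ-false⁻ {d₂ σ w} f))
      ... | inj₁ t = let y , hy = hot-neighbour w (∧-intro (∧-elimˡ {B σ w} h) (∧-intro (∧-elimʳ {B σ w} h) t)) in
                     inj₁ (subst (λ z → E₂ σ w z ≡ true) (only y (∧-elimʳ {E₂ σ w y} hy)) (∧-elimˡ hy))
      at-p : ∀ a → off₂ a ≡ true → a ≢ p → E₁ σ a p ≡ true ⊎ 2 ≤ d₁ σ a
      at-p a h _ with decide (d₁ σ a ≤ᵇ 100) | decide (E₁ σ a p)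
      ... | inj₂ f | _      = inj₂ (≤-trans (s≤s (s≤s z≤n)) (≤ᵇ-false⁻ {d₁ σ a} f))
      ... | inj₁ t | inj₁ e = inj₁ e
      ... | inj₁ t | inj₂ f = ⊥-elim (true≢false (∧-intro h (∧-intro t (not-intro f))) (stuck a))

-- A vertex of G₁ adjacent to all but boundedly many others

nonadjacent-degrees : ∀ {N} (σ : State N) {v b} → b ≢ v → E₁ σ v b ≡ false → 2 * d₁ σ b + 2 * d₁ σ v ≤ m₁ σ
nonadjacent-degrees σ {v} {b} ne h = ≤-trans (+-monoˡ-≤ _ (≤-trans (*-monoʳ-≤ 2 same) (degree≤half (place v v σ) b))) (≤-reflexive (m₁-place σ v v))
  where
  same : d₁ σ b ≤ d₁ (place v v σ) b
  same = ≤-reflexive (trans (sym (d₁-place σ v v b ne)) (trans (cong (λ z → d₁ (place v v σ) b + 𝟙 z) (trans (sym₁ σ b v) h)) (+-identityʳ _)))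

other-degrees : ∀ {N} (σ : State N) {v u} → u ≢ v → 2 * d₁ σ u + 2 * d₁ σ v ≤ m₁ σ + 2
other-degrees σ {v} {u} ne = lin (d₁ σ u) (d₁ (place v v σ) u) (𝟙 (E₁ σ u v)) (m₁ (place v v σ)) (d₁ σ v) (m₁ σ)
  (d₁-place σ v v u ne) (𝟙≤1 (E₁ σ u v)) (degree≤half (place v v σ) u) (m₁-place σ v v)
  where
  lin : ∀ x x′ e a y b → x′ + e ≡ x → e ≤ 1 → 2 * x′ ≤ a → a + 2 * y ≡ b → 2 * x + 2 * y ≤ b + 2
  lin x x′ e a y b h0 h1 h2 h3 =
    linear 6 (λ x x′ e a y b → (x′ ⊕ e ⊴ x) ∷ (x ⊴ x′ ⊕ e) ∷ (e ⊴ # 1) ∷ (2 ⊗ x′ ⊴ a) ∷ (a ⊕ 2 ⊗ y ⊴ b) ∷ (b ⊴ a ⊕ 2 ⊗ y) ∷ [] , (2 ⊗ x ⊕ 2 ⊗ y ⊴ b ⊕ # 2)) 1 (0 ∷ 2 ∷ 2 ∷ 1 ∷ 1 ∷ 0 ∷ []) x x′ e a y b (≤-reflexive h0) (≤-reflexive (sym h0)) h1 h2 (≤-reflexive h3) (≤-reflexive (sym h3))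

halve : ∀ x {y} → 2 * x ≤ y → x ≤ y / 2
halve x le = ≤-trans (≤-reflexive (trans (sym (m*n/n≡m x 2)) (cong (_/ 2) (*-comm x 2)))) (/-monoˡ-≤ 2 le)

-- Since `6 * 139000 < 836550`, the excess of `m₁` over `2 D` together with `m₂`, `2 m₃` and `2 T`
-- is below `2 D`. Hence every other degree is less than `D`, and `D` drops as soon as `v` loses an
-- edge or is placed.
module Star {N} (σ : State N) {k D T : ℕ} (hyp : Hyp N (suc (suc k))) (G : Good σ (suc (suc k)) D T)
            (v : Fin N) (av : A σ v ≡ true) (d₁v : d₁ σ v ≡ D) (wide : suc (suc k) ≤ D + 139000) where

  open Good G

  n : ℕ
  n = suc (suc k)

  m₁≥ : 2 * D ≤ m₁ σ
  m₁≥ = subst (λ d → 2 * d ≤ m₁ σ) d₁v (degree≤half σ v)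

  small₁ : ∀ x D a b c T n → 2 * x + 2 * D ≤ a + 2 → a + b + 2 * c + 2 * D + 2 * T + 836550 ≤ 6 * n → n ≤ D + 139000 → x + 1 ≤ D
  small₁ = linear 7 (λ x D a b c T n → (2 ⊗ x ⊕ 2 ⊗ D ⊴ a ⊕ # 2) ∷ (a ⊕ b ⊕ 2 ⊗ c ⊕ 2 ⊗ D ⊕ 2 ⊗ T ⊕ # 836550 ⊴ 6 ⊗ n) ∷ (n ⊴ D ⊕ # 139000) ∷ [] , (x ⊕ # 1 ⊴ D)) 2 (1 ∷ 1 ∷ 6 ∷ [])
  small₂ : ∀ x D a b c T n → 2 * x ≤ b → 2 * D ≤ a → a + b + 2 * c + 2 * D + 2 * T + 836550 ≤ 6 * n → n ≤ D + 139000 → x + 1 ≤ D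
  small₂ = linear 7 (λ x D a b c T n → (2 ⊗ x ⊴ b) ∷ (2 ⊗ D ⊴ a) ∷ (a ⊕ b ⊕ 2 ⊗ c ⊕ 2 ⊗ D ⊕ 2 ⊗ T ⊕ # 836550 ⊴ 6 ⊗ n) ∷ (n ⊴ D ⊕ # 139000) ∷ [] , (x ⊕ # 1 ⊴ D)) 2 (1 ∷ 1 ∷ 1 ∷ 6 ∷ [])
  small₃ : ∀ x D a b c T n → x ≤ c → 2 * D ≤ a → a + b + 2 * c + 2 * D + 2 * T + 836550 ≤ 6 * n → n ≤ D + 139000 → x < D
  small₃ = linear 7 (λ x D a b c T n → (x ⊴ c) ∷ (2 ⊗ D ⊴ a) ∷ (a ⊕ b ⊕ 2 ⊗ c ⊕ 2 ⊗ D ⊕ 2 ⊗ T ⊕ # 836550 ⊴ 6 ⊗ n) ∷ (n ⊴ D ⊕ # 139000) ∷ [] , (# 1 ⊕ x ⊴ D)) 2 (2 ∷ 1 ∷ 1 ∷ 6 ∷ [])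
  D-pos : ∀ D a b c T n → 2 * D ≤ a → a + b + 2 * c + 2 * D + 2 * T + 836550 ≤ 6 * n → n ≤ D + 139000 → 1 ≤ D
  D-pos = linear 6 (λ D a b c T n → (2 ⊗ D ⊴ a) ∷ (a ⊕ b ⊕ 2 ⊗ c ⊕ 2 ⊗ D ⊕ 2 ⊗ T ⊕ # 836550 ⊴ 6 ⊗ n) ∷ (n ⊴ D ⊕ # 139000) ∷ [] , (# 1 ⊴ D)) 2 (1 ∷ 1 ∷ 6 ∷ [])
  T-safe : ∀ D a b c T k → 2 * D ≤ a → a + b + 2 * c + 2 * D + 2 * T + 836550 ≤ 6 * (2 + k) → 2 + k ≤ D + 139000 → D + 2 ≤ 2 + k → T + 1 ≤ 1 + k
  T-safe = linear 6 (λ D a b c T k → (2 ⊗ D ⊴ a) ∷ (a ⊕ b ⊕ 2 ⊗ c ⊕ 2 ⊗ D ⊕ 2 ⊗ T ⊕ # 836550 ⊴ 6 ⊗ (# 2 ⊕ k)) ∷ (# 2 ⊕ k ⊴ D ⊕ # 139000) ∷ (D ⊕ # 2 ⊴ # 2 ⊕ k) ∷ [] , (T ⊕ # 1 ⊴ # 1 ⊕ k)) 2 (1 ∷ 1 ∷ 4 ∷ 0 ∷ [])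
  D-safe : ∀ D D′ k → D + 2 ≤ 2 + k → D′ + 1 ≡ D → D′ + 2 ≤ 1 + k
  D-safe D D′ k h0 h1 =
    linear 3 (λ D D′ k → (D ⊕ # 2 ⊴ # 2 ⊕ k) ∷ (D′ ⊕ # 1 ⊴ D) ∷ (D ⊴ D′ ⊕ # 1) ∷ [] , (D′ ⊕ # 2 ⊴ # 1 ⊕ k)) 1 (1 ∷ 1 ∷ 0 ∷ []) D D′ k h0 (≤-reflexive h1) (≤-reflexive (sym h1))

  D-pred : ∃ λ D′ → D′ + 1 ≡ D
  D-pred = let o , e = m≤n⇒∃[o]m+o≡n (D-pos D (m₁ σ) (m₂ σ) (m₃ σ) T n m₁≥ budget wide) in o , trans (+-comm o 1) e

  below : ∀ x → x + 1 ≤ D → x ≤ proj₁ D-pred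
  below x h = +-cancelʳ-≤ 1 x _ (≤-trans h (≤-reflexive (sym (proj₂ D-pred))))

  d₂-below : ∀ y → d₂ σ y ≤ proj₁ D-pred
  d₂-below y = below _ (small₂ (d₂ σ y) D (m₁ σ) (m₂ σ) (m₃ σ) T n (degree≤half (swap σ) y) m₁≥ budget wide)

  d₁-below : ∀ u → u ≢ v → d₁ σ u ≤ proj₁ D-pred
  d₁-below u ne = below _ (small₁ (d₁ σ u) D (m₁ σ) (m₂ σ) (m₃ σ) T n (subst (λ d → 2 * d₁ σ u + 2 * d ≤ m₁ σ + 2) d₁v (other-degrees σ ne)) budget wide)

  -- The drop of `D` pays 2; the edges of G₁ at `u` and of G₃ at `w`, at least two together, pay 4.
  isolated-partner : ∀ w → B σ w ≡ true → d₂ σ w ≡ 0 → ∀ u → A σ u ≡ true → E₃ σ u w ≡ false → 3 ≤ d₁ σ u + d₃ʳ σ w + 1 →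
                     1 ≤ d₁ σ u → d₁ (place u w σ) v ≤ proj₁ D-pred → Packing σ
  isolated-partner w bw d₂w u au nuw drop pos d₁v′ = reduce hyp G u w au bw nuw (proj₁ D-pred) T
    (λ x → left x (x ≟ᶠ v)) (λ y → ≤-trans (d₂-place≤ σ u w y) (d₂-below y))
    (λ x _ → ≤-trans (m+n≤o⇒m≤o _ (d₃ˡ-free x)) (Δ₃ˡ x)) (λ y _ → ≤-trans (m+n≤o⇒m≤o _ (d₃ʳ-free y)) (Δ₃ʳ y))
    (D-safe D _ k D+2≤n (proj₂ D-pred)) (T-safe D (m₁ σ) (m₂ σ) (m₃ σ) T k m₁≥ budget wide D+2≤n)
    (lin (m₁ τ) (m₂ τ) (m₃ τ) (m₁ σ) (m₂ σ) (m₃ σ) (d₁ σ u) (d₃ˡ σ u) (d₃ʳ σ w) D (proj₁ D-pred) T k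
      (m₁-place σ u w) (m₂-place≤ σ u w) (m₃-free nuw) drop pos (proj₂ D-pred) budget)
    where
    τ = place u w σ
    open Free σ u w (inj₂ d₂w)
    lin : ∀ a b c a₀ b₀ c₀ x p q D D′ T k → a + 2 * x ≡ a₀ → b ≤ b₀ → c + (p + q) ≤ c₀ → 3 ≤ x + q + 1 → 1 ≤ x → D′ + 1 ≡ D → a₀ + b₀ + 2 * c₀ + 2 * D + 2 * T + 836550 ≤ 6 * (2 + k) → a + b + 2 * c + 2 * D′ + 2 * T + 836550 ≤ 6 * (1 + k)
    lin a b c a₀ b₀ c₀ x p q D D′ T k h0 h1 h2 h3 h4 h5 h6 =
      linear 13 (λ a b c a₀ b₀ c₀ x p q D D′ T k → (a ⊕ 2 ⊗ x ⊴ a₀) ∷ (a₀ ⊴ a ⊕ 2 ⊗ x) ∷ (b ⊴ b₀) ∷ (c ⊕ (p ⊕ q) ⊴ c₀) ∷ (# 3 ⊴ x ⊕ q ⊕ # 1) ∷ (# 1 ⊴ x) ∷ (D′ ⊕ # 1 ⊴ D) ∷ (D ⊴ D′ ⊕ # 1) ∷ (a₀ ⊕ b₀ ⊕ 2 ⊗ c₀ ⊕ 2 ⊗ D ⊕ 2 ⊗ T ⊕ # 836550 ⊴ 6 ⊗ (# 2 ⊕ k)) ∷ [] , (a ⊕ b ⊕ 2 ⊗ c ⊕ 2 ⊗ D′ ⊕ 2 ⊗ T ⊕ # 836550 ⊴ 6 ⊗ (# 1 ⊕ k))) 1 (1 ∷ 0 ∷ 1 ∷ 2 ∷ 2 ∷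 0 ∷ 2 ∷ 0 ∷ 1 ∷ []) a b c a₀ b₀ c₀ x p q D D′ T k (≤-reflexive h0) (≤-reflexive (sym h0)) h1 h2 h3 h4 (≤-reflexive h5) (≤-reflexive (sym h5)) h6
    left : ∀ x → Dec (x ≡ v) → d₁ τ x ≤ proj₁ D-pred
    left x (yes refl) = d₁v′
    left x (no ne)    = ≤-trans (d₁-place≤ σ u w x) (d₁-below x ne)

  d₁v-large : ∀ D a b c T n k → 2 * D ≤ a → a + b + 2 * c + 2 * D + 2 * T + 836550 ≤ 6 * n → n ≤ D + 139000 → n ≡ 2 + k → 3 ≤ D
  d₁v-large D a b c T n k h0 h1 h2 h3 =
    linear 7 (λ D a b c T n k → (2 ⊗ D ⊴ a) ∷ (a ⊕ b ⊕ 2 ⊗ c ⊕ 2 ⊗ D ⊕ 2 ⊗ T ⊕ # 836550 ⊴ 6 ⊗ n) ∷ (n ⊴ D ⊕ # 139000) ∷ (n ⊴ # 2 ⊕ k) ∷ (# 2 ⊕ k ⊴ n) ∷ [] , (# 3 ⊴ D)) 2 (1 ∷ 1 ∷ 6 ∷ 0 ∷ 0 ∷ []) D a b c T n k h0 h1 h2 (≤-reflexive h3) (≤-reflexive (sym h3))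

  with-isolated : ∀ w → B σ w ≡ true → d₂ σ w ≡ 0 → Packing σ
  with-isolated w bw d₂w with decide (E₃ σ v w)
  ... | inj₂ nvw = isolated-partner w bw d₂w v av nvw
          (≤-trans (subst (3 ≤_) (sym d₁v) big) (≤-trans (m≤m+n _ _) (m≤m+n _ 1))) (≤-trans (s≤s z≤n) (subst (3 ≤_) (sym d₁v) big))
          (≤-trans (≤-reflexive (d₁-place-self σ v w)) z≤n)
    where
    big = d₁v-large D (m₁ σ) (m₂ σ) (m₃ σ) T n k m₁≥ budget wide refl
  -- G₃ forbids `v` on `w`, so a neighbour `a` of `v` goes there and the degree of `v` drops
  -- instead. As `m₃ < D`, some `a` is not joined to `w`; the edge `vw` of G₃ pays as well.
  ... | inj₁ vw =
    let a , va , naw = pick (E₁ σ v) (λ a → 𝟙 (E₃ σ a w)) (subst (d₃ʳ σ w <_) (sym d₁v)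
                         (small₃ (d₃ʳ σ w) D (m₁ σ) (m₂ σ) (m₃ σ) T n (≤-trans (≤∑ (d₃ʳ σ) w) (≤-reflexive (m₃-swap σ))) m₁≥ budget wide))
        pos = 1≤count (E₁ σ a) (trans (sym₁ σ a v) va)
    in isolated-partner w bw d₂w a (on₁ʳ σ v a va) (𝟙≡0 naw)
         (+-monoˡ-≤ 1 (+-mono-≤ pos (1≤count (λ u → E₃ σ u w) vw))) pos
         (below _ (subst₂ (λ b d → d₁ (place a w σ) v + 𝟙 b ≤ d) va d₁v (d₁-place+ σ a w v)))

  -- Here a leaf `w` of G₂ must be made isolated first: its neighbour `y` receives a non-neighbour
  -- `b` of `v`, then `w` receives `v`. A vertex `y` is `good` when G₃ permits both for some `w` and
  -- `b`.
  module Leafy (no-isolated : ∀ y → B σ y ≡ true → 1 ≤ d₂ σ y) where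

    away leaf good : Fin N → Bool
    away b = (A σ b ∧ not (E₁ σ v b)) ∧ not (b == v)
    leaf w = B σ w ∧ (d₂ σ w ≤ᵇ 1)

    leaves leavesᵛ leavesᵍ seen unseen : Fin N → ℕ
    leaves  y = ∑ (λ w → 𝟙 (leaf w) * 𝟙 (E₂ σ y w))
    leavesᵛ y = ∑ (λ w → 𝟙 (leaf w) * 𝟙 (E₃ σ v w) * 𝟙 (E₂ σ y w))
    leavesᵍ y = count (λ w → (leaf w ∧ not (E₃ σ v w)) ∧ E₂ σ y w)
    seen    y = count (λ b → away b ∧ E₃ σ b y)
    unseen  y = count (λ b → away b ∧ not (E₃ σ b y))
    good y = (1 ≤ᵇ leavesᵍ y) ∧ (1 ≤ᵇ unseen y)

    d₂-leaf : ∀ w → leaf w ≡ true → d₂ σ w ≡ 1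
    d₂-leaf w h = ≤-antisym (≤ᵇ-true⁻ (∧-elimʳ {B σ w} h)) (no-isolated w (∧-elimˡ h))

    split-leaves : ∀ y → leaves y ≡ leavesᵍ y + leavesᵛ y
    split-leaves y = trans (∑-cong (λ w → pt (leaf w) (E₃ σ v w) (E₂ σ y w))) (∑-+ _ _)
      where
      pt : ∀ l e f → 𝟙 l * 𝟙 f ≡ 𝟙 ((l ∧ not e) ∧ f) + 𝟙 l * 𝟙 e * 𝟙 f
      pt false e f = refl
      pt true true f = refl
      pt true false f = refl

    split-away : ∀ y → unseen y + seen y ≡ count away
    split-away y = trans (sym (∑-+ _ _)) (∑-cong (λ b → pt (away b) (E₃ σ b y)))
      where
      pt : ∀ a e → 𝟙 (a ∧ not e) + 𝟙 (a ∧ e) ≡ 𝟙 a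
      pt false e = refl
      pt true true = refl
      pt true false = refl

    -- A spanning star does not pack with a graph without isolated vertices, so `D + 2 ≤ n` is
    -- decisive here.
    away-nonempty : 1 ≤ count away
    away-nonempty = lin (count away) (count (λ b → A σ b ∧ not (E₁ σ v b))) (d₁ σ v) D k (𝟙 (A σ v ∧ not (E₁ σ v v)))
      (count-∖ (λ b → A σ b ∧ not (E₁ σ v b)) v) (trans (count-off (A σ) (E₁ σ v) (on₁ʳ σ v)) #A) d₁v (𝟙≤1 (A σ v ∧ not (E₁ σ v v))) D+2≤n
      where
      lin : ∀ x y z D k e → x + e ≡ y → y + z ≡ 2 + k → z ≡ D → e ≤ 1 → D + 2 ≤ 2 + k → 1 ≤ x
      lin x y z D k e h0 h1 h2 h3 h4 =
        linear 6 (λ x y z D k e → (x ⊕ e ⊴ y) ∷ (y ⊴ x ⊕ e) ∷ (y ⊕ z ⊴ # 2 ⊕ k) ∷ (# 2 ⊕ k ⊴ y ⊕ z) ∷ (z ⊴ D) ∷ (D ⊴ z) ∷ (e ⊴ # 1) ∷ (D ⊕ # 2 ⊴ # 2 ⊕ k) ∷ [] , (# 1 ⊴ x)) 1 (0 ∷ 1 ∷ 0 ∷ 1 ∷ 1 ∷ 0 ∷ 1 ∷ 1 ∷ []) x y z D k e (≤-reflexive h0) (≤-reflexive (sym h0)) (≤-reflexive h1) (≤-reflexive (sym h1)) (≤-reflexive h2) (≤-reflexive (sym h2)) h3 h4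

    -- If `y` has a leaf but is not good, then G₃ joins `v` to a leaf at `y` or some vertex of
    -- `away` to `y`. One such unit, taken twice, covers the gap between `d₂ σ y` and `d₂ σ y ∸ 2`.
    bound : ∀ y → leaves y ≤ (d₂ σ y ∸ 2) + 2 * (𝟙 (good y) + leavesᵛ y + seen y)
    bound y with zero-or-positive (leavesᵛ y) | zero-or-positive (seen y) | zero-or-positive (leaves y)
    ... | _ | _ | inj₁ z rewrite z = z≤n
    ... | inj₂ p | _ | _ = lin (leaves y) (d₂ σ y) (d₂ σ y ∸ 2) (𝟙 (good y)) (leavesᵛ y) (seen y) leaves≤ (m≤n+m∸n (d₂ σ y) 2) (≤-trans p (≤-trans (m≤n+m (leavesᵛ y) (𝟙 (good y))) (m≤m+n _ (seen y))))
      where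
      lin : ∀ l d d′ g a b → l ≤ d → d ≤ 2 + d′ → 1 ≤ g + a + b → l ≤ d′ + 2 * (g + a + b)
      lin = linear 6 (λ l d d′ g a b → (l ⊴ d) ∷ (d ⊴ # 2 ⊕ d′) ∷ (# 1 ⊴ g ⊕ a ⊕ b) ∷ [] , (l ⊴ d′ ⊕ 2 ⊗ (g ⊕ a ⊕ b))) 1 (1 ∷ 1 ∷ 2 ∷ [])
      leaves≤ : leaves y ≤ d₂ σ y
      leaves≤ = ∑-mono (λ w → 𝟙*-bound (leaf w) (λ _ → ≤-refl))
    ... | inj₁ _ | inj₂ p | _ = lin (leaves y) (d₂ σ y) (d₂ σ y ∸ 2) (𝟙 (good y)) (leavesᵛ y) (seen y) leaves≤ (m≤n+m∸n (d₂ σ y) 2) (≤-trans p (m≤n+m (seen y) (𝟙 (good y) + leavesᵛ y)))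
      where
      lin : ∀ l d d′ g a b → l ≤ d → d ≤ 2 + d′ → 1 ≤ g + a + b → l ≤ d′ + 2 * (g + a + b)
      lin = linear 6 (λ l d d′ g a b → (l ⊴ d) ∷ (d ⊴ # 2 ⊕ d′) ∷ (# 1 ⊴ g ⊕ a ⊕ b) ∷ [] , (l ⊴ d′ ⊕ 2 ⊗ (g ⊕ a ⊕ b))) 1 (1 ∷ 1 ∷ 2 ∷ [])
      leaves≤ : leaves y ≤ d₂ σ y
      leaves≤ = ∑-mono (λ w → 𝟙*-bound (leaf w) (λ _ → ≤-refl))
    ... | inj₁ z | inj₁ z′ | inj₂ p = lin (leaves y) (d₂ σ y) (d₂ σ y ∸ 2) (𝟙 (good y)) (leavesᵛ y) (seen y) leaves≤ (m≤n+m∸n (d₂ σ y) 2)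
        (≤-trans (≤-reflexive (sym (𝟙-true is-good))) (≤-trans (m≤m+n _ _) (m≤m+n _ _)))
      where
      lin : ∀ l d d′ g a b → l ≤ d → d ≤ 2 + d′ → 1 ≤ g + a + b → l ≤ d′ + 2 * (g + a + b)
      lin = linear 6 (λ l d d′ g a b → (l ⊴ d) ∷ (d ⊴ # 2 ⊕ d′) ∷ (# 1 ⊴ g ⊕ a ⊕ b) ∷ [] , (l ⊴ d′ ⊕ 2 ⊗ (g ⊕ a ⊕ b))) 1 (1 ∷ 1 ∷ 2 ∷ [])
      leaves≤ : leaves y ≤ d₂ σ y
      leaves≤ = ∑-mono (λ w → 𝟙*-bound (leaf w) (λ _ → ≤-refl))
      is-good : good y ≡ true
      is-good = ∧-intro (≤ᵇ-true (subst (1 ≤_) (trans (split-leaves y) (trans (cong (leavesᵍ y +_) z) (+-identityʳ _))) p))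
                        (≤ᵇ-true (subst (1 ≤_) (sym (trans (sym (trans (cong (unseen y +_) z′) (+-identityʳ _))) (split-away y))) away-nonempty))

    reverse-edges : (p : Fin N → ℕ) → ∑ (λ y → ∑ (λ w → p w * 𝟙 (E₂ σ y w))) ≡ ∑ (λ w → p w * d₂ σ w)
    reverse-edges p = trans (∑-swap (λ y w → p w * 𝟙 (E₂ σ y w))) (∑-cong λ w → trans (∑-* (p w) _) (cong (p w *_) (∑-cong λ y → cong 𝟙 (sym₂ σ y w))))

    -- All degrees are positive, so a degree is 2, less 1 at a leaf, plus its excess over 2. The sum
    -- of `leaves` counts each leaf at its only neighbour.
    leaves-total : 2 * n + ∑ (λ y → d₂ σ y ∸ 2) ≤ m₂ σ + ∑ leaves
    leaves-total = begin
      2 * n + ∑ (λ y → d₂ σ y ∸ 2)                     ≡⟨ cong (_+ ∑ (λ y → d₂ σ y ∸ 2)) (trans (cong (2 *_) (sym #B)) (sym (∑-* 2 _))) ⟩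
      ∑ (λ w → 2 * 𝟙 (B σ w)) + ∑ (λ y → d₂ σ y ∸ 2)   ≡⟨ sym (∑-+ _ (λ y → d₂ σ y ∸ 2)) ⟩
      ∑ (λ w → 2 * 𝟙 (B σ w) + (d₂ σ w ∸ 2))           ≤⟨ ∑-mono pt ⟩
      ∑ (λ w → d₂ σ w + 𝟙 (leaf w) * d₂ σ w)           ≡⟨ ∑-+ (d₂ σ) _ ⟩
      m₂ σ + ∑ (λ w → 𝟙 (leaf w) * d₂ σ w)             ≡⟨ cong (m₂ σ +_) (sym (reverse-edges (λ w → 𝟙 (leaf w)))) ⟩
      m₂ σ + ∑ leaves                                  ∎
      where
      open ≤-Reasoning
      num : ∀ b d → (b ≡ true → 1 ≤ d) → 2 * 𝟙 b + (d ∸ 2) ≤ d + 𝟙 (b ∧ (d ≤ᵇ 1)) * d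
      num false d h = ≤-trans (m∸n≤m d 2) (m≤m+n d _)
      num true zero h with () ← h refl
      num true (suc zero) h = ≤-refl
      num true (suc (suc d)) h = m≤m+n _ _
      pt : ∀ w → 2 * 𝟙 (B σ w) + (d₂ σ w ∸ 2) ≤ d₂ σ w + 𝟙 (leaf w) * d₂ σ w
      pt w = num (B σ w) (d₂ σ w) (no-isolated w)

    ∑leavesᵛ : ∑ leavesᵛ ≤ d₃ˡ σ v
    ∑leavesᵛ = ≤-trans (≤-reflexive (reverse-edges (λ w → 𝟙 (leaf w) * 𝟙 (E₃ σ v w)))) (∑-mono pt)
      where
      pt : ∀ w → 𝟙 (leaf w) * 𝟙 (E₃ σ v w) * d₂ σ w ≤ 𝟙 (E₃ σ v w)
      pt w with decide (leaf w)
      ... | inj₁ t = ≤-reflexive (trans (cong₂ (λ l d → 𝟙 l * 𝟙 (E₃ σ v w) * d) t (d₂-leaf w t)) (trans (*-identityʳ _) (+-identityʳ _)))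
      ... | inj₂ f = ≤-trans (≤-reflexive (cong (λ l → 𝟙 l * 𝟙 (E₃ σ v w) * d₂ σ w) f)) z≤n

    ∑seen : ∑ seen + d₃ˡ σ v ≤ m₃ σ
    ∑seen = ≤-trans (+-monoˡ-≤ _ (≤-reflexive (∑-swap (λ y b → 𝟙 (away b ∧ E₃ σ b y)))))
      (≤-trans (∑-excess (d₃ˡ σ) (λ b → count (λ y → away b ∧ E₃ σ b y)) v (λ b → count-mono λ y h → ∧-elimʳ {away b} h))
               (≤-reflexive (trans (cong (m₃ σ +_) (∑-0 λ y → cong 𝟙 (¬true⇒false λ h → ==-false⇒≢ {x = v} {v} (not-elim (∧-elimʳ {A σ v ∧ not (E₁ σ v v)} (∧-elimˡ {away v} h))) refl))) (+-identityʳ _))))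

    #good : 2 * n ≤ m₂ σ + 2 * count good + 2 * m₃ σ
    #good = lin n (∑ (λ y → d₂ σ y ∸ 2)) (m₂ σ) (∑ leaves) (count good) (∑ leavesᵛ) (∑ seen) (d₃ˡ σ v) (m₃ σ) leaves-total
      (≤-trans (∑-mono bound) (≤-reflexive (trans (∑-+ (λ y → d₂ σ y ∸ 2) _) (cong (∑ (λ y → d₂ σ y ∸ 2) +_)
        (trans (∑-* 2 (λ y → 𝟙 (good y) + leavesᵛ y + seen y)) (cong (2 *_) (trans (∑-+ (λ y → 𝟙 (good y) + leavesᵛ y) seen) (cong (_+ ∑ seen) (∑-+ (λ y → 𝟙 (good y)) leavesᵛ)))))))))
      ∑leavesᵛ ∑seen
      where
      lin : ∀ n s b l g x y z c → 2 * n + s ≤ b + l → l ≤ s + 2 * (g + x + y) → x ≤ z → y + z ≤ c → 2 * n ≤ b + 2 * g + 2 * c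
      lin = linear 9 (λ n s b l g x y z c → (2 ⊗ n ⊕ s ⊴ b ⊕ l) ∷ (l ⊴ s ⊕ 2 ⊗ (g ⊕ x ⊕ y)) ∷ (x ⊴ z) ∷ (y ⊕ z ⊴ c) ∷ [] , (2 ⊗ n ⊴ b ⊕ 2 ⊗ g ⊕ 2 ⊗ c)) 1 (1 ∷ 1 ∷ 2 ∷ 2 ∷ [])

    good-pos : ∀ g D a b c T n → 2 * n ≤ b + 2 * g + 2 * c → a + b + 2 * c + 2 * D + 2 * T + 836550 ≤ 6 * n → n ≤ D + 139000 → 2 * D ≤ a → 0 < g
    good-pos = linear 7 (λ g D a b c T n → (2 ⊗ n ⊴ b ⊕ 2 ⊗ g ⊕ 2 ⊗ c) ∷ (a ⊕ b ⊕ 2 ⊗ c ⊕ 2 ⊗ D ⊕ 2 ⊗ T ⊕ # 836550 ⊴ 6 ⊗ n) ∷ (n ⊴ D ⊕ # 139000) ∷ (2 ⊗ D ⊴ a) ∷ [] , (# 1 ⊕ # 0 ⊴ g)) 2 (1 ∷ 1 ∷ 4 ∷ 1 ∷ [])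
    good-many : ∀ x g D a b c T n → 2 * x + 2 * D ≤ a → 2 * n ≤ b + 2 * g + 2 * c → a + b + 2 * c + 2 * D + 2 * T + 836550 ≤ 6 * n → n ≤ D + 139000 → x ≤ g
    good-many = linear 8 (λ x g D a b c T n → (2 ⊗ x ⊕ 2 ⊗ D ⊴ a) ∷ (2 ⊗ n ⊴ b ⊕ 2 ⊗ g ⊕ 2 ⊗ c) ∷ (a ⊕ b ⊕ 2 ⊗ c ⊕ 2 ⊗ D ⊕ 2 ⊗ T ⊕ # 836550 ⊴ 6 ⊗ n) ∷ (n ⊴ D ⊕ # 139000) ∷ [] , (x ⊴ g)) 2 (1 ∷ 1 ∷ 1 ∷ 4 ∷ [])

    surplus : ∑ (λ y → d₂ σ y ∸ 1) + n ≤ m₂ σ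
    surplus = ≤-trans (≤-reflexive (trans (cong (∑ (λ y → d₂ σ y ∸ 1) +_) (sym #B)) (sym (∑-+ (λ y → d₂ σ y ∸ 1) _)))) (∑-mono λ y → num (B σ y) (d₂ σ y) (no-isolated y))
      where
      num : ∀ b d → (b ≡ true → 1 ≤ d) → (d ∸ 1) + 𝟙 b ≤ d
      num false d h = ≤-trans (≤-reflexive (+-identityʳ _)) (m∸n≤m d 1)
      num true zero h with () ← h refl
      num true (suc d) h = ≤-reflexive (+-comm d 1)

    module Finish (y w b : Fin N) (yw : E₂ σ y w ≡ true) (d₂w : d₂ σ w ≡ 1) (nvw : E₃ σ v w ≡ false)
                  (ab : A σ b ≡ true) (b≢v : b ≢ v) (nvb : E₁ σ v b ≡ false) (nby : E₃ σ b y ≡ false)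
                  (least : (d₂ σ y ∸ 1) * count good ≤ ∑ (λ y → d₂ σ y ∸ 1)) where

      by : B σ y ≡ true
      by = on₂ σ y w yw

      σ₁ = place b y σ
      σ₂ = place v w σ₁
      d g : ℕ
      d = d₁ σ b
      g = d₂ σ y

      d₁v₁ : d₁ σ₁ v ≡ D
      d₁v₁ = trans (trans (sym (+-identityʳ _)) (trans (cong (λ z → d₁ σ₁ v + 𝟙 z) (sym nvb)) (d₁-place σ b y v (b≢v ∘ sym)))) d₁v
      d₂w₁ : d₂ σ₁ w ≡ 0
      d₂w₁ = +-cancelʳ-≡ 1 _ 0 (trans (cong (λ z → d₂ σ₁ w + 𝟙 z) (sym (trans (sym₂ σ w y) yw))) (trans (d₂-place σ b y w (adjacent₂ σ yw ∘ sym)) d₂w))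
      nvw₁ : E₃ σ₁ v w ≡ false
      nvw₁ = E₃-place-false σ b y nvw (λ h _ → true≢false h nvb)

      open Free σ₁ v w (inj₂ d₂w₁)

      -- No degree exceeds half of its degree sum. This crude bound is affordable because `m₁` has
      -- lost the `2 D` of `v`.
      D′ T′ : ℕ
      D′ = (m₁ σ₂ + m₂ σ₂) / 2
      T′ = T + d + g

      product : d * g ≤ d + d * (g ∸ 1)
      product = ≤-trans (*-monoʳ-≤ d (m≤n+m∸n g 1)) (≤-reflexive (*-suc d (g ∸ 1)))

      -- `y` minimises `d₂ σ y ∸ 1` over the good vertices, and there are at least `d` of them. So
      -- the edges created beyond `d` are bounded by the sum of all `d₂ σ y ∸ 1`, which is at most
      -- `m₂ - n`.
      cheap : d * (g ∸ 1) ≤ ∑ (λ y → d₂ σ y ∸ 1)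
      cheap = ≤-trans (*-monoˡ-≤ (g ∸ 1) (good-many d (count good) D (m₁ σ) (m₂ σ) (m₃ σ) T n
                  (subst (λ z → 2 * d + 2 * z ≤ m₁ σ) d₁v (nonadjacent-degrees σ b≢v nvb)) #good budget wide))
                (≤-trans (≤-reflexive (*-comm (count good) (g ∸ 1))) least)

      m₁₂ : m₁ σ₂ + 2 * D + 2 * d ≡ m₁ σ
      m₁₂ = trans (cong (λ z → m₁ σ₂ + 2 * z + 2 * d) (sym d₁v₁)) (trans (cong (_+ 2 * d) (m₁-place σ₁ v w)) (m₁-place σ b y))
      m₂₂ : m₂ σ₂ + 2 * g ≤ m₂ σ
      m₂₂ = ≤-trans (+-monoˡ-≤ _ (m₂-place≤ σ₁ v w)) (≤-reflexive (m₂-place σ b y))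
      m₃₂ : m₃ σ₂ ≤ m₃ σ + d * g
      m₃₂ = ≤-trans (m+n≤o⇒m≤o _ (m₃-free nvw₁)) (m+n≤o⇒m≤o _ (m₃-place σ b y nby))

      half≤ : 2 * D′ ≤ m₁ σ₂ + m₂ σ₂
      half≤ = ≤-trans (≤-reflexive (*-comm 2 D′)) (m/n*n≤m _ 2)

      D-safe′ : ∀ D′ a₂ b₂ a b c d g D T k → 2 * D′ ≤ a₂ + b₂ → a₂ + 2 * D + 2 * d ≡ a → b₂ + 2 * g ≤ b → a + b + 2 * c + 2 * D + 2 * T + 836550 ≤ 6 * (2 + k) → 2 + k ≤ D + 139000 → D + 2 ≤ 2 + k → D′ + 2 ≤ k
      D-safe′ D′ a₂ b₂ a b c d g D T k h0 h1 h2 h3 h4 h5 =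
        linear 11 (λ D′ a₂ b₂ a b c d g D T k → (2 ⊗ D′ ⊴ a₂ ⊕ b₂) ∷ (a₂ ⊕ 2 ⊗ D ⊕ 2 ⊗ d ⊴ a) ∷ (a ⊴ a₂ ⊕ 2 ⊗ D ⊕ 2 ⊗ d) ∷ (b₂ ⊕ 2 ⊗ g ⊴ b) ∷ (a ⊕ b ⊕ 2 ⊗ c ⊕ 2 ⊗ D ⊕ 2 ⊗ T ⊕ # 836550 ⊴ 6 ⊗ (# 2 ⊕ k)) ∷ (# 2 ⊕ k ⊴ D ⊕ # 139000) ∷ (D ⊕ # 2 ⊴ # 2 ⊕ k) ∷ [] , (D′ ⊕ # 2 ⊴ k)) 2 (1 ∷ 1 ∷ 0 ∷ 1 ∷ 1 ∷ 4 ∷ 0 ∷ []) D′ a₂ b₂ a b c d g D T k h0 (≤-reflexive h1) (≤-reflexive (sym h1)) h2 h3 h4 h5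
      T-safe′ : ∀ a₂ b₂ a b c d g D T k → a₂ + 2 * D + 2 * d ≡ a → b₂ + 2 * g ≤ b → a + b + 2 * c + 2 * D + 2 * T + 836550 ≤ 6 * (2 + k) → 2 + k ≤ D + 139000 → D + 2 ≤ 2 + k → T + d + g + 1 ≤ k
      T-safe′ a₂ b₂ a b c d g D T k h0 h1 h2 h3 h4 =
        linear 10 (λ a₂ b₂ a b c d g D T k → (a₂ ⊕ 2 ⊗ D ⊕ 2 ⊗ d ⊴ a) ∷ (a ⊴ a₂ ⊕ 2 ⊗ D ⊕ 2 ⊗ d) ∷ (b₂ ⊕ 2 ⊗ g ⊴ b) ∷ (a ⊕ b ⊕ 2 ⊗ c ⊕ 2 ⊗ D ⊕ 2 ⊗ T ⊕ # 836550 ⊴ 6 ⊗ (# 2 ⊕ k)) ∷ (# 2 ⊕ k ⊴ D ⊕ # 139000) ∷ (D ⊕ # 2 ⊴ # 2 ⊕ k) ∷ [] , (T ⊕ d ⊕ g ⊕ # 1 ⊴ k)) 2 (1 ∷ 0 ∷ 1 ∷ 1 ∷ 4 ∷ 0 ∷ []) a₂ b₂ a b c d g D T k (≤-reflexive h0) (≤-reflexive (sym h0)) h1 h2 h3 h4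
      budget′ : ∀ D′ a₂ b₂ c₂ a b c d g D T k z p s → 2 * D′ ≤ a₂ + b₂ → a₂ + 2 * D + 2 * d ≡ a → b₂ + 2 * g ≤ b → c₂ ≤ c + p → p ≤ d + z → z ≤ s → s + (2 + k) ≤ b → a + b + 2 * c + 2 * D + 2 * T + 836550 ≤ 6 * (2 + k) → 2 + k ≤ D + 139000 → a₂ + b₂ + 2 * c₂ + 2 * D′ + 2 * (T + d + g) + 836550 ≤ 6 * k
      budget′ D′ a₂ b₂ c₂ a b c d g D T k z p s h0 h1 h2 h3 h4 h5 h6 h7 h8 =
        linear 15 (λ D′ a₂ b₂ c₂ a b c d g D T k z p s → (2 ⊗ D′ ⊴ a₂ ⊕ b₂) ∷ (a₂ ⊕ 2 ⊗ D ⊕ 2 ⊗ d ⊴ a) ∷ (a ⊴ a₂ ⊕ 2 ⊗ D ⊕ 2 ⊗ d) ∷ (b₂ ⊕ 2 ⊗ g ⊴ b) ∷ (c₂ ⊴ c ⊕ p) ∷ (p ⊴ d ⊕ z) ∷ (z ⊴ s) ∷ (s ⊕ (# 2 ⊕ k) ⊴ b) ∷ (a ⊕ b ⊕ 2 ⊗ c ⊕ 2 ⊗ D ⊕ 2 ⊗ T ⊕ # 836550 ⊴ 6 ⊗ (# 2 ⊕ k)) ∷ (# 2 ⊕ k ⊴ D ⊕ # 139000) ∷ [] , (a₂ ⊕ b₂ ⊕ 2 ⊗ c₂ ⊕ 2 ⊗ D′ ⊕ 2 ⊗ (T ⊕ d ⊕ g) ⊕ # 836550 ⊴ 6 ⊗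 k)) 1 (1 ∷ 4 ∷ 0 ∷ 2 ∷ 2 ∷ 2 ∷ 2 ∷ 2 ∷ 4 ∷ 16 ∷ []) D′ a₂ b₂ c₂ a b c d g D T k z p s h0 (≤-reflexive h1) (≤-reflexive (sym h1)) h2 h3 h4 h5 h6 h7 h8

      packing : Packing σ
      packing = place-packing σ b y ab by nby (place-packing σ₁ v w av₁ bw₁ nvw₁ (hyp σ₂ k D′ T′ (n≤1+n _) (record
        { #A = count-place (A σ₁) v av₁ (count-place (A σ) b ab #A) ; #B = count-place (B σ₁) w bw₁ (count-place (B σ) y by #B)
        ; bounded = record
          { Δ₁ = λ u → halve _ (≤-trans (degree≤half σ₂ u) (m≤m+n _ _))
          ; Δ₂ = λ u → halve _ (≤-trans (degree≤half (swap σ₂) u) (m≤n+m (m₂ σ₂) (m₁ σ₂)))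
          ; Δ₃ˡ = λ u → ≤-trans (m+n≤o⇒m≤o _ (d₃ˡ-free u)) (≤-trans (m+n≤o⇒m≤o _ (d₃ˡ-place σ b y u)) (≤-trans (+-mono-≤ (Δ₃ˡ u) (𝟙*-bound (E₁ σ u b) (λ _ → ≤-refl))) (+-monoˡ-≤ g (m≤m+n T d))))
          ; Δ₃ʳ = λ u → ≤-trans (m+n≤o⇒m≤o _ (d₃ʳ-free u)) (≤-trans (m+n≤o⇒m≤o _ (d₃ʳ-place σ b y u)) (≤-trans (+-mono-≤ (Δ₃ʳ u) (𝟙*-bound (E₂ σ u y) (λ _ → ≤-refl))) (m≤m+n _ g))) }
        ; D+2≤n = D-safe′ D′ (m₁ σ₂) (m₂ σ₂) (m₁ σ) (m₂ σ) (m₃ σ) d g D T k half≤ m₁₂ m₂₂ budget wide D+2≤n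
        ; T+1≤n = T-safe′ (m₁ σ₂) (m₂ σ₂) (m₁ σ) (m₂ σ) (m₃ σ) d g D T k m₁₂ m₂₂ budget wide D+2≤n
        ; budget = budget′ D′ (m₁ σ₂) (m₂ σ₂) (m₃ σ₂) (m₁ σ) (m₂ σ) (m₃ σ) d g D T k (d * (g ∸ 1)) (d * g) (∑ (λ y → d₂ σ y ∸ 1)) half≤ m₁₂ m₂₂ m₃₂ product cheap surplus budget wide })))
        where
        av₁ : A σ₁ v ≡ true
        av₁ = ∖-intro {p = A σ} av (b≢v ∘ sym)
        bw₁ : B σ₁ w ≡ true
        bw₁ = ∖-intro {p = B σ} (on₂ σ w y (trans (sym₂ σ w y) yw)) (adjacent₂ σ yw ∘ sym)

    leafy-packing : Packing σ
    leafy-packing =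
      let y , gy , least = below-average good (λ y → d₂ σ y ∸ 1) (nonempty good (good-pos (count good) D (m₁ σ) (m₂ σ) (m₃ σ) T n #good budget wide m₁≥))
          w , hw = nonempty (λ w → (leaf w ∧ not (E₃ σ v w)) ∧ E₂ σ y w) (≤ᵇ-true⁻ {1} {leavesᵍ y} (∧-elimˡ gy))
          b , hb = nonempty (λ b → away b ∧ not (E₃ σ b y)) (≤ᵇ-true⁻ {1} {unseen y} (∧-elimʳ {1 ≤ᵇ leavesᵍ y} gy))
          hl = ∧-elimˡ {leaf w ∧ not (E₃ σ v w)} hw
          hn = ∧-elimˡ {away b} hb
          hm = ∧-elimˡ {A σ b ∧ not (E₁ σ v b)} hn
      in Finish.packing y w b (∧-elimʳ {leaf w ∧ not (E₃ σ v w)} hw) (d₂-leaf w (∧-elimˡ {leaf w} hl)) (not-elim (∧-elimʳ {leaf w} hl))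
           (∧-elimˡ {A σ b} hm) (==-false⇒≢ (not-elim (∧-elimʳ {A σ b ∧ not (E₁ σ v b)} hn))) (not-elim (∧-elimʳ {A σ b} hm))
           (not-elim (∧-elimʳ {away b} hb)) least

  packing : Packing σ
  packing with search (λ w → isolated (B σ) (d₂ σ) w)
  ... | inj₁ (w , h) = with-isolated w (isolated-∈ {A = B σ} {d₂ σ} h) (isolated-0 {A = B σ} {d₂ σ} h)
  ... | inj₂ none    = Leafy.leafy-packing λ y by → [ (λ z → ⊥-elim (true≢false (isolated-intro {A = B σ} {d₂ σ} by z) (none y))) , id ]′ (zero-or-positive (d₂ σ y))

-- Placing several cheap pairs

length-filter : ∀ {N} {X : Set} {P : X → Set} (P? : Decidable P) (f : Fin N → X) →
                length (filter P? (tabulate f)) ≡ ∑ (λ x → 𝟙 (does (P? (f x))))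
length-filter {zero}  P? f = sym (∑-zero _)
length-filter {suc N} P? f with P? (f zero) in eq
... | yes _ = trans (cong suc (length-filter P? (f ∘ suc))) (trans (cong (λ d → 𝟙 (does d) + ∑ (λ x → 𝟙 (does (P? (f (suc x)))))) (sym eq)) (sym (∑-suc _)))
... | no _  = trans (length-filter P? (f ∘ suc)) (trans (cong (λ d → 𝟙 (does d) + ∑ (λ x → 𝟙 (does (P? (f (suc x)))))) (sym eq)) (sym (∑-suc _)))

elements : ∀ {N} → (Fin N → Bool) → List (Fin N)
elements {N} p = filter (λ x → p x Bool.≟ true) (allFin N)

elements⁺ : ∀ {N} (p : Fin N → Bool) {x} → p x ≡ true → x ∈ elements p
elements⁺ p {x} h = ∈-filter⁺ (λ x → p x Bool.≟ true) (∈-allFin x) h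

elements⁻ : ∀ {N} (p : Fin N → Bool) {x} → x ∈ elements p → p x ≡ true
elements⁻ {N} p h = proj₂ (∈-filter⁻ (λ x → p x Bool.≟ true) {xs = allFin N} h)

elements-unique : ∀ {N} (p : Fin N → Bool) → Unique (elements p)
elements-unique {N} p = Unique.filter⁺ (λ x → p x Bool.≟ true) (Unique.allFin⁺ N)

elements-length : ∀ {N} (p : Fin N → Bool) → length (elements p) ≡ count p
elements-length p = trans (length-filter (λ x → p x Bool.≟ true) id) (∑-cong λ x → cong 𝟙 (pt (p x)))
  where
  pt : ∀ b → does (b Bool.≟ true) ≡ b
  pt true  = refl
  pt false = refl

-- Greedy choice: a chosen partner bars itself and its at most 600 neighbours, hence 601 per element
-- of `ys`. `φ` is positive on everything barred so far, and `S` bounds its sum.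
choose-partners : ∀ {N} (E cand : Fin N → Fin N → Bool) → (∀ y b → cand y b ≡ true → count (E b) ≤ 600) →
                  ∀ ys (φ : Fin N → ℕ) S → ∑ φ ≤ S → All (λ y → S + 601 * length ys ≤ count (cand y)) ys →
                  ∃ λ L → map proj₂ L ≡ ys × All (λ p → cand (proj₂ p) (proj₁ p) ≡ true × φ (proj₁ p) ≡ 0) L ×
                          AllPairs (λ p q → proj₁ p ≢ proj₁ q × E (proj₁ p) (proj₁ q) ≡ false) L
choose-partners E cand low [] φ S ∑φ _ = [] , refl , [] , []
choose-partners E cand low (y ∷ ys) φ S ∑φ (many ∷ manys) =
  let b , cb , φb = pick (cand y) φ (first S (length ys) (∑ φ) _ ∑φ many)
      φ′ = λ x → φ x + (𝟙 (x == b) + 𝟙 (E b x))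
      L , eq , good , apart = choose-partners E cand low ys φ′ (S + 601)
        (∑-+≤ ∑φ (∑-+≤ {f = λ x → 𝟙 (x == b)} (≤-reflexive (count-point b)) (low y b cb)))
        (All.map (λ {z} h → ≤-trans (≤-reflexive (shift S (length ys))) h) manys)
  in (b , y) ∷ L , cong (y ∷_) eq
   , (cb , φb) ∷ All.map (λ {p} (c , z) → c , proj₁ (zero₂ (φ (proj₁ p)) _ z)) good
   , All.map (λ {p} (_ , z) → let e , f = zero₂ (𝟙 (proj₁ p == b)) _ (proj₂ (zero₂ (φ (proj₁ p)) _ z)) in
                              ==-false⇒≢ (𝟙≡0 e) ∘ sym , 𝟙≡0 f) good ∷ apart
  where
  first : ∀ S l s c → s ≤ S → S + 601 * (1 + l) ≤ c → s < c
  first = linear 4 (λ S l s c → (s ⊴ S) ∷ (S ⊕ 601 ⊗ (# 1 ⊕ l) ⊴ c) ∷ [] , (# 1 ⊕ s ⊴ c)) 1 (1 ∷ 1 ∷ [])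
  shift : ∀ S l → S + 601 + 601 * l ≡ S + 601 * suc l
  shift S l = trans (+-assoc S 601 _) (cong (S +_) (sym (*-suc 601 l)))

Pairs : ℕ → Set
Pairs N = List (Fin N × Fin N)

Avoidˡ Avoidʳ : ∀ {N} → Pairs N → Fin N → Set
Avoidˡ L u = All (λ p → proj₁ p ≢ u) L
Avoidʳ L y = All (λ p → proj₂ p ≢ y) L

-- Placing one of the pairs neither removes a vertex of the other nor forbids the other in G₃.
Compatible : ∀ {N} → State N → Fin N × Fin N → Fin N × Fin N → Set
Compatible σ p q = proj₁ p ≢ proj₁ q × proj₂ p ≢ proj₂ q × (E₁ σ (proj₁ p) (proj₁ q) ≡ true → E₂ σ (proj₂ p) (proj₂ q) ≡ true → ⊥)

record Cheap {N} (σ : State N) (κ : ℕ) (p : Fin N × Fin N) : Set where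
  constructor cheap
  field
    fst∈ : A σ (proj₁ p) ≡ true
    snd∈ : B σ (proj₂ p) ≡ true
    free : E₃ σ (proj₁ p) (proj₂ p) ≡ false
    cost : d₁ σ (proj₁ p) * d₂ σ (proj₂ p) ≤ κ

placeAll : ∀ {N} → Pairs N → State N → State N
placeAll []            σ = σ
placeAll ((b , y) ∷ L) σ = placeAll L (place b y σ)

total : ∀ {N} → State N → ℕ
total σ = m₁ σ + m₂ σ + 2 * m₃ σ

-- All that is used later about a sequence of placements of cost at most `κ` each. `light` is
-- sharper for left vertices of degree at most 1: such a pair adds at most `d₂` edges to G₃, and
-- `m₂` drops by `2 * d₂`, so `total` does not grow.
record After {N} (κ : ℕ) (σ : State N) (L : Pairs N) (τ : State N) : Set where
  field
    unplace : Packing τ → Packing σ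
    sizeˡ   : ∀ {n} → count (A σ) ≡ length L + n → count (A τ) ≡ n
    sizeʳ   : ∀ {n} → count (B σ) ≡ length L + n → count (B τ) ≡ n
    keepˡ   : ∀ {u} → A σ u ≡ true → Avoidˡ L u → A τ u ≡ true
    keepʳ   : ∀ {y} → B σ y ≡ true → Avoidʳ L y → B τ y ≡ true
    d₁≤     : ∀ u → d₁ τ u ≤ d₁ σ u
    d₂≤     : ∀ y → d₂ τ y ≤ d₂ σ y
    d₁≥     : ∀ {u} → Avoidˡ L u → d₁ σ u ≤ d₁ τ u + length L
    d₂≥     : ∀ {y} → Avoidʳ L y → d₂ σ y ≤ d₂ τ y + length L
    m₁≤     : m₁ τ ≤ m₁ σ
    m₂≤     : m₂ τ ≤ m₂ σ
    m₃≤     : m₃ τ ≤ m₃ σ + length L * κ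
    d₃ˡ≤    : ∀ u → d₃ˡ τ u ≤ d₃ˡ σ u + length L * κ
    d₃ʳ≤    : ∀ y → d₃ʳ τ y ≤ d₃ʳ σ y + length L * κ
    light   : All (λ p → d₁ σ (proj₁ p) ≤ 1) L → total τ ≤ total σ
    edge₁   : ∀ {u u′} → E₁ τ u u′ ≡ true → E₁ σ u u′ ≡ true × Avoidˡ L u′
    edge₂   : ∀ {y y′} → E₂ τ y y′ ≡ true → E₂ σ y y′ ≡ true × Avoidʳ L y′
    clear   : ∀ {u y} → E₃ σ u y ≡ false → All (λ p → E₁ σ u (proj₁ p) ≡ true → E₂ σ y (proj₂ p) ≡ true → ⊥) L → E₃ τ u y ≡ false

  total≤ : total τ ≤ total σ + 2 * (length L * κ)
  total≤ = lin (m₁ τ) (m₂ τ) (m₃ τ) (m₁ σ) (m₂ σ) (m₃ σ) (length L * κ) m₁≤ m₂≤ m₃≤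
    where
    lin : ∀ a b c a₀ b₀ c₀ x → a ≤ a₀ → b ≤ b₀ → c ≤ c₀ + x → a + b + 2 * c ≤ a₀ + b₀ + 2 * c₀ + 2 * x
    lin = linear 7 (λ a b c a₀ b₀ c₀ x → (a ⊴ a₀) ∷ (b ⊴ b₀) ∷ (c ⊴ c₀ ⊕ x) ∷ [] , (a ⊕ b ⊕ 2 ⊗ c ⊴ a₀ ⊕ b₀ ⊕ 2 ⊗ c₀ ⊕ 2 ⊗ x)) 1 (1 ∷ 1 ∷ 2 ∷ [])

isolate-elim : ∀ {N} (E : Fin N → Fin N → Bool) {v u u′} → isolate E v u u′ ≡ true → E u u′ ≡ true × u ≢ v × u′ ≢ v
isolate-elim E {v} {u} {u′} h = ∧-elimˡ h , ==-false⇒≢ (not-elim (∧-elimˡ (∧-elimʳ {E u u′} h))) ,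
                                ==-false⇒≢ (not-elim (∧-elimʳ {not (u == v)} (∧-elimʳ {E u u′} h)))

heat-boundˡ : ∀ {N} (σ : State N) {κ} b y u → d₁ σ b * d₂ σ y ≤ κ → 𝟙 (E₁ σ u b) * d₂ σ y ≤ κ
heat-boundˡ σ b y u h = 𝟙*-bound (E₁ σ u b) λ e →
  ≤-trans (≤-reflexive (sym (*-identityˡ _))) (≤-trans (*-monoˡ-≤ (d₂ σ y) (1≤count (E₁ σ b) {u} (trans (sym₁ σ b u) e))) h)

heat-boundʳ : ∀ {N} (σ : State N) {κ} b y z → d₁ σ b * d₂ σ y ≤ κ → 𝟙 (E₂ σ z y) * d₁ σ b ≤ κ
heat-boundʳ σ b y z h = 𝟙*-bound (E₂ σ z y) λ e →
  ≤-trans (≤-reflexive (sym (*-identityʳ _))) (≤-trans (*-monoʳ-≤ (d₁ σ b) (1≤count (E₂ σ y) {z} (trans (sym₂ σ y z) e))) h)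

after : ∀ {N κ} (σ : State N) L → All (Cheap σ κ) L → AllPairs (Compatible σ) L → After κ σ L (placeAll L σ)
after σ [] _ _ = record
  { unplace = id ; sizeˡ = id ; sizeʳ = id ; keepˡ = λ a _ → a ; keepʳ = λ b _ → b ; d₁≤ = λ _ → ≤-refl ; d₂≤ = λ _ → ≤-refl
  ; d₁≥ = λ _ → m≤m+n _ 0 ; d₂≥ = λ _ → m≤m+n _ 0 ; m₁≤ = ≤-refl ; m₂≤ = ≤-refl ; m₃≤ = m≤m+n _ 0 ; d₃ˡ≤ = λ _ → m≤m+n _ 0 ; d₃ʳ≤ = λ _ → m≤m+n _ 0 ; light = λ _ → ≤-refl
  ; edge₁ = λ h → h , [] ; edge₂ = λ h → h , [] ; clear = λ h _ → h }
after {κ = κ} σ ((b , y) ∷ L) (cheap ab by nby cost ∷ cheaps) (oks ∷ pairs) = record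
  { unplace = λ P → place-packing σ b y ab by nby (F.unplace P)
  ; sizeˡ = λ h → F.sizeˡ (count-place (A σ) b ab h) ; sizeʳ = λ h → F.sizeʳ (count-place (B σ) y by h)
  ; keepˡ = λ { au (ne ∷ av) → F.keepˡ (∖-intro {p = A σ} au (ne ∘ sym)) av }
  ; keepʳ = λ { bz (ne ∷ av) → F.keepʳ (∖-intro {p = B σ} bz (ne ∘ sym)) av }
  ; d₁≤ = λ u → ≤-trans (F.d₁≤ u) (d₁-place≤ σ b y u) ; d₂≤ = λ z → ≤-trans (F.d₂≤ z) (d₂-place≤ σ b y z)
  ; d₁≥ = λ { {u} (ne ∷ av) → drop (d₁ σ u) (d₁ τ u) (d₁ (placeAll L τ) u) (length L) (𝟙 (E₁ σ u b)) (d₁-place σ b y u (ne ∘ sym)) (𝟙≤1 (E₁ σ u b)) (F.d₁≥ av) }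
  ; d₂≥ = λ { {z} (ne ∷ av) → drop (d₂ σ z) (d₂ τ z) (d₂ (placeAll L τ) z) (length L) (𝟙 (E₂ σ z y)) (d₂-place σ b y z (ne ∘ sym)) (𝟙≤1 (E₂ σ z y)) (F.d₂≥ av) }
  ; m₁≤ = ≤-trans F.m₁≤ (m₁-place≤ σ b y) ; m₂≤ = ≤-trans F.m₂≤ (m₂-place≤ σ b y)
  ; m₃≤ = grow F.m₃≤ (≤-trans (m+n≤o⇒m≤o _ (m₃-place σ b y nby)) (+-monoʳ-≤ (m₃ σ) cost))
  ; d₃ˡ≤ = λ u → grow (F.d₃ˡ≤ u) (≤-trans (m+n≤o⇒m≤o _ (d₃ˡ-place σ b y u)) (+-monoʳ-≤ (d₃ˡ σ u) (heat-boundˡ σ b y u cost)))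
  ; d₃ʳ≤ = λ z → grow (F.d₃ʳ≤ z) (≤-trans (m+n≤o⇒m≤o _ (d₃ʳ-place σ b y z)) (+-monoʳ-≤ (d₃ʳ σ z) (heat-boundʳ σ b y z cost)))
  ; light = λ { (one ∷ ones) → ≤-trans (F.light (All.map (λ le → ≤-trans (d₁-place≤ σ b y _) le) ones))
      (lighten (m₁ τ) (m₂ τ) (m₃ τ) (m₁ σ) (m₂ σ) (m₃ σ) (d₂ σ y) (d₁ σ b * d₂ σ y) (d₃ˡ σ b + d₃ʳ σ y) (m₁-place≤ σ b y) (m₂-place σ b y) (m₃-place σ b y nby)
        (≤-trans (*-monoˡ-≤ (d₂ σ y) one) (≤-reflexive (*-identityˡ _)))) }
  ; edge₁ = λ h → let e , av = F.edge₁ h ; e′ , _ , ne = isolate-elim (E₁ σ) e in e′ , (ne ∘ sym) ∷ av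
  ; edge₂ = λ h → let e , av = F.edge₂ h ; e′ , _ , ne = isolate-elim (E₂ σ) e in e′ , (ne ∘ sym) ∷ av
  ; clear = λ { h (k ∷ ks) → F.clear (E₃-place-false σ b y h k) (All.map (λ k′ e f → k′ (∧-elimˡ e) (∧-elimˡ f)) ks) } }
  where
  τ = place b y σ
  drop : ∀ x x′ x″ l e → x′ + e ≡ x → e ≤ 1 → x′ ≤ x″ + l → x ≤ x″ + (1 + l)
  drop x x′ x″ l e h0 h1 h2 =
    linear 5 (λ x x′ x″ l e → (x′ ⊕ e ⊴ x) ∷ (x ⊴ x′ ⊕ e) ∷ (e ⊴ # 1) ∷ (x′ ⊴ x″ ⊕ l) ∷ [] , (x ⊴ x″ ⊕ (# 1 ⊕ l))) 1 (0 ∷ 1 ∷ 1 ∷ 1 ∷ []) x x′ x″ l e (≤-reflexive h0) (≤-reflexive (sym h0)) h1 h2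
  lighten : ∀ a b c a₀ b₀ c₀ y r z → a ≤ a₀ → b + 2 * y ≡ b₀ → c + z ≤ c₀ + r → r ≤ y → a + b + 2 * c ≤ a₀ + b₀ + 2 * c₀
  lighten a b c a₀ b₀ c₀ y r z h0 h1 h2 h3 =
    linear 9 (λ a b c a₀ b₀ c₀ y r z → (a ⊴ a₀) ∷ (b ⊕ 2 ⊗ y ⊴ b₀) ∷ (b₀ ⊴ b ⊕ 2 ⊗ y) ∷ (c ⊕ z ⊴ c₀ ⊕ r) ∷ (r ⊴ y) ∷ [] , (a ⊕ b ⊕ 2 ⊗ c ⊴ a₀ ⊕ b₀ ⊕ 2 ⊗ c₀)) 1 (1 ∷ 1 ∷ 0 ∷ 2 ∷ 2 ∷ []) a b c a₀ b₀ c₀ y r z h0 (≤-reflexive h1) (≤-reflexive (sym h1)) h2 h3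
  grow : ∀ {x y z} → x ≤ y + length L * κ → y ≤ z + κ → x ≤ z + (κ + length L * κ)
  grow {x} {y} {z} p q = ≤-trans p (≤-trans (+-monoˡ-≤ _ q) (≤-reflexive (+-assoc z κ _)))
  still : ∀ {p} → Compatible σ (b , y) p → Cheap σ κ p → Cheap τ κ p
  still (nb , ny , ok) (cheap a b′ f c) = cheap (∖-intro {p = A σ} a (nb ∘ sym)) (∖-intro {p = B σ} b′ (ny ∘ sym))
    (E₃-place-false σ b y f (λ e e′ → ok (trans (sym₁ σ b _) e) (trans (sym₂ σ y _) e′)))
    (≤-trans (*-mono-≤ (d₁-place≤ σ b y _) (d₂-place≤ σ b y _)) c)
  F = after τ L (All.zipWith (λ (o , c) → still o c) (oks , cheaps))
        (AllPairs.map (λ (n , n′ , ok) → n , n′ , λ e e′ → ok (∧-elimˡ e) (∧-elimˡ e′)) pairs)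
  module F = After F

-- The data of `Good` without the budget and the margins, which may fail in the middle of a chain
-- and are checked only at its end.
record Stage {N} (σ : State N) (k D T W : ℕ) : Set where
  field
    #A      : count (A σ) ≡ k
    #B      : count (B σ) ≡ k
    bounded : Bounded σ D T
    weight  : m₁ σ + m₂ σ + 2 * m₃ σ ≤ W
  open Bounded bounded public

swap-stage : ∀ {N} {σ : State N} {k D T W} → Stage σ k D T W → Stage (swap σ) k D T W
swap-stage {σ = σ} S = record
  { #A = #B ; #B = #A ; bounded = record { Δ₁ = Δ₂ ; Δ₂ = Δ₁ ; Δ₃ˡ = Δ₃ʳ ; Δ₃ʳ = Δ₃ˡ }
  ; weight = ≤-trans (≤-reflexive (cong₂ (λ a b → a + 2 * b) (+-comm (m₂ σ) (m₁ σ)) (m₃-swap σ))) weight }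
  where open Stage S

after-stage : ∀ {N} {σ τ : State N} {k D T W κ L} → Stage σ (length L + k) D T W → After κ σ L τ →
              Stage τ k D (T + length L * κ) (W + 2 * (length L * κ))
after-stage {σ = σ} {τ} {W = W} {κ} {L} S F = record
  { #A = F.sizeˡ #A ; #B = F.sizeʳ #B
  ; bounded = record { Δ₁ = λ u → ≤-trans (F.d₁≤ u) (Δ₁ u) ; Δ₂ = λ y → ≤-trans (F.d₂≤ y) (Δ₂ y)
                     ; Δ₃ˡ = λ u → ≤-trans (F.d₃ˡ≤ u) (+-monoˡ-≤ _ (Δ₃ˡ u)) ; Δ₃ʳ = λ y → ≤-trans (F.d₃ʳ≤ y) (+-monoˡ-≤ _ (Δ₃ʳ y)) }
  ; weight = lin (m₁ τ) (m₂ τ) (m₃ τ) (m₁ σ) (m₂ σ) (m₃ σ) (length L * κ) W F.m₁≤ F.m₂≤ F.m₃≤ weight }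
  where
  open Stage S
  module F = After F
  lin : ∀ a b c a₀ b₀ c₀ x W → a ≤ a₀ → b ≤ b₀ → c ≤ c₀ + x → a₀ + b₀ + 2 * c₀ ≤ W → a + b + 2 * c ≤ W + 2 * x
  lin = linear 8 (λ a b c a₀ b₀ c₀ x W → (a ⊴ a₀) ∷ (b ⊴ b₀) ∷ (c ⊴ c₀ ⊕ x) ∷ (a₀ ⊕ b₀ ⊕ 2 ⊗ c₀ ⊴ W) ∷ [] , (a ⊕ b ⊕ 2 ⊗ c ⊴ W ⊕ 2 ⊗ x)) 1 (1 ∷ 1 ∷ 2 ∷ 1 ∷ [])

module _ {N} {σ : State N} {k D T W : ℕ} (S : Stage σ (suc k) D T W) (p q : Fin N) (ap : A σ p ≡ true) (bq : B σ q ≡ true)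
         (npq : E₃ σ p q ≡ false) (free : d₁ σ p ≡ 0 ⊎ d₂ σ q ≡ 0) where

  open Stage S
  open Free σ p q free
  private τ = place p q σ

  free-stage : Stage τ k D T (total τ)
  free-stage = record
    { #A = count-place (A σ) p ap #A ; #B = count-place (B σ) q bq #B
    ; bounded = record { Δ₁ = λ u → ≤-trans (d₁-place≤ σ p q u) (Δ₁ u) ; Δ₂ = λ y → ≤-trans (d₂-place≤ σ p q y) (Δ₂ y)
                       ; Δ₃ˡ = λ u → ≤-trans (m+n≤o⇒m≤o _ (d₃ˡ-free u)) (Δ₃ˡ u) ; Δ₃ʳ = λ y → ≤-trans (m+n≤o⇒m≤o _ (d₃ʳ-free y)) (Δ₃ʳ y) }
    ; weight = ≤-refl }

  free-total : total τ + 2 * d₁ σ p + 2 * d₂ σ q ≤ W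
  free-total = lin (m₁ τ) (m₂ τ) (m₃ τ) (m₁ σ) (m₂ σ) (m₃ σ) (d₁ σ p) (d₂ σ q) (d₃ˡ σ p + d₃ʳ σ q) W
               (m₁-place σ p q) (m₂-place σ p q) (m₃-free npq) weight
    where
    lin : ∀ a b c a₀ b₀ c₀ x y z W → a + 2 * x ≡ a₀ → b + 2 * y ≡ b₀ → c + z ≤ c₀ → a₀ + b₀ + 2 * c₀ ≤ W → a + b + 2 * c + 2 * x + 2 * y ≤ W
    lin a b c a₀ b₀ c₀ x y z W h0 h1 h2 h3 =
      linear 10 (λ a b c a₀ b₀ c₀ x y z W → (a ⊕ 2 ⊗ x ⊴ a₀) ∷ (a₀ ⊴ a ⊕ 2 ⊗ x) ∷ (b ⊕ 2 ⊗ y ⊴ b₀) ∷ (b₀ ⊴ b ⊕ 2 ⊗ y) ∷ (c ⊕ z ⊴ c₀) ∷ (a₀ ⊕ b₀ ⊕ 2 ⊗ c₀ ⊴ W) ∷ [] , (a ⊕ b ⊕ 2 ⊗ c ⊕ 2 ⊗ x ⊕ 2 ⊗ y ⊴ W)) 1 (1 ∷ 0 ∷ 1 ∷ 0 ∷ 2 ∷ 1 ∷ []) a b c a₀ b₀ c₀ x y z W (≤-reflexive h0) (≤-reflexive (sym h0)) (≤-reflexive h1) (≤-reflexive (sym h1)) h2 h3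

-- As in `light`, the weight does not grow; the whole price is the new bound `T′`.
leaf-stage : ∀ {N} {σ : State N} {k D T W} → Stage σ (suc k) D T W → ∀ p q → A σ p ≡ true → B σ q ≡ true → E₃ σ p q ≡ false →
             d₁ σ p ≤ 1 → ∀ T′ → (∀ u → d₃ˡ σ u + 𝟙 (E₁ σ u p) * d₂ σ q ≤ T′) → (∀ y → d₃ʳ σ y + 𝟙 (E₂ σ y q) * d₁ σ p ≤ T′) →
             Stage (place p q σ) k D T′ W
leaf-stage {σ = σ} {W = W} S p q ap bq npq leaf T′ heatˡ heatʳ = record
  { #A = count-place (A σ) p ap #A ; #B = count-place (B σ) q bq #B
  ; bounded = record { Δ₁ = λ u → ≤-trans (d₁-place≤ σ p q u) (Δ₁ u) ; Δ₂ = λ y → ≤-trans (d₂-place≤ σ p q y) (Δ₂ y)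
                     ; Δ₃ˡ = λ u → ≤-trans (m+n≤o⇒m≤o _ (d₃ˡ-place σ p q u)) (heatˡ u) ; Δ₃ʳ = λ y → ≤-trans (m+n≤o⇒m≤o _ (d₃ʳ-place σ p q y)) (heatʳ y) }
  ; weight = lin (m₁ τ) (m₂ τ) (m₃ τ) (m₁ σ) (m₂ σ) (m₃ σ) (d₂ σ q) (d₁ σ p * d₂ σ q) (d₃ˡ σ p + d₃ʳ σ q) W
               (m₁-place≤ σ p q) (m₂-place σ p q) (m₃-place σ p q npq) (≤-trans (*-monoˡ-≤ (d₂ σ q) leaf) (≤-reflexive (*-identityˡ _))) weight }
  where
  open Stage S
  τ = place p q σ
  lin : ∀ a b c a₀ b₀ c₀ y r z W → a ≤ a₀ → b + 2 * y ≡ b₀ → c + z ≤ c₀ + r → r ≤ y → a₀ + b₀ + 2 * c₀ ≤ W → a + b + 2 * c ≤ W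
  lin a b c a₀ b₀ c₀ y r z W h0 h1 h2 h3 h4 =
    linear 10 (λ a b c a₀ b₀ c₀ y r z W → (a ⊴ a₀) ∷ (b ⊕ 2 ⊗ y ⊴ b₀) ∷ (b₀ ⊴ b ⊕ 2 ⊗ y) ∷ (c ⊕ z ⊴ c₀ ⊕ r) ∷ (r ⊴ y) ∷ (a₀ ⊕ b₀ ⊕ 2 ⊗ c₀ ⊴ W) ∷ [] , (a ⊕ b ⊕ 2 ⊗ c ⊴ W)) 1 (1 ∷ 1 ∷ 0 ∷ 2 ∷ 2 ∷ 1 ∷ []) a b c a₀ b₀ c₀ y r z W h0 (≤-reflexive h1) (≤-reflexive (sym h1)) h2 h3 h4

finish-stage : ∀ {N n} → Hyp N n → ∀ {σ : State N} {k D T W} → k < n → Stage σ k D T W → D + 2 ≤ k → T + 1 ≤ k →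
               W + 2 * D + 2 * T + 836550 ≤ 6 * k → Packing σ
finish-stage hyp {σ} {k} {D} {T} lt S safe₁ safe₃ bud = hyp σ k D T lt (record
  { #A = #A ; #B = #B ; bounded = bounded ; D+2≤n = safe₁ ; T+1≤n = safe₃
  ; budget = ≤-trans (+-monoˡ-≤ 836550 (+-monoˡ-≤ (2 * T) (+-monoˡ-≤ (2 * D) weight))) bud })
  where open Stage S

-- Candidates for cheap partners and their simultaneous choice

candidate : ∀ {N} → State N → ℕ → Fin N → Fin N → Fin N → Bool
candidate σ κ u y b = (A σ b ∧ (not (E₁ σ u b) ∧ not (b == u))) ∧ (not (E₃ σ b y) ∧ ((d₁ σ b * d₂ σ y ≤ᵇ κ) ∧ (d₁ σ b ≤ᵇ 600)))

record Candidate {N} (σ : State N) (κ : ℕ) (u y b : Fin N) : Set where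
  field
    b∈   : A σ b ≡ true
    b≁u  : E₁ σ u b ≡ false
    b≢u  : b ≢ u
    b≁y  : E₃ σ b y ≡ false
    cost : d₁ σ b * d₂ σ y ≤ κ
    low  : d₁ σ b ≤ 600

candidate-elim : ∀ {N} (σ : State N) κ u y b → candidate σ κ u y b ≡ true → Candidate σ κ u y b
candidate-elim σ κ u y b h = record
  { b∈ = ∧-elimˡ p ; b≁u = not-elim (∧-elimˡ q) ; b≢u = ==-false⇒≢ (not-elim (∧-elimʳ {not (E₁ σ u b)} q))
  ; b≁y = not-elim (∧-elimˡ r) ; cost = ≤ᵇ-true⁻ (∧-elimˡ t) ; low = ≤ᵇ-true⁻ (∧-elimʳ {d₁ σ b * d₂ σ y ≤ᵇ κ} t) }
  where
  p = ∧-elimˡ {A σ b ∧ (not (E₁ σ u b) ∧ not (b == u))} h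
  q = ∧-elimʳ {A σ b} p
  r = ∧-elimʳ {A σ b ∧ (not (E₁ σ u b) ∧ not (b == u))} h
  t = ∧-elimʳ {not (E₃ σ b y)} r

candidate-intro : ∀ {N} (σ : State N) κ u y b → Candidate σ κ u y b → candidate σ κ u y b ≡ true
candidate-intro σ κ u y b c = ∧-intro (∧-intro b∈ (∧-intro (not-intro b≁u) (not-intro (≢⇒==-false b≢u)))) (∧-intro (not-intro b≁y) (∧-intro (≤ᵇ-true cost) (≤ᵇ-true low)))
  where open Candidate c

Partners : ∀ {N} → State N → ℕ → Fin N → List (Fin N) → (Fin N → ℕ) → Pairs N → Set
Partners σ κ u ys φ L = map proj₂ L ≡ ys × All (λ p → Candidate σ κ u (proj₂ p) (proj₁ p) × φ (proj₁ p) ≡ 0) L ×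
                        All (Cheap σ κ) L × AllPairs (Compatible σ) L × AllPairs (λ p q → E₁ σ (proj₁ p) (proj₁ q) ≡ false) L

seconds : ∀ {N} {P : Fin N → Set} (L : Pairs N) {ys} → map proj₂ L ≡ ys → All P ys → All (λ p → P (proj₂ p)) L
seconds []      refl []       = []
seconds (p ∷ L) refl (q ∷ qs) = q ∷ seconds L refl qs

seconds-∈ : ∀ {N} (L : Pairs N) {ys y} → map proj₂ L ≡ ys → y ∈ ys → ¬ Avoidʳ L y
seconds-∈ (p ∷ L) refl (here refl) (ne ∷ _)  = ne refl
seconds-∈ (p ∷ L) refl (there h)   (_ ∷ nes) = seconds-∈ L refl h nes

seconds-apart : ∀ {N} (L : Pairs N) {ys} → map proj₂ L ≡ ys → Unique ys → AllPairs (λ p q → proj₂ p ≢ proj₂ q) L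
seconds-apart []      refl []       = []
seconds-apart (p ∷ L) refl (n ∷ ns) = seconds L refl n ∷ seconds-apart L refl ns

seconds-length : ∀ {N} (L : Pairs N) {ys} → map proj₂ L ≡ ys → length L ≡ length ys
seconds-length []      refl = refl
seconds-length (p ∷ L) refl = cong suc (seconds-length L refl)

opaque
  choose-among : ∀ {N} (σ : State N) κ u (cand : Fin N → Fin N → Bool) → (∀ y b → cand y b ≡ true → candidate σ κ u y b ≡ true) →
                 ∀ ys → Unique ys → All (λ y → B σ y ≡ true) ys → ∀ (φ : Fin N → ℕ) S → ∑ φ ≤ S →
                 All (λ y → S + 601 * length ys ≤ count (cand y)) ys →
                 ∃ λ L → Partners σ κ u ys φ L × All (λ p → cand (proj₂ p) (proj₁ p) ≡ true) L
  choose-among σ κ u cand sub ys distinct inB φ S ∑φ many with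
    choose-partners (E₁ σ) cand (λ y b h → Candidate.low (candidate-elim σ κ u y b (sub y b h))) ys φ S ∑φ many
  ... | L , eq , good , apart = L , (eq , good′ , All.zipWith (λ ((c , _) , by) → mk c by) (good′ , seconds L eq inB)
        , AllPairs.zipWith (λ ((n , e) , n′) → n , n′ , λ e′ _ → true≢false e′ e) (apart , seconds-apart L eq distinct) , AllPairs.map proj₂ apart) , All.map proj₁ good
    where
    good′ : All (λ p → Candidate σ κ u (proj₂ p) (proj₁ p) × φ (proj₁ p) ≡ 0) L
    good′ = All.map (λ {p} (c , z) → candidate-elim σ κ u (proj₂ p) (proj₁ p) (sub _ _ c) , z) good
    mk : ∀ {p} → Candidate σ κ u (proj₂ p) (proj₁ p) → B σ (proj₂ p) ≡ true → Cheap σ κ p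
    mk c by = cheap b∈ by b≁y cost where open Candidate c

choose-cheap : ∀ {N} (σ : State N) κ u ys → Unique ys → All (λ y → B σ y ≡ true) ys → ∀ (φ : Fin N → ℕ) S → ∑ φ ≤ S →
               All (λ y → S + 601 * length ys ≤ count (candidate σ κ u y)) ys → ∃ (Partners σ κ u ys φ)
choose-cheap σ κ u ys distinct inB φ S ∑φ many =
  let L , partners , _ = choose-among σ κ u (candidate σ κ u) (λ _ _ → id) ys distinct inB φ S ∑φ many in L , partners

no-neighbour : ∀ {N} {p : Fin N → Bool} → (∀ x → p x ≡ true → ⊥) → count p ≡ 0
no-neighbour h = ∑-0 λ x → 𝟙-false (¬true⇒false (h x))

one-neighbour : ∀ {N} {p : Fin N → Bool} z → (∀ x → p x ≡ true → x ≡ z) → count p ≤ 1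
one-neighbour z h = ≤-trans (∑-mono λ x → 𝟙-mono (λ t → trans (cong (_== z) (h x t)) (==-refl z))) (≤-reflexive (count-point z))

-- Place the neighbours of w cheaply, then v on w; T₀ bounds d₃ away from v and w,
-- and δ the increase of the total.
root-packing : ∀ {N} {σ : State N} {n D T} → Hyp N n → Good σ n D T → ∀ κ v w → A σ v ≡ true → B σ w ≡ true → E₃ σ v w ≡ false →
               ∀ L ℓ → length L ≡ ℓ → (∀ y → E₂ σ w y ≡ true → ¬ Avoidʳ L y) →
               All (Cheap σ κ) L → AllPairs (Compatible σ) L →
               All (λ p → proj₁ p ≢ v × E₁ σ v (proj₁ p) ≡ false) L → Avoidʳ L w →
               ∀ T₀ δ → T₀ ≤ T → (∀ u → u ≢ v → d₃ˡ σ u ≤ T₀) → (∀ y → y ≢ w → d₃ʳ σ y ≤ T₀) → total (placeAll L σ) ≤ total σ + δ →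
               -- The order drops by `ℓ + 1`, which costs `6 ℓ + 6`; `v` may lose `ℓ` neighbours
               -- beforehand, which costs `2 ℓ`; the rise of the bound on G₃ costs `2 (ℓ κ)`.
               δ + 2 * (ℓ * κ) + 8 * ℓ + 6 ≤ 2 * d₁ σ v → D + ℓ + 3 ≤ n → T₀ + ℓ * κ + ℓ + 2 ≤ n → Packing σ
root-packing {N} {σ} {n} {D} {T} hyp G κ v w av bw nvw L ℓ refl cover cheaps pairs off-v off-w T₀ δ T₀≤T heatˡ heatʳ heavy gain safe₁ safe₃ =
  F.unplace (place-packing τ v w av′ bw′ nvw′ (hyp ρ k D (T₀ + length L * κ) (k<n (length L) k n k-def) (record
    { #A = count-place (A τ) v av′ (F.sizeˡ (trans #A (sym k-def))) ; #B = count-place (B τ) w bw′ (F.sizeʳ (trans #B (sym k-def)))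
    ; bounded = record
      { Δ₁ = λ u → ≤-trans (d₁-place≤ τ v w u) (≤-trans (F.d₁≤ u) (Δ₁ u)) ; Δ₂ = λ y → ≤-trans (d₂-place≤ τ v w y) (≤-trans (F.d₂≤ y) (Δ₂ y))
      ; Δ₃ˡ = λ u → left u (u ≟ᶠ v) ; Δ₃ʳ = λ y → right y (y ≟ᶠ w) }
    ; D+2≤n = D-lin D (length L) k n safe₁ k-def ; T+1≤n = T-lin T₀ (length L) (length L * κ) k n safe₃ k-def
    ; budget = budget-lin (total ρ) (d₁ σ v) (d₁ τ v) D T T₀ (length L) (length L * κ) k n (total σ) (total τ) δ
        dropped heavy (F.d₁≥ v-off) budget T₀≤T gain k-def })))
  where
  open Good G
  size : ∀ D l n → D + l + 3 ≤ n → l + 1 ≤ n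
  size = linear 3 (λ D l n → (D ⊕ l ⊕ # 3 ⊴ n) ∷ [] , (l ⊕ # 1 ⊴ n)) 1 (1 ∷ [])
  k<n : ∀ l k n → l + (1 + k) ≡ n → k < n
  k<n l k n h0 =
    linear 3 (λ l k n → (l ⊕ (# 1 ⊕ k) ⊴ n) ∷ (n ⊴ l ⊕ (# 1 ⊕ k)) ∷ [] , (# 1 ⊕ k ⊴ n)) 1 (1 ∷ 0 ∷ []) l k n (≤-reflexive h0) (≤-reflexive (sym h0))
  D-lin : ∀ D l k n → D + l + 3 ≤ n → l + (1 + k) ≡ n → D + 2 ≤ k
  D-lin D l k n h0 h1 =
    linear 4 (λ D l k n → (D ⊕ l ⊕ # 3 ⊴ n) ∷ (l ⊕ (# 1 ⊕ k) ⊴ n) ∷ (n ⊴ l ⊕ (# 1 ⊕ k)) ∷ [] , (D ⊕ # 2 ⊴ k)) 1 (1 ∷ 0 ∷ 1 ∷ []) D l k n h0 (≤-reflexive h1) (≤-reflexive (sym h1))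
  T-lin : ∀ T l z k n → T + z + l + 2 ≤ n → l + (1 + k) ≡ n → T + z + 1 ≤ k
  T-lin T l z k n h0 h1 =
    linear 5 (λ T l z k n → (T ⊕ z ⊕ l ⊕ # 2 ⊴ n) ∷ (l ⊕ (# 1 ⊕ k) ⊴ n) ∷ (n ⊴ l ⊕ (# 1 ⊕ k)) ∷ [] , (T ⊕ z ⊕ # 1 ⊴ k)) 1 (1 ∷ 0 ∷ 1 ∷ []) T l z k n h0 (≤-reflexive h1) (≤-reflexive (sym h1))
  budget-lin : ∀ t d d′ D T T₀ l z k n W W′ δ → t + 2 * d′ ≤ W′ → W′ ≤ W + δ → d ≤ d′ + l → W + 2 * D + 2 * T + 836550 ≤ 6 * n → T₀ ≤ T → δ + 2 * z + 8 * l + 6 ≤ 2 * d → l + (1 + k) ≡ n → t + 2 * D + 2 * (T₀ + z) + 836550 ≤ 6 * k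
  budget-lin t d d′ D T T₀ l z k n W W′ δ h0 h1 h2 h3 h4 h5 h6 =
    linear 13 (λ t d d′ D T T₀ l z k n W W′ δ → (t ⊕ 2 ⊗ d′ ⊴ W′) ∷ (W′ ⊴ W ⊕ δ) ∷ (d ⊴ d′ ⊕ l) ∷ (W ⊕ 2 ⊗ D ⊕ 2 ⊗ T ⊕ # 836550 ⊴ 6 ⊗ n) ∷ (T₀ ⊴ T) ∷ (δ ⊕ 2 ⊗ z ⊕ 8 ⊗ l ⊕ # 6 ⊴ 2 ⊗ d) ∷ (l ⊕ (# 1 ⊕ k) ⊴ n) ∷ (n ⊴ l ⊕ (# 1 ⊕ k)) ∷ [] , (t ⊕ 2 ⊗ D ⊕ 2 ⊗ (T₀ ⊕ z) ⊕ # 836550 ⊴ 6 ⊗ k)) 1 (1 ∷ 1 ∷ 2 ∷ 1 ∷ 2 ∷ 1 ∷ 0 ∷ 6 ∷ []) t d d′ D T T₀ l z k n W W′ δ h0 h1 h2 h3 h4 h5 (≤-reflexive h6) (≤-reflexive (sym h6))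
  τ = placeAll L σ
  ρ = place v w τ
  F = after σ L cheaps pairs
  module F = After F
  split = m≤n⇒∃[o]m+o≡n (size D (length L) n safe₁)
  k = proj₁ split
  k-def : length L + suc k ≡ n
  k-def = trans (sym (+-assoc (length L) 1 k)) (proj₂ split)
  v-off : Avoidˡ L v
  v-off = All.map proj₁ off-v
  av′ = F.keepˡ av v-off
  bw′ = F.keepʳ bw off-w
  nvw′ = F.clear nvw (All.map (λ (_ , f) e _ → true≢false e f) off-v)
  d₂w : d₂ τ w ≡ 0
  d₂w = no-neighbour (λ y h → let e , av = F.edge₂ h in cover y e av)
  open Free τ v w (inj₂ d₂w)
  dropped : total ρ + 2 * d₁ τ v ≤ total τ
  dropped = lin (m₁ ρ) (m₂ ρ) (m₃ ρ) (m₁ τ) (m₂ τ) (m₃ τ) (d₁ τ v) (m₁-place τ v w) (m₂-place≤ τ v w) (m+n≤o⇒m≤o _ (m₃-free nvw′))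
    where
    lin : ∀ a b c a₀ b₀ c₀ d → a + 2 * d ≡ a₀ → b ≤ b₀ → c ≤ c₀ → a + b + 2 * c + 2 * d ≤ a₀ + b₀ + 2 * c₀
    lin a b c a₀ b₀ c₀ d h0 h1 h2 =
      linear 7 (λ a b c a₀ b₀ c₀ d → (a ⊕ 2 ⊗ d ⊴ a₀) ∷ (a₀ ⊴ a ⊕ 2 ⊗ d) ∷ (b ⊴ b₀) ∷ (c ⊴ c₀) ∷ [] , (a ⊕ b ⊕ 2 ⊗ c ⊕ 2 ⊗ d ⊴ a₀ ⊕ b₀ ⊕ 2 ⊗ c₀)) 1 (1 ∷ 0 ∷ 1 ∷ 2 ∷ []) a b c a₀ b₀ c₀ d (≤-reflexive h0) (≤-reflexive (sym h0)) h1 h2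
  left : ∀ u → Dec (u ≡ v) → d₃ˡ ρ u ≤ T₀ + length L * κ
  left u (yes refl) = ≤-trans (≤-reflexive (d₃ˡ-place-self τ u w)) z≤n
  left u (no ne)    = ≤-trans (m+n≤o⇒m≤o _ (d₃ˡ-free u)) (≤-trans (F.d₃ˡ≤ u) (+-monoˡ-≤ _ (heatˡ u ne)))
  right : ∀ y → Dec (y ≡ w) → d₃ʳ ρ y ≤ T₀ + length L * κ
  right y (yes refl) = ≤-trans (≤-reflexive (d₃ʳ-place-self τ v y)) z≤n
  right y (no ne)    = ≤-trans (m+n≤o⇒m≤o _ (d₃ʳ-free y)) (≤-trans (F.d₃ʳ≤ y) (+-monoˡ-≤ _ (heatʳ y ne)))

module _ {N n : ℕ} (hyp : Hyp N n) where

  -- First a on x, then v on w, when x is the only neighbour of w.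
  module Two {τ : State N} {k D T W : ℕ} (S : Stage τ (suc (suc k)) D T W) (k<n : k < n) (a x v w : Fin N)
             (aa : A τ a ≡ true) (bx : B τ x ≡ true) (nax : E₃ τ a x ≡ false)
             (av : A τ v ≡ true) (bw : B τ w ≡ true) (nvw : E₃ τ v w ≡ false)
             (v≢a : v ≢ a) (w≢x : w ≢ x) (nva : E₁ τ v a ≡ false) (only-x : ∀ y → E₂ τ w y ≡ true → y ≡ x) where

    ρ = place a x τ

    d₁v : d₁ τ v ≡ d₁ ρ v
    d₁v = trans (sym (d₁-place τ a x v v≢a)) (trans (cong (λ e → d₁ ρ v + 𝟙 e) nva) (+-identityʳ _))

    avρ : A ρ v ≡ true
    avρ = ∖-intro {p = A τ} av v≢a
    bwρ : B ρ w ≡ true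
    bwρ = ∖-intro {p = B τ} bw w≢x
    nvwρ : E₃ ρ v w ≡ false
    nvwρ = E₃-place-false τ a x nvw (λ e _ → true≢false e nva)
    d₂w : d₂ ρ w ≡ 0
    d₂w = no-neighbour (λ y h → let e , _ , ne = isolate-elim (E₂ τ) h in ne (only-x y e))

    module _ {T′ W′ : ℕ} (S′ : Stage ρ (suc k) D T′ W′) where
      last : D + 2 ≤ k → T′ + 1 ≤ k → W′ + 2 * D + 2 * T′ + 836550 ≤ 6 * k + 2 * d₁ τ v → Packing τ
      last safe₁ safe₃ bud = place-packing τ a x aa bx nax (place-packing ρ v w avρ bwρ nvwρ
        (finish-stage hyp k<n (free-stage S′ v w avρ bwρ nvwρ (inj₂ d₂w)) safe₁ safe₃
          (lin (total (place v w ρ)) (d₁ ρ v) (d₂ ρ w) W′ D T′ k (d₁ τ v) (free-total S′ v w avρ bwρ nvwρ (inj₂ d₂w)) d₁v bud)))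
        where
        lin : ∀ t d e W D T k d′ → t + 2 * d + 2 * e ≤ W → d′ ≡ d → W + 2 * D + 2 * T + 836550 ≤ 6 * k + 2 * d′ → t + 2 * D + 2 * T + 836550 ≤ 6 * k
        lin t d e W D T k d′ h0 h1 h2 =
          linear 8 (λ t d e W D T k d′ → (t ⊕ 2 ⊗ d ⊕ 2 ⊗ e ⊴ W) ∷ (d′ ⊴ d) ∷ (d ⊴ d′) ∷ (W ⊕ 2 ⊗ D ⊕ 2 ⊗ T ⊕ # 836550 ⊴ 6 ⊗ k ⊕ 2 ⊗ d′) ∷ [] , (t ⊕ 2 ⊗ D ⊕ 2 ⊗ T ⊕ # 836550 ⊴ 6 ⊗ k)) 1 (1 ∷ 2 ∷ 0 ∷ 1 ∷ []) t d e W D T k d′ h0 (≤-reflexive h1) (≤-reflexive (sym h1)) h2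

    closed : d₁ τ a ≡ 0 → D + 2 ≤ k → T + 1 ≤ k → W + 2 * D + 2 * T + 836550 ≤ 6 * k + 2 * d₁ τ v + 2 * d₂ τ x → Packing τ
    closed d₁a safe₁ safe₃ bud = last (free-stage S a x aa bx nax (inj₁ d₁a)) safe₁ safe₃
      (lin (total ρ) (d₁ τ a) (d₂ τ x) W D T k (d₁ τ v) (free-total S a x aa bx nax (inj₁ d₁a)) bud)
      where
      lin : ∀ t d e W D T k d′ → t + 2 * d + 2 * e ≤ W → W + 2 * D + 2 * T + 836550 ≤ 6 * k + 2 * d′ + 2 * e → t + 2 * D + 2 * T + 836550 ≤ 6 * k + 2 * d′
      lin = linear 8 (λ t d e W D T k d′ → (t ⊕ 2 ⊗ d ⊕ 2 ⊗ e ⊴ W) ∷ (W ⊕ 2 ⊗ D ⊕ 2 ⊗ T ⊕ # 836550 ⊴ 6 ⊗ k ⊕ 2 ⊗ d′ ⊕ 2 ⊗ e) ∷ [] , (t ⊕ 2 ⊗ D ⊕ 2 ⊗ T ⊕ # 836550 ⊴ 6 ⊗ k ⊕ 2 ⊗ d′)) 1 (1 ∷ 1 ∷ [])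

    -- If `a` still has a neighbour, that neighbour gains all `d₂ τ x` edges, while a neighbour of
    -- `x` gains at most one.
    open-end : d₁ τ a ≤ 1 → D + 2 ≤ k → T + d₂ τ x + 2 ≤ k → W + 2 * D + 2 * (T + d₂ τ x + 1) + 836550 ≤ 6 * k + 2 * d₁ τ v → Packing τ
    open-end d₁a safe₁ safe₃ bud = last (leaf-stage S a x aa bx nax d₁a (T + d₂ τ x + 1)
        (λ u → ≤-trans (+-mono-≤ (Δ₃ˡ u) (𝟙*-bound (E₁ τ u a) (λ _ → ≤-refl))) (m≤m+n _ 1))
        (λ y → ≤-trans (+-mono-≤ (Δ₃ʳ y) (𝟙*-bound (E₂ τ y x) (λ _ → d₁a))) (+-monoˡ-≤ 1 (m≤m+n T _))))
      safe₁ (≤-trans (≤-reflexive (+-assoc (T + d₂ τ x) 1 1)) safe₃) bud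
      where open Stage S

  -- First v′ on w′, which may leave a neighbour of w′ unplaced.
  module Three {τ : State N} {k D T W : ℕ} (S : Stage τ (suc (suc (suc k))) D T W) (k<n : k < n) (v′ w′ a x v w : Fin N)
               (av′ : A τ v′ ≡ true) (bw′ : B τ w′ ≡ true) (nvw′ : E₃ τ v′ w′ ≡ false)
               (aa : A τ a ≡ true) (bx : B τ x ≡ true) (nax : E₃ τ a x ≡ false)
               (av : A τ v ≡ true) (bw : B τ w ≡ true) (nvw : E₃ τ v w ≡ false)
               (v≢v′ : v ≢ v′) (v≢a : v ≢ a) (a≢v′ : a ≢ v′) (w≢w′ : w ≢ w′) (w≢x : w ≢ x) (x≢w′ : x ≢ w′)
               (nva : E₁ τ v a ≡ false) (nww′ : E₂ τ w w′ ≡ false) (nxw′ : E₂ τ x w′ ≡ false)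
               (only-x : ∀ y → E₂ τ w y ≡ true → y ≡ x) (only-v′ : ∀ u → E₁ τ a u ≡ true → u ≡ v′)
               (safe₁ : D + 2 ≤ k) where

    ρ = place v′ w′ τ

    d₁a : d₁ ρ a ≡ 0
    d₁a = no-neighbour (λ u h → let e , _ , ne = isolate-elim (E₁ τ) h in ne (only-v′ u e))
    d₂x : d₂ τ x ≡ d₂ ρ x
    d₂x = trans (sym (d₂-place τ v′ w′ x x≢w′)) (trans (cong (λ e → d₂ ρ x + 𝟙 e) nxw′) (+-identityʳ _))

    module _ {T′ W′ : ℕ} (S′ : Stage ρ (suc (suc k)) D T′ W′) where
      -- The additional 2 allows for an edge from `v` to `v′`, which is gone by the time `v` is
      -- placed.
      rest : T′ + 1 ≤ k → W′ + 2 * D + 2 * T′ + 836550 + 2 ≤ 6 * k + 2 * d₁ τ v + 2 * d₂ τ x → Packing τ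
      rest safe₃ bud = place-packing τ v′ w′ av′ bw′ nvw′ (Two.closed S′ k<n a x v w
        (∖-intro {p = A τ} aa a≢v′) (∖-intro {p = B τ} bx x≢w′) (E₃-place-false τ v′ w′ nax (λ _ e → true≢false e nxw′))
        (∖-intro {p = A τ} av v≢v′) (∖-intro {p = B τ} bw w≢w′) (E₃-place-false τ v′ w′ nvw (λ _ e → true≢false e nww′))
        v≢a w≢x (cong (_∧ (not (v == v′) ∧ not (a == v′))) nva) (λ y h → only-x y (proj₁ (isolate-elim (E₂ τ) h)))
        d₁a safe₁ safe₃
        (lin W′ D T′ k (d₁ τ v) (d₁ ρ v) (d₂ τ x) (d₂ ρ x) (𝟙 (E₁ τ v v′)) (d₁-place τ v′ w′ v v≢v′) (𝟙≤1 (E₁ τ v v′)) d₂x bud))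
        where
        lin : ∀ W D T k d d′ e e′ i → d′ + i ≡ d → i ≤ 1 → e ≡ e′ → W + 2 * D + 2 * T + 836550 + 2 ≤ 6 * k + 2 * d + 2 * e → W + 2 * D + 2 * T + 836550 ≤ 6 * k + 2 * d′ + 2 * e′
        lin W D T k d d′ e e′ i h0 h1 h2 h3 =
          linear 9 (λ W D T k d d′ e e′ i → (d′ ⊕ i ⊴ d) ∷ (d ⊴ d′ ⊕ i) ∷ (i ⊴ # 1) ∷ (e ⊴ e′) ∷ (e′ ⊴ e) ∷ (W ⊕ 2 ⊗ D ⊕ 2 ⊗ T ⊕ # 836550 ⊕ # 2 ⊴ 6 ⊗ k ⊕ 2 ⊗ d ⊕ 2 ⊗ e) ∷ [] , (W ⊕ 2 ⊗ D ⊕ 2 ⊗ T ⊕ # 836550 ⊴ 6 ⊗ k ⊕ 2 ⊗ d′ ⊕ 2 ⊗ e′)) 1 (0 ∷ 2 ∷ 2 ∷ 2 ∷ 0 ∷ 1 ∷ []) W D T k d d′ e e′ i (≤-reflexive h0) (≤-reflexive (sym h0)) h1 (≤-reflexive h2) (≤-reflexive (sym h2)) h3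

    closed : d₂ τ w′ ≡ 0 → T + 1 ≤ k → W + 2 * D + 2 * T + 836550 + 2 ≤ 6 * k + 2 * d₁ τ v + 2 * d₂ τ x → Packing τ
    closed d₂w′ safe₃ bud = rest (free-stage S v′ w′ av′ bw′ nvw′ (inj₂ d₂w′)) safe₃
      (≤-trans (+-monoˡ-≤ 2 (+-monoˡ-≤ 836550 (+-monoˡ-≤ (2 * T) (+-monoˡ-≤ (2 * D) (m+n≤o⇒m≤o (total ρ) (m+n≤o⇒m≤o _ (free-total S v′ w′ av′ bw′ nvw′ (inj₂ d₂w′)))))))) bud)

    open-end : ∀ T′ → d₂ τ w′ ≤ 1 → (∀ u → d₃ˡ τ u + 1 ≤ T′) → (∀ y → d₃ʳ τ y + 𝟙 (E₂ τ y w′) * d₁ τ v′ ≤ T′) →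
               T′ + 1 ≤ k → W + 2 * D + 2 * T′ + 836550 + 2 ≤ 6 * k + 2 * d₁ τ v + 2 * d₂ τ x → Packing τ
    open-end T′ d₂w′ heatˡ heatʳ safe₃ bud = rest (swap-back (leaf-stage (swap-stage S) w′ v′ bw′ av′ nvw′ d₂w′ T′ heatʳ
        (λ u → ≤-trans (+-monoʳ-≤ (d₃ˡ τ u) (𝟙*-bound (E₁ τ u v′) (λ _ → d₂w′))) (heatˡ u)))) safe₃ bud
      where
      -- Placing commutes with exchanging the two sides up to the order of a conjunction.
      swap-back : Stage (place w′ v′ (swap τ)) (suc (suc k)) D T′ W → Stage ρ (suc (suc k)) D T′ W
      swap-back S′ = record
        { #A = #B ; #B = #A
        ; bounded = record { Δ₁ = Δ₂ ; Δ₂ = Δ₁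
          ; Δ₃ˡ = λ u → ≤-trans (≤-reflexive (∑-cong λ y → cong 𝟙 (same u y))) (Δ₃ʳ u)
          ; Δ₃ʳ = λ y → ≤-trans (≤-reflexive (∑-cong λ u → cong 𝟙 (same u y))) (Δ₃ˡ y) }
        ; weight = ≤-trans (≤-reflexive (cong₂ (λ c d → c + 2 * d) (+-comm (m₁ ρ) (m₂ ρ))
            (trans (∑-cong λ u → ∑-cong λ y → cong 𝟙 (same u y)) (∑-swap (λ u y → 𝟙 (E₃ (place w′ v′ (swap τ)) y u)))))) weight }
        where
        open Stage S′
        same : ∀ u y → E₃ ρ u y ≡ E₃ (place w′ v′ (swap τ)) y u
        same u y = trans (∧-swap-not (E₃ τ u y ∨ (E₁ τ u v′ ∧ E₂ τ y w′)) (u == v′) (y == w′))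
                         (cong (λ c → (E₃ τ u y ∨ c) ∧ (not (y == w′) ∧ not (u == v′))) (Bool.∧-comm (E₁ τ u v′) (E₂ τ y w′)))

-- Chains: v on a neighbour w of x, x on a neighbour a of v′, v′ on w′

-- H is the set of hard vertices, those without many cheap partners; v is a vertex of degree D.
record Setting {N} (σ : State N) (n D T : ℕ) : Set where
  field
    hyp     : Hyp N n
    G       : Good σ n D T
    κ       : ℕ
    κ-small : 20 * κ ≤ D
    D-lo    : n < 700 * D
    D-hi    : D + 139000 < n
    T-far   : 3 * T + D + 400 < 3 * n
    v       : Fin N
    av      : A σ v ≡ true
    d₁v     : d₁ σ v ≡ D
    H       : Fin N → Bool
    M       : ℕ
    -- The terms `3 * M` and `3 * κ` make up for the neighbours of at most three vertices that the
    -- partners have to avoid; 3000 covers the greedy choices at 601 each and a few single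
    -- exceptions.
    easy-v  : ∀ y → B σ y ≡ true → H y ≡ false → 3 * M + 3000 ≤ count (candidate σ κ v y)
    easy-u  : ∀ u y → A σ u ≡ true → u ≢ v → B σ y ≡ true → H y ≡ false → 3 * κ + 3000 ≤ count (candidate σ κ u y)

  away : Fin N → Bool
  away b = A σ b ∧ (not (E₁ σ v b) ∧ not (b == v))

-- `H₁` is for `x`, seen from the other side, what `H` is for `v`. `spread` lets the partners chosen
-- for the neighbours of `w`, which lie in `away`, keep off the neighbourhoods of the easy
-- neighbours of `a`.
record Hard {N} {σ : State N} {n D T : ℕ} (X : Setting σ n D T) : Set where
  open Setting X
  field
    x      : Fin N
    hx     : H x ≡ true
    H₁     : Fin N → Bool
    easy-x : ∀ u → A σ u ≡ true → H₁ u ≡ false → 3000 ≤ count (candidate (swap σ) κ x u)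
    spread : ∀ u → A σ u ≡ true → u ≢ v → H₁ u ≡ false → d₁ σ u ≤ κ → count (λ b → E₁ σ u b ∧ away b) ≤ M

module Chain {N} {σ : State N} {n D T : ℕ} (X : Setting σ n D T) where

  open Setting X
  open Good G

  -- At most three pairs are placed. Their cost enters twice through the total and twice through the
  -- bound on G₃, altogether at most `12 κ ≤ 3 D / 5`, against `2 D` gained with `v`.
  unblocked : ∀ w → B σ w ≡ true → E₃ σ v w ≡ false → d₂ σ w ≤ 3 → (∀ y → E₂ σ w y ≡ true → H y ≡ false) → Packing σ
  unblocked w bw nvw few easy =
    let L , eq , cand , cheaps , pairs , _ = choose-cheap σ κ v ys (elements-unique (E₂ σ w)) (All.tabulate λ h → on₂ʳ (elements⁻ (E₂ σ w) h))
          (λ _ → 0) 0 (≤-reflexive (∑-0 {N} λ _ → refl))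
          (All.tabulate λ h → ≤-trans (enough (length ys) M len) (easy-v _ (on₂ʳ (elements⁻ (E₂ σ w) h)) (easy _ (elements⁻ (E₂ σ w) h))))
        ℓ≤3 = subst (_≤ 3) (sym (seconds-length L eq)) len
    in root-packing hyp G κ v w av bw nvw L (length L) refl (λ y h → seconds-∈ L eq (elements⁺ (E₂ σ w) h)) cheaps pairs
         (All.map (λ (c , _) → Candidate.b≢u c , Candidate.b≁u c) cand)
         (seconds L eq (All.tabulate λ h e → adjacent₂ σ (elements⁻ (E₂ σ w) h) (sym e)))
         T (2 * (length L * κ)) ≤-refl (λ u _ → Δ₃ˡ u) (λ y _ → Δ₃ʳ y) (After.total≤ (after σ L cheaps pairs))
         (subst (λ d → 2 * (length L * κ) + 2 * (length L * κ) + 8 * length L + 6 ≤ 2 * d) (sym d₁v) (gain (length L * κ) (length L) κ D n ℓ≤3 (*-monoˡ-≤ κ ℓ≤3) κ-small D-lo D-hi))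
         (safe₁ (length L) D n ℓ≤3 D-hi) (safe₃ (length L * κ) (length L) κ D T n ℓ≤3 (*-monoˡ-≤ κ ℓ≤3) κ-small T-far)
    where
    ys = elements (E₂ σ w)
    len : length ys ≤ 3
    len = subst (_≤ 3) (sym (elements-length (E₂ σ w))) few
    on₂ʳ : ∀ {y} → E₂ σ w y ≡ true → B σ y ≡ true
    on₂ʳ {y} h = on₂ σ y w (trans (sym₂ σ y w) h)
    enough : ∀ l M → l ≤ 3 → 601 * l ≤ 3 * M + 3000
    enough = linear 2 (λ l M → (l ⊴ # 3) ∷ [] , (601 ⊗ l ⊴ 3 ⊗ M ⊕ # 3000)) 1 (601 ∷ [])
    gain : ∀ z l k D n → l ≤ 3 → z ≤ 3 * k → 20 * k ≤ D → n < 700 * D → D + 139000 < n → 2 * z + 2 * z + 8 * l + 6 ≤ 2 * D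
    gain = linear 5 (λ z l k D n → (l ⊴ # 3) ∷ (z ⊴ 3 ⊗ k) ∷ (20 ⊗ k ⊴ D) ∷ (# 1 ⊕ n ⊴ 700 ⊗ D) ∷ (# 1 ⊕ (D ⊕ # 139000) ⊴ n) ∷ [] , (2 ⊗ z ⊕ 2 ⊗ z ⊕ 8 ⊗ l ⊕ # 6 ⊴ 2 ⊗ D)) 3495 (27960 ∷ 13980 ∷ 2097 ∷ 7 ∷ 7 ∷ [])
    safe₁ : ∀ l D n → l ≤ 3 → D + 139000 < n → D + l + 3 ≤ n
    safe₁ = linear 3 (λ l D n → (l ⊴ # 3) ∷ (# 1 ⊕ (D ⊕ # 139000) ⊴ n) ∷ [] , (D ⊕ l ⊕ # 3 ⊴ n)) 1 (1 ∷ 1 ∷ [])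
    safe₃ : ∀ z l k D T n → l ≤ 3 → z ≤ 3 * k → 20 * k ≤ D → 3 * T + D + 400 < 3 * n → T + z + l + 2 ≤ n
    safe₃ = linear 6 (λ z l k D T n → (l ⊴ # 3) ∷ (z ⊴ 3 ⊗ k) ∷ (20 ⊗ k ⊴ D) ∷ (# 1 ⊕ (3 ⊗ T ⊕ D ⊕ # 400) ⊴ 3 ⊗ n) ∷ [] , (T ⊕ z ⊕ l ⊕ # 2 ⊴ n)) 60 (60 ∷ 60 ∷ 9 ∷ 20 ∷ [])

  module At (Y : Hard X) where

    open Hard Y

    easyʷ : Fin N → Fin N → Bool
    easyʷ w y = E₂ σ w y ∧ not (H y)
    easyᵃ : Fin N → Fin N → Bool
    easyᵃ a u = E₁ σ a u ∧ not (H₁ u)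

    record Below (w : Fin N) : Set where
      field
        bw   : B σ w ≡ true
        nvw  : E₃ σ v w ≡ false
        wx   : E₂ σ w x ≡ true
        only : ∀ y → E₂ σ w y ≡ true → H y ≡ true → y ≡ x
        few  : count (easyʷ w) ≤ 1
        d₂w  : d₂ σ w ≤ 3

    record Above (a : Fin N) : Set where
      field
        aa  : A σ a ≡ true
        a≢v : a ≢ v
        nva : E₁ σ v a ≡ false
        nax : E₃ σ a x ≡ false
        d₁a : d₁ σ a ≤ 3

    -- z is kept out of the partners of the neighbours of w, the support of ψ
    -- out of those of the neighbours of a.
    module Kids {w a : Fin N} (bel : Below w) (abv : Above a) (z : Fin N) (ψ : Fin N → ℕ) (∑ψ : ∑ ψ ≤ 10) where
      open Below bel
      open Above abv

      kid : Fin N → Bool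
      kid u = easyᵃ a u ∧ (d₁ σ u ≤ᵇ κ)

      #kid : count kid ≤ 3
      #kid = ≤-trans (count-mono λ u h → ∧-elimˡ (∧-elimˡ {easyᵃ a u} h)) d₁a

      a∈ : ∀ {u} → E₁ σ a u ≡ true → A σ u ≡ true
      a∈ h = on₁ʳ σ a _ h
      a≢u : ∀ {u} → E₁ σ a u ≡ true → u ≢ v
      a≢u {u} h refl = true≢false h (trans (sym₁ σ a u) nva)

      -- What bars a vertex from being a partner for a neighbour of `w`. In the last term only
      -- neighbours inside `away` are counted, because partners lie there; `spread` bounds them by
      -- `M` for each kid.
      φ : Fin N → ℕ
      φ b = 𝟙 (b == a) + 𝟙 (b == z) + 𝟙 (E₁ σ a b) + ∑ (λ u → 𝟙 (kid u) * 𝟙 (E₁ σ u b ∧ away b))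

      ∑φ : ∑ φ ≤ 1 + 1 + 3 + 3 * M
      ∑φ = ∑-+≤ (∑-+≤ (∑-+≤ (≤-reflexive (count-point a)) (≤-reflexive (count-point z))) d₁a)
        (∑∑-bound _ (≤-trans (∑-mono per-kid) (≤-trans (≤-reflexive (trans (∑-cong λ u → *-comm (𝟙 (kid u)) M) (∑-* M _))) (≤-trans (≤-reflexive (*-comm M _)) (*-monoˡ-≤ M #kid)))))
        where
        per-kid : ∀ u → ∑ (λ b → 𝟙 (kid u) * 𝟙 (E₁ σ u b ∧ away b)) ≤ 𝟙 (kid u) * M
        per-kid u = ≤-trans (≤-reflexive (∑-* (𝟙 (kid u)) _)) (bound (kid u) refl)
          where
          bound : ∀ c → kid u ≡ c → 𝟙 c * count (λ b → E₁ σ u b ∧ away b) ≤ 𝟙 c * M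
          bound false _ = z≤n
          bound true h = *-monoʳ-≤ 1 (spread u (a∈ e) (a≢u e) (not-elim (∧-elimʳ {E₁ σ a u} (∧-elimˡ {easyᵃ a u} h))) (≤ᵇ-true⁻ (∧-elimʳ {easyᵃ a u} h)))
            where e = ∧-elimˡ {E₁ σ a u} (∧-elimˡ {easyᵃ a u} h)

      record KidW (p : Fin N × Fin N) : Set where
        field
          cand : Candidate σ κ v (proj₂ p) (proj₁ p)
          b≢a  : proj₁ p ≢ a
          b≢z  : proj₁ p ≢ z
          a≁b  : E₁ σ a (proj₁ p) ≡ false
          sep  : ∀ u → kid u ≡ true → E₁ σ u (proj₁ p) ≡ false
          w~y  : E₂ σ w (proj₂ p) ≡ true
          easy : H (proj₂ p) ≡ false

      record KidA (p : Fin N × Fin N) : Set where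
        field
          a~u  : E₁ σ a (proj₁ p) ≡ true
          easy : H₁ (proj₁ p) ≡ false
          cand : Candidate (swap σ) κ x (proj₁ p) (proj₂ p)
          c≢w  : proj₂ p ≢ w
          w≁c  : E₂ σ w (proj₂ p) ≡ false
          ψc   : ψ (proj₂ p) ≡ 0
          cost : d₁ σ (proj₁ p) * d₂ σ (proj₂ p) ≤ κ

      away-intro : ∀ {b y} → Candidate σ κ v y b → away b ≡ true
      away-intro c = ∧-intro b∈ (∧-intro (not-intro b≁u) (not-intro (≢⇒==-false b≢u))) where open Candidate c

      on₂ʳ : ∀ {y} → E₂ σ w y ≡ true → B σ y ≡ true
      on₂ʳ {y} h = on₂ σ y w (trans (sym₂ σ y w) h)

      ys = elements (easyʷ w)
      us = elements (easyᵃ a)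

      opaque
        chosenW : ∃ λ L → map proj₂ L ≡ ys × All KidW L × All (Cheap σ κ) L × AllPairs (Compatible σ) L
        chosenW =
          let L , eq , cand , cheaps , pairs , _ = choose-cheap σ κ v ys (elements-unique (easyʷ w)) (All.tabulate λ h → on₂ʳ (∧-elimˡ (elements⁻ (easyʷ w) h)))
                φ (1 + 1 + 3 + 3 * M) ∑φ (All.tabulate λ {y} h → ≤-trans (enough M (length ys) (subst (_≤ 1) (sym (elements-length (easyʷ w))) few))
                  (easy-v y (on₂ʳ (∧-elimˡ (elements⁻ (easyʷ w) h))) (not-elim (∧-elimʳ {E₂ σ w y} (elements⁻ (easyʷ w) h)))))
          in L , eq , All.zipWith (λ {p} ((c , z) , e) → make c z e) (cand , seconds L eq (All.tabulate {P = λ y → easyʷ w y ≡ true} (elements⁻ (easyʷ w)))) , cheaps , pairs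
          where
          enough : ∀ M l → l ≤ 1 → 1 + 1 + 3 + 3 * M + 601 * l ≤ 3 * M + 3000
          enough = linear 2 (λ M l → (l ⊴ # 1) ∷ [] , (# 1 ⊕ # 1 ⊕ # 3 ⊕ 3 ⊗ M ⊕ 601 ⊗ l ⊴ 3 ⊗ M ⊕ # 3000)) 1 (601 ∷ [])
          make : ∀ {p} → Candidate σ κ v (proj₂ p) (proj₁ p) → φ (proj₁ p) ≡ 0 → easyʷ w (proj₂ p) ≡ true → KidW p
          make {b , y} c z e =
            let q , r = zero₂ (𝟙 (b == a) + 𝟙 (b == _) + 𝟙 (E₁ σ a b)) _ z
                q′ , s = zero₂ (𝟙 (b == a) + 𝟙 (b == _)) _ q
                t , t′ = zero₂ (𝟙 (b == a)) _ q′
            in record { cand = c ; b≢a = ==-false⇒≢ (𝟙≡0 t) ; b≢z = ==-false⇒≢ (𝟙≡0 t′) ; a≁b = 𝟙≡0 s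
                      ; sep = λ u k → ¬true⇒false λ e′ → true≢false (∧-intro e′ (away-intro c)) (𝟙*𝟙≡0 k (∑≡0 {f = λ u → 𝟙 (kid u) * 𝟙 (E₁ σ u b ∧ away b)} r u))
                      ; w~y = ∧-elimˡ e ; easy = not-elim (∧-elimʳ {E₂ σ w y} e) }

      ψ′ : Fin N → ℕ
      ψ′ c = 𝟙 (c == w) + 𝟙 (E₂ σ w c) + ψ c

      flipped : Fin N × Fin N → Fin N × Fin N
      flipped p = proj₂ p , proj₁ p

      opaque
        chosenA : ∃ λ L → map proj₁ L ≡ us × All KidA L × All (Cheap σ κ) L × AllPairs (Compatible σ) L
        chosenA =
          let L , eq , cand , cheaps , pairs , _ = choose-cheap (swap σ) κ x us (elements-unique (easyᵃ a)) (All.tabulate λ h → a∈ (∧-elimˡ (elements⁻ (easyᵃ a) h)))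
                ψ′ (1 + 3 + 10) (∑-+≤ (∑-+≤ (≤-reflexive (count-point w)) d₂w) ∑ψ)
                (All.tabulate λ {u} h → ≤-trans (enough (length us) (subst (_≤ 3) (sym (elements-length (easyᵃ a))) (≤-trans (count-mono λ u h → ∧-elimˡ h) d₁a)))
                  (easy-x u (a∈ (∧-elimˡ (elements⁻ (easyᵃ a) h))) (not-elim (∧-elimʳ {E₁ σ a u} (elements⁻ (easyᵃ a) h)))))
          in map flipped L , trans (map-flip L) eq
           , AllP.map⁺ (All.zipWith (λ {p} ((c , z) , e) → make {p} c z e) (cand , seconds L eq (All.tabulate {P = λ u → easyᵃ a u ≡ true} (elements⁻ (easyᵃ a)))))
           , AllP.map⁺ (All.map (λ {p} c → cheap (Cheap.snd∈ c) (Cheap.fst∈ c) (Cheap.free c) (≤-trans (≤-reflexive (*-comm (d₁ σ (proj₂ p)) _)) (Cheap.cost c))) cheaps)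
           , AllPairsP.map⁺ (AllPairs.map (λ (n₁ , n₂ , o) → n₂ , n₁ , λ e e′ → o e′ e) pairs)
          where
          enough : ∀ l → l ≤ 3 → 1 + 3 + 10 + 601 * l ≤ 3000
          enough = linear 1 (λ l → (l ⊴ # 3) ∷ [] , (# 1 ⊕ # 3 ⊕ # 10 ⊕ 601 ⊗ l ⊴ # 3000)) 1 (601 ∷ [])
          map-flip : ∀ (L : Pairs N) → map proj₁ (map flipped L) ≡ map proj₂ L
          map-flip []      = refl
          map-flip (p ∷ L) = cong (proj₂ p ∷_) (map-flip L)
          make : ∀ {p} → Candidate (swap σ) κ x (proj₂ p) (proj₁ p) → ψ′ (proj₁ p) ≡ 0 → easyᵃ a (proj₂ p) ≡ true → KidA (flipped p)
          make {c , u} k z e =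
            let q , r = zero₂ (𝟙 (c == w) + 𝟙 (E₂ σ w c)) _ z
                s , t = zero₂ (𝟙 (c == w)) _ q
            in record { a~u = ∧-elimˡ e ; easy = not-elim (∧-elimʳ {E₁ σ a u} e) ; cand = k ; c≢w = ==-false⇒≢ (𝟙≡0 s) ; w≁c = 𝟙≡0 t ; ψc = r
                      ; cost = ≤-trans (≤-reflexive (*-comm (d₁ σ u) _)) (Candidate.cost k) }

      Lw = proj₁ chosenW
      La = proj₁ chosenA
      Lw-eq = proj₁ (proj₂ chosenW)
      La-eq = proj₁ (proj₂ chosenA)
      kidsW = proj₁ (proj₂ (proj₂ chosenW))
      kidsA = proj₁ (proj₂ (proj₂ chosenA))

      -- A costly u forces its partner to be isolated.
      no-conflict : ∀ {u c b y} → d₁ σ u * d₂ σ c ≤ κ → easyᵃ a u ≡ true → (kid u ≡ true → E₁ σ u b ≡ false) →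
                    E₁ σ b u ≡ true → E₂ σ y c ≡ true → ⊥
      no-conflict {u} {c} {b} {y} cost e sep bu yc with decide (d₁ σ u ≤ᵇ κ)
      ... | inj₁ t = true≢false bu (trans (sym₁ σ b u) (sep (∧-intro e t)))
      ... | inj₂ f = <⇒≱ (≤ᵇ-false⁻ {d₁ σ u} f) (≤-trans (≤-reflexive (sym (*-identityʳ _))) (≤-trans (*-monoʳ-≤ (d₁ σ u) (1≤count (E₂ σ c) {y} (trans (sym₂ σ c y) yc))) cost))

      compatible-WA : ∀ {p q} → KidW p → KidA q → Compatible σ p q
      compatible-WA {b , y} {u , c} W A′ =
          (λ { refl → true≢false A.a~u W.a≁b }) , (λ { refl → true≢false W.w~y A.w≁c })
        , λ e e′ → no-conflict A.cost (∧-intro A.a~u (not-intro A.easy)) (W.sep u) e e′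
        where
        module W = KidW W
        module A = KidA A′

      L₀ = Lw ++ La

      cheap₀ : All (Cheap σ κ) L₀
      cheap₀ = AllP.++⁺ (proj₁ (proj₂ (proj₂ (proj₂ chosenW)))) (proj₁ (proj₂ (proj₂ (proj₂ chosenA))))

      compatible₀ : AllPairs (Compatible σ) L₀
      compatible₀ = AllPairsP.++⁺ (proj₂ (proj₂ (proj₂ (proj₂ chosenW)))) (proj₂ (proj₂ (proj₂ (proj₂ chosenA))))
        (All.map (λ W → All.map (compatible-WA W) kidsA) kidsW)

      firsts-∈ : ∀ (L : Pairs N) {us u} → map proj₁ L ≡ us → u ∈ us → ¬ Avoidˡ L u
      firsts-∈ (p ∷ L) refl (here refl) (ne ∷ _)  = ne refl
      firsts-∈ (p ∷ L) refl (there h)   (_ ∷ nes) = firsts-∈ L refl h nes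

      #Lw : length Lw ≤ 1
      #Lw = subst (_≤ 1) (sym (trans (seconds-length Lw Lw-eq) (elements-length (easyʷ w)))) few

      #La : length La ≡ count (easyᵃ a)
      #La = trans (sym (length-map proj₁ La)) (trans (cong length La-eq) (elements-length (easyᵃ a)))

      v-off-W : Avoidˡ Lw v
      v-off-W = All.map (λ W → Candidate.b≢u (KidW.cand W)) kidsW
      v-off-A : Avoidˡ La v
      v-off-A = All.map (λ A′ → a≢u (KidA.a~u A′)) kidsA
      a-off-W : Avoidˡ Lw a
      a-off-W = All.map KidW.b≢a kidsW
      a-off-A : Avoidˡ La a
      a-off-A = All.map (λ A′ e → adjacent₁ σ (KidA.a~u A′) (sym e)) kidsA
      w-off-W : Avoidʳ Lw w
      w-off-W = All.map (λ W e → adjacent₂ σ (KidW.w~y W) (sym e)) kidsW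
      w-off-A : Avoidʳ La w
      w-off-A = All.map KidA.c≢w kidsA
      x-off-W : Avoidʳ Lw x
      x-off-W = All.map (λ W e → true≢false hx (subst (λ y → H y ≡ false) e (KidW.easy W))) kidsW
      x-off-A : Avoidʳ La x
      x-off-A = All.map (λ A′ → Candidate.b≢u (KidA.cand A′)) kidsA
      ax-W : All (λ p → E₁ σ a (proj₁ p) ≡ true → E₂ σ x (proj₂ p) ≡ true → ⊥) Lw
      ax-W = All.map (λ W e _ → true≢false e (KidW.a≁b W)) kidsW
      ax-A : All (λ p → E₁ σ a (proj₁ p) ≡ true → E₂ σ x (proj₂ p) ≡ true → ⊥) La
      ax-A = All.map (λ A′ _ e → true≢false e (Candidate.b≁u (KidA.cand A′))) kidsA
      vw-W : All (λ p → E₁ σ v (proj₁ p) ≡ true → E₂ σ w (proj₂ p) ≡ true → ⊥) Lw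
      vw-W = All.map (λ W e _ → true≢false e (Candidate.b≁u (KidW.cand W))) kidsW
      vw-A : All (λ p → E₁ σ v (proj₁ p) ≡ true → E₂ σ w (proj₂ p) ≡ true → ⊥) La
      vw-A = All.map (λ A′ _ e → true≢false e (KidA.w≁c A′)) kidsA

      cover-w : ∀ {y} → E₂ σ w y ≡ true → Avoidʳ Lw y → y ≡ x
      cover-w {y} e avoid with decide (H y)
      ... | inj₁ t = only y e t
      ... | inj₂ f = ⊥-elim (seconds-∈ Lw Lw-eq (elements⁺ (easyʷ w) (∧-intro e (not-intro f))) avoid)

      cover-a : ∀ {u} → E₁ σ a u ≡ true → Avoidˡ La u → H₁ u ≡ true
      cover-a {u} e avoid with decide (H₁ u)
      ... | inj₁ t = t
      ... | inj₂ f = ⊥-elim (firsts-∈ La La-eq (elements⁺ (easyᵃ a) (∧-intro e (not-intro f))) avoid)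

    start : Stage σ n D T (total σ)
    start = record { #A = #A ; #B = #B ; bounded = bounded ; weight = ≤-refl }

    ++-elimˡ : ∀ {P : Fin N × Fin N → Set} L {L′} → All P (L ++ L′) → All P L
    ++-elimˡ L = proj₁ ∘ AllP.++⁻ L
    ++-elimʳ : ∀ {P : Fin N × Fin N → Set} L {L′} → All P (L ++ L′) → All P L′
    ++-elimʳ L = proj₂ ∘ AllP.++⁻ L

    module Close₀ {w a : Fin N} (bel : Below w) (abv : Above a) where
      open Below bel
      open Above abv
      open Kids bel abv a (λ _ → 0) (≤-trans (≤-reflexive (∑-0 {N} λ _ → refl)) z≤n)
      F = after σ L₀ cheap₀ compatible₀
      module F = After F
      τ = placeAll L₀ σ
      ℓ = length L₀

      ℓ-def : ℓ ≡ length Lw + count (easyᵃ a)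
      ℓ-def = trans (length-++ Lw) (cong (length Lw +_) #La)

      size : ∀ l p q D n → l ≡ p + q → p ≤ 1 → q ≤ 3 → D + 139000 < n → l + 2 ≤ n
      size l p q D n h0 h1 h2 h3 =
        linear 5 (λ l p q D n → (l ⊴ p ⊕ q) ∷ (p ⊕ q ⊴ l) ∷ (p ⊴ # 1) ∷ (q ⊴ # 3) ∷ (# 1 ⊕ (D ⊕ # 139000) ⊴ n) ∷ [] , (l ⊕ # 2 ⊴ n)) 1 (1 ∷ 0 ∷ 1 ∷ 1 ∷ 1 ∷ []) l p q D n (≤-reflexive h0) (≤-reflexive (sym h0)) h1 h2 h3
      split = m≤n⇒∃[o]m+o≡n (size ℓ (length Lw) (count (easyᵃ a)) D n ℓ-def #Lw (≤-trans (count-mono λ u h → ∧-elimˡ h) d₁a) D-hi)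
      k = proj₁ split
      k-def : ℓ + suc (suc k) ≡ n
      k-def = trans (sym (+-assoc ℓ 2 k)) (proj₂ split)

      S : Stage τ (suc (suc k)) D (T + ℓ * κ) (total σ + 2 * (ℓ * κ))
      S = after-stage {L = L₀} (subst (λ m → Stage σ m D T (total σ)) (sym k-def) start) F

      k<n : ∀ l k n → l + (2 + k) ≡ n → k < n
      k<n l k n h0 =
        linear 3 (λ l k n → (l ⊕ (# 2 ⊕ k) ⊴ n) ∷ (n ⊴ l ⊕ (# 2 ⊕ k)) ∷ [] , (# 1 ⊕ k ⊴ n)) 1 (1 ∷ 0 ∷ []) l k n (≤-reflexive h0) (≤-reflexive (sym h0))
      module Z = Two hyp S (k<n ℓ k n k-def) a x v w (F.keepˡ aa (AllP.++⁺ a-off-W a-off-A)) (F.keepʳ (on₂ σ x w (trans (sym₂ σ x w) wx)) (AllP.++⁺ x-off-W x-off-A))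
        (F.clear nax (AllP.++⁺ ax-W ax-A)) (F.keepˡ av (AllP.++⁺ v-off-W v-off-A)) (F.keepʳ bw (AllP.++⁺ w-off-W w-off-A)) (F.clear nvw (AllP.++⁺ vw-W vw-A))
        (a≢v ∘ sym) (adjacent₂ σ wx) (¬true⇒false λ h → true≢false (proj₁ (F.edge₁ h)) nva)
        (λ y h → cover-w (proj₁ (F.edge₂ h)) (++-elimˡ Lw (proj₂ (F.edge₂ h))))

      v-kept = F.d₁≥ (AllP.++⁺ v-off-W v-off-A)

      -- All neighbours of `a` have been placed, so `a` is isolated when it goes on `x` and creates
      -- no edges.
      without-hard : (∀ u → E₁ σ a u ≡ true → H₁ u ≡ false) → Packing σ
      without-hard none = F.unplace (Z.closed
        (no-neighbour (λ u h → let e , avoid = F.edge₁ h in true≢false (cover-a e (++-elimʳ Lw avoid)) (none u e)))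
        (safe₁ D ℓ (length Lw) (count (easyᵃ a)) k n ℓ-def #Lw len D-hi k-def)
        (safe₃ T D (ℓ * κ) κ ℓ (length Lw) (count (easyᵃ a)) k n ℓ-def #Lw len ℓκ κ-small T-far k-def)
        (bud (total σ) (ℓ * κ) κ ℓ (length Lw) (count (easyᵃ a)) D T k n (d₁ τ v) (d₂ τ x) ℓ-def #Lw len ℓκ κ-small D-lo D-hi k-def
          (subst (_≤ d₁ τ v + ℓ) d₁v v-kept) budget))
        where
        len : count (easyᵃ a) ≤ 3
        len = ≤-trans (count-mono λ u h → ∧-elimˡ h) d₁a
        ℓκ : ℓ * κ ≤ 4 * κ
        ℓκ = *-monoˡ-≤ κ (≤-trans (≤-reflexive ℓ-def) (+-mono-≤ #Lw len))
        safe₁ : ∀ D l p q k n → l ≡ p + q → p ≤ 1 → q ≤ 3 → D + 139000 < n → l + (2 + k) ≡ n → D + 2 ≤ k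
        safe₁ D l p q k n h0 h1 h2 h3 h4 =
          linear 6 (λ D l p q k n → (l ⊴ p ⊕ q) ∷ (p ⊕ q ⊴ l) ∷ (p ⊴ # 1) ∷ (q ⊴ # 3) ∷ (# 1 ⊕ (D ⊕ # 139000) ⊴ n) ∷ (l ⊕ (# 2 ⊕ k) ⊴ n) ∷ (n ⊴ l ⊕ (# 2 ⊕ k)) ∷ [] , (D ⊕ # 2 ⊴ k)) 1 (1 ∷ 0 ∷ 1 ∷ 1 ∷ 1 ∷ 0 ∷ 1 ∷ []) D l p q k n (≤-reflexive h0) (≤-reflexive (sym h0)) h1 h2 h3 (≤-reflexive h4) (≤-reflexive (sym h4))
        safe₃ : ∀ T D z c l p q k n → l ≡ p + q → p ≤ 1 → q ≤ 3 → z ≤ 4 * c → 20 * c ≤ D → 3 * T + D + 400 < 3 * n → l + (2 + k) ≡ n → T + z + 1 ≤ k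
        safe₃ T D z c l p q k n h0 h1 h2 h3 h4 h5 h6 =
          linear 9 (λ T D z c l p q k n → (l ⊴ p ⊕ q) ∷ (p ⊕ q ⊴ l) ∷ (p ⊴ # 1) ∷ (q ⊴ # 3) ∷ (z ⊴ 4 ⊗ c) ∷ (20 ⊗ c ⊴ D) ∷ (# 1 ⊕ (3 ⊗ T ⊕ D ⊕ # 400) ⊴ 3 ⊗ n) ∷ (l ⊕ (# 2 ⊕ k) ⊴ n) ∷ (n ⊴ l ⊕ (# 2 ⊕ k)) ∷ [] , (T ⊕ z ⊕ # 1 ⊴ k)) 15 (15 ∷ 0 ∷ 15 ∷ 15 ∷ 15 ∷ 3 ∷ 5 ∷ 0 ∷ 15 ∷ []) T D z c l p q k n (≤-reflexive h0) (≤-reflexive (sym h0)) h1 h2 h3 h4 h5 (≤-reflexive h6) (≤-reflexive (sym h6))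
        bud : ∀ W z c l p q D T k n d e → l ≡ p + q → p ≤ 1 → q ≤ 3 → z ≤ 4 * c → 20 * c ≤ D → n < 700 * D → D + 139000 < n → l + (2 + k) ≡ n → D ≤ d + l → W + 2 * D + 2 * T + 836550 ≤ 6 * n → W + 2 * z + 2 * D + 2 * (T + z) + 836550 ≤ 6 * k + 2 * d + 2 * e
        bud W z c l p q D T k n d e h0 h1 h2 h3 h4 h5 h6 h7 h8 h9 =
          linear 12 (λ W z c l p q D T k n d e → (l ⊴ p ⊕ q) ∷ (p ⊕ q ⊴ l) ∷ (p ⊴ # 1) ∷ (q ⊴ # 3) ∷ (z ⊴ 4 ⊗ c) ∷ (20 ⊗ c ⊴ D) ∷ (# 1 ⊕ n ⊴ 700 ⊗ D) ∷ (# 1 ⊕ (D ⊕ # 139000) ⊴ n) ∷ (l ⊕ (# 2 ⊕ k) ⊴ n) ∷ (n ⊴ l ⊕ (# 2 ⊕ k)) ∷ (D ⊴ d ⊕ l) ∷ (W ⊕ 2 ⊗ D ⊕ 2 ⊗ T ⊕ # 836550 ⊴ 6 ⊗ n) ∷ [] , (W ⊕ 2 ⊗ z ⊕ 2 ⊗ D ⊕ 2 ⊗ (T ⊕ z) ⊕ # 836550 ⊴ 6 ⊗ k ⊕ 2 ⊗ d ⊕ 2 ⊗ e)) 10495 (83960 ∷ 0 ∷ 83960 ∷ 83960 ∷ 41980 ∷ 8396 ∷ 18 ∷ 0 ∷ 0 ∷ 62970 ∷ 20990 ∷ 10498 ∷ []) W z c l p q D T k n d e (≤-reflexive h0) (≤-reflexive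 (sym h0)) h1 h2 h3 h4 h5 h6 (≤-reflexive h7) (≤-reflexive (sym h7)) h8 h9

      -- The hard neighbour `v′` of `a` stays behind and gains up to `d₂ σ x ≤ 2 D / 3` edges. This
      -- costs `4 D / 3` of the `2 D` gained with `v`, and the rest pays for the cheap pairs.
      with-one : ∀ v′ → (∀ u → E₁ σ a u ≡ true → H₁ u ≡ true → u ≡ v′) → count (easyᵃ a) ≤ 1 → 3 * d₂ σ x ≤ 2 * D → T + D ≤ n → Packing σ
      with-one v′ only-v′ len d₂x TD = F.unplace (Z.open-end
        (one-neighbour v′ (λ u h → let e , avoid = F.edge₁ h in only-v′ u e (cover-a e (++-elimʳ Lw avoid))))
        (safe₁ D ℓ (length Lw) (count (easyᵃ a)) k n ℓ-def #Lw len D-hi k-def)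
        (safe₃ T D (ℓ * κ) κ ℓ (length Lw) (count (easyᵃ a)) k n (d₂ τ x) (d₂ σ x) ℓ-def #Lw len ℓκ κ-small (F.d₂≤ x) d₂x TD D-lo D-hi k-def)
        (bud (total σ) (ℓ * κ) κ ℓ (length Lw) (count (easyᵃ a)) D T k n (d₁ τ v) (d₂ τ x) (d₂ σ x) ℓ-def #Lw len ℓκ κ-small D-lo D-hi k-def
          (subst (_≤ d₁ τ v + ℓ) d₁v v-kept) (F.d₂≤ x) d₂x budget))
        where
        ℓκ : ℓ * κ ≤ 2 * κ
        ℓκ = *-monoˡ-≤ κ (≤-trans (≤-reflexive ℓ-def) (+-mono-≤ #Lw len))
        safe₁ : ∀ D l p q k n → l ≡ p + q → p ≤ 1 → q ≤ 1 → D + 139000 < n → l + (2 + k) ≡ n → D + 2 ≤ k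
        safe₁ D l p q k n h0 h1 h2 h3 h4 =
          linear 6 (λ D l p q k n → (l ⊴ p ⊕ q) ∷ (p ⊕ q ⊴ l) ∷ (p ⊴ # 1) ∷ (q ⊴ # 1) ∷ (# 1 ⊕ (D ⊕ # 139000) ⊴ n) ∷ (l ⊕ (# 2 ⊕ k) ⊴ n) ∷ (n ⊴ l ⊕ (# 2 ⊕ k)) ∷ [] , (D ⊕ # 2 ⊴ k)) 1 (1 ∷ 0 ∷ 1 ∷ 1 ∷ 1 ∷ 0 ∷ 1 ∷ []) D l p q k n (≤-reflexive h0) (≤-reflexive (sym h0)) h1 h2 h3 (≤-reflexive h4) (≤-reflexive (sym h4))
        safe₃ : ∀ T D z c l p q k n e f → l ≡ p + q → p ≤ 1 → q ≤ 1 → z ≤ 2 * c → 20 * c ≤ D → e ≤ f → 3 * f ≤ 2 * D → T + D ≤ n → n < 700 * D → D + 139000 < n → l + (2 + k) ≡ n → T + z + e + 2 ≤ k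
        safe₃ T D z c l p q k n e f h0 h1 h2 h3 h4 h5 h6 h7 h8 h9 h10 =
          linear 11 (λ T D z c l p q k n e f → (l ⊴ p ⊕ q) ∷ (p ⊕ q ⊴ l) ∷ (p ⊴ # 1) ∷ (q ⊴ # 1) ∷ (z ⊴ 2 ⊗ c) ∷ (20 ⊗ c ⊴ D) ∷ (e ⊴ f) ∷ (3 ⊗ f ⊴ 2 ⊗ D) ∷ (T ⊕ D ⊴ n) ∷ (# 1 ⊕ n ⊴ 700 ⊗ D) ∷ (# 1 ⊕ (D ⊕ # 139000) ⊴ n) ∷ (l ⊕ (# 2 ⊕ k) ⊴ n) ∷ (n ⊴ l ⊕ (# 2 ⊕ k)) ∷ [] , (T ⊕ z ⊕ e ⊕ # 2 ⊴ k)) 20970 (20970 ∷ 0 ∷ 20970 ∷ 20970 ∷ 20970 ∷ 2097 ∷ 20970 ∷ 6990 ∷ 20970 ∷ 7 ∷ 7 ∷ 0 ∷ 20970 ∷ []) T D z c l p q k n e f (≤-reflexive h0) (≤-reflexive (sym h0)) h1 h2 h3 h4 h5 h6 h7 h8 h9 (≤-reflexive h10) (≤-reflexive (sym h10))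
        bud : ∀ W z c l p q D T k n d e f → l ≡ p + q → p ≤ 1 → q ≤ 1 → z ≤ 2 * c → 20 * c ≤ D → n < 700 * D → D + 139000 < n → l + (2 + k) ≡ n → D ≤ d + l → e ≤ f → 3 * f ≤ 2 * D → W + 2 * D + 2 * T + 836550 ≤ 6 * n → W + 2 * z + 2 * D + 2 * (T + z + e + 1) + 836550 ≤ 6 * k + 2 * d
        bud W z c l p q D T k n d e f h0 h1 h2 h3 h4 h5 h6 h7 h8 h9 h10 h11 =
          linear 13 (λ W z c l p q D T k n d e f → (l ⊴ p ⊕ q) ∷ (p ⊕ q ⊴ l) ∷ (p ⊴ # 1) ∷ (q ⊴ # 1) ∷ (z ⊴ 2 ⊗ c) ∷ (20 ⊗ c ⊴ D) ∷ (# 1 ⊕ n ⊴ 700 ⊗ D) ∷ (# 1 ⊕ (D ⊕ # 139000) ⊴ n) ∷ (l ⊕ (# 2 ⊕ k) ⊴ n) ∷ (n ⊴ l ⊕ (# 2 ⊕ k)) ∷ (D ⊴ d ⊕ l) ∷ (e ⊴ f) ∷ (3 ⊗ f ⊴ 2 ⊗ D) ∷ (W ⊕ 2 ⊗ D ⊕ 2 ⊗ T ⊕ # 836550 ⊴ 6 ⊗ n) ∷ [] , (W ⊕ 2 ⊗ z ⊕ 2 ⊗ D ⊕ 2 ⊗ (T ⊕ z ⊕ e ⊕ # 1) ⊕ # 836550 ⊴ 6 ⊗ k ⊕ 2 ⊗ d)) 31485 (251880 ∷ 0 ∷ 251880 ∷ 251880 ∷ 125940 ∷ 12594 ∷ 12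 ∷ 0 ∷ 0 ∷ 188910 ∷ 62970 ∷ 62970 ∷ 20990 ∷ 31487 ∷ []) W z c l p q D T k n d e f (≤-reflexive h0) (≤-reflexive (sym h0)) h1 h2 h3 h4 h5 h6 (≤-reflexive h7) (≤-reflexive (sym h7)) h8 h9 h10 h11

-- Chains that also place the hard neighbour `v′` of `a`

module Third {N} {σ : State N} {n D T : ℕ} (X : Setting σ n D T) (Y : Hard X) where

  open Setting X
  open Hard Y
  open Chain X
  open At Y
  open Good G

  near : Pairs N → Fin N → ℕ
  near []      b = 0
  near (p ∷ L) b = (𝟙 (b == proj₁ p) + 𝟙 (E₁ σ (proj₁ p) b)) + near L b

  ∑near : ∀ L → All (λ p → d₁ σ (proj₁ p) ≤ 600) L → ∑ (near L) ≤ 601 * length L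
  ∑near []      []       = ≤-trans (≤-reflexive (∑-0 {N} λ _ → refl)) z≤n
  ∑near (p ∷ L) (h ∷ hs) = ≤-trans (∑-+≤ (∑-+≤ (≤-reflexive (count-point (proj₁ p))) h) (∑near L hs)) (≤-reflexive (sym (*-suc 601 (length L))))

  near-0 : ∀ L {b} → near L b ≡ 0 → All (λ p → proj₁ p ≢ b × E₁ σ (proj₁ p) b ≡ false) L
  near-0 []      _ = []
  near-0 (p ∷ L) {b} z =
    let q , r = zero₂ (𝟙 (b == proj₁ p) + 𝟙 (E₁ σ (proj₁ p) b)) _ z
        s , t = zero₂ (𝟙 (b == proj₁ p)) _ q
    in (==-false⇒≢ (𝟙≡0 s) ∘ sym , 𝟙≡0 t) ∷ near-0 L r

  record End (w v′ w′ : Fin N) : Set where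
    field
      bw′  : B σ w′ ≡ true
      nvw′ : E₃ σ v′ w′ ≡ false
      w≢w′ : w ≢ w′
      nww′ : E₂ σ w w′ ≡ false
      nxw′ : E₂ σ x w′ ≡ false
      x≢w′ : x ≢ w′
      d₂w′ : d₂ σ w′ ≤ 3
      -- A neighbour `y` of `w` of degree above `κ` gets an isolated partner, so only those of
      -- degree at most `κ` can interfere with `v′` on `w′`.
      sep′ : ∀ y → easyʷ w y ≡ true → d₂ σ y ≤ κ → E₂ σ y w′ ≡ false

  module Close {w a v′ w′ : Fin N} (bel : Below w) (abv : Above a) (av′ : E₁ σ a v′ ≡ true) (hv′ : H₁ v′ ≡ true)
               (only-v′ : ∀ u → E₁ σ a u ≡ true → H₁ u ≡ true → u ≡ v′) (few-a : count (easyᵃ a) ≤ 1)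
               (d₂x : 2 * D < 3 * d₂ σ x) (end : End w v′ w′) where
    open Below bel
    open Above abv
    open End end
    open Kids bel abv v′ (λ c → 𝟙 (c == w′) + 𝟙 (E₂ σ w′ c)) (≤-trans (∑-+≤ (≤-reflexive (count-point w′)) d₂w′) (m≤m+n 4 6))

    -- A common easy neighbour of `w` and `w′` is already placed together with those of `w`.
    pʸ : Fin N → Bool
    pʸ y = easyʷ w′ y ∧ not (E₂ σ w y)
    ys′ = elements pʸ

    φ′ : Fin N → ℕ
    φ′ b = 𝟙 (b == a) + 𝟙 (b == v) + 𝟙 (E₁ σ a b) + near Lw b + ∑ (λ u → 𝟙 (kid u) * 𝟙 (E₁ σ u b))

    ∑φ′ : ∑ φ′ ≤ 1 + 1 + 3 + 601 * 1 + 3 * κ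
    ∑φ′ = ∑-+≤ (∑-+≤ (∑-+≤ (∑-+≤ (≤-reflexive (count-point a)) (≤-reflexive (count-point v))) d₁a)
        (≤-trans (∑near Lw (All.map (λ W → Candidate.low (KidW.cand W)) kidsW)) (*-monoʳ-≤ 601 #Lw)))
        (∑∑-bound _ (≤-trans (∑-mono per-kid) (≤-trans (≤-reflexive (trans (∑-cong λ u → *-comm (𝟙 (kid u)) κ) (∑-* κ _))) (≤-trans (≤-reflexive (*-comm κ _)) (*-monoˡ-≤ κ #kid)))))
      where
      per-kid : ∀ u → ∑ (λ b → 𝟙 (kid u) * 𝟙 (E₁ σ u b)) ≤ 𝟙 (kid u) * κ
      per-kid u = ≤-trans (≤-reflexive (∑-* (𝟙 (kid u)) _)) (bound (kid u) refl)
        where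
        bound : ∀ c → kid u ≡ c → 𝟙 c * d₁ σ u ≤ 𝟙 c * κ
        bound false _ = z≤n
        bound true h  = *-monoʳ-≤ 1 (≤ᵇ-true⁻ (∧-elimʳ {easyᵃ a u} h))

    record KidE (p : Fin N × Fin N) : Set where
      field
        cand  : Candidate σ κ v′ (proj₂ p) (proj₁ p)
        b≢a   : proj₁ p ≢ a
        b≢v   : proj₁ p ≢ v
        a≁b   : E₁ σ a (proj₁ p) ≡ false
        apart : All (λ q → proj₁ q ≢ proj₁ p × E₁ σ (proj₁ q) (proj₁ p) ≡ false) Lw
        sep   : ∀ u → kid u ≡ true → E₁ σ u (proj₁ p) ≡ false
        w′~y  : E₂ σ w′ (proj₂ p) ≡ true
        easy  : H (proj₂ p) ≡ false
        w≁y   : E₂ σ w (proj₂ p) ≡ false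

    v′≢v : v′ ≢ v
    v′≢v = a≢u av′

    w′∈ : ∀ {y} → E₂ σ w′ y ≡ true → B σ y ≡ true
    w′∈ {y} h = on₂ σ y w′ (trans (sym₂ σ y w′) h)

    pʸ-elim : ∀ {y} → pʸ y ≡ true → E₂ σ w′ y ≡ true × H y ≡ false × E₂ σ w y ≡ false
    pʸ-elim {y} h = ∧-elimˡ {E₂ σ w′ y} e , not-elim (∧-elimʳ {E₂ σ w′ y} e) , not-elim (∧-elimʳ {easyʷ w′ y} h)
      where e = ∧-elimˡ {easyʷ w′ y} h

    opaque
      chosenE : ∃ λ L → map proj₂ L ≡ ys′ × All KidE L × All (Cheap σ κ) L × AllPairs (Compatible σ) L
      chosenE =
        let L , eq , cand , cheaps , pairs , _ = choose-cheap σ κ v′ ys′ (elements-unique pʸ) (All.tabulate λ h → w′∈ (proj₁ (pʸ-elim (elements⁻ pʸ h))))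
              φ′ (1 + 1 + 3 + 601 * 1 + 3 * κ) ∑φ′ (All.tabulate λ {y} h → ≤-trans (enough κ (length ys′) len)
                (easy-u v′ y (a∈ av′) v′≢v (w′∈ (proj₁ (pʸ-elim (elements⁻ pʸ h)))) (proj₁ (proj₂ (pʸ-elim (elements⁻ pʸ h))))))
        in L , eq , All.zipWith (λ {p} ((c , z) , e) → make c z e) (cand , seconds L eq (All.tabulate {P = λ y → pʸ y ≡ true} (elements⁻ pʸ))) , cheaps , pairs
        where
        len : length ys′ ≤ 3
        len = ≤-trans (≤-reflexive (elements-length pʸ)) (≤-trans (count-mono λ y h → proj₁ (pʸ-elim h)) d₂w′)
        enough : ∀ k l → l ≤ 3 → 1 + 1 + 3 + 601 * 1 + 3 * k + 601 * l ≤ 3 * k + 3000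
        enough = linear 2 (λ k l → (l ⊴ # 3) ∷ [] , (# 1 ⊕ # 1 ⊕ # 3 ⊕ 601 ⊗ # 1 ⊕ 3 ⊗ k ⊕ 601 ⊗ l ⊴ 3 ⊗ k ⊕ # 3000)) 1 (601 ∷ [])
        make : ∀ {p} → Candidate σ κ v′ (proj₂ p) (proj₁ p) → φ′ (proj₁ p) ≡ 0 → pʸ (proj₂ p) ≡ true → KidE p
        make {b , y} c z e =
          let q₁ , r₁ = zero₂ (𝟙 (b == a) + 𝟙 (b == v) + 𝟙 (E₁ σ a b) + near Lw b) _ z
              q₂ , r₂ = zero₂ (𝟙 (b == a) + 𝟙 (b == v) + 𝟙 (E₁ σ a b)) _ q₁
              q₃ , r₃ = zero₂ (𝟙 (b == a) + 𝟙 (b == v)) _ q₂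
              q₄ , r₄ = zero₂ (𝟙 (b == a)) _ q₃
          in record { cand = c ; b≢a = ==-false⇒≢ (𝟙≡0 q₄) ; b≢v = ==-false⇒≢ (𝟙≡0 r₄) ; a≁b = 𝟙≡0 r₃ ; apart = near-0 Lw r₂
                    ; sep = λ u k → 𝟙*𝟙≡0 k (∑≡0 {f = λ u → 𝟙 (kid u) * 𝟙 (E₁ σ u b)} r₁ u)
                    ; w′~y = proj₁ (pʸ-elim e) ; easy = proj₁ (proj₂ (pʸ-elim e)) ; w≁y = proj₂ (proj₂ (pʸ-elim e)) }

    Le = proj₁ chosenE
    Le-eq = proj₁ (proj₂ chosenE)
    kidsE = proj₁ (proj₂ (proj₂ chosenE))

    compatible-WE : ∀ {p q} → KidW p → proj₁ p ≢ proj₁ q × E₁ σ (proj₁ p) (proj₁ q) ≡ false → KidE q → Compatible σ p q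
    compatible-WE W (ne , e) E′ = ne , (λ { refl → true≢false (KidW.w~y W) (KidE.w≁y E′) }) , λ e′ _ → true≢false e′ e

    compatible-AE : ∀ {p q} → KidA p → KidE q → Compatible σ p q
    compatible-AE {u , c} {b , y} A′ E′ =
        (λ { refl → true≢false (KidA.a~u A′) (KidE.a≁b E′) })
      , (λ { refl → true≢false (KidE.w′~y E′) (𝟙≡0 (proj₂ (zero₂ (𝟙 (c == w′)) _ (KidA.ψc A′)))) })
      , λ e e′ → no-conflict {y = y} (KidA.cost A′) (∧-intro (KidA.a~u A′) (not-intro (KidA.easy A′))) (KidE.sep E′ u)
                   (trans (sym₁ σ b u) e) (trans (sym₂ σ y c) e′)

    L = L₀ ++ Le

    transposed : ∀ {P : Fin N × Fin N → Fin N × Fin N → Set} {ps qs} → All (λ q → All (λ p → P p q) ps) qs → All (λ p → All (P p) qs) ps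
    transposed {ps = []}     h = []
    transposed {ps = p ∷ ps} h = All.map (λ { (x ∷ _) → x }) h ∷ transposed (All.map (λ { (_ ∷ xs) → xs }) h)

    cheapL : All (Cheap σ κ) L
    cheapL = AllP.++⁺ cheap₀ (proj₁ (proj₂ (proj₂ (proj₂ chosenE))))

    compatibleL : AllPairs (Compatible σ) L
    compatibleL = AllPairsP.++⁺ compatible₀ (proj₂ (proj₂ (proj₂ (proj₂ chosenE))))
      (AllP.++⁺ (transposed (All.map (λ E′ → All.zipWith (λ (W , ne) → compatible-WE W ne E′) (kidsW , KidE.apart E′)) kidsE))
                (All.map (λ A′ → All.map (compatible-AE A′) kidsE) kidsA))

    ℓ = length L
    F = after σ L cheapL compatibleL
    module F = After F
    τ = placeAll L σ

    on-all : ∀ {P : Fin N × Fin N → Set} → All P Lw → All P La → All P Le → All P L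
    on-all p q r = AllP.++⁺ (AllP.++⁺ p q) r

    v-off = on-all v-off-W v-off-A (All.map KidE.b≢v kidsE)

    x-off : Avoidʳ L x
    x-off = on-all x-off-W x-off-A (All.map (λ E′ e → true≢false hx (subst (λ y → H y ≡ false) e (KidE.easy E′))) kidsE)

    w′-kids : All (λ p → E₁ σ v′ (proj₁ p) ≡ true → E₂ σ w′ (proj₂ p) ≡ true → ⊥) L
    w′-kids = on-all (All.map apart-W kidsW)
        (All.map (λ {p} A′ _ e → true≢false e (𝟙≡0 (proj₂ (zero₂ (𝟙 (proj₂ p == w′)) _ (KidA.ψc A′))))) kidsA)
        (All.map (λ E′ e _ → true≢false e (Candidate.b≁u (KidE.cand E′))) kidsE)
      where
      apart-W : ∀ {p} → KidW p → E₁ σ v′ (proj₁ p) ≡ true → E₂ σ w′ (proj₂ p) ≡ true → ⊥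
      apart-W {b , y} W e e′ with d₂ σ y ≤? κ
      ... | yes le = true≢false (trans (sym₂ σ y w′) e′) (sep′ y (∧-intro (KidW.w~y W) (not-intro (KidW.easy W))) le)
      ... | no gt  = gt (≤-trans (≤-reflexive (sym (*-identityˡ _))) (≤-trans (*-monoˡ-≤ (d₂ σ y) (1≤count (E₁ σ b) {v′} (trans (sym₁ σ b v′) e))) (Candidate.cost (KidW.cand W))))

    left-over : ∀ {y} → E₂ τ w′ y ≡ true → E₂ σ w′ y ≡ true × H y ≡ true
    left-over {y} h with F.edge₂ h | decide (H y) | decide (E₂ σ w y)
    ... | e , _     | inj₁ t | _      = e , t
    ... | e , avoid | inj₂ f | inj₁ s = ⊥-elim (seconds-∈ Lw Lw-eq (elements⁺ (easyʷ w) (∧-intro s (not-intro f))) (++-elimˡ Lw (++-elimˡ L₀ avoid)))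
    ... | e , avoid | inj₂ f | inj₂ s = ⊥-elim (seconds-∈ Le Le-eq (elements⁺ pʸ (∧-intro (∧-intro e (not-intro f)) (not-intro s))) (++-elimʳ L₀ avoid))

    ℓ-def : ℓ ≡ length Lw + count (easyᵃ a) + count pʸ
    ℓ-def = trans (length-++ L₀) (cong₂ _+_ (trans (length-++ Lw) (cong (length Lw +_) #La)) (trans (seconds-length Le Le-eq) (elements-length pʸ)))

    #pʸ : count pʸ ≤ 3
    #pʸ = ≤-trans (count-mono λ y h → proj₁ (pʸ-elim h)) d₂w′

    size : ∀ l p q r D n → l ≡ p + q + r → p ≤ 1 → q ≤ 1 → r ≤ 3 → D + 139000 < n → l + 4 ≤ n
    size l p q r D n h0 h1 h2 h3 h4 =
      linear 6 (λ l p q r D n → (l ⊴ p ⊕ q ⊕ r) ∷ (p ⊕ q ⊕ r ⊴ l) ∷ (p ⊴ # 1) ∷ (q ⊴ # 1) ∷ (r ⊴ # 3) ∷ (# 1 ⊕ (D ⊕ # 139000) ⊴ n) ∷ [] , (l ⊕ # 4 ⊴ n)) 1 (1 ∷ 0 ∷ 1 ∷ 1 ∷ 1 ∷ 1 ∷ []) l p q r D n (≤-reflexive h0) (≤-reflexive (sym h0)) h1 h2 h3 h4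
    split = m≤n⇒∃[o]m+o≡n (size ℓ (length Lw) (count (easyᵃ a)) (count pʸ) D n ℓ-def #Lw few-a #pʸ D-hi)
    -- A successor, so that its predecessor can cap a bound on G₃-degrees that must stay below `k`.
    k : ℕ
    k = suc (proj₁ split)
    k-def : ℓ + suc (suc (suc k)) ≡ n
    k-def = trans (sym (+-assoc ℓ 4 (proj₁ split))) (proj₂ split)

    S : Stage τ (suc (suc (suc k))) D (T + ℓ * κ) (total σ + 2 * (ℓ * κ))
    S = after-stage {L = L} (subst (λ m → Stage σ m D T (total σ)) (sym k-def) start) F

    k<n : ∀ l k n → l + (3 + k) ≡ n → k < n
    k<n l k n h0 =
      linear 3 (λ l k n → (l ⊕ (# 3 ⊕ k) ⊴ n) ∷ (n ⊴ l ⊕ (# 3 ⊕ k)) ∷ [] , (# 1 ⊕ k ⊴ n)) 1 (1 ∷ 0 ∷ []) l k n (≤-reflexive h0) (≤-reflexive (sym h0))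
    safe₁ : ∀ D l p q r k n → l ≡ p + q + r → p ≤ 1 → q ≤ 1 → r ≤ 3 → D + 139000 < n → l + (3 + k) ≡ n → D + 2 ≤ k
    safe₁ D l p q r k n h0 h1 h2 h3 h4 h5 =
      linear 7 (λ D l p q r k n → (l ⊴ p ⊕ q ⊕ r) ∷ (p ⊕ q ⊕ r ⊴ l) ∷ (p ⊴ # 1) ∷ (q ⊴ # 1) ∷ (r ⊴ # 3) ∷ (# 1 ⊕ (D ⊕ # 139000) ⊴ n) ∷ (l ⊕ (# 3 ⊕ k) ⊴ n) ∷ (n ⊴ l ⊕ (# 3 ⊕ k)) ∷ [] , (D ⊕ # 2 ⊴ k)) 1 (1 ∷ 0 ∷ 1 ∷ 1 ∷ 1 ∷ 1 ∷ 0 ∷ 1 ∷ []) D l p q r k n (≤-reflexive h0) (≤-reflexive (sym h0)) h1 h2 h3 h4 (≤-reflexive h5) (≤-reflexive (sym h5))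
    module Z = Three hyp S (k<n ℓ k n k-def) v′ w′ a x v w
      (F.keepˡ (a∈ av′) (on-all (All.map KidW.b≢z kidsW) (All.map (λ A′ e → true≢false hv′ (subst (λ u → H₁ u ≡ false) e (KidA.easy A′))) kidsA) (All.map (λ E′ → Candidate.b≢u (KidE.cand E′)) kidsE)))
      (F.keepʳ bw′ (on-all (All.map (λ W e → true≢false (subst (λ y → E₂ σ w y ≡ true) e (KidW.w~y W)) nww′) kidsW)
                           (All.map (λ {p} A′ → ==-false⇒≢ (𝟙≡0 (proj₁ (zero₂ (𝟙 (proj₂ p == w′)) _ (KidA.ψc A′))))) kidsA)
                           (All.map (λ E′ e → adjacent₂ σ (KidE.w′~y E′) (sym e)) kidsE)))
      (F.clear nvw′ w′-kids)
      (F.keepˡ aa (on-all a-off-W a-off-A (All.map KidE.b≢a kidsE)))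
      (F.keepʳ (on₂ σ x w (trans (sym₂ σ x w) wx)) x-off)
      (F.clear nax (on-all ax-W ax-A (All.map (λ E′ e _ → true≢false e (KidE.a≁b E′)) kidsE)))
      (F.keepˡ av v-off)
      (F.keepʳ bw (on-all w-off-W w-off-A (All.map (λ E′ e → true≢false (subst (λ y → E₂ σ w′ y ≡ true) e (KidE.w′~y E′)) (trans (sym₂ σ w′ w) nww′)) kidsE)))
      (F.clear nvw (on-all vw-W vw-A (All.map (λ E′ _ e → true≢false e (KidE.w≁y E′)) kidsE)))
      (v′≢v ∘ sym) (a≢v ∘ sym) (adjacent₁ σ av′) w≢w′ (adjacent₂ σ wx) x≢w′
      (¬true⇒false λ h → true≢false (proj₁ (F.edge₁ h)) nva)
      (¬true⇒false λ h → true≢false (proj₁ (F.edge₂ h)) nww′)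
      (¬true⇒false λ h → true≢false (proj₁ (F.edge₂ h)) nxw′)
      (λ y h → cover-w (proj₁ (F.edge₂ h)) (++-elimˡ Lw (++-elimˡ L₀ (proj₂ (F.edge₂ h)))))
      (λ u h → only-v′ u (proj₁ (F.edge₁ h)) (cover-a (proj₁ (F.edge₁ h)) (++-elimʳ Lw (++-elimˡ L₀ (proj₂ (F.edge₁ h))))))
      (safe₁ D ℓ (length Lw) (count (easyᵃ a)) (count pʸ) k n ℓ-def #Lw few-a #pʸ D-hi k-def)

    v-kept : D ≤ d₁ τ v + ℓ
    v-kept = subst (_≤ d₁ τ v + ℓ) d₁v (F.d₁≥ v-off)
    x-kept : d₂ σ x ≤ d₂ τ x + ℓ
    x-kept = F.d₂≥ x-off

    no-hard : (∀ y → E₂ σ w′ y ≡ true → H y ≡ false) → Packing σ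
    no-hard none = F.unplace (Z.closed (no-neighbour (λ y h → let e , t = left-over h in true≢false t (none y e)))
        (safe₃ T D (ℓ * κ) κ ℓ (length Lw) (count (easyᵃ a)) (count pʸ) k n ℓ-def #Lw few-a #pʸ ℓκ κ-small T-far k-def)
        (bud (total σ) (ℓ * κ) κ ℓ (length Lw) (count (easyᵃ a)) (count pʸ) D T k n (d₁ τ v) (d₂ τ x) (d₂ σ x) ℓ-def #Lw few-a #pʸ ℓκ κ-small D-lo D-hi k-def v-kept x-kept d₂x budget))
      where
      ℓκ : ℓ * κ ≤ 5 * κ
      ℓκ = *-monoˡ-≤ κ (≤-trans (≤-reflexive ℓ-def) (+-mono-≤ (+-mono-≤ #Lw few-a) #pʸ))
      safe₃ : ∀ T D z c l p q r k n → l ≡ p + q + r → p ≤ 1 → q ≤ 1 → r ≤ 3 → z ≤ 5 * c → 20 * c ≤ D → 3 * T + D + 400 < 3 * n → l + (3 + k) ≡ n → T + z + 1 ≤ k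
      safe₃ T D z c l p q r k n h0 h1 h2 h3 h4 h5 h6 h7 =
        linear 10 (λ T D z c l p q r k n → (l ⊴ p ⊕ q ⊕ r) ∷ (p ⊕ q ⊕ r ⊴ l) ∷ (p ⊴ # 1) ∷ (q ⊴ # 1) ∷ (r ⊴ # 3) ∷ (z ⊴ 5 ⊗ c) ∷ (20 ⊗ c ⊴ D) ∷ (# 1 ⊕ (3 ⊗ T ⊕ D ⊕ # 400) ⊴ 3 ⊗ n) ∷ (l ⊕ (# 3 ⊕ k) ⊴ n) ∷ (n ⊴ l ⊕ (# 3 ⊕ k)) ∷ [] , (T ⊕ z ⊕ # 1 ⊴ k)) 12 (12 ∷ 0 ∷ 12 ∷ 12 ∷ 12 ∷ 12 ∷ 3 ∷ 4 ∷ 0 ∷ 12 ∷ []) T D z c l p q r k n (≤-reflexive h0) (≤-reflexive (sym h0)) h1 h2 h3 h4 h5 h6 (≤-reflexive h7) (≤-reflexive (sym h7))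
      bud : ∀ W z c l p q r D T k n d e f → l ≡ p + q + r → p ≤ 1 → q ≤ 1 → r ≤ 3 → z ≤ 5 * c → 20 * c ≤ D → n < 700 * D → D + 139000 < n → l + (3 + k) ≡ n → D ≤ d + l → f ≤ e + l → 2 * D < 3 * f → W + 2 * D + 2 * T + 836550 ≤ 6 * n → W + 2 * z + 2 * D + 2 * (T + z) + 836550 + 2 ≤ 6 * k + 2 * d + 2 * e
      bud W z c l p q r D T k n d e f h0 h1 h2 h3 h4 h5 h6 h7 h8 h9 h10 h11 h12 =
        linear 14 (λ W z c l p q r D T k n d e f → (l ⊴ p ⊕ q ⊕ r) ∷ (p ⊕ q ⊕ r ⊴ l) ∷ (p ⊴ # 1) ∷ (q ⊴ # 1) ∷ (r ⊴ # 3) ∷ (z ⊴ 5 ⊗ c) ∷ (20 ⊗ c ⊴ D) ∷ (# 1 ⊕ n ⊴ 700 ⊗ D) ∷ (# 1 ⊕ (D ⊕ # 139000) ⊴ n) ∷ (l ⊕ (# 3 ⊕ k) ⊴ n) ∷ (n ⊴ l ⊕ (# 3 ⊕ k)) ∷ (D ⊴ d ⊕ l) ∷ (f ⊴ e ⊕ l) ∷ (# 1 ⊕ 2 ⊗ D ⊴ 3 ⊗ f) ∷ (W ⊕ 2 ⊗ D ⊕ 2 ⊗ T ⊕ # 836550 ⊴ 6 ⊗ n) ∷ [] , (W ⊕ 2 ⊗ z ⊕ 2 ⊗ D ⊕ 2 ⊗ (T ⊕ z) ⊕ # 836550 ⊕ # 2 ⊴ 6 ⊗ k ⊕ 2 ⊗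 d ⊕ 2 ⊗ e)) 12594 (125940 ∷ 0 ∷ 125940 ∷ 125940 ∷ 125940 ∷ 50376 ∷ 12594 ∷ 42 ∷ 0 ∷ 0 ∷ 75564 ∷ 25188 ∷ 25188 ∷ 8396 ∷ 12601 ∷ []) W z c l p q r D T k n d e f (≤-reflexive h0) (≤-reflexive (sym h0)) h1 h2 h3 h4 h5 h6 h7 (≤-reflexive h8) (≤-reflexive (sym h8)) h9 h10 h11 h12

    -- `w′` keeps one neighbour, `x″`, which gains up to `d₁ σ v′ ≤ D` edges; `safe-x″` keeps it
    -- below the order. The price of about `2 D` is met by `2 D + 2 * d₂ σ x`, because
    -- `2 D < 3 * d₂ σ x`.
    one-hard : ∀ x″ → (∀ y → E₂ σ w′ y ≡ true → H y ≡ true → y ≡ x″) → count (easyʷ w′) ≤ 1 →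
               d₃ʳ σ x″ + d₁ σ v′ + 3 * κ + 8 ≤ n → Packing σ
    one-hard x″ only-x″ few-w′ safe-x″ = F.unplace (Z.open-end T′
        (one-neighbour x″ (λ y h → let e , t = left-over h in only-x″ y e t))
        (λ u → ⊓-glb (≤-trans (+-monoˡ-≤ 1 (≤-trans (F.d₃ˡ≤ u) (+-mono-≤ (Δ₃ˡ u) ℓκ))) (+-monoˡ-≤ 1 (m≤m+n (T + 3 * κ) D)))
                     (cool _ (d₃ˡ σ u) (≤-trans (F.d₃ˡ≤ u) (+-monoʳ-≤ (d₃ˡ σ u) ℓκ)) (Δ₃ˡ u)))
        (λ y → heat y (decide (E₂ τ y w′)))
        (≤-trans (≤-reflexive (+-comm T′ 1)) (s≤s (m⊓n≤n (T + 3 * κ + D + 1) (proj₁ split))))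
        (bud (total σ) (ℓ * κ) κ ℓ (length Lw) (count (easyᵃ a)) (count pʸ) D T k n (d₁ τ v) (d₂ τ x) (d₂ σ x) T′ ℓ-def #Lw few-a #pʸ′ ℓκ κ-small D-lo D-hi k-def v-kept x-kept d₂x
          (m⊓n≤m (T + 3 * κ + D + 1) (proj₁ split)) budget))
      where
      #pʸ′ : count pʸ ≤ 1
      #pʸ′ = ≤-trans (count-mono λ y h → ∧-elimˡ {easyʷ w′ y} h) few-w′
      ℓ≤3 : ℓ ≤ 3
      ℓ≤3 = ≤-trans (≤-reflexive ℓ-def) (+-mono-≤ (+-mono-≤ #Lw few-a) #pʸ′)
      ℓκ : ℓ * κ ≤ 3 * κ
      ℓκ = *-monoˡ-≤ κ ℓ≤3
      T′ : ℕ
      T′ = (T + 3 * κ + D + 1) ⊓ proj₁ split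
      cool-lin : ∀ y x T D c l k n → y ≤ x + 3 * c → x ≤ T → 20 * c ≤ D → 3 * T + D + 400 < 3 * n → l ≤ 3 → l + (4 + k) ≡ n → y + 1 ≤ k
      cool-lin y x T D c l k n h0 h1 h2 h3 h4 h5 =
        linear 8 (λ y x T D c l k n → (y ⊴ x ⊕ 3 ⊗ c) ∷ (x ⊴ T) ∷ (20 ⊗ c ⊴ D) ∷ (# 1 ⊕ (3 ⊗ T ⊕ D ⊕ # 400) ⊴ 3 ⊗ n) ∷ (l ⊴ # 3) ∷ (l ⊕ (# 4 ⊕ k) ⊴ n) ∷ (n ⊴ l ⊕ (# 4 ⊕ k)) ∷ [] , (y ⊕ # 1 ⊴ k)) 60 (60 ∷ 60 ∷ 9 ∷ 20 ∷ 60 ∷ 0 ∷ 60 ∷ []) y x T D c l k n h0 h1 h2 h3 h4 (≤-reflexive h5) (≤-reflexive (sym h5))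
      safe-lin : ∀ y x d c l k n → y ≤ x + 3 * c → x + d + 3 * c + 8 ≤ n → l ≤ 3 → l + (4 + k) ≡ n → y + d ≤ k
      safe-lin y x d c l k n h0 h1 h2 h3 =
        linear 7 (λ y x d c l k n → (y ⊴ x ⊕ 3 ⊗ c) ∷ (x ⊕ d ⊕ 3 ⊗ c ⊕ # 8 ⊴ n) ∷ (l ⊴ # 3) ∷ (l ⊕ (# 4 ⊕ k) ⊴ n) ∷ (n ⊴ l ⊕ (# 4 ⊕ k)) ∷ [] , (y ⊕ d ⊴ k)) 1 (1 ∷ 1 ∷ 1 ∷ 0 ∷ 1 ∷ []) y x d c l k n h0 h1 h2 (≤-reflexive h3) (≤-reflexive (sym h3))
      bud : ∀ W z c l p q r D T k n d e f t → l ≡ p + q + r → p ≤ 1 → q ≤ 1 → r ≤ 1 → z ≤ 3 * c → 20 * c ≤ D → n < 700 * D → D + 139000 < n → l + (3 + k) ≡ n → D ≤ d + l → f ≤ e + l → 2 * D < 3 * f → t ≤ T + 3 * c + D + 1 → W + 2 * D + 2 * T + 836550 ≤ 6 * n → W + 2 * z + 2 * D + 2 * t + 836550 + 2 ≤ 6 * k + 2 * d + 2 * e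
      bud W z c l p q r D T k n d e f t h0 h1 h2 h3 h4 h5 h6 h7 h8 h9 h10 h11 h12 h13 =
        linear 15 (λ W z c l p q r D T k n d e f t → (l ⊴ p ⊕ q ⊕ r) ∷ (p ⊕ q ⊕ r ⊴ l) ∷ (p ⊴ # 1) ∷ (q ⊴ # 1) ∷ (r ⊴ # 1) ∷ (z ⊴ 3 ⊗ c) ∷ (20 ⊗ c ⊴ D) ∷ (# 1 ⊕ n ⊴ 700 ⊗ D) ∷ (# 1 ⊕ (D ⊕ # 139000) ⊴ n) ∷ (l ⊕ (# 3 ⊕ k) ⊴ n) ∷ (n ⊴ l ⊕ (# 3 ⊕ k)) ∷ (D ⊴ d ⊕ l) ∷ (f ⊴ e ⊕ l) ∷ (# 1 ⊕ 2 ⊗ D ⊴ 3 ⊗ f) ∷ (t ⊴ T ⊕ 3 ⊗ c ⊕ D ⊕ # 1) ∷ (W ⊕ 2 ⊗ D ⊕ 2 ⊗ T ⊕ # 836550 ⊴ 6 ⊗ n) ∷ [] , (W ⊕ 2 ⊗ z ⊕ 2 ⊗ D ⊕ 2 ⊗ t ⊕ # 836550 ⊕ # 2 ⊴ 6 ⊗ k ⊕ 2 ⊗ d ⊕ 2 ⊗ e)) 62970 (629700 ∷ 0 ∷ 629700 ∷ 629700 ∷ 629700 ∷ 125940 ∷ 37782 ∷ 66 ∷ 0 ∷ 0 ∷ 377820 ∷ 125940 ∷ 125940 ∷ 41980 ∷ 125940 ∷ 62981 ∷ []) W z c l p q r D T k n d e f t (≤-reflexive h0) (≤-reflexive (sym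 h0)) h1 h2 h3 h4 h5 h6 h7 (≤-reflexive h8) (≤-reflexive (sym h8)) h9 h10 h11 h12 h13
      cool : ∀ y x → y ≤ x + 3 * κ → x ≤ T → y + 1 ≤ proj₁ split
      cool y x h h′ = cool-lin y x T D κ ℓ (proj₁ split) n h h′ κ-small T-far ℓ≤3 k-def
      heat : ∀ y → E₂ τ y w′ ≡ true ⊎ E₂ τ y w′ ≡ false → d₃ʳ τ y + 𝟙 (E₂ τ y w′) * d₁ τ v′ ≤ T′
      heat y (inj₂ f) = ≤-trans (≤-reflexive (trans (cong (λ b → d₃ʳ τ y + 𝟙 b * d₁ τ v′) f) (+-identityʳ _)))
        (⊓-glb (≤-trans (≤-trans (F.d₃ʳ≤ y) (+-mono-≤ (Δ₃ʳ y) ℓκ)) (≤-trans (m≤m+n (T + 3 * κ) D) (m≤m+n _ 1)))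
               (≤-trans (m≤m+n _ 1) (cool _ (d₃ʳ σ y) (≤-trans (F.d₃ʳ≤ y) (+-monoʳ-≤ (d₃ʳ σ y) ℓκ)) (Δ₃ʳ y))))
      heat y (inj₁ t) = ≤-trans (≤-reflexive (trans (cong (λ b → d₃ʳ τ y + 𝟙 b * d₁ τ v′) t) (cong (d₃ʳ τ y +_) (*-identityˡ _))))
        (⊓-glb (≤-trans (+-mono-≤ (≤-trans (F.d₃ʳ≤ y) (+-mono-≤ (Δ₃ʳ y) ℓκ)) (≤-trans (F.d₁≤ v′) (Δ₁ v′))) (m≤m+n (T + 3 * κ + D) 1))
               (≤-trans (+-monoʳ-≤ (d₃ʳ τ y) (F.d₁≤ v′)) (safe-lin (d₃ʳ τ y) (d₃ʳ σ y) (d₁ σ v′) κ ℓ (proj₁ split) n (≤-trans (F.d₃ʳ≤ y) (+-monoʳ-≤ (d₃ʳ σ y) ℓκ))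
                  (subst (λ z → d₃ʳ σ z + d₁ σ v′ + 3 * κ + 8 ≤ n) (sym is-x″) safe-x″) ℓ≤3 k-def)))
        where
        is-x″ : y ≡ x″
        is-x″ = let e , h = left-over (trans (sym₂ τ w′ y) t) in only-x″ y e h

-- Counting vertices by degree plus number of hard neighbours

∑-2* : ∀ {N} {p q : Fin N → Bool} c → ∑ (λ x → c * 𝟙 (p x) + c * 𝟙 (q x)) ≡ c * count p + c * count q
∑-2* {p = p} {q} c = trans (∑-+ (λ x → c * 𝟙 (p x)) _) (cong₂ _+_ (∑-* c (λ x → 𝟙 (p x))) (∑-* c (λ x → 𝟙 (q x))))

module Load {N} (B : Fin N → Bool) (E : Fin N → Fin N → Bool) (E-sym : ∀ x y → E x y ≡ E y x) (H : Fin N → Bool) where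

  deg hard load : Fin N → ℕ
  deg  w = count (E w)
  hard w = count (λ y → E w y ∧ H y)
  load w = hard w + deg w

  nice bad : Fin N → Bool
  nice w = (B w ∧ not (H w)) ∧ (load w ≤ᵇ 3)
  bad  w = (B w ∧ not (H w)) ∧ (4 ≤ᵇ load w)

  ∑-hard : ∑ hard ≡ ∑ (λ y → 𝟙 (H y) * deg y)
  ∑-hard = trans (∑-swap (λ w y → 𝟙 (E w y ∧ H y))) (∑-cong λ y → trans (∑-cong λ w → pt (H y) (E-sym w y)) (∑-* (𝟙 (H y)) (λ w → 𝟙 (E y w))))
    where
    pt : ∀ h {e e′} → e ≡ e′ → 𝟙 (e ∧ h) ≡ 𝟙 h * 𝟙 e′
    pt true  {true}  refl = refl
    pt true  {false} refl = refl
    pt false {true}  refl = refl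
    pt false {false} refl = refl

  -- Summed over all vertices, `hard` gives the degrees of the vertices in `H`. Restricting the load
  -- to the others omits exactly these degrees, so the total stays within the degree sum.
  ∑-load : ∑ (λ w → 𝟙 (not (H w)) * load w) ≤ ∑ deg
  ∑-load = begin
    ∑ (λ w → 𝟙 (not (H w)) * load w)                          ≤⟨ ∑-mono (λ w → pt (not (H w)) (hard w) (deg w)) ⟩
    ∑ (λ w → hard w + 𝟙 (not (H w)) * deg w)                  ≡⟨ ∑-+ hard _ ⟩
    ∑ hard + ∑ (λ w → 𝟙 (not (H w)) * deg w)                  ≡⟨ cong (_+ ∑ (λ w → 𝟙 (not (H w)) * deg w)) ∑-hard ⟩
    ∑ (λ w → 𝟙 (H w) * deg w) + ∑ (λ w → 𝟙 (not (H w)) * deg w) ≡⟨ sym (∑-+ (λ w → 𝟙 (H w) * deg w) (λ w → 𝟙 (not (H w)) * deg w)) ⟩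
    ∑ (λ w → 𝟙 (H w) * deg w + 𝟙 (not (H w)) * deg w)         ≡⟨ ∑-cong (λ w → whole (H w) (deg w)) ⟩
    ∑ deg                                                     ∎
    where
    open ≤-Reasoning
    pt : ∀ b s d → 𝟙 b * (s + d) ≤ s + 𝟙 b * d
    pt true  s d = ≤-reflexive (trans (+-identityʳ _) (cong (s +_) (sym (+-identityʳ d))))
    pt false s d = z≤n
    whole : ∀ b d → 𝟙 b * d + 𝟙 (not b) * d ≡ d
    whole true  d = trans (+-identityʳ _) (+-identityʳ d)
    whole false d = +-identityʳ d

  -- Vertices outside `H` and `R` bring load 2 and bad ones load 4; the members of `H` and `R` are
  -- charged separately.
  blocked₂ : ∀ R → (∀ w → B w ≡ true → H w ≡ false → R w ≡ false → 2 ≤ load w) →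
             2 * count B + 2 * count bad ≤ ∑ deg + (2 * count H + 2 * count R)
  blocked₂ R two = ≤-trans (≤-reflexive (sym (∑-2* 2))) (≤-trans (∑-mono (λ w → pt w (B w) (H w) (R w) (load w) refl refl refl refl)) (∑-+≤ ∑-load (≤-reflexive (∑-2* 2))))
    where
    pt : ∀ w b h r l → B w ≡ b → H w ≡ h → R w ≡ r → load w ≡ l →
         2 * 𝟙 b + 2 * 𝟙 ((b ∧ not h) ∧ (4 ≤ᵇ l)) ≤ 𝟙 (not h) * l + (2 * 𝟙 h + 2 * 𝟙 r)
    pt w false h r l _ _ _ _ = z≤n
    pt w true true r l _ _ _ _ = s≤s (s≤s z≤n)
    pt w true false r l eb eh er el with decide (4 ≤ᵇ l)
    ... | inj₁ t rewrite t = ≤-trans (≤ᵇ-true⁻ {4} {l} t) (≤-trans (m≤m+n l 0) (m≤m+n (l + 0) _))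
    pt w true false true l eb eh er el | inj₂ f rewrite f = m≤n+m 2 (l + 0)
    pt w true false false l eb eh er el | inj₂ f rewrite f = ≤-trans (subst (2 ≤_) el (two w eb eh er)) (≤-trans (m≤m+n l 0) (m≤m+n (l + 0) 0))

  blocked₄ : ∀ R → (∀ w → B w ≡ true → H w ≡ false → R w ≡ false → 4 ≤ load w) →
             4 * count B ≤ ∑ deg + (4 * count H + 4 * count R)
  blocked₄ R four = ≤-trans (≤-reflexive (sym (∑-* 4 (λ w → 𝟙 (B w))))) (≤-trans (∑-mono (λ w → pt w (B w) (H w) (R w) (load w) refl refl refl refl)) (∑-+≤ ∑-load (≤-reflexive (∑-2* 4))))
    where
    pt : ∀ w b h r l → B w ≡ b → H w ≡ h → R w ≡ r → load w ≡ l → 4 * 𝟙 b ≤ 𝟙 (not h) * l + (4 * 𝟙 h + 4 * 𝟙 r)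
    pt w false h r l _ _ _ _ = z≤n
    pt w true true r l _ _ _ _ = s≤s (s≤s (s≤s (s≤s z≤n)))
    pt w true false true l eb eh er el = m≤n+m 4 (l + 0)
    pt w true false false l eb eh er el = ≤-trans (subst (4 ≤_) el (four w eb eh er)) (≤-trans (m≤m+n l 0) (m≤m+n (l + 0) 0))

  sorted : count B ≤ count nice + count bad + count H
  sorted = ≤-trans (∑-mono (λ w → pt (B w) (H w) (load w))) (∑-+≤ (≤-reflexive (∑-+ _ _)) ≤-refl)
    where
    pt : ∀ b h l → 𝟙 b ≤ 𝟙 ((b ∧ not h) ∧ (l ≤ᵇ 3)) + 𝟙 ((b ∧ not h) ∧ (4 ≤ᵇ l)) + 𝟙 h
    pt false h l = z≤n
    pt true true l = s≤s z≤n
    pt true false l with decide (l ≤ᵇ 3)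
    ... | inj₁ t rewrite t = s≤s z≤n
    ... | inj₂ f rewrite f | ≤ᵇ-true (≤ᵇ-false⁻ {l} {3} f) = ≤-refl

  hard≤deg : ∀ w → hard w ≤ deg w
  hard≤deg w = count-mono λ y → ∧-elimˡ

  easy+hard : ∀ w → count (λ y → E w y ∧ not (H y)) + hard w ≡ deg w
  easy+hard w = trans (sym (∑-+ _ _)) (∑-cong λ y → pt (E w y) (H y))
    where
    pt : ∀ e h → 𝟙 (e ∧ not h) + 𝟙 (e ∧ h) ≡ 𝟙 e
    pt false h = refl
    pt true true = refl
    pt true false = refl

  no-hard : ∀ {w} → hard w ≡ 0 → ∀ y → E w y ≡ true → H y ≡ false
  no-hard {w} z y e = ¬true⇒false λ h → true≢false (∧-intro e h) (count-zero z y)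

  one-hard : ∀ {w} → hard w ≤ 1 → ∀ {x y} → E w x ≡ true → H x ≡ true → E w y ≡ true → H y ≡ true → y ≡ x
  one-hard {w} le {x} {y} ex hx ey hy = help (y ≟ᶠ x)
    where
    help : Dec (y ≡ x) → y ≡ x
    help (yes e) = e
    help (no ne) = ⊥-elim (<⇒≱ (s≤s le) (≤-trans (≤-reflexive (cong₂ (λ a b → 𝟙 a + 𝟙 b) (sym (∧-intro ey hy)) (sym (∧-intro ex hx)))) (two-point (λ z → 𝟙 (E w z ∧ H z)) ne)))

  nice-elim : ∀ {w} → nice w ≡ true → B w ≡ true × H w ≡ false × load w ≤ 3
  nice-elim {w} h = ∧-elimˡ p , not-elim (∧-elimʳ {B w} p) , ≤ᵇ-true⁻ (∧-elimʳ {B w ∧ not (H w)} h)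
    where p = ∧-elimˡ {B w ∧ not (H w)} h

  light-deg : ∀ {w} → load w ≤ 3 → deg w ≤ 3
  light-deg {w} h = ≤-trans (m≤n+m (deg w) (hard w)) h

  -- Two hard neighbours count twice each and would already make the load 4.
  light-hard : ∀ {w} → load w ≤ 3 → hard w ≤ 1
  light-hard {w} h = lin (hard w) (deg w) h (hard≤deg w)
    where
    few : ∀ s d → s + d ≤ 3 → s ≤ d → 2 ≤ s → 1 ≤ 0
    few = linear 2 (λ s d → (s ⊕ d ⊴ # 3) ∷ (s ⊴ d) ∷ (# 2 ⊴ s) ∷ [] , (# 1 ⊴ # 0)) 0 (1 ∷ 1 ∷ 2 ∷ [])
    lin : ∀ s d → s + d ≤ 3 → s ≤ d → s ≤ 1
    lin s d p q = ≮⇒≥ λ lt → impossible (few s d p q lt)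

  light-easy : ∀ {w} → load w ≤ 3 → 1 ≤ hard w → count (λ y → E w y ∧ not (H y)) ≤ 1
  light-easy {w} h pos = lin (count (λ y → E w y ∧ not (H y))) (hard w) (deg w) (easy+hard w) h pos
    where
    lin : ∀ e s d → e + s ≡ d → s + d ≤ 3 → 1 ≤ s → e ≤ 1
    lin e s d h0 h1 h2 =
      linear 3 (λ e s d → (e ⊕ s ⊴ d) ∷ (d ⊴ e ⊕ s) ∷ (s ⊕ d ⊴ # 3) ∷ (# 1 ⊴ s) ∷ [] , (e ⊴ # 1)) 1 (1 ∷ 0 ∷ 1 ∷ 2 ∷ []) e s d (≤-reflexive h0) (≤-reflexive (sym h0)) h1 h2

  weightless : ∀ {w} → load w ≤ 1 → hard w ≡ 0 × deg w ≤ 1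
  weightless {w} h = lin (hard w) (deg w) h (hard≤deg w) , ≤-trans (m≤n+m (deg w) (hard w)) h
    where
    lin : ∀ s d → s + d ≤ 1 → s ≤ d → s ≡ 0
    lin zero    d p q = refl
    lin (suc s) (suc d) (s≤s p) q = ⊥-elim (<⇒≱ (≤-trans (s≤s z≤n) (m≤n+m (suc d) s)) p)

-- Selecting the chain

record Tame {N} {σ : State N} {n D T : ℕ} (X : Setting σ n D T) (x : Fin N) : Set where
  open Setting X
  field
    H₁     : Fin N → Bool
    #H₁    : count H₁ ≤ 132000
    easy-x : ∀ u → A σ u ≡ true → H₁ u ≡ false → 3000 ≤ count (candidate (swap σ) κ x u)
    spread : ∀ u → A σ u ≡ true → u ≢ v → H₁ u ≡ false → d₁ σ u ≤ κ → count (λ b → E₁ σ u b ∧ away b) ≤ M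

module Select {N} {σ : State N} {n D T : ℕ} (X : Setting σ n D T) (#H : count (Setting.H X) ≤ 132000) where

  open Setting X
  open Good G
  open Chain X
  module L₂ = Load (B σ) (E₂ σ) (sym₂ σ) H

  Guarded : Set
  Guarded = ∀ w → B σ w ≡ true → E₃ σ v w ≡ false → d₂ σ w ≤ 3 → 1 ≤ L₂.hard w

  guarded : Packing σ ⊎ Guarded
  guarded with search (λ w → (B σ w ∧ not (E₃ σ v w)) ∧ ((d₂ σ w ≤ᵇ 3) ∧ (L₂.hard w ≤ᵇ 0)))
  ... | inj₁ (w , h) = inj₁ (unblocked w (∧-elimˡ p) (not-elim (∧-elimʳ {B σ w} p)) (≤ᵇ-true⁻ (∧-elimˡ q))
          (L₂.no-hard (n≤0⇒n≡0 (≤ᵇ-true⁻ (∧-elimʳ {d₂ σ w ≤ᵇ 3} q)))))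
    where
    p = ∧-elimˡ {B σ w ∧ not (E₃ σ v w)} h
    q = ∧-elimʳ {B σ w ∧ not (E₃ σ v w)} h
  ... | inj₂ none = inj₂ λ w bw nvw few → ≤ᵇ-false⁻ (¬true⇒false λ t →
          true≢false (∧-intro (∧-intro bw (not-intro nvw)) (∧-intro (≤ᵇ-true few) t)) (none w))

  module _ (guard : Guarded) (tame : ∀ x → B σ x ≡ true → Tame X x) where

    guarded-load : ∀ w → B σ w ≡ true → H w ≡ false → E₃ σ v w ≡ false → 2 ≤ L₂.load w
    guarded-load w bw _ nvw with d₂ σ w ≤? 3
    ... | yes few = let s = guard w bw nvw few in +-mono-≤ s (≤-trans s (L₂.hard≤deg w))
    ... | no many = ≤-trans (≤-trans (s≤s (s≤s z≤n)) (≰⇒> many)) (m≤n+m _ (L₂.hard w))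

    ∑₂ : 2 * n + 2 * count L₂.bad ≤ m₂ σ + (2 * count H + 2 * d₃ˡ σ v)
    ∑₂ = subst (λ c → 2 * c + 2 * count L₂.bad ≤ m₂ σ + (2 * count H + 2 * d₃ˡ σ v)) #B (L₂.blocked₂ (E₃ σ v) guarded-load)

    module Under (x : Fin N) (bx : B σ x ≡ true) (tx : Tame X x) (hx : H x ≡ true) where

      open Tame tx
      module L₁ = Load (A σ) (E₁ σ) (sym₁ σ) H₁

      Y : Hard X
      Y = record { x = x ; hx = hx ; H₁ = H₁ ; easy-x = easy-x ; spread = spread }

      open At Y
      open Third X Y using (End; module Close)

      Stuck : Set
      Stuck = ∀ a → A σ a ≡ true → H₁ a ≡ false → E₃ σ a x ≡ false → 2 ≤ L₁.load a

      below : ∀ w → L₂.nice w ≡ true → E₃ σ v w ≡ false → E₂ σ w x ≡ true → Below w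
      below w h nvw wx = let bw , _ , le = L₂.nice-elim h in record
        { bw = bw ; nvw = nvw ; wx = wx ; d₂w = L₂.light-deg {w} le
        ; only = λ y e hy → L₂.one-hard (L₂.light-hard {w} le) wx hx e hy
        ; few = L₂.light-easy {w} le (1≤count (λ y → E₂ σ w y ∧ H y) (∧-intro wx hx)) }

      -- If `v` were adjacent to `a`, it would not be in `H₁` and would have a candidate `c` with
      -- respect to `x`. Cost at most `κ < D` makes `c` isolated, and an isolated vertex that misses
      -- `v` contradicts the guard. Degree 1 also distinguishes `a` from `v`.
      off-v : ∀ a → H₁ a ≡ false → L₁.hard a ≡ 0 → d₁ σ a ≤ 1 → a ≢ v × E₁ σ v a ≡ false
      off-v a h z few = ≢v , ¬true⇒false λ va →
        let v-easy = L₁.no-hard z v (trans (sym₁ σ a v) va)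
            c , hc = nonempty (candidate (swap σ) κ x v) (≤-trans (s≤s z≤n) (easy-x v av v-easy))
            open Candidate (candidate-elim (swap σ) κ x v c hc)
            alone = no-cost (d₂ σ c) (subst (λ d → d₂ σ c * d ≤ κ) d₁v cost)
        in <⇒≱ (≤-trans (guard c b∈ b≁y (≤-trans (≤-reflexive alone) z≤n)) (L₂.hard≤deg c)) (≤-reflexive alone)
        where
        small : ∀ D n → n < 700 * D → D + 139000 < n → D ≤ 1 → 1 ≤ 0
        small = linear 2 (λ D n → (# 1 ⊕ n ⊴ 700 ⊗ D) ∷ (# 1 ⊕ (D ⊕ # 139000) ⊴ n) ∷ (D ⊴ # 1) ∷ [] , (# 1 ⊴ # 0)) 0 (1 ∷ 1 ∷ 699 ∷ [])
        costly : ∀ D n k z → n < 700 * D → D + 139000 < n → 20 * k ≤ D → D + z ≤ k → 1 ≤ 0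
        costly = linear 4 (λ D n k z → (# 1 ⊕ n ⊴ 700 ⊗ D) ∷ (# 1 ⊕ (D ⊕ # 139000) ⊴ n) ∷ (20 ⊗ k ⊴ D) ∷ (D ⊕ z ⊴ k) ∷ [] , (# 1 ⊴ # 0)) 0 (19 ∷ 19 ∷ 699 ∷ 13980 ∷ [])
        ≢v : a ≢ v
        ≢v refl = impossible (small D n D-lo D-hi (subst (_≤ 1) d₁v few))
        no-cost : ∀ d → d * D ≤ κ → d ≡ 0
        no-cost zero    _  = refl
        no-cost (suc d) le = impossible (costly D n κ (d * D) D-lo D-hi κ-small le)

      stuck : ∀ w → Below w → Packing σ ⊎ Stuck
      stuck w bel with search (λ a → (A σ a ∧ not (H₁ a)) ∧ (not (E₃ σ a x) ∧ (L₁.load a ≤ᵇ 1)))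
      ... | inj₁ (a , h) =
        let p = ∧-elimˡ {A σ a ∧ not (H₁ a)} h
            q = ∧-elimʳ {A σ a ∧ not (H₁ a)} h
            z , few = L₁.weightless (≤ᵇ-true⁻ (∧-elimʳ {not (E₃ σ a x)} q))
            ne , nva = off-v a (not-elim (∧-elimʳ {A σ a} p)) z few
        in inj₁ (Close₀.without-hard bel (record { aa = ∧-elimˡ p ; a≢v = ne ; nva = nva ; nax = not-elim (∧-elimˡ q) ; d₁a = ≤-trans few (s≤s z≤n) })
                   (L₁.no-hard z))
      ... | inj₂ none = inj₂ λ a aa h nax → ≤ᵇ-false⁻ (¬true⇒false λ t →
              true≢false (∧-intro (∧-intro aa (not-intro h)) (∧-intro (not-intro nax) t)) (none a))

      ∑₁ : Stuck → 2 * n + 2 * count L₁.bad ≤ m₁ σ + (2 * count H₁ + 2 * d₃ʳ σ x)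
      ∑₁ st = subst (λ c → 2 * c + 2 * count L₁.bad ≤ m₁ σ + (2 * count H₁ + 2 * d₃ʳ σ x)) #A (L₁.blocked₂ (λ a → E₃ σ a x) st)

      key-lin : ∀ n a b c D T b₁ b₂ h h₁ e d i → 2 * n + 2 * b₁ ≤ a + (2 * h₁ + 2 * e) → 2 * n + 2 * b₂ ≤ b + (2 * h + 2 * d) → e + d ≤ c + i → i ≤ 1 → a + b + 2 * c + 2 * D + 2 * T + 836550 ≤ 6 * n → b₁ + b₂ + D + T + 418274 ≤ n + h + h₁
      key-lin = linear 13 (λ n a b c D T b₁ b₂ h h₁ e d i → (2 ⊗ n ⊕ 2 ⊗ b₁ ⊴ a ⊕ (2 ⊗ h₁ ⊕ 2 ⊗ e)) ∷ (2 ⊗ n ⊕ 2 ⊗ b₂ ⊴ b ⊕ (2 ⊗ h ⊕ 2 ⊗ d)) ∷ (e ⊕ d ⊴ c ⊕ i) ∷ (i ⊴ # 1) ∷ (a ⊕ b ⊕ 2 ⊗ c ⊕ 2 ⊗ D ⊕ 2 ⊗ T ⊕ # 836550 ⊴ 6 ⊗ n) ∷ [] , (b₁ ⊕ b₂ ⊕ D ⊕ T ⊕ # 418274 ⊴ n ⊕ h ⊕ h₁)) 2 (1 ∷ 1 ∷ 2 ∷ 2 ∷ 1 ∷ [])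

      -- Load at least 2 on both sides makes each of `m₁` and `m₂` about `2 n`, apart from hard
      -- vertices and the vertices joined to `x` or to `v`. The latter are counted by `m₃` with one
      -- possible overlap. What is left of the budget bounds the bad vertices, `D` and `T` together.
      key : Stuck → count L₁.bad + count L₂.bad + D + T + 418274 ≤ n + count H + count H₁
      key st = key-lin n (m₁ σ) (m₂ σ) (m₃ σ) D T (count L₁.bad) (count L₂.bad) (count H) (count H₁) (d₃ʳ σ x) (d₃ˡ σ v) (𝟙 (E₃ σ v x))
        (∑₁ st) ∑₂ (d₃-crossing σ v x) (𝟙≤1 (E₃ σ v x)) budget

      -- From 418274 the bound 132000 is lost once for `H₁` and twice for `H`, since `sorted`
      -- excludes the hard vertices again; 22274 remains.
      nice₂-lin : Stuck → D + T + 22273 < count L₂.nice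
      nice₂-lin st = lin n D T (count L₁.bad) (count L₂.bad) (count H) (count H₁) (count L₂.nice) (subst (_≤ count L₂.nice + count L₂.bad + count H) #B L₂.sorted) #H #H₁ (key st)
        where
        lin : ∀ n D T b₁ b₂ h h₁ c → n ≤ c + b₂ + h → h ≤ 132000 → h₁ ≤ 132000 → b₁ + b₂ + D + T + 418274 ≤ n + h + h₁ → D + T + 22273 < c
        lin = linear 8 (λ n D T b₁ b₂ h h₁ c → (n ⊴ c ⊕ b₂ ⊕ h) ∷ (h ⊴ # 132000) ∷ (h₁ ⊴ # 132000) ∷ (b₁ ⊕ b₂ ⊕ D ⊕ T ⊕ # 418274 ⊴ n ⊕ h ⊕ h₁) ∷ [] , (# 1 ⊕ (D ⊕ T ⊕ # 22273) ⊴ c)) 1 (1 ∷ 2 ∷ 1 ∷ 1 ∷ [])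

      class : Fin N → Bool
      class w = L₂.nice w ∧ E₂ σ x w

      -- `thin` leaves at least half of the nice vertices nonadjacent to `x`, and `w′` is sought
      -- among them.
      module Climb (st : Stuck) (thin : 2 * count class ≤ count L₂.nice) (w : Fin N) (bel : Below w) where

        open Below bel using (d₂w)

        a-pick : ∃ λ a → L₁.nice a ≡ true × 𝟙 (E₃ σ a x) + (𝟙 (E₁ σ v a) + 𝟙 (a == v)) ≡ 0
        a-pick = pick L₁.nice (λ a → 𝟙 (E₃ σ a x) + (𝟙 (E₁ σ v a) + 𝟙 (a == v)))
          (≤-<-trans (∑-+≤ (Δ₃ʳ x) (∑-+≤ (Δ₁ v) (≤-reflexive (count-point v))))
            (lin n D T (count L₁.bad) (count L₂.bad) (count H) (count H₁) (count L₁.nice) (subst (_≤ count L₁.nice + count L₁.bad + count H₁) #A L₁.sorted) #H #H₁ (key st)))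
          where
          lin : ∀ n D T b₁ b₂ h h₁ c → n ≤ c + b₁ + h₁ → h ≤ 132000 → h₁ ≤ 132000 → b₁ + b₂ + D + T + 418274 ≤ n + h + h₁ → T + (D + 1) < c
          lin = linear 8 (λ n D T b₁ b₂ h h₁ c → (n ⊴ c ⊕ b₁ ⊕ h₁) ∷ (h ⊴ # 132000) ∷ (h₁ ⊴ # 132000) ∷ (b₁ ⊕ b₂ ⊕ D ⊕ T ⊕ # 418274 ⊴ n ⊕ h ⊕ h₁) ∷ [] , (# 1 ⊕ (T ⊕ (D ⊕ # 1)) ⊴ c)) 1 (1 ∷ 1 ∷ 2 ∷ 1 ∷ [])

        with-a : ∀ a → L₁.nice a ≡ true → E₃ σ a x ≡ false → E₁ σ v a ≡ false → a ≢ v → Packing σ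
        with-a a na nax nva a≢v = split (zero-or-positive (L₁.hard a))
          where
          facts = L₁.nice-elim {a} na
          load≤3 = proj₂ (proj₂ facts)
          abv : Above a
          abv = record { aa = proj₁ facts ; a≢v = a≢v ; nva = nva ; nax = nax ; d₁a = L₁.light-deg {a} load≤3 }

          module _ (v′ : Fin N) (av′ : E₁ σ a v′ ≡ true) (hv′ : H₁ v′ ≡ true) (one : 1 ≤ L₁.hard a) (large : 2 * D < 3 * d₂ σ x) where

            only-v′ : ∀ u → E₁ σ a u ≡ true → H₁ u ≡ true → u ≡ v′
            only-v′ u e h = L₁.one-hard (L₁.light-hard {a} load≤3) av′ hv′ e h

            v≢v′ : v ≢ v′
            v≢v′ refl = true≢false av′ (trans (sym₁ σ a v) nva)

            kid : Fin N → Bool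
            kid z = easyʷ w z ∧ (d₂ σ z ≤ᵇ κ)

            avoid : Fin N → ℕ
            avoid y = 𝟙 (E₃ σ v′ y) + 𝟙 (class y) + 𝟙 (y == w) + 𝟙 (E₂ σ w y) + ∑ (λ z → 𝟙 (kid z) * 𝟙 (E₂ σ z y))

            ∑avoid : ∑ avoid ≤ d₃ˡ σ v′ + count class + 1 + 3 + κ
            ∑avoid = ∑-+≤ (∑-+≤ (∑-+≤ (∑-+≤ {f = λ y → 𝟙 (E₃ σ v′ y)} ≤-refl ≤-refl) (≤-reflexive (count-point w))) d₂w)
              (∑∑-bound _ (≤-trans (∑-mono per-kid) (≤-trans (≤-reflexive (trans (∑-cong λ u → *-comm (𝟙 (kid u)) κ) (∑-* κ _)))
                (≤-trans (*-monoʳ-≤ κ (≤-trans (count-mono λ z → ∧-elimˡ) (Below.few bel))) (≤-reflexive (*-identityʳ κ))))))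
              where
              per-kid : ∀ z → ∑ (λ y → 𝟙 (kid z) * 𝟙 (E₂ σ z y)) ≤ 𝟙 (kid z) * κ
              per-kid z = ≤-trans (≤-reflexive (∑-* (𝟙 (kid z)) _)) (bound (kid z) refl)
                where
                bound : ∀ c → kid z ≡ c → 𝟙 c * d₂ σ z ≤ 𝟙 c * κ
                bound false _ = z≤n
                bound true h  = *-monoʳ-≤ 1 (≤ᵇ-true⁻ (∧-elimʳ {easyʷ w z} h))

            -- If `T < κ`, the term in G₃ and `κ` itself are negligible, and `thin` leaves half of
            -- more than `D + T` nice vertices. If `κ ≤ T`, the class has at most `D` members, and
            -- the edges of G₃ at `v`, `v′` and `x` are counted jointly in `m₃`.
            room : d₃ˡ σ v′ + count class + 1 + 3 + κ < count L₂.nice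
            room with κ ≤? T
            ... | no few = room-few D T κ n (count class) (count L₂.nice) (d₃ˡ σ v′) (nice₂-lin st) thin (Δ₃ˡ v′) (≰⇒> few) κ-small
              where
              room-few : ∀ D T k n q c f → D + T + 22273 < c → 2 * q ≤ c → f ≤ T → T < k → 20 * k ≤ D → f + q + 1 + 3 + k < c
              room-few = linear 7 (λ D T k n q c f → (# 1 ⊕ (D ⊕ T ⊕ # 22273) ⊴ c) ∷ (2 ⊗ q ⊴ c) ∷ (f ⊴ T) ∷ (# 1 ⊕ T ⊴ k) ∷ (20 ⊗ k ⊴ D) ∷ [] , (# 1 ⊕ (f ⊕ q ⊕ # 1 ⊕ # 3 ⊕ k) ⊴ c)) 40 (20 ∷ 20 ∷ 40 ∷ 20 ∷ 3 ∷ [])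
            ... | yes many = room-many n (m₁ σ) (m₂ σ) (m₃ σ) D T κ (count L₁.bad) (count L₂.bad) (count H) (count H₁) (d₃ʳ σ x) (d₃ˡ σ v) (d₃ˡ σ v′) (count class) (count L₂.nice)
                (∑₁ st) ∑₂ (subst (λ m → d₃ˡ σ v + d₃ˡ σ v′ + d₃ʳ σ x ≤ m + 2) (m₃-swap σ) (d₃-crossing₂ (swap σ) x v≢v′)) budget
                (subst (_≤ count L₂.nice + count L₂.bad + count H) #B L₂.sorted) #H #H₁ (≤-trans (count-mono λ y → ∧-elimʳ {L₂.nice y}) (Δ₂ x)) many
              where
              room-many : ∀ n a b c D T k b₁ b₂ h h₁ e d f q r → 2 * n + 2 * b₁ ≤ a + (2 * h₁ + 2 * e) → 2 * n + 2 * b₂ ≤ b + (2 * h + 2 * d) → d + f + e ≤ c + 2 → a + b + 2 * c + 2 * D + 2 * T + 836550 ≤ 6 * n → n ≤ r + b₂ + h → h ≤ 132000 → h₁ ≤ 132000 → q ≤ D → k ≤ T → f + q + 1 + 3 + k < r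
              room-many = linear 16 (λ n a b c D T k b₁ b₂ h h₁ e d f q r → (2 ⊗ n ⊕ 2 ⊗ b₁ ⊴ a ⊕ (2 ⊗ h₁ ⊕ 2 ⊗ e)) ∷ (2 ⊗ n ⊕ 2 ⊗ b₂ ⊴ b ⊕ (2 ⊗ h ⊕ 2 ⊗ d)) ∷ (d ⊕ f ⊕ e ⊴ c ⊕ # 2) ∷ (a ⊕ b ⊕ 2 ⊗ c ⊕ 2 ⊗ D ⊕ 2 ⊗ T ⊕ # 836550 ⊴ 6 ⊗ n) ∷ (n ⊴ r ⊕ b₂ ⊕ h) ∷ (h ⊴ # 132000) ∷ (h₁ ⊴ # 132000) ∷ (q ⊴ D) ∷ (k ⊴ T) ∷ [] , (# 1 ⊕ (f ⊕ q ⊕ # 1 ⊕ # 3 ⊕ k) ⊴ r)) 2 (1 ∷ 1 ∷ 2 ∷ 1 ∷ 2 ∷ 4 ∷ 2 ∷ 2 ∷ 2 ∷ [])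

            -- The budget bounds the two degrees by about `2 n - 2 D - T`. Averaging with the bounds
            -- `T` and `D` leaves about `n - D / 2`, and `D / 2` exceeds `3 κ`.
            safe : ∀ x″ → d₃ʳ σ x″ + d₁ σ v′ + 3 * κ + 8 ≤ n
            safe x″ = lin n (m₁ σ) (m₂ σ) (m₃ σ) D T κ (count L₂.bad) (count H) (d₃ˡ σ v) (d₃ʳ σ x″) (d₁ σ v′) (𝟙 (E₃ σ v x″))
              (subst (λ d → 2 * d₁ σ v′ + 2 * d ≤ m₁ σ + 2) d₁v (other-degrees σ (v≢v′ ∘ sym))) ∑₂ (d₃-crossing σ v x″) (𝟙≤1 (E₃ σ v x″)) budget #H (Δ₃ʳ x″) (Δ₁ v′) κ-small
              where
              lin : ∀ n a b c D T k b₂ h d e f i → 2 * f + 2 * D ≤ a + 2 → 2 * n + 2 * b₂ ≤ b + (2 * h + 2 * d) → e + d ≤ c + i → i ≤ 1 → a + b + 2 * c + 2 * D + 2 * T + 836550 ≤ 6 * n → h ≤ 132000 → e ≤ T → f ≤ D → 20 * k ≤ D → e + f + 3 * k + 8 ≤ n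
              lin = linear 13 (λ n a b c D T k b₂ h d e f i → (2 ⊗ f ⊕ 2 ⊗ D ⊴ a ⊕ # 2) ∷ (2 ⊗ n ⊕ 2 ⊗ b₂ ⊴ b ⊕ (2 ⊗ h ⊕ 2 ⊗ d)) ∷ (e ⊕ d ⊴ c ⊕ i) ∷ (i ⊴ # 1) ∷ (a ⊕ b ⊕ 2 ⊗ c ⊕ 2 ⊗ D ⊕ 2 ⊗ T ⊕ # 836550 ⊴ 6 ⊗ n) ∷ (h ⊴ # 132000) ∷ (e ⊴ T) ∷ (f ⊴ D) ∷ (20 ⊗ k ⊴ D) ∷ [] , (e ⊕ f ⊕ 3 ⊗ k ⊕ # 8 ⊴ n)) 20 (5 ∷ 5 ∷ 10 ∷ 10 ∷ 5 ∷ 10 ∷ 10 ∷ 10 ∷ 3 ∷ [])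

            extend : Packing σ
            extend =
              let w′ , nw′ , z = pick L₂.nice avoid (≤-<-trans ∑avoid room)
                  p₁ , q₁ = zero₂ (𝟙 (E₃ σ v′ w′) + 𝟙 (class w′) + 𝟙 (w′ == w) + 𝟙 (E₂ σ w w′)) _ z
                  p₂ , q₂ = zero₂ (𝟙 (E₃ σ v′ w′) + 𝟙 (class w′) + 𝟙 (w′ == w)) _ p₁
                  p₃ , q₃ = zero₂ (𝟙 (E₃ σ v′ w′) + 𝟙 (class w′)) _ p₂
                  p₄ , q₄ = zero₂ (𝟙 (E₃ σ v′ w′)) _ p₃
              in finish w′ nw′ (𝟙≡0 p₄) (¬true⇒false λ e → true≢false (∧-intro nw′ e) (𝟙≡0 q₄)) (==-false⇒≢ (𝟙≡0 q₃) ∘ sym) (𝟙≡0 q₂)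
                   (λ y e le → 𝟙*𝟙≡0 (∧-intro e (≤ᵇ-true le)) (∑≡0 {f = λ z → 𝟙 (kid z) * 𝟙 (E₂ σ z w′)} q₁ y))
              where
              finish : ∀ w′ → L₂.nice w′ ≡ true → E₃ σ v′ w′ ≡ false → E₂ σ x w′ ≡ false → w ≢ w′ → E₂ σ w w′ ≡ false →
                       (∀ y → easyʷ w y ≡ true → d₂ σ y ≤ κ → E₂ σ y w′ ≡ false) → Packing σ
              finish w′ nw′ nvw′ nxw′ w≢w′ nww′ sep′ = by-hard (zero-or-positive (L₂.hard w′))
                where
                facts′ = L₂.nice-elim {w′} nw′
                load′ = proj₂ (proj₂ facts′)
                end : End w v′ w′
                end = record { bw′ = proj₁ facts′ ; nvw′ = nvw′ ; w≢w′ = w≢w′ ; nww′ = nww′ ; nxw′ = nxw′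
                             ; x≢w′ = λ e → true≢false hx (trans (cong H e) (proj₁ (proj₂ facts′))) ; d₂w′ = L₂.light-deg {w′} load′ ; sep′ = sep′ }
                module Cl = Close bel abv av′ hv′ only-v′ (L₁.light-easy {a} load≤3 one) large end
                by-hard : L₂.hard w′ ≡ 0 ⊎ 1 ≤ L₂.hard w′ → Packing σ
                by-hard (inj₁ z)   = Cl.no-hard (L₂.no-hard z)
                by-hard (inj₂ pos) =
                  let x″ , h″ = neighbour {p = λ y → E₂ σ w′ y ∧ H y} pos
                  in Cl.one-hard x″ (λ y e h → L₂.one-hard (L₂.light-hard {w′} load′) (∧-elimˡ h″) (∧-elimʳ {E₂ σ w′ x″} h″) e h)
                       (L₂.light-easy {w′} load′ pos) (safe x″)

          TD : ∀ n D T b₁ b₂ h h₁ → h ≤ 132000 → h₁ ≤ 132000 → b₁ + b₂ + D + T + 418274 ≤ n + h + h₁ → T + D ≤ n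
          TD = linear 7 (λ n D T b₁ b₂ h h₁ → (h ⊴ # 132000) ∷ (h₁ ⊴ # 132000) ∷ (b₁ ⊕ b₂ ⊕ D ⊕ T ⊕ # 418274 ⊴ n ⊕ h ⊕ h₁) ∷ [] , (T ⊕ D ⊴ n)) 1 (1 ∷ 1 ∷ 1 ∷ [])

          split : L₁.hard a ≡ 0 ⊎ 1 ≤ L₁.hard a → Packing σ
          split (inj₁ z)   = Close₀.without-hard bel abv (L₁.no-hard z)
          split (inj₂ pos) with neighbour {p = λ u → E₁ σ a u ∧ H₁ u} pos | 3 * d₂ σ x ≤? 2 * D
          ... | v′ , h | yes le = Close₀.with-one bel abv v′
                  (λ u e h′ → L₁.one-hard (L₁.light-hard {a} load≤3) (∧-elimˡ h) (∧-elimʳ {E₁ σ a v′} h) e h′)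
                  (L₁.light-easy {a} load≤3 pos) le (TD n D T (count L₁.bad) (count L₂.bad) (count H) (count H₁) #H #H₁ (key st))
          ... | v′ , h | no gt  = extend v′ (∧-elimˡ h) (∧-elimʳ {E₁ σ a v′} h) pos (≰⇒> gt)

        climb : Packing σ
        climb = let a , na , z = a-pick
                    p , q = zero₂ (𝟙 (E₃ σ a x)) _ z
                    r , s = zero₂ (𝟙 (E₁ σ v a)) _ q
                in with-a a na (𝟙≡0 p) (𝟙≡0 r) (==-false⇒≢ (𝟙≡0 s))

    hard-neighbour : ∀ w → L₂.nice w ≡ true → E₃ σ v w ≡ false → ∃ λ x → E₂ σ w x ≡ true × H x ≡ true
    hard-neighbour w nw nvw =
      let bw , _ , le = L₂.nice-elim {w} nw
          x , h = neighbour {p = λ y → E₂ σ w y ∧ H y} (guard w bw nvw (L₂.light-deg {w} le))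
      in x , ∧-elimˡ h , ∧-elimʳ {E₂ σ w x} h

    -- Two hard vertices are tried. A nice vertex has at most one hard neighbour, so the classes of
    -- `x₁` and `x₂` are disjoint, and one of them contains at most half of the nice vertices.
    by-nice : ∀ w → L₂.nice w ≡ true → E₃ σ v w ≡ false → Packing σ
    by-nice w₁ nw₁ nvw₁ = first (U₁.stuck w₁ bel₁)
      where
      hn₁ = hard-neighbour w₁ nw₁ nvw₁
      x₁ = proj₁ hn₁
      wx₁ = proj₁ (proj₂ hn₁)
      hx₁ = proj₂ (proj₂ hn₁)
      bx₁ = on₂ σ x₁ w₁ (trans (sym₂ σ x₁ w₁) wx₁)
      module U₁ = Under x₁ bx₁ (tame x₁ bx₁) hx₁
      bel₁ = U₁.below w₁ nw₁ nvw₁ wx₁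

      module _ (st₁ : U₁.Stuck) (w₂ : Fin N) (nw₂ : L₂.nice w₂ ≡ true) (nvw₂ : E₃ σ v w₂ ≡ false) (x₁w₂ : E₂ σ x₁ w₂ ≡ false) where
        hn₂ = hard-neighbour w₂ nw₂ nvw₂
        x₂ = proj₁ hn₂
        wx₂ = proj₁ (proj₂ hn₂)
        hx₂ = proj₂ (proj₂ hn₂)
        bx₂ = on₂ σ x₂ w₂ (trans (sym₂ σ x₂ w₂) wx₂)
        module U₂ = Under x₂ bx₂ (tame x₂ bx₂) hx₂
        bel₂ = U₂.below w₂ nw₂ nvw₂ wx₂

        x₁≢x₂ : x₁ ≢ x₂
        x₁≢x₂ e = true≢false (trans (sym₂ σ x₂ w₂) wx₂) (subst (λ z → E₂ σ z w₂ ≡ false) e x₁w₂)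

        disjoint : count U₁.class + count U₂.class ≤ count L₂.nice
        disjoint = ≤-trans (≤-reflexive (sym (∑-+ _ _))) (∑-mono λ y → pt y (L₂.nice y) (E₂ σ x₁ y) (E₂ σ x₂ y) refl refl refl)
          where
          pt : ∀ y c e f → L₂.nice y ≡ c → E₂ σ x₁ y ≡ e → E₂ σ x₂ y ≡ f → 𝟙 (c ∧ e) + 𝟙 (c ∧ f) ≤ 𝟙 c
          pt y false e f _ _ _ = z≤n
          pt y true false f _ _ _ = 𝟙≤1 f
          pt y true true false _ _ _ = ≤-refl
          pt y true true true ny e f = ⊥-elim (x₁≢x₂ (L₂.one-hard (L₂.light-hard {y} (proj₂ (proj₂ (L₂.nice-elim {y} ny))))
            (trans (sym₂ σ y x₂) f) hx₂ (trans (sym₂ σ y x₁) e) hx₁))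

        second : U₂.Stuck → Packing σ
        second st₂ with 2 * count U₁.class ≤? count L₂.nice
        ... | yes le = U₁.Climb.climb st₁ le w₁ bel₁
        ... | no gt  = U₂.Climb.climb st₂ (lin (count U₁.class) (count U₂.class) (count L₂.nice) disjoint (≰⇒> gt)) w₂ bel₂
          where
          lin : ∀ p q c → p + q ≤ c → c < 2 * p → 2 * q ≤ c
          lin = linear 3 (λ p q c → (p ⊕ q ⊴ c) ∷ (# 1 ⊕ c ⊴ 2 ⊗ p) ∷ [] , (2 ⊗ q ⊴ c)) 1 (2 ∷ 1 ∷ [])

        both : Packing σ
        both = [ id , second ]′ (U₂.stuck w₂ bel₂)

      first : Packing σ ⊎ U₁.Stuck → Packing σ
      first (inj₁ P)   = P
      first (inj₂ st₁) =
        let w₂ , nw₂ , z = pick L₂.nice (λ w → 𝟙 (E₃ σ v w) + 𝟙 (E₂ σ x₁ w))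
              (≤-<-trans (∑-+≤ (Δ₃ˡ v) (Δ₂ x₁)) (lin D T (count L₂.nice) (U₁.nice₂-lin st₁)))
            p , q = zero₂ (𝟙 (E₃ σ v w₂)) _ z
        in both st₁ w₂ nw₂ (𝟙≡0 p) (𝟙≡0 q)
        where
        lin : ∀ D T c → D + T + 22273 < c → T + D < c
        lin = linear 3 (λ D T c → (# 1 ⊕ (D ⊕ T ⊕ # 22273) ⊴ c) ∷ [] , (# 1 ⊕ (T ⊕ D) ⊴ c)) 1 (1 ∷ [])

-- When the vertices that could hold v have load at least four

floor : ∀ c D → ∃ λ q → suc c * q ≤ D × D < suc c * suc q
floor c zero    = 0 , ≤-reflexive (*-zeroʳ c) , s≤s z≤n
floor c (suc D) with floor c D
... | q , le , lt with suc D <? suc c * suc q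
...   | yes lt′ = q , m≤n⇒m≤1+n le , lt′
...   | no nlt  = suc q , ≮⇒≥ nlt , ≤-trans (s≤s lt) (≤-trans (s≤s (m≤n+m (suc c * suc q) c)) (≤-reflexive (sym (*-suc (suc c) (suc q)))))

below-floor : ∀ c {D q x} → D < suc c * suc q → suc c * x ≤ D → x ≤ q
below-floor c {D} {q} {x} lt le = ≤-pred (*-cancelˡ-< (suc c) x (suc q) (≤-<-trans le lt))

-- Every vertex that misses `v` brings 7 to `m₂`, which under the budget leaves enough isolated
-- vertices for `by-isolated`. Its outcome `Leftover` would give a vertex missing `v` degree at most
-- 2.
high-off : ∀ {N} (σ : State N) {n D T R} → Hyp N n → Good σ n D T → ∀ v → A σ v ≡ true → d₃ˡ σ v ≡ T → T + R ≡ m₃ σ → 2 * D ≤ m₁ σ → D + 3 ≤ n →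
           7 * n ≤ m₂ σ + 7 * T → (∀ w → B σ w ≡ true → E₃ σ v w ≡ false → 7 ≤ d₂ σ w) → Packing σ
high-off σ {zero} hyp G = ⊥-elim (<⇒≱ (≤-trans (≤-reflexive (+-comm 1 _)) (Good.T+1≤n G)) z≤n)
high-off σ {suc k} {D} {T} {R} hyp G v av d₃v R-def m₁≥ D-safe ∑₂ high = conclude (by-isolated
    (many n′ (m₁ σ) (m₂ σ) (m₃ σ) D T R (count off-p) (count i₁) (count i₂) (subst (_≤ count i₁ + m₁ σ) #A (count-isolated (A σ) (d₁ σ))) heavy count-off-p R-def budget))
  where
  open Good G
  n′ : ℕ
  n′ = suc k
  unique : ∀ n a b c D T R → T + R ≡ c → 7 * n ≤ b + 7 * T → 2 * D ≤ a → T + 1 ≤ n → a + b + 2 * c + 2 * D + 2 * T + 836550 ≤ 6 * n → R + 2 ≤ T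
  unique n a b c D T R h0 h1 h2 h3 h4 =
    linear 7 (λ n a b c D T R → (T ⊕ R ⊴ c) ∷ (c ⊴ T ⊕ R) ∷ (7 ⊗ n ⊴ b ⊕ 7 ⊗ T) ∷ (2 ⊗ D ⊴ a) ∷ (T ⊕ # 1 ⊴ n) ∷ (a ⊕ b ⊕ 2 ⊗ c ⊕ 2 ⊗ D ⊕ 2 ⊗ T ⊕ # 836550 ⊴ 6 ⊗ n) ∷ [] , (R ⊕ # 2 ⊴ T)) 14 (14 ∷ 0 ∷ 6 ∷ 0 ∷ 0 ∷ 7 ∷ []) n a b c D T R (≤-reflexive h0) (≤-reflexive (sym h0)) h1 h2 h3 h4
  many : ∀ n a b c D T R q x y → n ≤ x + a → n + 6 * q ≤ y + b → q + T ≡ n → T + R ≡ c → a + b + 2 * c + 2 * D + 2 * T + 836550 ≤ 6 * n → 2 * R + 4 ≤ x + y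
  many n a b c D T R q x y h0 h1 h2 h3 h4 =
    linear 10 (λ n a b c D T R q x y → (n ⊴ x ⊕ a) ∷ (n ⊕ 6 ⊗ q ⊴ y ⊕ b) ∷ (q ⊕ T ⊴ n) ∷ (n ⊴ q ⊕ T) ∷ (T ⊕ R ⊴ c) ∷ (c ⊴ T ⊕ R) ∷ (a ⊕ b ⊕ 2 ⊗ c ⊕ 2 ⊗ D ⊕ 2 ⊗ T ⊕ # 836550 ⊴ 6 ⊗ n) ∷ [] , (2 ⊗ R ⊕ # 4 ⊴ x ⊕ y)) 1 (1 ∷ 1 ∷ 0 ∷ 4 ∷ 2 ∷ 0 ∷ 1 ∷ []) n a b c D T R q x y h0 h1 (≤-reflexive h2) (≤-reflexive (sym h2)) (≤-reflexive h3) (≤-reflexive (sym h3)) h4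
  open Dominated σ hyp G v av d₃v R-def (unique n′ (m₁ σ) (m₂ σ) (m₃ σ) D T R R-def ∑₂ m₁≥ T+1≤n budget) D-safe
  heavy : n′ + 6 * count off-p ≤ count i₂ + m₂ σ
  heavy = ≤-trans (≤-reflexive (trans (cong₂ _+_ (sym #B) (sym (∑-* 6 (λ y → 𝟙 (off-p y))))) (sym (∑-+ _ _)))) (≤-trans (∑-mono pt) (≤-reflexive (∑-+ _ _)))
    where
    pt : ∀ y → 𝟙 (B σ y) + 6 * 𝟙 (off-p y) ≤ 𝟙 (i₂ y) + d₂ σ y
    pt y = split (decide (off-p y))
      where
      base : ∀ b d → 𝟙 b ≤ 𝟙 (b ∧ (d ≤ᵇ 0)) + d
      base false d       = z≤n
      base true  zero    = ≤-refl
      base true  (suc d) = s≤s z≤n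
      split : off-p y ≡ true ⊎ off-p y ≡ false → 𝟙 (B σ y) + 6 * 𝟙 (off-p y) ≤ 𝟙 (i₂ y) + d₂ σ y
      split (inj₁ t) = ≤-trans (+-mono-≤ (𝟙≤1 (B σ y)) (*-monoʳ-≤ 6 (𝟙≤1 (off-p y))))
                         (≤-trans (high y (∧-elimˡ t) (not-elim (∧-elimʳ {B σ y} t))) (m≤n+m (d₂ σ y) (𝟙 (i₂ y))))
      split (inj₂ f) = ≤-trans (≤-reflexive (trans (cong (λ b → 𝟙 (B σ y) + 6 * 𝟙 b) f) (+-identityʳ _))) (base (B σ y) (d₂ σ y))
  conclude : Packing σ ⊎ Leftover → Packing σ
  conclude (inj₁ P) = P
  conclude (inj₂ left) = let w , h = some-off-p
                             big = high w (∧-elimˡ h) (not-elim (∧-elimʳ {B σ w} h))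
                         in ⊥-elim (<⇒≱ (s≤s (s≤s (s≤s z≤n))) (≤-trans big (proj₂ (left w (≤-trans (s≤s z≤n) big)))))

module Loaded {N} {σ : State N} {n D T : ℕ} (X : Setting σ n D T) (#H : count (Setting.H X) ≤ 132000)
              (tame : ∀ x → B σ x ≡ true → Tame X x)
              (loaded : ∀ w → B σ w ≡ true → Setting.H X w ≡ false → E₃ σ (Setting.v X) w ≡ false → 4 ≤ Load.load (B σ) (E₂ σ) (sym₂ σ) (Setting.H X) w)
              (exact : (∃ λ p → A σ p ≡ true × d₃ˡ σ p ≡ T) ⊎ (∃ λ p → B σ p ≡ true × d₃ʳ σ p ≡ T)) where

  open Setting X
  open Good G

  R : ℕ
  R = proj₁ (m≤n⇒∃[o]m+o≡n (≤∑ (d₃ˡ σ) v))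
  R-def : d₃ˡ σ v + R ≡ m₃ σ
  R-def = proj₂ (m≤n⇒∃[o]m+o≡n (≤∑ (d₃ˡ σ) v))

  m₁≥ : 2 * D ≤ m₁ σ
  m₁≥ = subst (λ d → 2 * d ≤ m₁ σ) d₁v (degree≤half σ v)

  ∑₂ : 4 * n ≤ m₂ σ + (4 * count H + 4 * d₃ˡ σ v)
  ∑₂ = subst (λ c → 4 * c ≤ m₂ σ + (4 * count H + 4 * d₃ˡ σ v)) #B (Load.blocked₄ (B σ) (E₂ σ) (sym₂ σ) H (E₃ σ v) loaded)

  -- With `4 n` already taken by G₂ and the edges at `v`, not every admissible `a` can have load 2.
  -- So `x`, of degree at least `D / 7`, takes the part of `v` from the other side: it gains
  -- `2 D / 7`, against at most `D / 5` for one cheap pair.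
  by-root : ∀ x → B σ x ≡ true → D ≤ 7 * d₂ σ x → Packing σ
  by-root x bx large = found (search (λ a → (A σ a ∧ not (H₁ a)) ∧ (not (E₃ σ a x) ∧ (L₁.load a ≤ᵇ 1))))
    where
    open Tame (tame x bx)
    module L₁ = Load (A σ) (E₁ σ) (sym₁ σ) H₁
    found : (∃ λ a → (A σ a ∧ not (H₁ a)) ∧ (not (E₃ σ a x) ∧ (L₁.load a ≤ᵇ 1)) ≡ true) ⊎
            (∀ a → (A σ a ∧ not (H₁ a)) ∧ (not (E₃ σ a x) ∧ (L₁.load a ≤ᵇ 1)) ≡ false) → Packing σ
    found (inj₂ none) = impossible (contra n (m₁ σ) (m₂ σ) (m₃ σ) D T (count L₁.bad) (count H) (count H₁) (d₃ˡ σ v) (d₃ʳ σ x) (𝟙 (E₃ σ v x))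
        (subst (λ c → 2 * c + 2 * count L₁.bad ≤ m₁ σ + (2 * count H₁ + 2 * d₃ʳ σ x)) #A (L₁.blocked₂ (λ a → E₃ σ a x) (λ a aa h nax → ≤ᵇ-false⁻ (¬true⇒false λ t →
          true≢false (∧-intro (∧-intro aa (not-intro h)) (∧-intro (not-intro nax) t)) (none a)))))
        ∑₂ (d₃-crossing σ v x) (𝟙≤1 (E₃ σ v x)) (Δ₃ˡ v) budget #H #H₁)
      where
      contra : ∀ n a b c D T b₁ h h₁ d e i → 2 * n + 2 * b₁ ≤ a + (2 * h₁ + 2 * e) → 4 * n ≤ b + (4 * h + 4 * d) → e + d ≤ c + i → i ≤ 1 → d ≤ T → a + b + 2 * c + 2 * D + 2 * T + 836550 ≤ 6 * n → h ≤ 132000 → h₁ ≤ 132000 → 1 ≤ 0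
      contra = linear 12 (λ n a b c D T b₁ h h₁ d e i → (2 ⊗ n ⊕ 2 ⊗ b₁ ⊴ a ⊕ (2 ⊗ h₁ ⊕ 2 ⊗ e)) ∷ (4 ⊗ n ⊴ b ⊕ (4 ⊗ h ⊕ 4 ⊗ d)) ∷ (e ⊕ d ⊴ c ⊕ i) ∷ (i ⊴ # 1) ∷ (d ⊴ T) ∷ (a ⊕ b ⊕ 2 ⊗ c ⊕ 2 ⊗ D ⊕ 2 ⊗ T ⊕ # 836550 ⊴ 6 ⊗ n) ∷ (h ⊴ # 132000) ∷ (h₁ ⊴ # 132000) ∷ [] , (# 1 ⊴ # 0)) 0 (1 ∷ 1 ∷ 2 ∷ 2 ∷ 2 ∷ 1 ∷ 4 ∷ 2 ∷ [])
    found (inj₁ (a , h)) = swap-packing σ (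
        let L , eq , cand , cheaps , pairs , _ = choose-cheap (swap σ) κ x us (elements-unique (E₁ σ a)) (All.tabulate λ h → on₁ʳ σ a _ (elements⁻ (E₁ σ a) h))
              (λ _ → 0) 0 (≤-reflexive (∑-0 {N} λ _ → refl))
              (All.tabulate λ h → ≤-trans (enough (length us) len) (easy-x _ (on₁ʳ σ a _ (elements⁻ (E₁ σ a) h)) (L₁.no-hard z _ (elements⁻ (E₁ σ a) h))))
            ℓ≤1 = subst (_≤ 1) (sym (seconds-length L eq)) len
        in root-packing (λ τ → hyp τ) (swap-good G) κ x a bx aa nax L (length L) refl (λ y e → seconds-∈ L eq (elements⁺ (E₁ σ a) e)) cheaps pairs
             (All.map (λ (c , _) → Candidate.b≢u c , Candidate.b≁u c) cand)
             (seconds L eq (All.tabulate λ h e → adjacent₁ σ (elements⁻ (E₁ σ a) h) (sym e)))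
             T (2 * (length L * κ)) ≤-refl (λ u _ → Δ₃ʳ u) (λ y _ → Δ₃ˡ y) (After.total≤ (after (swap σ) L cheaps pairs))
             (gain (length L * κ) (length L) κ D n (d₂ σ x) ℓ≤1 (*-monoˡ-≤ κ ℓ≤1) κ-small D-lo D-hi large)
             (safe₁ (length L) D n ℓ≤1 D-hi) (safe₃ (length L * κ) (length L) κ D T n ℓ≤1 (*-monoˡ-≤ κ ℓ≤1) κ-small T-far))
      where
      p = ∧-elimˡ {A σ a ∧ not (H₁ a)} h
      q = ∧-elimʳ {A σ a ∧ not (H₁ a)} h
      aa = ∧-elimˡ p
      nax = not-elim (∧-elimˡ q)
      light = L₁.weightless {a} (≤ᵇ-true⁻ (∧-elimʳ {not (E₃ σ a x)} q))
      z = proj₁ light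
      us = elements (E₁ σ a)
      len : length us ≤ 1
      len = subst (_≤ 1) (sym (elements-length (E₁ σ a))) (proj₂ light)
      enough : ∀ l → l ≤ 1 → 601 * l ≤ 3000
      enough = linear 1 (λ l → (l ⊴ # 1) ∷ [] , (601 ⊗ l ⊴ # 3000)) 1 (601 ∷ [])
      gain : ∀ z l k D n d → l ≤ 1 → z ≤ 1 * k → 20 * k ≤ D → n < 700 * D → D + 139000 < n → D ≤ 7 * d → 2 * z + 2 * z + 8 * l + 6 ≤ 2 * d
      gain = linear 6 (λ z l k D n d → (l ⊴ # 1) ∷ (z ⊴ 1 ⊗ k) ∷ (20 ⊗ k ⊴ D) ∷ (# 1 ⊕ n ⊴ 700 ⊗ D) ∷ (# 1 ⊕ (D ⊕ # 139000) ⊴ n) ∷ (D ⊴ 7 ⊗ d) ∷ [] , (2 ⊗ z ⊕ 2 ⊗ z ⊕ 8 ⊗ l ⊕ # 6 ⊴ 2 ⊗ d)) 8155 (65240 ∷ 32620 ∷ 1631 ∷ 1 ∷ 1 ∷ 2330 ∷ [])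
      safe₁ : ∀ l D n → l ≤ 1 → D + 139000 < n → D + l + 3 ≤ n
      safe₁ = linear 3 (λ l D n → (l ⊴ # 1) ∷ (# 1 ⊕ (D ⊕ # 139000) ⊴ n) ∷ [] , (D ⊕ l ⊕ # 3 ⊴ n)) 1 (1 ∷ 1 ∷ [])
      safe₃ : ∀ z l k D T n → l ≤ 1 → z ≤ 1 * k → 20 * k ≤ D → 3 * T + D + 400 < 3 * n → T + z + l + 2 ≤ n
      safe₃ = linear 6 (λ z l k D T n → (l ⊴ # 1) ∷ (z ⊴ 1 ⊗ k) ∷ (20 ⊗ k ⊴ D) ∷ (# 1 ⊕ (3 ⊗ T ⊕ D ⊕ # 400) ⊴ 3 ⊗ n) ∷ [] , (T ⊕ z ⊕ l ⊕ # 2 ⊴ n)) 60 (60 ∷ 60 ∷ 3 ∷ 20 ∷ [])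

  module Small (small : ∀ y → 7 * d₂ σ y ≤ D) where

    -- All degrees of G₂ are at most `D / 7`, so a partner of degree at most 1 has cost at most
    -- `κ′`, and such pairs do not raise the total. Six of them cost at most `12 D / 7` through the
    -- bound on G₃, less than the `2 D` gained with `v`.
    κ′ : ℕ
    κ′ = proj₁ (floor 6 D)
    κ′-small : 7 * κ′ ≤ D
    κ′-small = proj₁ (proj₂ (floor 6 D))
    d₂≤κ′ : ∀ y → d₂ σ y ≤ κ′
    d₂≤κ′ y = below-floor 6 (proj₂ (proj₂ (floor 6 D))) (small y)

    leafy : Fin N → Fin N → Bool
    leafy y b = candidate σ κ′ v y b ∧ (d₁ σ b ≤ᵇ 1)

    -- `3606 = 6 * 601`, for up to six pairs. A vertex other than `v` that is neither leafy nor
    -- joined to `y` contributes 2 to `m₁`, where a neighbour of `v` is counted together with its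
    -- edge to `v`.
    #leafy : ∀ y → 3606 ≤ count (leafy y)
    #leafy y = lin n (m₁ σ) (m₂ σ) (m₃ σ) D T (d₃ˡ σ v) (d₃ʳ σ y) (count H) (𝟙 (E₃ σ v y)) (count (leafy y)) bound ∑₂ m₁≥ (d₃-crossing σ v y) (𝟙≤1 (E₃ σ v y)) (Δ₃ˡ v) budget #H
      where
      lin : ∀ n a b c D T d e h i q → 2 * n ≤ 2 * q + 2 * e + 2 + a → 4 * n ≤ b + (4 * h + 4 * d) → 2 * D ≤ a → e + d ≤ c + i → i ≤ 1 → d ≤ T → a + b + 2 * c + 2 * D + 2 * T + 836550 ≤ 6 * n → h ≤ 132000 → 3606 ≤ q
      lin = linear 11 (λ n a b c D T d e h i q → (2 ⊗ n ⊴ 2 ⊗ q ⊕ 2 ⊗ e ⊕ # 2 ⊕ a) ∷ (4 ⊗ n ⊴ b ⊕ (4 ⊗ h ⊕ 4 ⊗ d)) ∷ (2 ⊗ D ⊴ a) ∷ (e ⊕ d ⊴ c ⊕ i) ∷ (i ⊴ # 1) ∷ (d ⊴ T) ∷ (a ⊕ b ⊕ 2 ⊗ c ⊕ 2 ⊗ D ⊕ 2 ⊗ T ⊕ # 836550 ⊴ 6 ⊗ n) ∷ (h ⊴ # 132000) ∷ [] , (# 3606 ⊴ q)) 2 (1 ∷ 1 ∷ 0 ∷ 2 ∷ 2 ∷ 2 ∷ 1 ∷ 4 ∷ [])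
      pt : ∀ b → 2 * 𝟙 (A σ b) + 𝟙 (b == v) * d₁ σ b ≤ 2 * 𝟙 (leafy y b) + 2 * 𝟙 (E₃ σ b y) + 2 * 𝟙 (b == v) + (d₁ σ b + 𝟙 (E₁ σ v b))
      pt b = [ at-v , off-v ]′ (decide (b == v))
        where
        Pt : Bool → Set
        Pt c = 2 * 𝟙 (A σ b) + 𝟙 c * d₁ σ b ≤ 2 * 𝟙 (leafy y b) + 2 * 𝟙 (E₃ σ b y) + 2 * 𝟙 c + (d₁ σ b + 𝟙 (E₁ σ v b))
        at-lin : ∀ a d p q → a ≤ 1 → 2 * a + (d + 0) ≤ p + 2 + (d + q)
        at-lin = linear 4 (λ a d p q → (a ⊴ # 1) ∷ [] , (2 ⊗ a ⊕ (d ⊕ # 0) ⊴ p ⊕ # 2 ⊕ (d ⊕ q))) 1 (2 ∷ [])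
        at-v : (b == v) ≡ true → Pt (b == v)
        at-v t = subst Pt (sym t) (at-lin (𝟙 (A σ b)) (d₁ σ b) (2 * 𝟙 (leafy y b) + 2 * 𝟙 (E₃ σ b y)) (𝟙 (E₁ σ v b)) (𝟙≤1 (A σ b)))
        other : (b == v) ≡ false → ∀ a e f l → A σ b ≡ a → E₁ σ v b ≡ e → E₃ σ b y ≡ f → (d₁ σ b ≤ᵇ 1) ≡ l →
                2 * 𝟙 a + 0 ≤ 2 * 𝟙 (leafy y b) + 2 * 𝟙 f + 0 + (d₁ σ b + 𝟙 e)
        other ne false _ _ _ _ _ _ _ = z≤n
        other ne true true f _ _ e _ _ = ≤-trans (+-monoˡ-≤ 1 (1≤count (E₁ σ b) (trans (sym₁ σ b v) e))) (m≤n+m (d₁ σ b + 1) (2 * 𝟙 (leafy y b) + 2 * 𝟙 f + 0))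
        other ne true false true _ _ _ _ _ = ≤-trans (≤-trans (m≤n+m 2 (2 * 𝟙 (leafy y b))) (m≤m+n _ 0)) (m≤m+n _ _)
        other ne true false false false _ _ _ l = ≤-trans (≤-trans (≤ᵇ-false⁻ {d₁ σ b} {1} l) (m≤m+n (d₁ σ b) 0)) (m≤n+m (d₁ σ b + 0) (2 * 𝟙 (leafy y b) + 0 + 0))
        other ne true false false true a e f l = ≤-trans (≤-trans (≤-trans (≤-reflexive (sym (cong (λ c → 2 * 𝟙 c) (∧-intro (candidate-intro σ κ′ v y b (record
          { b∈ = a ; b≁u = e ; b≢u = ==-false⇒≢ ne ; b≁y = f ; cost = ≤-trans (*-monoˡ-≤ (d₂ σ y) (≤ᵇ-true⁻ {d₁ σ b} {1} l)) (≤-trans (≤-reflexive (*-identityˡ _)) (d₂≤κ′ y))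
          ; low = ≤-trans (≤ᵇ-true⁻ {d₁ σ b} {1} l) (s≤s z≤n) })) l)))) (m≤m+n _ 0)) (m≤m+n _ 0)) (m≤m+n _ _)
        off-v : (b == v) ≡ false → Pt (b == v)
        off-v f = subst Pt (sym f) (other f (A σ b) (E₁ σ v b) (E₃ σ b y) (d₁ σ b ≤ᵇ 1) refl refl refl refl)
      bound : 2 * n ≤ 2 * count (leafy y) + 2 * d₃ʳ σ y + 2 + m₁ σ
      bound = +-cancelʳ-≤ (d₁ σ v) _ _ (begin
        2 * n + d₁ σ v                                            ≡⟨ cong₂ (λ x z → 2 * x + z) (sym #A) (sym (∑-point v (d₁ σ))) ⟩
        2 * count (A σ) + ∑ (λ b → 𝟙 (b == v) * d₁ σ b)           ≡⟨ cong (_+ ∑ (λ b → 𝟙 (b == v) * d₁ σ b)) (sym (∑-* 2 (λ b → 𝟙 (A σ b)))) ⟩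
        ∑ (λ b → 2 * 𝟙 (A σ b)) + ∑ (λ b → 𝟙 (b == v) * d₁ σ b)   ≡⟨ sym (∑-+ (λ b → 2 * 𝟙 (A σ b)) (λ b → 𝟙 (b == v) * d₁ σ b)) ⟩
        ∑ (λ b → 2 * 𝟙 (A σ b) + 𝟙 (b == v) * d₁ σ b)             ≤⟨ ∑-mono pt ⟩
        ∑ (λ b → 2 * 𝟙 (leafy y b) + 2 * 𝟙 (E₃ σ b y) + 2 * 𝟙 (b == v) + (d₁ σ b + 𝟙 (E₁ σ v b)))
          ≤⟨ ∑-+≤ (∑-+≤ (∑-+≤ (≤-reflexive (∑-* 2 (λ b → 𝟙 (leafy y b)))) (≤-reflexive (∑-* 2 (λ b → 𝟙 (E₃ σ b y)))))
               (≤-reflexive (trans (∑-* 2 (λ b → 𝟙 (b == v))) (cong (2 *_) (count-point v))))) (≤-reflexive (∑-+ (d₁ σ) (λ b → 𝟙 (E₁ σ v b)))) ⟩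
        2 * count (leafy y) + 2 * d₃ʳ σ y + 2 + (m₁ σ + d₁ σ v)   ≡⟨ sym (+-assoc (2 * count (leafy y) + 2 * d₃ʳ σ y + 2) (m₁ σ) (d₁ σ v)) ⟩
        2 * count (leafy y) + 2 * d₃ʳ σ y + 2 + m₁ σ + d₁ σ v     ∎)
        where open ≤-Reasoning

    by-leaves : ∀ w → B σ w ≡ true → E₃ σ v w ≡ false → d₂ σ w ≤ 6 → Packing σ
    by-leaves w bw nvw few =
      let L , (eq , cand , cheaps , pairs , _) , leaves = choose-among σ κ′ v leafy (λ y b → ∧-elimˡ) ys (elements-unique (E₂ σ w)) (All.tabulate λ h → on₁ʳ (swap σ) w _ (elements⁻ (E₂ σ w) h))
            (λ _ → 0) 0 (≤-reflexive (∑-0 {N} λ _ → refl)) (All.tabulate λ {y} h → ≤-trans (*-monoʳ-≤ 601 len) (#leafy y))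
          ℓ≤6 = subst (_≤ 6) (sym (seconds-length L eq)) len
      in root-packing hyp G κ′ v w av bw nvw L (length L) refl (λ y h → seconds-∈ L eq (elements⁺ (E₂ σ w) h)) cheaps pairs
           (All.map (λ (c , _) → Candidate.b≢u c , Candidate.b≁u c) cand)
           (seconds L eq (All.tabulate λ h e → adjacent₂ σ (elements⁻ (E₂ σ w) h) (sym e)))
           -- Away from `v` no vertex has more than `R + 1` edges of G₃. The budget is served by the
           -- bound `T`, the margin under the order by `R + 1`.
           (T ⊓ (R + 1)) 0 (m⊓n≤m T (R + 1))
           (λ u ne → ⊓-glb (Δ₃ˡ u) (≤-trans (others (d₃ˡ σ u) (d₃ˡ σ v) R (m₃ σ) (two-point (d₃ˡ σ) ne) R-def) (m≤m+n R 1)))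
           (λ y _ → ⊓-glb (Δ₃ʳ y) (others′ (d₃ʳ σ y) (d₃ˡ σ v) R (m₃ σ) (𝟙 (E₃ σ v y)) (d₃-crossing σ v y) (𝟙≤1 (E₃ σ v y)) R-def))
           (≤-trans (After.light (after σ L cheaps pairs) (All.map (λ {p} h → ≤ᵇ-true⁻ (∧-elimʳ {candidate σ κ′ v (proj₂ p) (proj₁ p)} h)) leaves)) (m≤m+n _ 0))
           (subst (λ d → 2 * (length L * κ′) + 8 * length L + 6 ≤ 2 * d) (sym d₁v) (gain (length L * κ′) (length L) κ′ D n ℓ≤6 (*-monoˡ-≤ κ′ ℓ≤6) κ′-small D-lo D-hi))
           (safe₁ (length L) D n ℓ≤6 D-hi)
           (safe₃ (length L * κ′) (length L) κ′ D T R n (T ⊓ (R + 1)) (m₁ σ) (m₂ σ) (m₃ σ) (count H) (d₃ˡ σ v) ℓ≤6 (*-monoˡ-≤ κ′ ℓ≤6) κ′-small (m⊓n≤n T (R + 1)) ∑₂ m₁≥ R-def (Δ₃ˡ v) budget #H)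
      where
      ys = elements (E₂ σ w)
      len : length ys ≤ 6
      len = subst (_≤ 6) (sym (elements-length (E₂ σ w))) few
      others : ∀ x d R c → x + d ≤ c → d + R ≡ c → x ≤ R
      others x d R c h0 h1 =
        linear 4 (λ x d R c → (x ⊕ d ⊴ c) ∷ (d ⊕ R ⊴ c) ∷ (c ⊴ d ⊕ R) ∷ [] , (x ⊴ R)) 1 (1 ∷ 0 ∷ 1 ∷ []) x d R c h0 (≤-reflexive h1) (≤-reflexive (sym h1))
      others′ : ∀ x d R c i → x + d ≤ c + i → i ≤ 1 → d + R ≡ c → x ≤ R + 1
      others′ x d R c i h0 h1 h2 =
        linear 5 (λ x d R c i → (x ⊕ d ⊴ c ⊕ i) ∷ (i ⊴ # 1) ∷ (d ⊕ R ⊴ c) ∷ (c ⊴ d ⊕ R) ∷ [] , (x ⊴ R ⊕ # 1)) 1 (1 ∷ 1 ∷ 0 ∷ 1 ∷ []) x d R c i h0 h1 (≤-reflexive h2) (≤-reflexive (sym h2))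
      gain : ∀ z l k D n → l ≤ 6 → z ≤ 6 * k → 7 * k ≤ D → n < 700 * D → D + 139000 < n → 2 * z + 8 * l + 6 ≤ 2 * D
      gain = linear 5 (λ z l k D n → (l ⊴ # 6) ∷ (z ⊴ 6 ⊗ k) ∷ (7 ⊗ k ⊴ D) ∷ (# 1 ⊕ n ⊴ 700 ⊗ D) ∷ (# 1 ⊕ (D ⊕ # 139000) ⊴ n) ∷ [] , (2 ⊗ z ⊕ 8 ⊗ l ⊕ # 6 ⊴ 2 ⊗ D)) 4893 (39144 ∷ 9786 ∷ 8388 ∷ 2 ∷ 2 ∷ [])
      safe₁ : ∀ l D n → l ≤ 6 → D + 139000 < n → D + l + 3 ≤ n
      safe₁ = linear 3 (λ l D n → (l ⊴ # 6) ∷ (# 1 ⊕ (D ⊕ # 139000) ⊴ n) ∷ [] , (D ⊕ l ⊕ # 3 ⊴ n)) 1 (1 ∷ 1 ∷ [])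
      safe₃ : ∀ z l k D T R n t a b c h d → l ≤ 6 → z ≤ 6 * k → 7 * k ≤ D → t ≤ R + 1 → 4 * n ≤ b + (4 * h + 4 * d) → 2 * D ≤ a → d + R ≡ c → d ≤ T → a + b + 2 * c + 2 * D + 2 * T + 836550 ≤ 6 * n → h ≤ 132000 → t + z + l + 2 ≤ n
      safe₃ z l k D T R n t a b c h d h0 h1 h2 h3 h4 h5 h6 h7 h8 h9 =
        linear 13 (λ z l k D T R n t a b c h d → (l ⊴ # 6) ∷ (z ⊴ 6 ⊗ k) ∷ (7 ⊗ k ⊴ D) ∷ (t ⊴ R ⊕ # 1) ∷ (4 ⊗ n ⊴ b ⊕ (4 ⊗ h ⊕ 4 ⊗ d)) ∷ (2 ⊗ D ⊴ a) ∷ (d ⊕ R ⊴ c) ∷ (c ⊴ d ⊕ R) ∷ (d ⊴ T) ∷ (a ⊕ b ⊕ 2 ⊗ c ⊕ 2 ⊗ D ⊕ 2 ⊗ T ⊕ # 836550 ⊴ 6 ⊗ n) ∷ (h ⊴ # 132000) ∷ [] , (t ⊕ z ⊕ l ⊕ # 2 ⊴ n)) 14 (14 ∷ 14 ∷ 12 ∷ 14 ∷ 7 ∷ 0 ∷ 14 ∷ 0 ∷ 14 ∷ 7 ∷ 28 ∷ []) z l k D T R n t a b c h d h0 h1 h2 h3 h4 h5 (≤-reflexive h6) (≤-reflexive (sym h6)) h7 h8 h9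

    by-degree : (∀ w → B σ w ≡ true → E₃ σ v w ≡ false → 7 ≤ d₂ σ w) → Packing σ
    by-degree high = high-off σ hyp G v av full (subst (λ t → t + R ≡ m₃ σ) full R-def) m₁≥ (safe D n D-hi) (subst (λ t → 7 * n ≤ m₂ σ + 7 * t) full ∑₇) high
      where
      safe : ∀ D n → D + 139000 < n → D + 3 ≤ n
      safe = linear 2 (λ D n → (# 1 ⊕ (D ⊕ # 139000) ⊴ n) ∷ [] , (D ⊕ # 3 ⊴ n)) 1 (1 ∷ [])
      ∑₇ : 7 * n ≤ m₂ σ + 7 * d₃ˡ σ v
      ∑₇ = ≤-trans (≤-reflexive (trans (cong (7 *_) (sym #B)) (sym (∑-* 7 (λ w → 𝟙 (B σ w)))))) (≤-trans (∑-mono λ w → pt w (decide (B σ w)) (decide (E₃ σ v w)))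
             (∑-+≤ ≤-refl (≤-reflexive (∑-* 7 (λ w → 𝟙 (E₃ σ v w))))))
        where
        pt : ∀ w → B σ w ≡ true ⊎ B σ w ≡ false → E₃ σ v w ≡ true ⊎ E₃ σ v w ≡ false → 7 * 𝟙 (B σ w) ≤ d₂ σ w + 7 * 𝟙 (E₃ σ v w)
        pt w (inj₂ f) _ rewrite f = z≤n
        pt w (inj₁ t) (inj₁ e) rewrite t | e = m≤n+m 7 (d₂ σ w)
        pt w (inj₁ t) (inj₂ f) = ≤-trans (*-monoʳ-≤ 7 (𝟙≤1 (B σ w))) (≤-trans (high w t f) (m≤m+n _ _))
      clash : ∀ n a b c D T e → T + e ≤ c + 1 → e ≤ T → 7 * n ≤ b + 7 * e → 2 * D ≤ a → a + b + 2 * c + 2 * D + 2 * T + 836550 ≤ 6 * n → T + 1 ≤ n → 1 ≤ 0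
      clash = linear 7 (λ n a b c D T e → (T ⊕ e ⊴ c ⊕ # 1) ∷ (e ⊴ T) ∷ (7 ⊗ n ⊴ b ⊕ 7 ⊗ e) ∷ (2 ⊗ D ⊴ a) ∷ (a ⊕ b ⊕ 2 ⊗ c ⊕ 2 ⊗ D ⊕ 2 ⊗ T ⊕ # 836550 ⊴ 6 ⊗ n) ∷ (T ⊕ # 1 ⊴ n) ∷ [] , (# 1 ⊴ # 0)) 0 (14 ∷ 28 ∷ 6 ∷ 0 ∷ 7 ∷ 0 ∷ [])
      -- The premise holds when another vertex carries `T` edges of G₃; the budget has no room for
      -- these beside those at `v`.
      crowded : T + d₃ˡ σ v ≤ m₃ σ + 1 → d₃ˡ σ v ≡ T
      crowded h = impossible (clash n (m₁ σ) (m₂ σ) (m₃ σ) D T (d₃ˡ σ v) h (Δ₃ˡ v) ∑₇ m₁≥ budget T+1≤n)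
      full : d₃ˡ σ v ≡ T
      full = [ fromˡ , (λ (p , _ , d₃p) → crowded (subst (λ t → t + d₃ˡ σ v ≤ m₃ σ + 1) d₃p (≤-trans (d₃-crossing σ v p) (+-monoʳ-≤ (m₃ σ) (𝟙≤1 (E₃ σ v p)))))) ]′ exact
        where
        fromˡ : (∃ λ p → A σ p ≡ true × d₃ˡ σ p ≡ T) → d₃ˡ σ v ≡ T
        fromˡ (p , _ , d₃p) with p ≟ᶠ v
        ... | yes e = subst (λ z → d₃ˡ σ z ≡ T) e d₃p
        ... | no ne = crowded (subst (λ t → t + d₃ˡ σ v ≤ m₃ σ + 1) d₃p (≤-trans (two-point (d₃ˡ σ) ne) (m≤m+n (m₃ σ) 1)))

  packing : Packing σ
  packing with search (λ x → D ≤ᵇ 7 * d₂ σ x)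
  ... | inj₁ (x , h) = by-root x (positive (d₂ σ x) refl) (≤ᵇ-true⁻ h)
    where
    nonzero : ∀ D n → D ≤ 0 → n < 700 * D → 1 ≤ 0
    nonzero = linear 2 (λ D n → (D ⊴ # 0) ∷ (# 1 ⊕ n ⊴ 700 ⊗ D) ∷ [] , (# 1 ⊴ # 0)) 0 (700 ∷ 1 ∷ [])
    positive : ∀ d → d₂ σ x ≡ d → B σ x ≡ true
    positive zero    e = impossible (nonzero D n (subst (λ d → D ≤ 7 * d) e (≤ᵇ-true⁻ h)) D-lo)
    positive (suc d) e = let y , xy = neighbour {p = E₂ σ x} (subst (1 ≤_) (sym e) (s≤s z≤n)) in on₂ σ x y xy
  ... | inj₂ none with search (λ w → (B σ w ∧ not (E₃ σ v w)) ∧ (d₂ σ w ≤ᵇ 6))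
  ...   | inj₁ (w , h) = let p = ∧-elimˡ {B σ w ∧ not (E₃ σ v w)} h in
            S.by-leaves w (∧-elimˡ p) (not-elim (∧-elimʳ {B σ w} p)) (≤ᵇ-true⁻ (∧-elimʳ {B σ w ∧ not (E₃ σ v w)} h))
    where module S = Small (λ y → <⇒≤ (≤ᵇ-false⁻ {D} (none y)))
  ...   | inj₂ none′ = S.by-degree λ w bw nvw → ≤ᵇ-false⁻ (¬true⇒false λ t → true≢false (∧-intro (∧-intro bw (not-intro nvw)) t) (none′ w))
    where module S = Small (λ y → <⇒≤ (≤ᵇ-false⁻ {D} (none y)))

select : ∀ {N} {σ : State N} {n D T} (X : Setting σ n D T) → count (Setting.H X) ≤ 132000 → (∀ x → B σ x ≡ true → Tame X x) →
         (∃ λ p → A σ p ≡ true × d₃ˡ σ p ≡ T) ⊎ (∃ λ p → B σ p ≡ true × d₃ʳ σ p ≡ T) → Packing σ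
select {σ = σ} X #H tame exact = [ id , with-guard ]′ S.guarded
  where
  open Setting X using (v; H)
  module S = Select X #H
  with-guard : S.Guarded → Packing σ
  with-guard guard with search (λ w → S.L₂.nice w ∧ not (E₃ σ v w))
  ... | inj₁ (w , h) = S.by-nice guard tame w (∧-elimˡ h) (not-elim (∧-elimʳ {S.L₂.nice w} h))
  ... | inj₂ none = Loaded.packing X #H tame (λ w bw hw nvw → ≤ᵇ-false⁻ (¬true⇒false λ t →
          true≢false (∧-intro (∧-intro (∧-intro bw (not-intro hw)) t) (not-intro nvw)) (none w))) exact

-- Vertices with few cheap partners are rare

weight : ∀ {N} → (Fin N → Bool) → (Fin N → ℕ) → ℕ
weight P d = ∑ (λ b → 𝟙 (P b) * d b)

weight≤ : ∀ {N} (P : Fin N → Bool) d → weight P d ≤ ∑ d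
weight≤ P d = ∑-mono λ b → 𝟙*-bound (P b) (λ _ → ≤-refl)

partner : ∀ {N} → State N → ℕ → ℕ → (Fin N → Bool) → Fin N → Fin N → Bool
partner σ κ Λ P y b = P b ∧ (not (E₃ σ b y) ∧ ((d₁ σ b * d₂ σ y ≤ᵇ κ) ∧ (d₁ σ b ≤ᵇ Λ)))

-- A vertex of `P` fails as a partner of `y` because it is joined to `y`, because it is `tall`, or
-- because the product of the degrees exceeds `κ`. The tall ones do not depend on `y`; the other
-- failures are bounded in total over all `y`, so only few `y` can have few partners.
module Scarce {N} (σ : State N) (κ Λ : ℕ) (P : Fin N → Bool) where

  tall : ℕ
  tall = count (λ b → P b ∧ (suc Λ ≤ᵇ d₁ σ b))

  seen costly : Fin N → ℕ
  seen   y = count (λ b → P b ∧ E₃ σ b y)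
  costly y = count (λ b → P b ∧ (suc κ ≤ᵇ d₁ σ b * d₂ σ y))

  ∑tall : suc Λ * tall ≤ weight P (d₁ σ)
  ∑tall = ≤-trans (≤-reflexive (sym (∑-* (suc Λ) (λ b → 𝟙 (P b ∧ (suc Λ ≤ᵇ d₁ σ b)))))) (∑-mono λ b → pt (P b) (d₁ σ b))
    where
    pt : ∀ p d → suc Λ * 𝟙 (p ∧ (suc Λ ≤ᵇ d)) ≤ 𝟙 p * d
    pt false d = ≤-reflexive (*-zeroʳ (suc Λ))
    pt true  d = ≤-trans (≤-reflexive (*-comm (suc Λ) (𝟙 (suc Λ ≤ᵇ d)))) (≤-trans (𝟙*-bound (suc Λ ≤ᵇ d) ≤ᵇ-true⁻) (m≤m+n d 0))

  ∑costly : suc κ * ∑ costly ≤ weight P (d₁ σ) * m₂ σ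
  ∑costly = begin
    suc κ * ∑ costly                              ≡⟨ sym (∑-* (suc κ) costly) ⟩
    ∑ (λ y → suc κ * costly y)                    ≤⟨ ∑-mono (λ y → ≤-trans (≤-reflexive (sym (∑-* (suc κ) (λ b → 𝟙 (P b ∧ (suc κ ≤ᵇ d₁ σ b * d₂ σ y))))))
                                                       (≤-trans (∑-mono λ b → pt (P b) (d₁ σ b) (d₂ σ y)) (≤-reflexive (trans (∑-* (d₂ σ y) (λ b → 𝟙 (P b) * d₁ σ b)) (*-comm (d₂ σ y) _))))) ⟩
    ∑ (λ y → weight P (d₁ σ) * d₂ σ y)            ≡⟨ ∑-* (weight P (d₁ σ)) (d₂ σ) ⟩
    weight P (d₁ σ) * m₂ σ                        ∎
    where
    open ≤-Reasoning
    pt : ∀ p d e → suc κ * 𝟙 (p ∧ (suc κ ≤ᵇ d * e)) ≤ e * (𝟙 p * d)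
    pt false d e = ≤-trans (≤-reflexive (*-zeroʳ (suc κ))) z≤n
    pt true  d e = ≤-trans (≤-reflexive (*-comm (suc κ) (𝟙 (suc κ ≤ᵇ d * e)))) (≤-trans (𝟙*-bound (suc κ ≤ᵇ d * e) ≤ᵇ-true⁻)
                     (≤-reflexive (trans (*-comm d e) (cong (e *_) (sym (+-identityʳ d))))))

  ∑seen : ∑ seen ≤ m₃ σ
  ∑seen = ≤-trans (∑-mono λ y → count-mono λ b → ∧-elimʳ {P b}) (≤-reflexive (m₃-swap σ))

  ∑seen-off : ∀ v → P v ≡ false → ∑ seen + d₃ˡ σ v ≤ m₃ σ
  ∑seen-off v pv = ≤-trans (≤-reflexive (sym (∑-+ seen _)))
      (≤-trans (∑-mono λ y → ≤-trans (+-monoʳ-≤ (seen y) (≤-trans (≤-reflexive (sym (∑-point v (λ u → 𝟙 (E₃ σ u y))))) ≤-refl))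
                 (≤-trans (≤-reflexive (sym (∑-+ _ _))) (∑-mono λ b → pt b y (decide (b == v)))))
               (≤-reflexive (m₃-swap σ)))
    where
    pt : ∀ b y → (b == v) ≡ true ⊎ (b == v) ≡ false → 𝟙 (P b ∧ E₃ σ b y) + 𝟙 (b == v) * 𝟙 (E₃ σ b y) ≤ 𝟙 (E₃ σ b y)
    pt b y (inj₁ t) rewrite t | trans (cong P (==⇒≡ {x = b} {v} t)) pv = ≤-reflexive (+-identityʳ _)
    pt b y (inj₂ f) rewrite f = ≤-trans (≤-reflexive (+-identityʳ _)) (𝟙-mono (∧-elimʳ {P b}))

  classify : ∀ y → count P ≤ count (partner σ κ Λ P y) + seen y + tall + costly y
  classify y = ≤-trans (∑-mono λ b → pt (P b) (E₃ σ b y) (d₁ σ b) (d₁ σ b * d₂ σ y))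
      (∑-+≤ (∑-+≤ (∑-+≤ {f = λ b → 𝟙 (partner σ κ Λ P y b)} ≤-refl ≤-refl) ≤-refl) ≤-refl)
    where
    pt : ∀ p e d c → 𝟙 p ≤ 𝟙 (p ∧ (not e ∧ ((c ≤ᵇ κ) ∧ (d ≤ᵇ Λ)))) + 𝟙 (p ∧ e) + 𝟙 (p ∧ (suc Λ ≤ᵇ d)) + 𝟙 (p ∧ (suc κ ≤ᵇ c))
    pt false e d c = z≤n
    pt true true d c = s≤s z≤n
    pt true false d c with decide (c ≤ᵇ κ) | decide (d ≤ᵇ Λ)
    ... | inj₁ t | inj₁ t′ rewrite t | t′ = s≤s z≤n
    ... | inj₁ t | inj₂ f rewrite ≤ᵇ-true (≤ᵇ-false⁻ {d} {Λ} f) = ≤-trans (m≤n+m 1 (𝟙 ((c ≤ᵇ κ) ∧ (d ≤ᵇ Λ)) + 0)) (m≤m+n _ _)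
    ... | inj₂ f | _ rewrite ≤ᵇ-true (≤ᵇ-false⁻ {c} {κ} f) = m≤n+m 1 (𝟙 ((c ≤ᵇ κ) ∧ (d ≤ᵇ Λ)) + 0 + 𝟙 (suc Λ ≤ᵇ d))

  scarce : ∀ (S : Fin N → Bool) t g → (∀ y → S y ≡ true → count (partner σ κ Λ P y) ≤ t) → t + tall + g ≡ count P →
           count S * g ≤ ∑ seen + ∑ costly
  scarce S t g few room = ≤-trans (≤-reflexive (trans (*-comm (count S) g) (sym (∑-* g (λ y → 𝟙 (S y))))))
      (≤-trans (∑-mono λ y → ≤-trans (≤-reflexive (*-comm g (𝟙 (S y)))) (𝟙*-bound (S y) (λ s →
        lin t g (count P) (count (partner σ κ Λ P y)) (seen y) tall (costly y) (few y s) room (classify y)))) (≤-reflexive (∑-+ seen costly)))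
    where
    lin : ∀ t g p c s l z → c ≤ t → t + l + g ≡ p → p ≤ c + s + l + z → g ≤ s + z
    lin t g p c s l z h0 h1 h2 =
      linear 7 (λ t g p c s l z → (c ⊴ t) ∷ (t ⊕ l ⊕ g ⊴ p) ∷ (p ⊴ t ⊕ l ⊕ g) ∷ (p ⊴ c ⊕ s ⊕ l ⊕ z) ∷ [] , (g ⊴ s ⊕ z)) 1 (1 ∷ 1 ∷ 0 ∷ 1 ∷ []) t g p c s l z h0 (≤-reflexive h1) (≤-reflexive (sym h1)) h2

around : ∀ {N} → State N → Fin N → Fin N → Bool
around σ u b = A σ b ∧ (not (E₁ σ u b) ∧ not (b == u))

count-around : ∀ {N} (σ : State N) u → A σ u ≡ true → count (around σ u) + d₁ σ u + 1 ≡ count (A σ)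
count-around σ u au = begin
  count (around σ u) + d₁ σ u + 1                                      ≡⟨ cong (λ z → count (around σ u) + d₁ σ u + z) (sym (count-point u)) ⟩
  count (around σ u) + d₁ σ u + count (_== u)                          ≡⟨ cong (_+ count (_== u)) (sym (∑-+ (λ b → 𝟙 (around σ u b)) (λ b → 𝟙 (E₁ σ u b)))) ⟩
  ∑ (λ b → 𝟙 (around σ u b) + 𝟙 (E₁ σ u b)) + count (_== u)            ≡⟨ sym (∑-+ (λ b → 𝟙 (around σ u b) + 𝟙 (E₁ σ u b)) (λ b → 𝟙 (b == u))) ⟩
  ∑ (λ b → 𝟙 (around σ u b) + 𝟙 (E₁ σ u b) + 𝟙 (b == u))               ≡⟨ ∑-cong (λ b → pt b (A σ b) (E₁ σ u b) (b == u) refl refl refl) ⟩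
  count (A σ)                                                          ∎
  where
  open ≡-Reasoning
  pt : ∀ b a e i → A σ b ≡ a → E₁ σ u b ≡ e → (b == u) ≡ i → 𝟙 (a ∧ (not e ∧ not i)) + 𝟙 e + 𝟙 i ≡ 𝟙 a
  pt b true  true  true  _ e i = ⊥-elim (true≢false (subst (λ z → E₁ σ u z ≡ true) (==⇒≡ {x = b} i) e) (irr₁ σ u))
  pt b true  true  false _ _ _ = refl
  pt b true  false true  _ _ _ = refl
  pt b true  false false _ _ _ = refl
  pt b false true  i     a e _ = ⊥-elim (true≢false (on₁ʳ σ u b e) a)
  pt b false false true  a _ i = ⊥-elim (true≢false au (subst (λ z → A σ z ≡ false) (==⇒≡ {x = b} i) a))
  pt b false false false _ _ _ = refl

-- One `d₁ σ u` is the degree of `u` itself; the other comes from its neighbours, each of degree at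
-- least 1.
weight-around : ∀ {N} (σ : State N) u → weight (around σ u) (d₁ σ) + 2 * d₁ σ u ≤ m₁ σ
weight-around σ u = ≤-trans (≤-reflexive (lin (weight (around σ u) (d₁ σ)) (d₁ σ u))) (≤-trans
    (≤-reflexive (cong (λ z → weight (around σ u) (d₁ σ) + d₁ σ u + z) (sym (∑-point u (d₁ σ)))))
    (≤-trans (≤-reflexive (trans (cong (_+ ∑ (λ b → 𝟙 (b == u) * d₁ σ b)) (sym (∑-+ (λ b → 𝟙 (around σ u b) * d₁ σ b) (λ b → 𝟙 (E₁ σ u b)))))
                                 (sym (∑-+ (λ b → 𝟙 (around σ u b) * d₁ σ b + 𝟙 (E₁ σ u b)) (λ b → 𝟙 (b == u) * d₁ σ b)))))
             (∑-mono λ b → pt b (A σ b) (E₁ σ u b) (b == u) refl refl)))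
  where
  lin : ∀ w d → w + 2 * d ≡ w + d + d
  lin w d = trans (cong (w +_) (cong (d +_) (+-identityʳ d))) (sym (+-assoc w d d))
  pt : ∀ b a e i → E₁ σ u b ≡ e → (b == u) ≡ i → 𝟙 (a ∧ (not e ∧ not i)) * d₁ σ b + 𝟙 e + 𝟙 i * d₁ σ b ≤ d₁ σ b
  pt b a true  true  e i = ⊥-elim (true≢false (subst (λ z → E₁ σ u z ≡ true) (==⇒≡ {x = b} i) e) (irr₁ σ u))
  pt b false true  false e _ = 1≤count (E₁ σ b) (trans (sym₁ σ b u) e)
  pt b true  true  false e _ = 1≤count (E₁ σ b) (trans (sym₁ σ b u) e)
  pt b false false true  _ _ = ≤-reflexive (+-identityʳ _)
  pt b true  false true  _ _ = ≤-reflexive (+-identityʳ _)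
  pt b true  false false _ _ = ≤-reflexive (trans (+-identityʳ _) (trans (+-identityʳ _) (+-identityʳ _)))
  pt b false false false _ _ = z≤n

candidate-loss : ∀ {N} (σ : State N) κ u y → count (partner σ κ 600 (A σ) y) ≤ count (candidate σ κ u y) + d₁ σ u + 1
candidate-loss σ κ u y = ≤-trans (∑-mono λ b → pt (A σ b) (E₁ σ u b) (b == u) (not (E₃ σ b y) ∧ ((d₁ σ b * d₂ σ y ≤ᵇ κ) ∧ (d₁ σ b ≤ᵇ 600))))
    (∑-+≤ (∑-+≤ {f = λ b → 𝟙 (candidate σ κ u y b)} ≤-refl ≤-refl) (≤-reflexive (count-point u)))
  where
  pt : ∀ a e i r → 𝟙 (a ∧ r) ≤ 𝟙 ((a ∧ (not e ∧ not i)) ∧ r) + 𝟙 e + 𝟙 i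
  pt false e i r = z≤n
  pt true true i r = ≤-trans (𝟙≤1 r) (m≤m+n 1 (𝟙 i))
  pt true false true r = ≤-trans (𝟙≤1 r) ≤-refl
  pt true false false r = ≤-trans (m≤m+n (𝟙 r) 0) (m≤m+n _ 0)

-- The inequality of the arithmetic and geometric means: with `b = a + o` the two sides of `four`
-- differ by `o * o`.
product≤-ordered : ∀ a b c → a ≤ b → a + b ≤ 2 * c → a * b ≤ c * c
product≤-ordered a b c le h = *-cancelˡ-≤ 4 (≤-trans four (≤-trans (*-mono-≤ h h) (≤-reflexive (square c))))
  where
  o = proj₁ (m≤n⇒∃[o]m+o≡n le)
  o-def = proj₂ (m≤n⇒∃[o]m+o≡n le)
  square : ∀ c → (2 * c) * (2 * c) ≡ 4 * (c * c)
  square c = [m*n]*[o*p]≡[m*o]*[n*p] 2 c 2 c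
  four : 4 * (a * b) ≤ (a + b) * (a + b)
  four = subst (λ b → 4 * (a * b) ≤ (a + b) * (a + b)) o-def (lin (a * (a + o)) (a * a) (a * o) (o * a) (o * o) ((a + (a + o)) * (a + (a + o)))
      (*-distribˡ-+ a a o) (*-comm o a) expand)
    where
    expand : (a + (a + o)) * (a + (a + o)) ≡ a * a + a * a + a * o + (a * a + a * a + a * o) + (o * a + o * a + o * o)
    expand = trans (cong (λ z → z * z) (sym (+-assoc a a o))) (trans (*-distribʳ-+ (a + a + o) (a + a) o)
      (cong₂ _+_ (trans (*-distribʳ-+ (a + a + o) a a) (cong₂ _+_ (row a) (row a))) (row o)))
      where
      row : ∀ x → x * (a + a + o) ≡ x * a + x * a + x * o
      row x = trans (*-distribˡ-+ x (a + a) o) (cong (_+ x * o) (*-distribˡ-+ x a a))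
    lin : ∀ p q r r′ s t → p ≡ q + r → r′ ≡ r → t ≡ q + q + r + (q + q + r) + (r′ + r′ + s) → 4 * p ≤ t
    lin p q r r′ s t h0 h1 h2 =
      linear 6 (λ p q r r′ s t → (p ⊴ q ⊕ r) ∷ (q ⊕ r ⊴ p) ∷ (r′ ⊴ r) ∷ (r ⊴ r′) ∷ (t ⊴ q ⊕ q ⊕ r ⊕ (q ⊕ q ⊕ r) ⊕ (r′ ⊕ r′ ⊕ s)) ∷ (q ⊕ q ⊕ r ⊕ (q ⊕ q ⊕ r) ⊕ (r′ ⊕ r′ ⊕ s) ⊴ t) ∷ [] , (4 ⊗ p ⊴ t)) 1 (4 ∷ 0 ∷ 0 ∷ 2 ∷ 0 ∷ 1 ∷ []) p q r r′ s t (≤-reflexive h0) (≤-reflexive (sym h0)) (≤-reflexive h1) (≤-reflexive (sym h1)) (≤-reflexive h2) (≤-reflexive (sym h2))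

product≤ : ∀ a b c → a + b ≤ 2 * c → a * b ≤ c * c
product≤ a b c h with ≤-total a b
... | inj₁ le = product≤-ordered a b c le h
... | inj₂ ge = ≤-trans (≤-reflexive (*-comm a b)) (product≤-ordered b a c ge (≤-trans (≤-reflexive (+-comm b a)) h))

-- Maximum degree at most half the order

*-swapˡ : ∀ a b c → a * (b * c) ≡ b * (a * c)
*-swapˡ a b c = trans (sym (*-assoc a b c)) (trans (cong (_* c) (*-comm a b)) (*-assoc b a c))

*-scale : ∀ D {a b} c d → c * a ≤ d * b → c * (D * a) ≤ d * (D * b)
*-scale D {a} {b} c d le = ≤-trans (≤-reflexive (*-swapˡ c D a)) (≤-trans (*-monoʳ-≤ D le) (≤-reflexive (*-swapˡ D d b)))

module Moderate {N} {σ : State N} {n D T : ℕ} (G : Good σ n D T) (κ : ℕ) (κ-small : 20 * κ ≤ D) (κ-large : D < 20 * suc κ)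
                (D-lo : n < 700 * D) (D-half : 2 * D ≤ n) where

  open Good G
  open Scarce σ κ 600 (A σ)

  remote : Fin N → Bool
  remote y = B σ y ∧ (count (partner σ κ 600 (A σ) y) ≤ᵇ D + 3 * κ + 3000)

  not-remote : ∀ u y → B σ y ≡ true → remote y ≡ false → 3 * κ + 3000 ≤ count (candidate σ κ u y)
  not-remote u y by h = lin (count (partner σ κ 600 (A σ) y)) (count (candidate σ κ u y)) (d₁ σ u) D κ
      (≤ᵇ-false⁻ (¬true⇒false λ t → true≢false (∧-intro by t) h)) (candidate-loss σ κ u y) (Δ₁ u)
    where
    lin : ∀ p c d D k → D + 3 * k + 3000 < p → p ≤ c + d + 1 → d ≤ D → 3 * k + 3000 ≤ c
    lin = linear 5 (λ p c d D k → (# 1 ⊕ (D ⊕ 3 ⊗ k ⊕ # 3000) ⊴ p) ∷ (p ⊴ c ⊕ d ⊕ # 1) ∷ (d ⊴ D) ∷ [] , (3 ⊗ k ⊕ # 3000 ⊴ c)) 1 (1 ∷ 1 ∷ 1 ∷ [])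

  size : ∀ n D k h w a b c T → 601 * h ≤ w → w ≤ a → 20 * k ≤ D → 2 * D ≤ n → a + b + 2 * c + 2 * D + 2 * T + 836550 ≤ 6 * n → D + 3 * k + 3000 + h ≤ n
  size = linear 9 (λ n D k h w a b c T → (601 ⊗ h ⊴ w) ∷ (w ⊴ a) ∷ (20 ⊗ k ⊴ D) ∷ (2 ⊗ D ⊴ n) ∷ (a ⊕ b ⊕ 2 ⊗ c ⊕ 2 ⊗ D ⊕ 2 ⊗ T ⊕ # 836550 ⊴ 6 ⊗ n) ∷ [] , (D ⊕ 3 ⊗ k ⊕ # 3000 ⊕ h ⊴ n)) 120200 (200 ∷ 200 ∷ 18030 ∷ 58898 ∷ 10217 ∷ [])
  ∑tall-m₁ : 601 * tall ≤ m₁ σ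
  ∑tall-m₁ = ≤-trans ∑tall (weight≤ (A σ) (d₁ σ))
  m₁-lin : ∀ a b c D T n → a + b + 2 * c + 2 * D + 2 * T + 836550 ≤ 6 * n → a ≤ 6 * n
  m₁-lin = linear 6 (λ a b c D T n → (a ⊕ b ⊕ 2 ⊗ c ⊕ 2 ⊗ D ⊕ 2 ⊗ T ⊕ # 836550 ⊴ 6 ⊗ n) ∷ [] , (a ⊴ 6 ⊗ n)) 1 (1 ∷ [])
  m₃-lin : ∀ a b c D T n → a + b + 2 * c + 2 * D + 2 * T + 836550 ≤ 6 * n → 1 * c ≤ 3 * n
  m₃-lin = linear 6 (λ a b c D T n → (a ⊕ b ⊕ 2 ⊗ c ⊕ 2 ⊗ D ⊕ 2 ⊗ T ⊕ # 836550 ⊴ 6 ⊗ n) ∷ [] , (1 ⊗ c ⊴ 3 ⊗ n)) 2 (1 ∷ [])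
  m₁₂-lin : ∀ a b c D T n → a + b + 2 * c + 2 * D + 2 * T + 836550 ≤ 6 * n → a + b ≤ 2 * (3 * n)
  m₁₂-lin = linear 6 (λ a b c D T n → (a ⊕ b ⊕ 2 ⊗ c ⊕ 2 ⊗ D ⊕ 2 ⊗ T ⊕ # 836550 ⊴ 6 ⊗ n) ∷ [] , (a ⊕ b ⊴ 2 ⊗ (3 ⊗ n))) 1 (1 ∷ [])
  n-lin : ∀ a b c D T n → a + b + 2 * c + 2 * D + 2 * T + 836550 ≤ 6 * n → 139425 * 1 ≤ 1 * n
  n-lin = linear 6 (λ a b c D T n → (a ⊕ b ⊕ 2 ⊗ c ⊕ 2 ⊗ D ⊕ 2 ⊗ T ⊕ # 836550 ⊴ 6 ⊗ n) ∷ [] , (139425 ⊗ # 1 ⊴ 1 ⊗ n)) 6 (1 ∷ [])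

  room = m≤n⇒∃[o]m+o≡n (size n D κ tall (weight (A σ) (d₁ σ)) (m₁ σ) (m₂ σ) (m₃ σ) T ∑tall (weight≤ (A σ) (d₁ σ)) κ-small D-half budget)
  g = proj₁ room

  split : D * n ≡ D * D + D * (3 * κ) + D * 3000 + D * tall + D * g
  split = begin
    D * n                                                ≡⟨ cong (D *_) (sym (proj₂ room)) ⟩
    D * (D + 3 * κ + 3000 + tall + g)                    ≡⟨ *-distribˡ-+ D (D + 3 * κ + 3000 + tall) g ⟩
    D * (D + 3 * κ + 3000 + tall) + D * g                ≡⟨ cong (_+ D * g) (*-distribˡ-+ D (D + 3 * κ + 3000) tall) ⟩
    D * (D + 3 * κ + 3000) + D * tall + D * g            ≡⟨ cong (λ z → z + D * tall + D * g) (*-distribˡ-+ D (D + 3 * κ) 3000) ⟩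
    D * (D + 3 * κ) + D * 3000 + D * tall + D * g        ≡⟨ cong (λ z → z + D * 3000 + D * tall + D * g) (*-distribˡ-+ D D (3 * κ)) ⟩
    D * D + D * (3 * κ) + D * 3000 + D * tall + D * g    ∎
    where open ≡-Reasoning

  -- (700D - n)(n - 2D) ≥ 0
  convex : 1400 * (D * D) + n * n ≤ 702 * (D * n)
  convex = subst (λ n → 1400 * (D * D) + n * n ≤ 702 * (D * n)) o-def
      (lin (D * D) (D * o) (o * o) ((2 * D + o) * (2 * D + o)) (D * (2 * D + o)) square row (*-monoˡ-≤ o (few D o n o-def D-lo)) (*-assoc 698 D o))
    where
    o = proj₁ (m≤n⇒∃[o]m+o≡n D-half)
    o-def = proj₂ (m≤n⇒∃[o]m+o≡n D-half)
    few : ∀ D o n → 2 * D + o ≡ n → n < 700 * D → o ≤ 698 * D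
    few D o n h0 h1 =
      linear 3 (λ D o n → (2 ⊗ D ⊕ o ⊴ n) ∷ (n ⊴ 2 ⊗ D ⊕ o) ∷ (# 1 ⊕ n ⊴ 700 ⊗ D) ∷ [] , (o ⊴ 698 ⊗ D)) 1 (1 ∷ 0 ∷ 1 ∷ []) D o n (≤-reflexive h0) (≤-reflexive (sym h0)) h1
    lin : ∀ p q r s t → s ≡ 2 * t + (2 * q + r) → t ≡ 2 * p + q → r ≤ 698 * D * o → 698 * D * o ≡ 698 * q → 1400 * p + s ≤ 702 * t
    lin p q r s t e₁ e₂ le e₃ = go p q r s t e₁ e₂ (≤-trans le (≤-reflexive e₃))
      where
      go : ∀ p q r s t → s ≡ 2 * t + (2 * q + r) → t ≡ 2 * p + q → r ≤ 698 * q → 1400 * p + s ≤ 702 * t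
      go p q r s t h0 h1 h2 =
        linear 5 (λ p q r s t → (s ⊴ 2 ⊗ t ⊕ (2 ⊗ q ⊕ r)) ∷ (2 ⊗ t ⊕ (2 ⊗ q ⊕ r) ⊴ s) ∷ (t ⊴ 2 ⊗ p ⊕ q) ∷ (2 ⊗ p ⊕ q ⊴ t) ∷ (r ⊴ 698 ⊗ q) ∷ [] , (1400 ⊗ p ⊕ s ⊴ 702 ⊗ t)) 1 (1 ∷ 0 ∷ 0 ∷ 700 ∷ 1 ∷ []) p q r s t (≤-reflexive h0) (≤-reflexive (sym h0)) (≤-reflexive h1) (≤-reflexive (sym h1)) h2
    row : D * (2 * D + o) ≡ 2 * (D * D) + D * o
    row = trans (*-distribˡ-+ D (2 * D) o) (cong (_+ D * o) (*-swapˡ D 2 D))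
    square : (2 * D + o) * (2 * D + o) ≡ 2 * (D * (2 * D + o)) + (2 * (D * o) + o * o)
    square = trans (*-distribʳ-+ (2 * D + o) (2 * D) o) (cong₂ _+_ (*-assoc 2 D (2 * D + o))
      (trans (*-distribˡ-+ o (2 * D) o) (cong (_+ o * o) (trans (*-swapˡ o 2 D) (cong (2 *_) (*-comm o D))))))

  product : m₁ σ * m₂ σ ≤ 9 * (n * n)
  product = ≤-trans (product≤ (m₁ σ) (m₂ σ) (3 * n) (m₁₂-lin (m₁ σ) (m₂ σ) (m₃ σ) D T n budget)) (≤-reflexive ([m*n]*[o*p]≡[m*o]*[n*p] 3 n 3 n))

  D*costly : D * ∑ costly ≤ 180 * (n * n)
  D*costly = begin
    D * ∑ costly                                ≤⟨ *-monoˡ-≤ (∑ costly) (<⇒≤ κ-large) ⟩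
    20 * suc κ * ∑ costly                       ≡⟨ *-assoc 20 (suc κ) (∑ costly) ⟩
    20 * (suc κ * ∑ costly)                     ≤⟨ *-monoʳ-≤ 20 (≤-trans ∑costly (*-monoˡ-≤ (m₂ σ) (weight≤ (A σ) (d₁ σ)))) ⟩
    20 * (m₁ σ * m₂ σ)                          ≤⟨ *-monoʳ-≤ 20 product ⟩
    20 * (9 * (n * n))                          ≡⟨ sym (*-assoc 20 9 (n * n)) ⟩
    180 * (n * n)                               ∎
    where open ≤-Reasoning

  -- Everything is multiplied by `D`, which removes the denominator from the bound on `∑ costly`.
  -- `convex` then eliminates `n * n`, and the remaining products are treated as unknowns. The
  -- critical case is `D` near `n / 700`, where the costly pairs number up to `126000 n` and a
  -- remote vertex lacks nearly `n` partners.
  #remote : count remote ≤ 132000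
  #remote = ≮⇒≥ λ many → impossible (lin (D * D) (D * κ) (D * tall) (D * g) (D * n) (n * n) (D * 1) (D * (3 * κ)) (D * 3000) (D * ∑ seen) (D * ∑ costly)
      (*-scale D 20 1 (≤-trans κ-small (≤-reflexive (sym (+-identityʳ D)))))
      (*-scale D 601 6 (≤-trans ∑tall-m₁ (m₁-lin (m₁ σ) (m₂ σ) (m₃ σ) D T n budget)))
      (*-scale D 139425 1 (n-lin (m₁ σ) (m₂ σ) (m₃ σ) D T n budget))
      (*-scale D 1 3 (≤-trans (*-monoʳ-≤ 1 ∑seen) (m₃-lin (m₁ σ) (m₂ σ) (m₃ σ) D T n budget)))
      D*costly convex split (*-swapˡ D 3 κ) (*-swapˡ D 3000 1)
      (≤-trans (≤-reflexive (*-swapˡ 132001 D g)) (≤-trans (*-monoʳ-≤ D (≤-trans (*-monoˡ-≤ g many)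
        (scarce remote (D + 3 * κ + 3000) g (λ y h → ≤ᵇ-true⁻ (∧-elimʳ {B σ y} h)) (trans (proj₂ room) (sym #A))))) (≤-reflexive (*-distribˡ-+ D (∑ seen) (∑ costly)))))
      (≤-trans (positive (m₁ σ) (m₂ σ) (m₃ σ) D T n budget D-lo) (≤-reflexive (sym (*-identityʳ D)))))
    where
    positive : ∀ a b c D T n → a + b + 2 * c + 2 * D + 2 * T + 836550 ≤ 6 * n → n < 700 * D → 1 ≤ D
    positive = linear 6 (λ a b c D T n → (a ⊕ b ⊕ 2 ⊗ c ⊕ 2 ⊗ D ⊕ 2 ⊗ T ⊕ # 836550 ⊴ 6 ⊗ n) ∷ (# 1 ⊕ n ⊴ 700 ⊗ D) ∷ [] , (# 1 ⊴ D)) 4198 (1 ∷ 6 ∷ [])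
    lin : ∀ DD Dk Dh Dg Dn nn D D3k D3000 DY DZ → 20 * Dk ≤ 1 * DD → 601 * Dh ≤ 6 * Dn → 139425 * D ≤ 1 * Dn → 1 * DY ≤ 3 * Dn → DZ ≤ 180 * nn → 1400 * DD + nn ≤ 702 * Dn → Dn ≡ DD + D3k + D3000 + Dh + Dg → D3k ≡ 3 * Dk → D3000 ≡ 3000 * D → 132001 * Dg ≤ DY + DZ → 1 ≤ D → 1 ≤ 0
    lin DD Dk Dh Dg Dn nn D D3k D3000 DY DZ h0 h1 h2 h3 h4 h5 h6 h7 h8 h9 h10 =
      linear 11 (λ DD Dk Dh Dg Dn nn D D3k D3000 DY DZ → (20 ⊗ Dk ⊴ 1 ⊗ DD) ∷ (601 ⊗ Dh ⊴ 6 ⊗ Dn) ∷ (139425 ⊗ D ⊴ 1 ⊗ Dn) ∷ (1 ⊗ DY ⊴ 3 ⊗ Dn) ∷ (DZ ⊴ 180 ⊗ nn) ∷ (1400 ⊗ DD ⊕ nn ⊴ 702 ⊗ Dn) ∷ (Dn ⊴ DD ⊕ D3k ⊕ D3000 ⊕ Dh ⊕ Dg) ∷ (DD ⊕ D3k ⊕ D3000 ⊕ Dh ⊕ Dg ⊴ Dn) ∷ (D3k ⊴ 3 ⊗ Dk) ∷ (3 ⊗ Dk ⊴ D3k) ∷ (D3000 ⊴ 3000 ⊗ D) ∷ (3000 ⊗ D ⊴ D3000) ∷ (132001 ⊗ Dg ⊴ DY ⊕ DZ) ∷ (# 1 ⊴ D) ∷ [] , (# 1 ⊴ # 0)) 0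 (237997803 ∷ 2640020 ∷ 51928640 ∷ 12020 ∷ 12020 ∷ 2163600 ∷ 1586652020 ∷ 0 ∷ 1586652020 ∷ 0 ∷ 1586652020 ∷ 0 ∷ 12020 ∷ 2480194572000 ∷ []) DD Dk Dh Dg Dn nn D D3k D3000 DY DZ h0 h1 h2 h3 h4 h5 (≤-reflexive h6) (≤-reflexive (sym h6)) (≤-reflexive h7) (≤-reflexive (sym h7)) (≤-reflexive h8) (≤-reflexive (sym h8)) h9 h10

moderate-packing : ∀ {N} {σ : State N} {n D T} → Hyp N n → Good σ n D T → n < 700 * D → 2 * D ≤ n → D + 139000 < n → 3 * T + D + 400 < 3 * n →
                   ∀ v → A σ v ≡ true → d₁ σ v ≡ D →
                   (∃ λ p → A σ p ≡ true × d₃ˡ σ p ≡ T) ⊎ (∃ λ p → B σ p ≡ true × d₃ʳ σ p ≡ T) → Packing σ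
moderate-packing {N} {σ} {n} {D} {T} hyp G D-lo D-half D-hi T-far v av d₁v exact = select X M.#remote tame exact
  where
  κ = proj₁ (floor 19 D)
  κ-small = proj₁ (proj₂ (floor 19 D))
  κ-large = proj₂ (proj₂ (floor 19 D))
  module M = Moderate G κ κ-small κ-large D-lo D-half
  module M′ = Moderate (swap-good G) κ κ-small κ-large D-lo D-half
  X : Setting σ n D T
  X = record { hyp = hyp ; G = G ; κ = κ ; κ-small = κ-small ; D-lo = D-lo ; D-hi = D-hi ; T-far = T-far ; v = v ; av = av ; d₁v = d₁v
             ; H = M.remote ; M = κ ; easy-v = M.not-remote v ; easy-u = λ u y _ _ → M.not-remote u y }
  tame : ∀ x → B σ x ≡ true → Tame X x
  tame x _ = record { H₁ = M′.remote ; #H₁ = M′.#remote ; easy-x = λ u au h → ≤-trans (m≤n+m 3000 (3 * κ)) (M′.not-remote x u au h)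
                    -- With `M = κ` this is just the bound on the degree of `u`.
                    ; spread = λ u _ _ _ le → ≤-trans (count-mono λ b → ∧-elimˡ) le }

-- Maximum degree above half the order

count-∨ : ∀ {N} (p q : Fin N → Bool) → count (λ x → p x ∨ q x) ≤ count p + count q
count-∨ p q = ≤-trans (∑-mono λ x → pt (p x) (q x)) (≤-reflexive (∑-+ _ _))
  where
  pt : ∀ a b → 𝟙 (a ∨ b) ≤ 𝟙 a + 𝟙 b
  pt true  b = s≤s z≤n
  pt false b = ≤-refl

∨-false : ∀ {a b} → a ∨ b ≡ false → a ≡ false × b ≡ false
∨-false {false} h = refl , h

costly-bound : ∀ {D κ Z a b} c → 1 ≤ D → D < 20 * suc κ → suc κ * Z ≤ a * b → b ≤ c * D → Z ≤ 20 * c * a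
costly-bound {D@(suc _)} {κ} {Z} {a} {b} c _ large le bound = *-cancelˡ-≤ D (begin
    D * Z                  ≤⟨ *-monoˡ-≤ Z (<⇒≤ large) ⟩
    20 * suc κ * Z         ≡⟨ *-assoc 20 (suc κ) Z ⟩
    20 * (suc κ * Z)       ≤⟨ *-monoʳ-≤ 20 (≤-trans le (*-monoʳ-≤ a bound)) ⟩
    20 * (a * (c * D))     ≡⟨ cong (20 *_) (trans (*-swapˡ a c D) (cong (c *_) (*-comm a D))) ⟩
    20 * (c * (D * a))     ≡⟨ sym (*-assoc 20 c (D * a)) ⟩
    20 * c * (D * a)       ≡⟨ *-swapˡ (20 * c) D a ⟩
    D * (20 * c * a)       ∎)
  where open ≤-Reasoning

-- Partners must be non-neighbours of `v`, and there may be few of them compared with `n`. So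
-- everything is measured against their number `o`; their total degree is at most `F`, the excess of
-- `m₁` over `2 D`.
module Dense {N} {σ : State N} {n D T : ℕ} (hyp : Hyp N n) (G : Good σ n D T) (D-half : n < 2 * D) (D-hi : D + 139000 < n)
             (T-far : 3 * T + D + 400 < 3 * n) (v : Fin N) (av : A σ v ≡ true) (d₁v : d₁ σ v ≡ D) where

  open Good G

  κ : ℕ
  κ = proj₁ (floor 19 D)
  κ-small : 20 * κ ≤ D
  κ-small = proj₁ (proj₂ (floor 19 D))
  κ-large : D < 20 * suc κ
  κ-large = proj₂ (proj₂ (floor 19 D))

  D-lo-lin : ∀ n D → n < 2 * D → n < 700 * D
  D-lo-lin = linear 2 (λ n D → (# 1 ⊕ n ⊴ 2 ⊗ D) ∷ [] , (# 1 ⊕ n ⊴ 700 ⊗ D)) 1 (350 ∷ [])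
  D-lo = D-lo-lin n D D-half
  1≤D-lin : ∀ n D → n < 2 * D → 1 ≤ D
  1≤D-lin = linear 2 (λ n D → (# 1 ⊕ n ⊴ 2 ⊗ D) ∷ [] , (# 1 ⊴ D)) 2 (1 ∷ [])
  1≤D = 1≤D-lin n D D-half

  R : ℕ
  R = proj₁ (m≤n⇒∃[o]m+o≡n (≤∑ (d₃ˡ σ) v))
  R-def : d₃ˡ σ v + R ≡ m₃ σ
  R-def = proj₂ (m≤n⇒∃[o]m+o≡n (≤∑ (d₃ˡ σ) v))

  m₁≥ : 2 * D ≤ m₁ σ
  m₁≥ = subst (λ d → 2 * d ≤ m₁ σ) d₁v (degree≤half σ v)
  F : ℕ
  F = proj₁ (m≤n⇒∃[o]m+o≡n m₁≥)
  F-def : 2 * D + F ≡ m₁ σ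
  F-def = proj₂ (m≤n⇒∃[o]m+o≡n m₁≥)

  away : Fin N → Bool
  away = around σ v
  o : ℕ
  o = count away
  o-def : o + D + 1 ≡ n
  o-def = trans (cong (λ d → o + d + 1) (sym d₁v)) (trans (count-around σ v av) #A)

  weight-away : weight away (d₁ σ) ≤ F
  weight-away = lin (weight away (d₁ σ)) D (d₁ σ v) F (m₁ σ) (weight-around σ v) d₁v F-def
    where
    lin : ∀ w D d F a → w + 2 * d ≤ a → d ≡ D → 2 * D + F ≡ a → w ≤ F
    lin w D d F a h0 h1 h2 =
      linear 5 (λ w D d F a → (w ⊕ 2 ⊗ d ⊴ a) ∷ (d ⊴ D) ∷ (D ⊴ d) ∷ (2 ⊗ D ⊕ F ⊴ a) ∷ (a ⊴ 2 ⊗ D ⊕ F) ∷ [] , (w ⊴ F)) 1 (1 ∷ 0 ∷ 2 ∷ 0 ∷ 1 ∷ []) w D d F a h0 (≤-reflexive h1) (≤-reflexive (sym h1)) (≤-reflexive h2) (≤-reflexive (sym h2))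

  away-v : away v ≡ false
  away-v = ¬true⇒false λ h → true≢false (==-refl v) (not-elim (∧-elimʳ {not (E₁ σ v v)} (∧-elimʳ {A σ v} h)))

  m₂≤8D : m₂ σ ≤ 8 * D
  m₂≤8D = lin (m₁ σ) (m₂ σ) (m₃ σ) D T n m₁≥ budget D-half
    where
    lin : ∀ a b c D T n → 2 * D ≤ a → a + b + 2 * c + 2 * D + 2 * T + 836550 ≤ 6 * n → n < 2 * D → b ≤ 8 * D
    lin = linear 6 (λ a b c D T n → (2 ⊗ D ⊴ a) ∷ (a ⊕ b ⊕ 2 ⊗ c ⊕ 2 ⊗ D ⊕ 2 ⊗ T ⊕ # 836550 ⊴ 6 ⊗ n) ∷ (# 1 ⊕ n ⊴ 2 ⊗ D) ∷ [] , (b ⊴ 8 ⊗ D)) 1 (1 ∷ 1 ∷ 6 ∷ [])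

  m₁≤12D : m₁ σ ≤ 12 * D
  m₁≤12D = lin (m₁ σ) (m₂ σ) (m₃ σ) D T n budget D-half
    where
    lin : ∀ a b c D T n → a + b + 2 * c + 2 * D + 2 * T + 836550 ≤ 6 * n → n < 2 * D → a ≤ 12 * D
    lin = linear 6 (λ a b c D T n → (a ⊕ b ⊕ 2 ⊗ c ⊕ 2 ⊗ D ⊕ 2 ⊗ T ⊕ # 836550 ⊴ 6 ⊗ n) ∷ (# 1 ⊕ n ⊴ 2 ⊗ D) ∷ [] , (a ⊴ 12 ⊗ D)) 5 (6 ∷ 36 ∷ [])

  -- With `D` as the degree cap no vertex is tall. This suffices for `mild`, which places a single
  -- pair and has no further partner to keep apart from it.
  module S₀ = Scarce σ κ D away

  H₀ : Fin N → Bool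
  H₀ y = B σ y ∧ (suc (2 * count (partner σ κ D away y)) ≤ᵇ o)
  h₀ : ℕ
  h₀ = count H₀

  not-H₀ : ∀ y → B σ y ≡ true → H₀ y ≡ false → o ≤ 2 * count (partner σ κ D away y)
  not-H₀ y by h = ≤-pred (≤ᵇ-false⁻ (¬true⇒false λ t → true≢false (∧-intro by t) h))

  no-tall : S₀.tall ≡ 0
  no-tall = ∑-0 λ b → 𝟙-false (¬true⇒false λ h → <⇒≱ (≤ᵇ-true⁻ {suc D} (∧-elimʳ {away b} h)) (Δ₁ b))

  -- A vertex of `H₀` lacks at least half of the `o` possible partners, and at most `R + 160 F`
  -- failures occur altogether. The factor `160 = 20 * 8` comes from `D < 20 * suc κ` and
  -- `m₂ ≤ 8 D`.
  h₀-area : h₀ * o ≤ 2 * R + 320 * F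
  h₀-area = lin h₀ (h₀ * t) (h₀ * g) (h₀ * o) (∑ S₀.seen) (∑ S₀.costly) R F (d₃ˡ σ v) (m₃ σ) (S₀.∑seen-off v away-v) R-def
      (costly-bound {Z = ∑ S₀.costly} {a = F} {b = m₂ σ} 8 1≤D κ-large (≤-trans S₀.∑costly (*-monoˡ-≤ (m₂ σ) weight-away)) m₂≤8D)
      (S₀.scarce H₀ t g (λ y h → below-floor 1 (proj₂ (proj₂ (floor 1 o))) (<⇒≤ (≤ᵇ-true⁻ {suc (2 * count (partner σ κ D away y))} (∧-elimʳ {B σ y} h)))) room)
      (≤-trans (≤-reflexive (cong (h₀ *_) (sym room′))) (≤-reflexive (*-distribˡ-+ h₀ t g))) (*-monoʳ-≤ h₀ (half t g o room′ (proj₁ (proj₂ (floor 1 o)))))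
    where
    t = proj₁ (floor 1 o)
    t-lin : ∀ t o → 2 * t ≤ o → t ≤ o
    t-lin = linear 2 (λ t o → (2 ⊗ t ⊴ o) ∷ [] , (t ⊴ o)) 2 (1 ∷ [])
    split = m≤n⇒∃[o]m+o≡n (t-lin t o (proj₁ (proj₂ (floor 1 o))))
    g = proj₁ split
    room′ : t + g ≡ o
    room′ = proj₂ split
    room : t + S₀.tall + g ≡ o
    room = trans (cong (λ z → t + z + g) no-tall) (trans (cong (_+ g) (+-identityʳ t)) room′)
    half : ∀ t g o → t + g ≡ o → 2 * t ≤ o → t ≤ g
    half t g o h0 h1 =
      linear 3 (λ t g o → (t ⊕ g ⊴ o) ∷ (o ⊴ t ⊕ g) ∷ (2 ⊗ t ⊴ o) ∷ [] , (t ⊴ g)) 1 (0 ∷ 1 ∷ 1 ∷ []) t g o (≤-reflexive h0) (≤-reflexive (sym h0)) h1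
    lin : ∀ h ht hg ho s z R F d c → s + d ≤ c → d + R ≡ c → z ≤ 160 * F → hg ≤ s + z → ho ≤ ht + hg → ht ≤ hg → ho ≤ 2 * R + 320 * F
    lin h ht hg ho s z R F d c h0 h1 h2 h3 h4 h5 =
      linear 10 (λ h ht hg ho s z R F d c → (s ⊕ d ⊴ c) ∷ (d ⊕ R ⊴ c) ∷ (c ⊴ d ⊕ R) ∷ (z ⊴ 160 ⊗ F) ∷ (hg ⊴ s ⊕ z) ∷ (ho ⊴ ht ⊕ hg) ∷ (ht ⊴ hg) ∷ [] , (ho ⊴ 2 ⊗ R ⊕ 320 ⊗ F)) 1 (2 ∷ 0 ∷ 2 ∷ 2 ∷ 2 ∷ 1 ∷ 1 ∷ []) h ht hg ho s z R F d c h0 (≤-reflexive h1) (≤-reflexive (sym h1)) h2 h3 h4 h5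

  mild : ∀ w → B σ w ≡ true → E₃ σ v w ≡ false → d₂ σ w ≤ 1 → (∀ y → E₂ σ w y ≡ true → H₀ y ≡ false) → Packing σ
  mild w bw nvw few easy = [ isolated-w , leaf-w ]′ (zero-or-positive (d₂ σ w))
    where
    finish : ∀ L ℓ → length L ≡ ℓ → ℓ ≤ 1 → (∀ y → E₂ σ w y ≡ true → ¬ Avoidʳ L y) → All (Cheap σ κ) L → AllPairs (Compatible σ) L →
             All (λ p → proj₁ p ≢ v × E₁ σ v (proj₁ p) ≡ false) L → Avoidʳ L w → Packing σ
    finish L ℓ refl ℓ≤1 cover cheaps pairs off-v off-w = root-packing hyp G κ v w av bw nvw L ℓ refl cover cheaps pairs off-v off-w
      T (2 * (length L * κ)) ≤-refl (λ u _ → Δ₃ˡ u) (λ y _ → Δ₃ʳ y) (After.total≤ (after σ L cheaps pairs))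
      (subst (λ d → 2 * (length L * κ) + 2 * (length L * κ) + 8 * length L + 6 ≤ 2 * d) (sym d₁v) (gain (length L * κ) (length L) κ D n ℓ≤1 (*-monoˡ-≤ κ ℓ≤1) κ-small D-half D-hi))
      (safe₁ (length L) D n ℓ≤1 D-hi) (safe₃ (length L * κ) (length L) κ D T n ℓ≤1 (*-monoˡ-≤ κ ℓ≤1) κ-small T-far)
      where
      gain : ∀ z l k D n → l ≤ 1 → z ≤ 1 * k → 20 * k ≤ D → n < 2 * D → D + 139000 < n → 2 * z + 2 * z + 8 * l + 6 ≤ 2 * D
      gain = linear 5 (λ z l k D n → (l ⊴ # 1) ∷ (z ⊴ 1 ⊗ k) ∷ (20 ⊗ k ⊴ D) ∷ (# 1 ⊕ n ⊴ 2 ⊗ D) ∷ (# 1 ⊕ (D ⊕ # 139000) ⊴ n) ∷ [] , (2 ⊗ z ⊕ 2 ⊗ z ⊕ 8 ⊗ l ⊕ # 6 ⊴ 2 ⊗ D)) 5 (40 ∷ 20 ∷ 1 ∷ 9 ∷ 9 ∷ [])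
      safe₁ : ∀ l D n → l ≤ 1 → D + 139000 < n → D + l + 3 ≤ n
      safe₁ = linear 3 (λ l D n → (l ⊴ # 1) ∷ (# 1 ⊕ (D ⊕ # 139000) ⊴ n) ∷ [] , (D ⊕ l ⊕ # 3 ⊴ n)) 1 (1 ∷ 1 ∷ [])
      safe₃ : ∀ z l k D T n → l ≤ 1 → z ≤ 1 * k → 20 * k ≤ D → 3 * T + D + 400 < 3 * n → T + z + l + 2 ≤ n
      safe₃ = linear 6 (λ z l k D T n → (l ⊴ # 1) ∷ (z ⊴ 1 ⊗ k) ∷ (20 ⊗ k ⊴ D) ∷ (# 1 ⊕ (3 ⊗ T ⊕ D ⊕ # 400) ⊴ 3 ⊗ n) ∷ [] , (T ⊕ z ⊕ l ⊕ # 2 ⊴ n)) 60 (60 ∷ 60 ∷ 3 ∷ 20 ∷ [])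
    isolated-w : d₂ σ w ≡ 0 → Packing σ
    isolated-w z = finish [] 0 refl z≤n (λ y e _ → true≢false e (count-zero z y)) [] [] [] []
    leaf-w : 1 ≤ d₂ σ w → Packing σ
    leaf-w pos = finish ((b , y) ∷ []) 1 refl ≤-refl (λ z e → λ { (ne ∷ []) → ne (sym (only z e)) })
        (cheap (∧-elimˡ {A σ b} (∧-elimˡ {away b} hb)) (on₂ σ y w (trans (sym₂ σ y w) wy)) (not-elim (∧-elimˡ r)) (≤ᵇ-true⁻ (∧-elimˡ (∧-elimʳ {not (E₃ σ b y)} r))) ∷ [])
        ([] ∷ []) ((==-false⇒≢ (not-elim (∧-elimʳ {not (E₁ σ v b)} a)) , not-elim (∧-elimˡ a)) ∷ []) ((λ e → adjacent₂ σ wy (sym e)) ∷ [])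
      where
      y-found = neighbour {p = E₂ σ w} pos
      y = proj₁ y-found
      wy = proj₂ y-found
      by = on₂ σ y w (trans (sym₂ σ y w) wy)
      b-found = nonempty (partner σ κ D away y) (some o (count (partner σ κ D away y)) D n (not-H₀ y by (easy y wy)) o-def D-hi)
        where
        some : ∀ o c D n → o ≤ 2 * c → o + D + 1 ≡ n → D + 139000 < n → 1 ≤ c
        some o c D n h0 h1 h2 =
          linear 4 (λ o c D n → (o ⊴ 2 ⊗ c) ∷ (o ⊕ D ⊕ # 1 ⊴ n) ∷ (n ⊴ o ⊕ D ⊕ # 1) ∷ (# 1 ⊕ (D ⊕ # 139000) ⊴ n) ∷ [] , (# 1 ⊴ c)) 2 (1 ∷ 0 ∷ 1 ∷ 1 ∷ []) o c D n h0 (≤-reflexive h1) (≤-reflexive (sym h1)) h2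
      b = proj₁ b-found
      hb = proj₂ b-found
      a = ∧-elimʳ {A σ b} (∧-elimˡ {away b} hb)
      r = ∧-elimʳ {away b} hb
      only : ∀ z → E₂ σ w z ≡ true → z ≡ y
      only z e with z ≟ᶠ y
      ... | yes eq = eq
      ... | no ne  = ⊥-elim (<⇒≱ (s≤s few) (≤-trans (≤-reflexive (cong₂ (λ p q → 𝟙 p + 𝟙 q) (sym e) (sym wy))) (two-point (λ z → 𝟙 (E₂ σ w z)) ne)))

  module L₀ = Load (B σ) (E₂ σ) (sym₂ σ) H₀

  Crowded : Set
  Crowded = ∀ w → B σ w ≡ true → H₀ w ≡ false → E₃ σ v w ≡ false → 2 ≤ L₀.load w

  crowded : Packing σ ⊎ Crowded
  crowded with search (λ w → (B σ w ∧ not (E₃ σ v w)) ∧ (L₀.load w ≤ᵇ 1))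
  ... | inj₁ (w , h) = let p = ∧-elimˡ {B σ w ∧ not (E₃ σ v w)} h
                           z , few = L₀.weightless {w} (≤ᵇ-true⁻ (∧-elimʳ {B σ w ∧ not (E₃ σ v w)} h))
                       in inj₁ (mild w (∧-elimˡ p) (not-elim (∧-elimʳ {B σ w} p)) few (L₀.no-hard {w} z))
  ... | inj₂ none = inj₂ λ w bw _ nvw → ≤ᵇ-false⁻ (¬true⇒false λ t → true≢false (∧-intro (∧-intro bw (not-intro nvw)) t) (none w))

  module Rest (cr : Crowded) where

    ∑₂ : 2 * n + 2 * count L₀.bad ≤ m₂ σ + (2 * h₀ + 2 * d₃ˡ σ v)
    ∑₂ = subst (λ c → 2 * c + 2 * count L₀.bad ≤ m₂ σ + (2 * h₀ + 2 * d₃ˡ σ v)) #B (L₀.blocked₂ (E₃ σ v) cr)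

    -- G₂ and the edges of G₃ at `v` take about `2 n` of the budget, the edges at `v` in G₁ and the
    -- term in `D` take `4 D`. The remaining `4 (n - D)` is `4 o + 4`.
    slim : F + 2 * R + 836550 ≤ 4 * o + 4 + 2 * h₀
    slim = lin n (m₁ σ) (m₂ σ) (m₃ σ) D T (count L₀.bad) h₀ (d₃ˡ σ v) R F o ∑₂ R-def F-def o-def budget
      where
      lin : ∀ n a b c D T b₂ h d R F o → 2 * n + 2 * b₂ ≤ b + (2 * h + 2 * d) → d + R ≡ c → 2 * D + F ≡ a → o + D + 1 ≡ n → a + b + 2 * c + 2 * D + 2 * T + 836550 ≤ 6 * n → F + 2 * R + 836550 ≤ 4 * o + 4 + 2 * h
      lin n a b c D T b₂ h d R F o h0 h1 h2 h3 h4 =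
        linear 12 (λ n a b c D T b₂ h d R F o → (2 ⊗ n ⊕ 2 ⊗ b₂ ⊴ b ⊕ (2 ⊗ h ⊕ 2 ⊗ d)) ∷ (d ⊕ R ⊴ c) ∷ (c ⊴ d ⊕ R) ∷ (2 ⊗ D ⊕ F ⊴ a) ∷ (a ⊴ 2 ⊗ D ⊕ F) ∷ (o ⊕ D ⊕ # 1 ⊴ n) ∷ (n ⊴ o ⊕ D ⊕ # 1) ∷ (a ⊕ b ⊕ 2 ⊗ c ⊕ 2 ⊗ D ⊕ 2 ⊗ T ⊕ # 836550 ⊴ 6 ⊗ n) ∷ [] , (F ⊕ 2 ⊗ R ⊕ # 836550 ⊴ 4 ⊗ o ⊕ # 4 ⊕ 2 ⊗ h)) 1 (1 ∷ 2 ∷ 0 ∷ 1 ∷ 0 ∷ 0 ∷ 4 ∷ 1 ∷ []) n a b c D T b₂ h d R F o h0 (≤-reflexive h1) (≤-reflexive (sym h1)) (≤-reflexive h2) (≤-reflexive (sym h2)) (≤-reflexive h3) (≤-reflexive (sym h3)) h4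

    o-large : 139000 ≤ o
    o-large = lin o D n o-def D-hi
      where
      lin : ∀ o D n → o + D + 1 ≡ n → D + 139000 < n → 139000 ≤ o
      lin o D n h0 h1 =
        linear 3 (λ o D n → (o ⊕ D ⊕ # 1 ⊴ n) ∷ (n ⊴ o ⊕ D ⊕ # 1) ∷ (# 1 ⊕ (D ⊕ # 139000) ⊴ n) ∷ [] , (# 139000 ⊴ o)) 1 (0 ∷ 1 ∷ 1 ∷ []) o D n (≤-reflexive h0) (≤-reflexive (sym h0)) h1

    -- By `slim` the right side of `h₀-area` is about `320 * 4 o = 1280 o`; the lower-order terms
    -- are absorbed by `o ≥ 139000`.
    #H₀ : h₀ ≤ 1300
    #H₀ = ≮⇒≥ λ many → impossible (lin h₀ o (h₀ * o) R F h₀-area slim (*-monoˡ-≤ o many) (≤-trans (≤-reflexive (*-comm 139000 h₀)) (*-monoʳ-≤ h₀ o-large)) o-large)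
      where
      lin : ∀ h o ho R F → ho ≤ 2 * R + 320 * F → F + 2 * R + 836550 ≤ 4 * o + 4 + 2 * h → 1301 * o ≤ ho → 139000 * h ≤ ho → 139000 ≤ o → 1 ≤ 0
      lin = linear 5 (λ h o ho R F → (ho ⊴ 2 ⊗ R ⊕ 320 ⊗ F) ∷ (F ⊕ 2 ⊗ R ⊕ # 836550 ⊴ 4 ⊗ o ⊕ # 4 ⊕ 2 ⊗ h) ∷ (1301 ⊗ o ⊴ ho) ∷ (139000 ⊗ h ⊴ ho) ∷ (# 139000 ⊴ o) ∷ [] , (# 1 ⊴ # 0)) 0 (279301 ∷ 90419500 ∷ 278000 ∷ 1301 ∷ 0 ∷ [])

    F≤4o : F ≤ 4 * o
    F≤4o = lin o h₀ R F slim #H₀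
      where
      lin : ∀ o h R F → F + 2 * R + 836550 ≤ 4 * o + 4 + 2 * h → h ≤ 1300 → F ≤ 4 * o
      lin = linear 4 (λ o h R F → (F ⊕ 2 ⊗ R ⊕ # 836550 ⊴ 4 ⊗ o ⊕ # 4 ⊕ 2 ⊗ h) ∷ (h ⊴ # 1300) ∷ [] , (F ⊴ 4 ⊗ o)) 1 (1 ∷ 2 ∷ [])

    M : ℕ
    M = proj₁ (floor 15 o)
    M-small : 16 * M ≤ o
    M-small = proj₁ (proj₂ (floor 15 o))
    M-large : o < 16 * suc M
    M-large = proj₂ (proj₂ (floor 15 o))

    module S₁ = Scarce σ κ 600 away

    -- Of the `o / 2` partners at most `4 o / 601` have degree above 600, and the rest exceeds
    -- `3 o / 16 + 3000`.
    easy-v₀ : ∀ y → B σ y ≡ true → H₀ y ≡ false → 3 * M + 3000 ≤ count (candidate σ κ v y)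
    easy-v₀ y by h = lin o M (count (partner σ κ D away y)) (count (candidate σ κ v y)) S₁.tall F (not-H₀ y by h)
        (≤-trans (∑-mono λ b → pt (away b) (E₃ σ b y) (d₁ σ b * d₂ σ y ≤ᵇ κ) (d₁ σ b ≤ᵇ D) (d₁ σ b)) (∑-+≤ {f = λ b → 𝟙 (candidate σ κ v y b)} ≤-refl ≤-refl))
        (≤-trans S₁.∑tall weight-away) F≤4o M-small o-large
      where
      lin : ∀ o M p c h F → o ≤ 2 * p → p ≤ c + h → 601 * h ≤ F → F ≤ 4 * o → 16 * M ≤ o → 139000 ≤ o → 3 * M + 3000 ≤ c
      lin = linear 6 (λ o M p c h F → (o ⊴ 2 ⊗ p) ∷ (p ⊴ c ⊕ h) ∷ (601 ⊗ h ⊴ F) ∷ (F ⊴ 4 ⊗ o) ∷ (16 ⊗ M ⊴ o) ∷ (# 139000 ⊴ o) ∷ [] , (3 ⊗ M ⊕ # 3000 ⊴ c)) 9616 (4808 ∷ 9616 ∷ 16 ∷ 16 ∷ 1803 ∷ 2941 ∷ [])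
      pt : ∀ a e c l d → 𝟙 (a ∧ (not e ∧ (c ∧ l))) ≤ 𝟙 (a ∧ (not e ∧ (c ∧ (d ≤ᵇ 600)))) + 𝟙 (a ∧ (601 ≤ᵇ d))
      pt false e c l d = z≤n
      pt true true c l d = z≤n
      pt true false false l d = z≤n
      pt true false true l d with decide (d ≤ᵇ 600)
      ... | inj₁ t rewrite t = ≤-trans (𝟙≤1 l) (s≤s z≤n)
      ... | inj₂ f rewrite ≤ᵇ-true (≤ᵇ-false⁻ {d} {600} f) = ≤-trans (𝟙≤1 l) (m≤n+m 1 (𝟙 (d ≤ᵇ 600)))

    D″ : ℕ
    D″ = proj₁ (floor 2 (2 * n))

    -- A second degree `d` is at most `F / 2 + 1`, which is less than `2 (n - D)`. Adding
    -- `2 d ≤ 2 D` gives `3 d ≤ 2 n`.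
    others : ∀ u → u ≢ v → d₁ σ u ≤ D″
    others u ne = below-floor 2 (proj₂ (proj₂ (floor 2 (2 * n)))) (lin (d₁ σ u) D n o F (m₁ σ) (d₁ σ v) (other-degrees σ ne) d₁v (Δ₁ u) F-def o-def F≤4o)
      where
      lin : ∀ d D n o F a e → 2 * d + 2 * e ≤ a + 2 → e ≡ D → d ≤ D → 2 * D + F ≡ a → o + D + 1 ≡ n → F ≤ 4 * o → 3 * d ≤ 2 * n
      lin d D n o F a e h0 h1 h2 h3 h4 h5 =
        linear 7 (λ d D n o F a e → (2 ⊗ d ⊕ 2 ⊗ e ⊴ a ⊕ # 2) ∷ (e ⊴ D) ∷ (D ⊴ e) ∷ (d ⊴ D) ∷ (2 ⊗ D ⊕ F ⊴ a) ∷ (a ⊴ 2 ⊗ D ⊕ F) ∷ (o ⊕ D ⊕ # 1 ⊴ n) ∷ (n ⊴ o ⊕ D ⊕ # 1) ∷ (F ⊴ 4 ⊗ o) ∷ [] , (3 ⊗ d ⊴ 2 ⊗ n)) 2 (1 ∷ 0 ∷ 2 ∷ 4 ∷ 0 ∷ 1 ∷ 4 ∷ 0 ∷ 1 ∷ []) d D n o F a e h0 (≤-reflexive h1) (≤-reflexive (sym h1)) h2 (≤-reflexive h3) (≤-reflexive (sym h3)) (≤-reflexive h4) (≤-reflexive (sym h4)) h5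

    module S₂ = Scarce σ κ 600 (A σ)

    H₂ : Fin N → Bool
    H₂ y = B σ y ∧ (count (partner σ κ 600 (A σ) y) ≤ᵇ D″ + 3 * κ + 3000)

    easy-u₂ : ∀ u y → A σ u ≡ true → u ≢ v → B σ y ≡ true → H₂ y ≡ false → 3 * κ + 3000 ≤ count (candidate σ κ u y)
    easy-u₂ u y _ ne by h = lin (count (partner σ κ 600 (A σ) y)) (count (candidate σ κ u y)) (d₁ σ u) D″ κ
        (≤ᵇ-false⁻ (¬true⇒false λ t → true≢false (∧-intro by t) h)) (candidate-loss σ κ u y) (others u ne)
      where
      lin : ∀ p c d D k → D + 3 * k + 3000 < p → p ≤ c + d + 1 → d ≤ D → 3 * k + 3000 ≤ c
      lin = linear 5 (λ p c d D k → (# 1 ⊕ (D ⊕ 3 ⊗ k ⊕ # 3000) ⊴ p) ∷ (p ⊴ c ⊕ d ⊕ # 1) ∷ (d ⊴ D) ∷ [] , (3 ⊗ k ⊕ # 3000 ⊴ c)) 1 (1 ∷ 1 ∷ 1 ∷ [])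

    #H₂ : count H₂ ≤ 10000
    #H₂ = ≮⇒≥ λ many → impossible (lin g n D″ κ D S₂.tall (m₁ σ) (m₂ σ) (m₃ σ) T (∑ S₂.seen) (∑ S₂.costly) (proj₂ room) (proj₁ (proj₂ (floor 2 (2 * n)))) κ-small
        (≤-trans S₂.∑tall (weight≤ (A σ) (d₁ σ))) budget S₂.∑seen
        (costly-bound {Z = ∑ S₂.costly} {a = m₁ σ} {b = m₂ σ} 8 1≤D κ-large (≤-trans S₂.∑costly (*-monoˡ-≤ (m₂ σ) (weight≤ (A σ) (d₁ σ)))) m₂≤8D)
        D-half D-hi
        (≤-trans (*-monoˡ-≤ g many) (S₂.scarce H₂ (D″ + 3 * κ + 3000) g (λ y h → ≤ᵇ-true⁻ (∧-elimʳ {B σ y} h)) (trans (proj₂ room) (sym #A)))))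
      where
      size : ∀ n D″ k D h a b c T → 3 * D″ ≤ 2 * n → 20 * k ≤ D → 601 * h ≤ a → a + b + 2 * c + 2 * D + 2 * T + 836550 ≤ 6 * n → n < 2 * D → D + 139000 < n → D″ + 3 * k + 3000 + h ≤ n
      size = linear 9 (λ n D″ k D h a b c T → (3 ⊗ D″ ⊴ 2 ⊗ n) ∷ (20 ⊗ k ⊴ D) ∷ (601 ⊗ h ⊴ a) ∷ (a ⊕ b ⊕ 2 ⊗ c ⊕ 2 ⊗ D ⊕ 2 ⊗ T ⊕ # 836550 ⊴ 6 ⊗ n) ∷ (# 1 ⊕ n ⊴ 2 ⊗ D) ∷ (# 1 ⊕ (D ⊕ # 139000) ⊴ n) ∷ [] , (D″ ⊕ 3 ⊗ k ⊕ # 3000 ⊕ h ⊴ n)) 36060 (12020 ∷ 5409 ∷ 60 ∷ 60 ∷ 6371 ∷ 18031 ∷ [])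
      room = m≤n⇒∃[o]m+o≡n (size n D″ κ D S₂.tall (m₁ σ) (m₂ σ) (m₃ σ) T (proj₁ (proj₂ (floor 2 (2 * n)))) κ-small (≤-trans S₂.∑tall (weight≤ (A σ) (d₁ σ))) budget D-half D-hi)
      g = proj₁ room
      lin : ∀ g n D″ k D h a b c T s z → D″ + 3 * k + 3000 + h + g ≡ n → 3 * D″ ≤ 2 * n → 20 * k ≤ D → 601 * h ≤ a → a + b + 2 * c + 2 * D + 2 * T + 836550 ≤ 6 * n → s ≤ c → z ≤ 160 * a → n < 2 * D → D + 139000 < n → 10001 * g ≤ s + z → 1 ≤ 0
      lin g n D″ k D h a b c T s z h0 h1 h2 h3 h4 h5 h6 h7 h8 h9 =
        linear 12 (λ g n D″ k D h a b c T s z → (D″ ⊕ 3 ⊗ k ⊕ # 3000 ⊕ h ⊕ g ⊴ n) ∷ (n ⊴ D″ ⊕ 3 ⊗ k ⊕ # 3000 ⊕ h ⊕ g) ∷ (3 ⊗ D″ ⊴ 2 ⊗ n) ∷ (20 ⊗ k ⊴ D) ∷ (601 ⊗ h ⊴ a) ∷ (a ⊕ b ⊕ 2 ⊗ c ⊕ 2 ⊗ D ⊕ 2 ⊗ T ⊕ # 836550 ⊴ 6 ⊗ n) ∷ (s ⊴ c) ∷ (z ⊴ 160 ⊗ a) ∷ (# 1 ⊕ n ⊴ 2 ⊗ D) ∷ (# 1 ⊕ (D ⊕ # 139000) ⊴ n) ∷ (10001 ⊗ g ⊴ s ⊕ z) ∷ [] , (# 1 ⊴ # 0)) 0 (0 ∷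 360636060 ∷ 120212020 ∷ 54095409 ∷ 600060 ∷ 6369660 ∷ 36060 ∷ 36060 ∷ 40637971 ∷ 122632031 ∷ 36060 ∷ []) g n D″ k D h a b c T s z (≤-reflexive h0) (≤-reflexive (sym h0)) h1 h2 h3 h4 h5 h6 h7 h8 h9

    X : Setting σ n D T
    X = record { hyp = hyp ; G = G ; κ = κ ; κ-small = κ-small ; D-lo = D-lo ; D-hi = D-hi ; T-far = T-far ; v = v ; av = av ; d₁v = d₁v
               ; H = λ y → H₀ y ∨ H₂ y ; M = M ; easy-v = λ y by h → easy-v₀ y by (proj₁ (∨-false h))
               ; easy-u = λ u y au ne by h → easy-u₂ u y au ne by (proj₂ (∨-false h)) }

    #H : count (Setting.H X) ≤ 132000
    #H = ≤-trans (count-∨ H₀ H₂) (≤-trans (+-mono-≤ #H₀ #H₂) (≤ᵇ⇒≤ 11300 132000 tt))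

    crossing : Fin N → Bool
    crossing u = A σ u ∧ (suc M ≤ᵇ count (λ b → E₁ σ u b ∧ away b))

    -- A vertex counted here meets more than `M` edges into `away`, whereas the degrees in `away`
    -- sum to at most `4 o < 64 (M + 1)`.
    #crossing : count crossing ≤ 64
    #crossing = *-cancelˡ-≤ (suc M) (begin
        suc M * count crossing                           ≡⟨ sym (∑-* (suc M) (λ u → 𝟙 (crossing u))) ⟩
        ∑ (λ u → suc M * 𝟙 (crossing u))                 ≤⟨ ∑-mono (λ u → ≤-trans (≤-reflexive (*-comm (suc M) (𝟙 (crossing u)))) (𝟙*-bound (crossing u) (λ h → ≤ᵇ-true⁻ (∧-elimʳ {A σ u} h)))) ⟩
        ∑ (λ u → count (λ b → E₁ σ u b ∧ away b))        ≡⟨ ∑-swap (λ u b → 𝟙 (E₁ σ u b ∧ away b)) ⟩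
        ∑ (λ b → count (λ u → E₁ σ u b ∧ away b))        ≤⟨ ∑-mono (λ b → ≤-trans (∑-mono (λ u → pt (away b) (sym₁ σ u b))) (≤-reflexive (∑-* (𝟙 (away b)) (λ u → 𝟙 (E₁ σ b u))))) ⟩
        weight away (d₁ σ)                               ≤⟨ lin (weight away (d₁ σ)) F o M weight-away F≤4o M-large ⟩
        64 * suc M                                       ≡⟨ *-comm 64 (suc M) ⟩
        suc M * 64                                       ∎)
      where
      open ≤-Reasoning
      lin : ∀ w F o M → w ≤ F → F ≤ 4 * o → o < 16 * (1 + M) → w ≤ 64 * (1 + M)
      lin = linear 4 (λ w F o M → (w ⊴ F) ∷ (F ⊴ 4 ⊗ o) ∷ (# 1 ⊕ o ⊴ 16 ⊗ (# 1 ⊕ M)) ∷ [] , (w ⊴ 64 ⊗ (# 1 ⊕ M))) 1 (1 ∷ 1 ∷ 4 ∷ [])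
      pt : ∀ a {e e′} → e ≡ e′ → 𝟙 (e ∧ a) ≤ 𝟙 a * 𝟙 e′
      pt true  {true}  refl = ≤-refl
      pt true  {false} refl = z≤n
      pt false {true}  refl = z≤n
      pt false {false} refl = z≤n

    module _ (x : Fin N) (bx : B σ x ≡ true) where

      module S₃ = Scarce (swap σ) κ 600 (around (swap σ) x)

      lonely : Fin N → Bool
      lonely u = A σ u ∧ (count (candidate (swap σ) κ x u) ≤ᵇ 2999)

      W o₂ : ℕ
      W = weight (around (swap σ) x) (d₂ σ)
      o₂ = count (around (swap σ) x)
      o₂-def : o₂ + d₂ σ x + 1 ≡ n
      o₂-def = trans (count-around (swap σ) x bx) #B

      W-lin : ∀ W d b a c D T n o o₂ → W + 2 * d ≤ b → 2 * D ≤ a → a + b + 2 * c + 2 * D + 2 * T + 836550 ≤ 6 * n → o + D + 1 ≡ n → o₂ + d + 1 ≡ n → d ≤ D → W + 2 * c ≤ 6 * o₂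
      W-lin W d b a c D T n o o₂ h0 h1 h2 h3 h4 h5 =
        linear 10 (λ W d b a c D T n o o₂ → (W ⊕ 2 ⊗ d ⊴ b) ∷ (2 ⊗ D ⊴ a) ∷ (a ⊕ b ⊕ 2 ⊗ c ⊕ 2 ⊗ D ⊕ 2 ⊗ T ⊕ # 836550 ⊴ 6 ⊗ n) ∷ (o ⊕ D ⊕ # 1 ⊴ n) ∷ (n ⊴ o ⊕ D ⊕ # 1) ∷ (o₂ ⊕ d ⊕ # 1 ⊴ n) ∷ (n ⊴ o₂ ⊕ d ⊕ # 1) ∷ (d ⊴ D) ∷ [] , (W ⊕ 2 ⊗ c ⊴ 6 ⊗ o₂)) 1 (1 ∷ 1 ∷ 1 ∷ 0 ∷ 0 ∷ 0 ∷ 6 ∷ 4 ∷ []) W d b a c D T n o o₂ h0 h1 h2 (≤-reflexive h3) (≤-reflexive (sym h3)) (≤-reflexive h4) (≤-reflexive (sym h4)) h5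
      -- The budget leaves at most `6 n - 4 D - 2 * d₂ σ x` for the left side, and `d₂ σ x ≤ D`
      -- compares this with `6 (n - d₂ σ x)`.
      W≤ : W + 2 * m₃ σ ≤ 6 * o₂
      W≤ = W-lin W (d₂ σ x) (m₂ σ) (m₁ σ) (m₃ σ) D T n o o₂ (weight-around (swap σ) x) m₁≥ budget o-def o₂-def (Δ₂ x)
      o₂-lin : ∀ o o₂ D d n → o + D + 1 ≡ n → o₂ + d + 1 ≡ n → d ≤ D → 139000 ≤ o → 139000 ≤ o₂
      o₂-lin o o₂ D d n h0 h1 h2 h3 =
        linear 5 (λ o o₂ D d n → (o ⊕ D ⊕ # 1 ⊴ n) ∷ (n ⊴ o ⊕ D ⊕ # 1) ∷ (o₂ ⊕ d ⊕ # 1 ⊴ n) ∷ (n ⊴ o₂ ⊕ d ⊕ # 1) ∷ (d ⊴ D) ∷ (# 139000 ⊴ o) ∷ [] , (# 139000 ⊴ o₂)) 1 (1 ∷ 0 ∷ 0 ∷ 1 ∷ 1 ∷ 1 ∷ []) o o₂ D d n (≤-reflexive h0) (≤-reflexive (sym h0)) (≤-reflexive h1) (≤-reflexive (sym h1)) h2 h3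
      o₂-large : 139000 ≤ o₂
      o₂-large = o₂-lin o o₂ D (d₂ σ x) n o-def o₂-def (Δ₂ x) o-large

      -- The number 2999 is kept behind an equation, as 2999 + n would unfold to a numeral in unary.
      #lonely-bound : ∀ t → t ≡ 2999 → count lonely ≤ 2000
      #lonely-bound t t-def = ≮⇒≥ λ many → impossible (lin t g o₂ S₃.tall W (m₃ σ) (∑ S₃.seen) (∑ S₃.costly) t-def (proj₂ room) S₃.∑tall (≤-trans S₃.∑seen (≤-reflexive (m₃-swap σ)))
          (costly-bound {Z = ∑ S₃.costly} {a = W} {b = m₁ σ} 12 1≤D κ-large S₃.∑costly m₁≤12D) W≤ o₂-large
          (≤-trans (*-monoˡ-≤ g many) (S₃.scarce lonely t g (λ u h → ≤-trans (≤ᵇ-true⁻ (∧-elimʳ {A σ u} h)) (≤-reflexive (sym t-def))) (proj₂ room))))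
        where
        size : ∀ t o h W c → t ≡ 2999 → 601 * h ≤ W → W + 2 * c ≤ 6 * o → 139000 ≤ o → t + h ≤ o
        size t o h W c h0 h1 h2 h3 =
          linear 5 (λ t o h W c → (t ⊴ # 2999) ∷ (# 2999 ⊴ t) ∷ (601 ⊗ h ⊴ W) ∷ (W ⊕ 2 ⊗ c ⊴ 6 ⊗ o) ∷ (# 139000 ⊴ o) ∷ [] , (t ⊕ h ⊴ o)) 601 (601 ∷ 0 ∷ 1 ∷ 1 ∷ 595 ∷ []) t o h W c (≤-reflexive h0) (≤-reflexive (sym h0)) h1 h2 h3
        room = m≤n⇒∃[o]m+o≡n (size t o₂ S₃.tall W (m₃ σ) t-def S₃.∑tall W≤ o₂-large)
        g = proj₁ room
        lin : ∀ t g o h W c s z → t ≡ 2999 → t + h + g ≡ o → 601 * h ≤ W → s ≤ c → z ≤ 240 * W → W + 2 * c ≤ 6 * o → 139000 ≤ o → 2001 * g ≤ s + z → 1 ≤ 0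
        lin t g o h W c s z h0 h1 h2 h3 h4 h5 h6 h7 =
          linear 8 (λ t g o h W c s z → (t ⊴ # 2999) ∷ (# 2999 ⊴ t) ∷ (t ⊕ h ⊕ g ⊴ o) ∷ (o ⊴ t ⊕ h ⊕ g) ∷ (601 ⊗ h ⊴ W) ∷ (s ⊴ c) ∷ (z ⊴ 240 ⊗ W) ∷ (W ⊕ 2 ⊗ c ⊴ 6 ⊗ o) ∷ (# 139000 ⊴ o) ∷ (2001 ⊗ g ⊴ s ⊕ z) ∷ [] , (# 1 ⊴ # 0)) 0 (1202601 ∷ 0 ∷ 0 ∷ 1202601 ∷ 2001 ∷ 601 ∷ 601 ∷ 146241 ∷ 325155 ∷ 601 ∷ []) t g o h W c s z (≤-reflexive h0) (≤-reflexive (sym h0)) (≤-reflexive h1) (≤-reflexive (sym h1)) h2 h3 h4 h5 h6 h7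

      #lonely : count lonely ≤ 2000
      #lonely = #lonely-bound 2999 refl

      tame : Tame X x
      tame = record
        { H₁ = λ u → lonely u ∨ crossing u
        ; #H₁ = ≤-trans (count-∨ lonely crossing) (≤-trans (+-mono-≤ #lonely #crossing) (≤ᵇ⇒≤ 2064 132000 tt))
        ; easy-x = λ u au h → ≤ᵇ-false⁻ {_} {2999} (¬true⇒false λ t → true≢false (∧-intro au t) (proj₁ (∨-false {lonely u} h)))
        ; spread = λ u au _ h _ → ≤-pred (≤ᵇ-false⁻ (¬true⇒false λ t → true≢false (∧-intro au t) (proj₂ (∨-false {lonely u} h)))) }

    packing : (∃ λ p → A σ p ≡ true × d₃ˡ σ p ≡ T) ⊎ (∃ λ p → B σ p ≡ true × d₃ʳ σ p ≡ T) → Packing σ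
    packing = select X #H tame

  dense-packing : (∃ λ p → A σ p ≡ true × d₃ˡ σ p ≡ T) ⊎ (∃ λ p → B σ p ≡ true × d₃ʳ σ p ≡ T) → Packing σ
  dense-packing exact = [ id , (λ cr → Rest.packing cr exact) ]′ crowded

-- The induction, and the passage from graph triples

record Exact {N} (σ : State N) (D T : ℕ) : Set where
  field
    degree    : (∃ λ v → A σ v ≡ true × d₁ σ v ≡ D) ⊎ (∃ λ v → B σ v ≡ true × d₂ σ v ≡ D)
    crossings : (∃ λ p → A σ p ≡ true × d₃ˡ σ p ≡ T) ⊎ (∃ λ p → B σ p ≡ true × d₃ʳ σ p ≡ T)

outside : ∀ {N} (A : Fin N → Bool) (E : Fin N → Bool) {x} → A x ≡ false → (∀ y → E y ≡ true → A x ≡ true) → count E ≡ 0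
outside A E off on = no-neighbour λ y e → true≢false (on y e) off

maximum : ∀ {N} (A B : Fin N → Bool) (f g : Fin N → ℕ) → (∀ x → A x ≡ false → f x ≡ 0) → (∀ y → B y ≡ false → g y ≡ 0) →
          ∃ (λ x → A x ≡ true) → ∃ (λ y → B y ≡ true) →
          ∃ λ m → ((∃ λ x → A x ≡ true × f x ≡ m) ⊎ (∃ λ y → B y ≡ true × g y ≡ m)) × (∀ x → f x ≤ m) × (∀ y → g y ≤ m)
maximum A B f g offA offB neA neB = larger (argmax A f neA) (argmax B g neB)
  where
  bound : ∀ A f → (∀ x → A x ≡ false → f x ≡ 0) → ∀ {m} → (∀ x → A x ≡ true → f x ≤ m) → ∀ x → f x ≤ m
  bound A f off le x with decide (A x)
  ... | inj₁ t = le x t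
  ... | inj₂ t = ≤-trans (≤-reflexive (off x t)) z≤n
  larger : (∃ λ x → A x ≡ true × (∀ y → A y ≡ true → f y ≤ f x)) → (∃ λ x → B x ≡ true × (∀ y → B y ≡ true → g y ≤ g x)) →
           ∃ λ m → ((∃ λ x → A x ≡ true × f x ≡ m) ⊎ (∃ λ y → B y ≡ true × g y ≡ m)) × (∀ x → f x ≤ m) × (∀ y → g y ≤ m)
  larger (x , ax , mx) (y , by , my) with ≤-total (f x) (g y)
  ... | inj₁ le = g y , inj₂ (y , by , refl) , bound A f offA (λ z h → ≤-trans (mx z h) le) , bound B g offB my
  ... | inj₂ ge = f x , inj₁ (x , ax , refl) , bound A f offA mx , bound B g offB (λ z h → ≤-trans (my z h) ge)

tighten : ∀ {N} {σ : State N} {n D T} → Good σ n D T → ∃ λ D′ → ∃ λ T′ → Good σ n D′ T′ × Exact σ D′ T′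
tighten {N} {σ} {n} {D} {T} G = proj₁ mD , proj₁ mT
    , record { #A = #A ; #B = #B ; bounded = record { Δ₁ = proj₁ (proj₂ (proj₂ mD)) ; Δ₂ = proj₂ (proj₂ (proj₂ mD)) ; Δ₃ˡ = proj₁ (proj₂ (proj₂ mT)) ; Δ₃ʳ = proj₂ (proj₂ (proj₂ mT)) }
             ; D+2≤n = ≤-trans (+-monoˡ-≤ 2 D′≤) D+2≤n ; T+1≤n = ≤-trans (+-monoˡ-≤ 1 T′≤) T+1≤n
             ; budget = lin (m₁ σ) (m₂ σ) (m₃ σ) D T (proj₁ mD) (proj₁ mT) n D′≤ T′≤ budget }
    , record { degree = proj₁ (proj₂ mD) ; crossings = proj₁ (proj₂ mT) }
  where
  open Good G
  lin : ∀ a b c D T D′ T′ n → D′ ≤ D → T′ ≤ T → a + b + 2 * c + 2 * D + 2 * T + 836550 ≤ 6 * n → a + b + 2 * c + 2 * D′ + 2 * T′ + 836550 ≤ 6 * n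
  lin = linear 8 (λ a b c D T D′ T′ n → (D′ ⊴ D) ∷ (T′ ⊴ T) ∷ (a ⊕ b ⊕ 2 ⊗ c ⊕ 2 ⊗ D ⊕ 2 ⊗ T ⊕ # 836550 ⊴ 6 ⊗ n) ∷ [] , (a ⊕ b ⊕ 2 ⊗ c ⊕ 2 ⊗ D′ ⊕ 2 ⊗ T′ ⊕ # 836550 ⊴ 6 ⊗ n)) 1 (2 ∷ 2 ∷ 1 ∷ [])
  inhabited : ∀ {P : Fin N → Bool} → count P ≡ n → ∃ λ x → P x ≡ true
  inhabited {P} h = nonempty P (≤-trans (≤-trans (m≤n+m 1 T) T+1≤n) (≤-reflexive (sym h)))
  mD = maximum (A σ) (B σ) (d₁ σ) (d₂ σ) (λ x off → outside (A σ) (E₁ σ x) off (on₁ σ x)) (λ y off → outside (B σ) (E₂ σ y) off (on₂ σ y)) (inhabited #A) (inhabited #B)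
  mT = maximum (A σ) (B σ) (d₃ˡ σ) (d₃ʳ σ) (λ x off → outside (A σ) (E₃ σ x) off (on₃ˡ σ x)) (λ y off → outside (B σ) (λ u → E₃ σ u y) off (λ u → on₃ʳ σ u y)) (inhabited #A) (inhabited #B)
  D′≤ : proj₁ mD ≤ D
  D′≤ = [ (λ (v , _ , e) → subst (_≤ D) e (Δ₁ v)) , (λ (v , _ , e) → subst (_≤ D) e (Δ₂ v)) ]′ (proj₁ (proj₂ mD))
  T′≤ : proj₁ mT ≤ T
  T′≤ = [ (λ (v , _ , e) → subst (_≤ T) e (Δ₃ˡ v)) , (λ (v , _ , e) → subst (_≤ T) e (Δ₃ʳ v)) ]′ (proj₁ (proj₂ mT))

by-crossing : ∀ {N} (σ : State N) {n D T} → Hyp N n → Good σ n D T → 2 * D ≤ m₁ σ + m₂ σ → 3 * n ≤ 3 * T + D + 400 ⊎ (700 * D ≤ n × n ≤ 4 * T × 3 * T + D + 400 < 3 * n) →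
              ∀ p → A σ p ≡ true → d₃ˡ σ p ≡ T → Packing σ
by-crossing σ {zero}  hyp G = ⊥-elim (<⇒≱ (≤-trans (≤-reflexive (+-comm 1 _)) (Good.T+1≤n G)) z≤n)
by-crossing σ {suc k} hyp G dense (inj₁ near) p ap d₃p = nearly-full σ hyp G p ap d₃p dense near
by-crossing σ {suc k} hyp G dense (inj₂ (small , large , far)) p ap d₃p = dominated σ hyp G p ap d₃p small large far

by-degree : ∀ {N} (σ : State N) {n D T} → Hyp N n → Good σ n D T → 3 * T + D + 400 < 3 * n → n < 700 * D →
            ∀ v → A σ v ≡ true → d₁ σ v ≡ D →
            (∃ λ p → A σ p ≡ true × d₃ˡ σ p ≡ T) ⊎ (∃ λ p → B σ p ≡ true × d₃ʳ σ p ≡ T) → Packing σ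
by-degree σ {zero}        {D} hyp G = ⊥-elim (<⇒≱ (≤-trans (m≤n+m 1 D) (≤-trans (+-monoʳ-≤ D (s≤s z≤n)) (Good.D+2≤n G))) z≤n)
by-degree σ {suc zero}    {D} hyp G = ⊥-elim (<⇒≱ (≤-trans (m≤n+m 2 D) (Good.D+2≤n G)) ≤-refl)
by-degree σ {n@(suc (suc k))} {D} hyp G far large v av d₁v exact with n ≤? D + 139000 | 2 * D ≤? n
... | yes wide | _         = Star.packing σ hyp G v av d₁v wide
... | no thin  | yes half  = moderate-packing hyp G large half (≰⇒> thin) far v av d₁v exact
... | no thin  | no over   = Dense.dense-packing hyp G (≰⇒> over) (≰⇒> thin) far v av d₁v exact

good-packing : ∀ {N n} → Acc _<_ n → ∀ (σ : State N) D T → Good σ n D T → Packing σ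
good-packing {N} {n} (acc rec) σ D₀ T₀ G₀ = cases (3 * n ≤? 3 * T + D + 400) (700 * D ≤? n) (4 * T ≤? n)
  where
  D = proj₁ (tighten G₀)
  T = proj₁ (proj₂ (tighten G₀))
  G : Good σ n D T
  G = proj₁ (proj₂ (proj₂ (tighten G₀)))
  open Good G
  open Exact (proj₂ (proj₂ (proj₂ (tighten G₀))))
  hyp : Hyp N n
  hyp τ k D′ T′ lt = good-packing (rec lt) τ D′ T′
  dense : 2 * D ≤ m₁ σ + m₂ σ
  dense = [ (λ (v , _ , e) → ≤-trans (subst (λ d → 2 * d ≤ m₁ σ) e (degree≤half σ v)) (m≤m+n (m₁ σ) (m₂ σ)))
          , (λ (v , _ , e) → ≤-trans (subst (λ d → 2 * d ≤ m₂ σ) e (degree≤half (swap σ) v)) (m≤n+m (m₂ σ) (m₁ σ))) ]′ degree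
  crossing : 3 * n ≤ 3 * T + D + 400 ⊎ (700 * D ≤ n × n ≤ 4 * T × 3 * T + D + 400 < 3 * n) → Packing σ
  crossing c = [ (λ (p , ap , e) → by-crossing σ hyp G dense c p ap e)
               , (λ (p , bp , e) → swap-packing σ (by-crossing (swap σ) hyp (swap-good G) (≤-trans dense (≤-reflexive (+-comm (m₁ σ) (m₂ σ)))) c p bp e)) ]′ crossings
  n-large : ∀ a b c D T n → a + b + 2 * c + 2 * D + 2 * T + 836550 ≤ 6 * n → 139425 ≤ n
  n-large = linear 6 (λ a b c D T n → (a ⊕ b ⊕ 2 ⊗ c ⊕ 2 ⊗ D ⊕ 2 ⊗ T ⊕ # 836550 ⊴ 6 ⊗ n) ∷ [] , (# 139425 ⊴ n)) 6 (1 ∷ [])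
  edges : ∀ a b c D T n → a + b + 2 * c + 2 * D + 2 * T + 836550 ≤ 6 * n → a + b + 2 * c ≤ 6 * n
  edges = linear 6 (λ a b c D T n → (a ⊕ b ⊕ 2 ⊗ c ⊕ 2 ⊗ D ⊕ 2 ⊗ T ⊕ # 836550 ⊴ 6 ⊗ n) ∷ [] , (a ⊕ b ⊕ 2 ⊗ c ⊴ 6 ⊗ n)) 1 (1 ∷ [])
  cases : Dec (3 * n ≤ 3 * T + D + 400) → Dec (700 * D ≤ n) → Dec (4 * T ≤ n) → Packing σ
  cases (yes near) _ _ = crossing (inj₁ near)
  cases (no far) (yes small) (yes sparse) = Sparse.sparse-packing n D (n-large (m₁ σ) (m₂ σ) (m₃ σ) D T n budget) small σ T #A #B bounded sparse
    (edges (m₁ σ) (m₂ σ) (m₃ σ) D T n budget)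
  cases (no far) (yes small) (no large) = crossing (inj₂ (small , <⇒≤ (≰⇒> large) , ≰⇒> far))
  cases (no far) (no large) _ = [ (λ (v , av , e) → by-degree σ hyp G (≰⇒> far) (≰⇒> large) v av e crossings)
      , (λ (v , bv , e) → swap-packing σ (by-degree (swap σ) hyp (swap-good G) (≰⇒> far) (≰⇒> large) v bv e (⊎-swap crossings))) ]′ degree

-- From decidable graphs to Boolean states

does⁺ : ∀ {P : Set} (P? : Dec P) → P → does P? ≡ true
does⁺ (yes _) _ = refl
does⁺ (no ¬p) p = ⊥-elim (¬p p)

does⁻ : ∀ {P : Set} (P? : Dec P) → does P? ≡ true → P
does⁻ (yes p) _ = p

does-⇔ : ∀ {P Q : Set} (P? : Dec P) (Q? : Dec Q) → (P → Q) → (Q → P) → does P? ≡ does Q?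
does-⇔ (yes p) Q?      f g = sym (does⁺ Q? (f p))
does-⇔ (no ¬p) (yes q) f g = ⊥-elim (¬p (g q))
does-⇔ (no ¬p) (no _)  f g = refl

length-filter-product : ∀ {M N} {X Y : Set} {P : X × Y → Set} (P? : Decidable P) (f : Fin M → X) (g : Fin N → Y) →
                        length (filter P? (cartesianProduct (tabulate f) (tabulate g))) ≡ ∑ (λ x → ∑ (λ y → 𝟙 (does (P? (f x , g y)))))
length-filter-product {zero}  P? f g = sym (∑-zero _)
length-filter-product {suc M} P? f g = begin
  length (filter P? (map (f zero ,_) (tabulate g) ++ rest))                   ≡⟨ cong length (filter-++ P? (map (f zero ,_) (tabulate g)) rest) ⟩
  length (filter P? (map (f zero ,_) (tabulate g)) ++ filter P? rest)         ≡⟨ length-++ (filter P? (map (f zero ,_) (tabulate g))) ⟩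
  length (filter P? (map (f zero ,_) (tabulate g))) + length (filter P? rest)
    ≡⟨ cong₂ _+_ (trans (cong (λ l → length (filter P? l)) (map-tabulate g (f zero ,_))) (length-filter P? (λ y → f zero , g y))) (length-filter-product P? (f ∘ suc) g) ⟩
  ∑ (λ y → 𝟙 (does (P? (f zero , g y)))) + ∑ (λ x → ∑ (λ y → 𝟙 (does (P? (f (suc x) , g y)))))  ≡⟨ sym (∑-suc _) ⟩
  ∑ (λ x → ∑ (λ y → 𝟙 (does (P? (f x , g y)))))                               ∎
  where
  open ≡-Reasoning
  rest = cartesianProduct (tabulate (f ∘ suc)) (tabulate g)

module FromGraph {n} (H : Graph n) where
  open Graph H renaming (sym to Adj-sym)

  edge : Fin n → Fin n → Bool
  edge u u′ = does (Adj? u u′)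

  edge-sym : ∀ u u′ → edge u u′ ≡ edge u′ u
  edge-sym u u′ = does-⇔ (Adj? u u′) (Adj? u′ u) Adj-sym Adj-sym

  edge-irr : ∀ u → edge u u ≡ false
  edge-irr u = ¬true⇒false λ h → irrefl refl (does⁻ (Adj? u u) h)

  degree≤Δ : ∀ u → count (edge u) ≤ Δ
  degree≤Δ u = ≤-trans (≤-reflexive (sym (length-filter (Adj? u) id))) (All.lookup (xs≤max 0 (map degree (allFin n))) (∈-map⁺ degree (∈-allFin u)))

  -- Of the two orders of an adjacent pair exactly one is increasing, so the list of edges contains
  -- half of the ordered pairs.
  edges-count : ∑ (λ u → count (edge u)) ≤ 2 * ∣E∣
  edges-count = ≤-trans (∑-mono λ u → ≤-trans (∑-mono (pt u)) (≤-reflexive (∑-+ (λ u′ → 𝟙 (up u u′)) (λ u′ → 𝟙 (up u′ u)))))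
      (≤-trans (≤-reflexive (∑-+ (λ u → count (up u)) (λ u → count (λ u′ → up u′ u))))
        (≤-reflexive (cong₂ _+_ half (trans (∑-swap (λ u u′ → 𝟙 (up u′ u))) (trans half (sym (+-identityʳ _)))))))
    where
    up : Fin n → Fin n → Bool
    up u u′ = does (u <?ᶠ u′) ∧ edge u u′
    half : ∑ (λ u → count (up u)) ≡ ∣E∣
    half = sym (length-filter-product _ id id)
    pt : ∀ u u′ → 𝟙 (edge u u′) ≤ 𝟙 (up u u′) + 𝟙 (up u′ u)
    pt u u′ with <-cmpᶠ u u′
    ... | tri< lt _ _ = ≤-trans (𝟙-mono λ h → ∧-intro (does⁺ (u <?ᶠ u′) lt) h) (m≤m+n (𝟙 (up u u′)) _)
    ... | tri≈ _ refl _ = ≤-trans (≤-reflexive (cong 𝟙 (edge-irr u))) z≤n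
    ... | tri> _ _ gt = ≤-trans (𝟙-mono λ h → ∧-intro (does⁺ (u′ <?ᶠ u) gt) (subst (_≡ true) (edge-sym u u′) h)) (m≤n+m (𝟙 (up u′ u)) _)

module FromBipartite {m n} (H : BipartiteGraph m n) where
  open BipartiteGraph H

  edge : Fin m → Fin n → Bool
  edge u y = does (Adj? u y)

  degreeˡ≤Δ : ∀ u → count (edge u) ≤ Δ
  degreeˡ≤Δ u = ≤-trans (≤-reflexive (sym (length-filter (Adj? u) id)))
    (All.lookup (xs≤max 0 (map degreeˡ (allFin m) ++ map degreeʳ (allFin n))) (∈-++⁺ˡ (∈-map⁺ degreeˡ (∈-allFin u))))

  degreeʳ≤Δ : ∀ y → count (λ u → edge u y) ≤ Δ
  degreeʳ≤Δ y = ≤-trans (≤-reflexive (sym (length-filter (λ u → Adj? u y) id)))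
    (All.lookup (xs≤max 0 (map degreeˡ (allFin m) ++ map degreeʳ (allFin n))) (∈-++⁺ʳ (map degreeˡ (allFin m)) (∈-map⁺ degreeʳ (∈-allFin y))))

  edges-count : ∑ (λ u → count (edge u)) ≡ ∣E∣
  edges-count = sym (length-filter-product _ id id)

mainTheorem2 :
  ∀ (n : ℕ) → 2 ≤ n → (𝐆 : GraphTriple n) →
  let open GraphTriple 𝐆 in
  G₁.Δ ≤ n ∸ 2 →
  G₂.Δ ≤ n ∸ 2 →
  G₃.Δ ≤ n ∸ 1 →
  G₁.∣E∣ + G₂.∣E∣ + G₃.∣E∣ + (G₁.Δ ⊔ G₂.Δ) + G₃.Δ + C ≤ 3 * n →
  Packs 𝐆
mainTheorem2 n 2≤n 𝐆 Δ₁≤ Δ₂≤ Δ₃≤ size = mk⤖ {to = P.f} (injective , surjective) , ok₃′ , ok′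
  where
  open GraphTriple 𝐆
  module F₁ = FromGraph G₁
  module F₂ = FromGraph G₂
  module F₃ = FromBipartite G₃

  σ : State n
  σ = record
    { A = λ _ → true ; B = λ _ → true ; E₁ = F₁.edge ; E₂ = F₂.edge ; E₃ = F₃.edge
    ; sym₁ = F₁.edge-sym ; sym₂ = F₂.edge-sym ; irr₁ = F₁.edge-irr ; irr₂ = F₂.edge-irr
    ; on₁ = λ _ _ _ → refl ; on₂ = λ _ _ _ → refl ; on₃ˡ = λ _ _ _ → refl ; on₃ʳ = λ _ _ _ → refl }

  everything : ∀ n → count {n} (λ _ → true) ≡ n
  everything zero    = ∑-zero _
  everything (suc n) = trans (∑-suc _) (cong suc (everything n))

  budget-lin : ∀ a b c e₁ e₂ e₃ D T C n → a ≤ 2 * e₁ → b ≤ 2 * e₂ → c ≡ e₃ → C ≡ 418275 → e₁ + e₂ + e₃ + D + T + C ≤ 3 * n → a + b + 2 * c + 2 * D + 2 * T + 836550 ≤ 6 * n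
  budget-lin a b c e₁ e₂ e₃ D T C n h0 h1 h2 h3 h4 =
    linear 10 (λ a b c e₁ e₂ e₃ D T C n → (a ⊴ 2 ⊗ e₁) ∷ (b ⊴ 2 ⊗ e₂) ∷ (c ⊴ e₃) ∷ (e₃ ⊴ c) ∷ (C ⊴ # 418275) ∷ (# 418275 ⊴ C) ∷ (e₁ ⊕ e₂ ⊕ e₃ ⊕ D ⊕ T ⊕ C ⊴ 3 ⊗ n) ∷ [] , (a ⊕ b ⊕ 2 ⊗ c ⊕ 2 ⊗ D ⊕ 2 ⊗ T ⊕ # 836550 ⊴ 6 ⊗ n)) 1 (1 ∷ 1 ∷ 2 ∷ 0 ∷ 0 ∷ 2 ∷ 2 ∷ []) a b c e₁ e₂ e₃ D T C n h0 h1 (≤-reflexive h2) (≤-reflexive (sym h2)) (≤-reflexive h3) (≤-reflexive (sym h3)) h4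

  G : Good σ n (G₁.Δ ⊔ G₂.Δ) G₃.Δ
  G = record
    { #A = everything n ; #B = everything n
    ; bounded = record { Δ₁ = λ u → ≤-trans (F₁.degree≤Δ u) (m≤m⊔n _ _) ; Δ₂ = λ y → ≤-trans (F₂.degree≤Δ y) (m≤n⊔m G₁.Δ _)
                       ; Δ₃ˡ = F₃.degreeˡ≤Δ ; Δ₃ʳ = F₃.degreeʳ≤Δ }
    ; D+2≤n = ≤-trans (+-monoˡ-≤ 2 (⊔-lub Δ₁≤ Δ₂≤)) (≤-reflexive (m∸n+n≡m 2≤n))
    ; T+1≤n = ≤-trans (+-monoˡ-≤ 1 Δ₃≤) (≤-reflexive (m∸n+n≡m (≤-trans (s≤s z≤n) 2≤n)))
    -- The `refl` evaluates `C` to 418275; keeping `C` a variable in `budget-lin` lets the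
    -- certificate work with the numeral.
    ; budget = budget-lin (m₁ σ) (m₂ σ) (m₃ σ) G₁.∣E∣ G₂.∣E∣ G₃.∣E∣ (G₁.Δ ⊔ G₂.Δ) G₃.Δ C n F₁.edges-count F₂.edges-count F₃.edges-count refl size }

  module P = Packing (good-packing (<-wellFounded n) σ (G₁.Δ ⊔ G₂.Δ) G₃.Δ G)

  injective : ∀ {u u′} → P.f u ≡ P.f u′ → u ≡ u′
  injective {u} {u′} e = trans (sym (P.gf u refl)) (trans (cong P.g e) (P.gf u′ refl))

  surjective : ∀ y → ∃ λ u → ∀ {z} → z ≡ u → P.f z ≡ y
  surjective y = P.g y , λ { refl → P.fg y refl }

  ok₃′ : ∀ v → ¬ G₃.Adj v (P.f v)
  ok₃′ v h = true≢false (does⁺ (G₃.Adj? v (P.f v)) h) (P.ok₃ v refl)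

  ok′ : ∀ u v → G₁.Adj u v → ¬ G₂.Adj (P.f u) (P.f v)
  ok′ u v h h′ = true≢false (does⁺ (G₂.Adj? (P.f u) (P.f v)) h′) (P.ok u v (does⁺ (G₁.Adj? u v) h))
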